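{- Let $p,q,r\ge 0$ be integers, at most one of which is $0$. The graph $\theta(p,q,r)$ is determined by its Laplacian permanental polynomial; that is, for every graph $H$, if $\pi(L(H);x)=\pi(L(\theta(p,q,r));x)$ then $H$ is isomorphic to $\theta(p,q,r)$.
   Context: All graphs are finite, simple and undirected (not necessarily connected). For a graph $G$ with vertices $v_1,\dots,v_n$, let $A(G)$ be its $(0,1)$-adjacency matrix, $D(G)=\mathrm{diag}(d(v_1),\dots,d(v_n))$ the diagonal matrix of vertex degrees, and $L(G)=D(G)-A(G)$ the Laplacian matrix. The permanent of an $n\times n$ matrix $X=(x_{ij})$ is $\mathrm{per}(X)=\sum_{\sigma}\prod_{i=1}^n x_{i\sigma(i)}$, the sum being over all permutations $\sigma$ of $\{1,\dots,n\}$. The Laplacian permanental polynomial of $G$ is $\pi(L(G);x)=\mathrm{per}(xI-L(G))$, where $I$ is the $n\times n$ identity matrix. The graph $\theta(p,q,r)$, on $n=p+q+r+2$ vertices, consists of two given distinct vertices $u,v$ joined by three internally disjoint paths having respectively $p$, $q$ and $r$ interior vertices (a path with $0$ interior vertices is the single edge $uv$), where $p,q,r\ge 0$ and at most one of them is $0$. -}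

module Defs where

open import Data.Bool.Base using (Bool; true; false; _∨_; if_then_else_)
open import Data.Bool.Properties using (∨-comm)
open import Data.Fin.Base using (Fin; zero; suc; toℕ; punchIn)
open import Data.Fin.Patterns using (0F; 1F)
open import Data.Fin.Permutation as Perm using (Permutation; Permutation′; _⟨$⟩ʳ_)
open import Data.Fin.Properties using (_≟_; +↔⊎; punchIn-injective)
open import Data.Fin.Subset using (Subset; ∣_∣)
open import Data.Integer.Base using (ℤ; +_; -_; _+_; _*_; _-_)
open import Data.List.Base using (List; []; _∷_; map; foldr; allFin; cartesianProductWith)
open import Data.List.Membership.Propositional.Properties using (∈-allFin)
open import Data.List.Relation.Unary.Any using (Any; here)
open import Data.List.Relation.Unary.Any.Properties using (cartesianProductWith⁺)
open import Data.List.Relation.Unary.AllPairs using ([]; _∷_)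
open import Data.List.Relation.Unary.All using ([])
import Data.List.Relation.Unary.Unique.Setoid as Unique
import Data.List.Relation.Unary.Unique.Setoid.Properties as UniqueS
open import Data.List.Relation.Unary.Unique.Propositional.Properties using (allFin⁺)
open import Data.Nat.Base as ℕ using (ℕ; zero; suc; _≡ᵇ_)
open import Data.Product.Base using (Σ-syntax; _×_; _,_)
open import Data.Sum.Base using (_⊎_; inj₁; inj₂)
open import Data.Sum.Function.Propositional using (_⊎-↔_)
open import Data.Vec.Base using (tabulate)
open import Data.Vec.Functional as Vector using (Vector)
open import Function.Base using (_∘_)
open import Function.Bundles using (_↔_; Inverse)
open import Function.Properties.Inverse using (↔-refl; ↔-trans)
open import Level using (0ℓ)
open import Relation.Binary.Bundles using (Setoid)
open import Relation.Binary.PropositionalEquality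
  using (_≡_; refl; sym; trans; cong; cong₂; setoid)
open import Relation.Nullary.Decidable using (does)

------------------------------------------------------------------------
-- Finite simple graphs

record Graph (n : ℕ) : Set where
  field
    adj        : Fin n → Fin n → Bool
    adj-sym    : ∀ i j → adj i j ≡ adj j i
    adj-irrefl : ∀ i → adj i i ≡ false

open Graph public

infix 4 _≅_

_≅_ : ∀ {m n} → Graph m → Graph n → Set
_≅_ {m} {n} G H =
  Σ[ f ∈ Permutation m n ] (∀ i j → adj G i j ≡ adj H (f ⟨$⟩ʳ i) (f ⟨$⟩ʳ j))

neighbours : ∀ {n} → Graph n → Fin n → Subset n
neighbours G i = tabulate (adj G i)

degree : ∀ {n} → Graph n → Fin n → ℕ
degree G i = ∣ neighbours G i ∣

------------------------------------------------------------------------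
-- Matrices

Matrix : Set → ℕ → Set
Matrix A n = Vector (Vector A n) n

diag : ∀ {n} → Vector ℤ n → Matrix ℤ n
diag d i j = if does (i ≟ j) then d i else + 0

identity : ∀ {n} → Matrix ℤ n
identity = diag (λ _ → + 1)

adjacency : ∀ {n} → Graph n → Matrix ℤ n
adjacency G i j = if adj G i j then + 1 else + 0

laplacian : ∀ {n} → Graph n → Matrix ℤ n
laplacian G i j = diag (λ k → + degree G k) i j - adjacency G i j

------------------------------------------------------------------------
-- Polynomials over ℤ in one variable

-- The list a₀ ∷ a₁ ∷ … ∷ [] stands for a₀ + a₁ x + …; trailing zeros are
-- allowed, so equality of polynomials is _≈ₚ_ and not _≡_.
Poly : Set
Poly = List ℤ

coeff : Poly → ℕ → ℤ
coeff []      _       = + 0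
coeff (a ∷ _) zero    = a
coeff (_ ∷ f) (suc k) = coeff f k

infix 4 _≈ₚ_

_≈ₚ_ : Poly → Poly → Set
f ≈ₚ g = ∀ k → coeff f k ≡ coeff g k

infixl 6 _+ₚ_
infixl 7 _*ₚ_

0ₚ 1ₚ : Poly
0ₚ = []
1ₚ = + 1 ∷ []

_+ₚ_ : Poly → Poly → Poly
[]      +ₚ g       = g
(a ∷ f) +ₚ []      = a ∷ f
(a ∷ f) +ₚ (b ∷ g) = (a + b) ∷ (f +ₚ g)

_*ₚ_ : Poly → Poly → Poly
[]      *ₚ g = []
(a ∷ f) *ₚ g = map (a *_) g +ₚ (+ 0 ∷ (f *ₚ g))

------------------------------------------------------------------------
-- Permanents

-- A permutation of Fin (suc n) is an image j of 0 together with a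
-- permutation of the remaining n points.
permutations : ∀ n → List (Permutation′ n)
permutations zero    = Perm.id ∷ []
permutations (suc n) =
  cartesianProductWith (Perm.insert 0F) (allFin (suc n)) (permutations n)

per : ∀ {n} → Matrix Poly n → Poly
per {n} M =
  foldr _+ₚ_ 0ₚ
    (map (λ σ → Vector.foldr _*ₚ_ 1ₚ (λ i → M i (σ ⟨$⟩ʳ i))) (permutations n))

xI-_ : ∀ {n} → Matrix ℤ n → Matrix Poly n
(xI- M) i j = - M i j ∷ identity i j ∷ []

π[L_] : ∀ {n} → Graph n → Poly
π[L G ] = per (xI- laplacian G)

-- The list permutations n contains every permutation, and contains it once.

private
  insert-cong : ∀ {n} {i j : Fin (suc n)} {σ τ : Permutation′ n} →
                i ≡ j → σ Perm.≈ τ → Perm.insert 0F i σ Perm.≈ Perm.insert 0F j τ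
  insert-cong i≡j σ≈τ zero    = i≡j
  insert-cong i≡j σ≈τ (suc k) = cong₂ punchIn i≡j (σ≈τ k)

  insert-injective : ∀ {n} {i j : Fin (suc n)} {σ τ : Permutation′ n} →
                     Perm.insert 0F i σ Perm.≈ Perm.insert 0F j τ →
                     i ≡ j × σ Perm.≈ τ
  insert-injective {i = i} eq with refl ← eq 0F =
    refl , λ k → punchIn-injective i _ _ (eq (suc k))

permutationSetoid : ℕ → Setoid 0ℓ 0ℓ
permutationSetoid n = record
  { Carrier       = Permutation′ n
  ; _≈_           = Perm._≈_
  ; isEquivalence = record
    { refl  = λ _ → refl
    ; sym   = λ eq i → sym (eq i)
    ; trans = λ eq eq′ i → trans (eq i) (eq′ i)
    }
  }

permutations-complete : ∀ {n} (σ : Permutation′ n) →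
                        Any (σ Perm.≈_) (permutations n)
permutations-complete {zero}  σ = here λ ()
permutations-complete {suc n} σ =
  cartesianProductWith⁺ (Perm.insert 0F)
    (λ {j} {τ} σ0≡j rest≈τ k →
      trans (sym (Perm.insert-remove 0F σ k))
            (insert-cong {σ = Perm.remove 0F σ} {τ} σ0≡j rest≈τ k))
    (∈-allFin (σ ⟨$⟩ʳ 0F))
    (permutations-complete (Perm.remove 0F σ))

permutations-unique : ∀ n → Unique.Unique (permutationSetoid n) (permutations n)
permutations-unique zero    = [] ∷ []
permutations-unique (suc n) =
  UniqueS.cartesianProductWith⁺
    (setoid (Fin (suc n))) (permutationSetoid n) (permutationSetoid (suc n))
    (Perm.insert 0F)
    (λ {_} {_} {σ} {τ} → insert-injective {σ = σ} {τ})
    (allFin⁺ (suc n)) (permutations-unique n)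

------------------------------------------------------------------------
-- Theta graphs

-- The interior vertices of the three paths, followed by the two ends.
Vertex : ℕ → ℕ → ℕ → Set
Vertex p q r = ((Fin p ⊎ Fin q) ⊎ Fin r) ⊎ Fin 2

pattern onP i = inj₁ (inj₁ (inj₁ i))
pattern onQ i = inj₁ (inj₁ (inj₂ i))
pattern onR i = inj₁ (inj₂ i)
pattern u     = inj₂ 0F
pattern v     = inj₂ 1F

vertices : ∀ p q r → Fin (p ℕ.+ q ℕ.+ r ℕ.+ 2) ↔ Vertex p q r
vertices p q r =
  ↔-trans (+↔⊎ {p ℕ.+ q ℕ.+ r})
    (↔-trans (+↔⊎ {p ℕ.+ q}) (+↔⊎ {p} ⊎-↔ ↔-refl) ⊎-↔ ↔-refl)

private
  1+n≢ᵇn : ∀ n → (suc n ≡ᵇ n) ≡ false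
  1+n≢ᵇn zero    = refl
  1+n≢ᵇn (suc n) = 1+n≢ᵇn n

-- x ⟶ y: y comes immediately after x on one of the three paths, each
-- traversed from u to v.
module _ {p q r : ℕ} where

  infix 4 _⟶_

  _⟶_ : Vertex p q r → Vertex p q r → Bool
  u     ⟶ v     = (p ≡ᵇ 0) ∨ (q ≡ᵇ 0) ∨ (r ≡ᵇ 0)
  u     ⟶ onP j = toℕ j ≡ᵇ 0
  u     ⟶ onQ j = toℕ j ≡ᵇ 0
  u     ⟶ onR j = toℕ j ≡ᵇ 0
  onP i ⟶ v     = suc (toℕ i) ≡ᵇ p
  onQ i ⟶ v     = suc (toℕ i) ≡ᵇ q
  onR i ⟶ v     = suc (toℕ i) ≡ᵇ r
  onP i ⟶ onP j = suc (toℕ i) ≡ᵇ toℕ j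
  onQ i ⟶ onQ j = suc (toℕ i) ≡ᵇ toℕ j
  onR i ⟶ onR j = suc (toℕ i) ≡ᵇ toℕ j
  _     ⟶ _     = false

  ⟶-irrefl : ∀ x → (x ⟶ x) ≡ false
  ⟶-irrefl u       = refl
  ⟶-irrefl v       = refl
  ⟶-irrefl (onP i) = 1+n≢ᵇn (toℕ i)
  ⟶-irrefl (onQ i) = 1+n≢ᵇn (toℕ i)
  ⟶-irrefl (onR i) = 1+n≢ᵇn (toℕ i)

-- If two of p, q, r are 0, the corresponding paths coincide.
θ : ∀ p q r → Graph (p ℕ.+ q ℕ.+ r ℕ.+ 2)
θ p q r = record
  { adj        = λ i j → (at i ⟶ at j) ∨ (at j ⟶ at i)
  ; adj-sym    = λ i j → ∨-comm (at i ⟶ at j) (at j ⟶ at i)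
  ; adj-irrefl = λ i → cong₂ _∨_ (⟶-irrefl (at i)) (⟶-irrefl (at i))
  }
  where at = Inverse.to (vertices p q r)

{-# OPTIONS --safe #-}

-- Write x = Y + 2S and make π(L(G); x) homogeneous in Y and S. It is then the permanent of a matrix that
-- differs from a multiple of the identity only along edges and at vertices of degree other than 2, and
-- it is multiplicative over the components left after deleting two vertices. Its expansion in S
-- to second order gives Σ d and Σ d², and Σ (d - 2)(d - 3) = 0 leaves two vertices of degree 3 and
-- otherwise degree 2: the graph is a theta graph or a dumbbell (two cycles joined by a path), plus cycles.
--
-- To first order at Y = 0, S = 1 only theta graphs without further cycles can share the polynomial of a
-- theta graph, unless all paths of the latter have even length. In that case the signs of the coefficients
-- at S = -1 exclude odd cycles. At Y = 1 - s², S = s the recurrences for paths and cycles have roots 1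
-- and -s², so all values become explicit polynomials in s. The low coefficients of their odd parts
-- exclude even cycles and dumbbells, and for two theta graphs the lowest power of s at which
-- the values differ determines the path lengths; reading divisibility at s = 8 suffices.

module Submission where

open import Defs
open import Data.Nat.Base using (ℕ)
open import Data.Product.Base using (_×_)
open import Relation.Binary.PropositionalEquality using (_≡_)
open import Relation.Nullary.Negation.Core using (¬_)

open import Data.Bool.Base using (Bool; true; false; _∧_; _∨_; not; if_then_else_)
open import Data.Bool.Properties using (∨-identityʳ; ∧-identityʳ; ∧-zeroʳ; ∧-comm)
open import Data.Empty using (⊥; ⊥-elim)
open import Data.Fin.Base using (Fin; zero; suc; toℕ; punchIn)
import Data.Fin.Properties as Finₚ
import Data.Fin.Permutation as Perm
open import Data.Integer.Base as ℤ using (ℤ; +_; -_; -[1+_]; 0ℤ; 1ℤ; -1ℤ; _+_; _*_; _-_)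
import Data.Integer.Properties as ℤₚ
open import Data.Integer.Divisibility.Signed using (_∣_; divides; _∣?_; ∣-trans; ∣m∣n⇒∣m+n; ∣m∣n⇒∣m-n; ∣m⇒∣m*n; ∣n⇒∣m*n; *-cancelˡ-∣)
open import Data.Integer.Solver using (module +-*-Solver)
open import Data.List.Base using (List; []; _∷_; _++_; map; foldr; allFin; tabulate; length; concat; zip; cartesianProductWith)
import Algebra.Properties.AbelianGroup ℤₚ.+-0-abelianGroup as ℤ+ₚ
import Data.List.Properties as Listₚ
open import Data.List.Membership.Propositional using (_∈_; _∉_; find; lose)
import Data.List.Membership.Propositional.Properties as ∈ₚ
open import Data.List.Membership.Propositional.Properties.WithK using (unique∧set⇒bag)
open import Data.List.Relation.Binary.BagAndSetEquality using (∼bag⇒↭)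
open import Data.List.Relation.Binary.Permutation.Propositional using (_↭_; prep; swap; ↭-refl; ↭-sym; ↭-trans; ↭-reflexive; ↭-prep; ↭-swap)
import Data.List.Relation.Binary.Permutation.Propositional.Properties as ↭ₚ
open import Data.List.Relation.Unary.All as All using (All; []; _∷_)
import Data.List.Relation.Unary.All.Properties as Allₚ
open import Data.List.Relation.Unary.AllPairs as AllPairs using (AllPairs; []; _∷_)
import Data.List.Relation.Unary.AllPairs.Properties as AllPairsₚ
open import Data.List.Relation.Unary.Any using (Any; here; there; any?)
open import Data.List.Relation.Unary.Unique.Propositional using (Unique)
import Data.List.Relation.Unary.Unique.Propositional.Properties as Uniqueₚ
import Data.Nat.Base as ℕ
open import Data.Nat.Base using (zero; suc; z≤n; s≤s)
import Data.Nat.Properties as ℕₚ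
open import Data.Product.Base using (Σ-syntax; ∃; ∃-syntax; _,_; proj₁; proj₂)
open import Data.Sum.Base using (_⊎_; inj₁; inj₂)
import Data.Vec.Functional as Vector
open import Data.Vec.Base as Vec using (Vec; []; _∷_)
open import Function.Base using (_∘_; id; flip; case_of_)
open import Function.Bundles using (Inverse; mk⇔)
open import Relation.Binary.PropositionalEquality using (_≢_; refl; sym; trans; cong; cong₂; subst; subst₂; module ≡-Reasoning)
open import Relation.Binary.Definitions using (Tri; tri<; tri≈; tri>)
open import Relation.Nullary.Decidable using (Dec; yes; no; does; from-no)
open import Relation.Nullary.Negation.Core using (contradiction)

open ≡-Reasoning
open +-*-Solver using (solve; _:=_; _:+_; _:*_; _:-_; :-_; con; var; prove; ⟦_⟧; ⟦_⟧↓; Polynomial)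

-- A permanent allows no row reduction and no general product rule, so the tools are Laplace
-- expansion and zero patterns. This is why a piece of the graph is summarised by six minors at two
-- cut vertices. The shift by 2S gives almost all vertices the diagonal entry Y, and the two
-- exceptional ones Y - S.
--
-- Paths and cycles obey a recurrence with discriminant Y² + 4S². The substitution Y = 1 - s², S = s
-- turns it into the square (1 + s²)²; this is where the explicit roots come from.
--
-- At Y = 0, S = 1 every cycle has constant term 2 or 4, so a nonzero constant term of the theta
-- graph controls the cycles. If all three paths are even, this constant term is 0 and the expansion
-- says nothing about them; bipartiteness has to be used instead. Then every quantity is even in s
-- except the entry Y - S, so the odd part keeps only short polynomials in s².
--
-- For two theta graphs the first differing coefficient is congruent to 2, 4 or 6 modulo s, or is an
-- odd number minus an even one when s is even; s = 8 detects all of these.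

+-interchange : ∀ a b c d → (a + b) + (c + d) ≡ (a + c) + (b + d)
+-interchange = solve 4 (λ a b c d → (a :+ b) :+ (c :+ d) := (a :+ c) :+ (b :+ d)) refl

+-swapˡ : ∀ a b c → a + (b + c) ≡ b + (a + c)
+-swapˡ = solve 3 (λ a b c → a :+ (b :+ c) := b :+ (a :+ c)) refl

+-congˡ : ∀ a {b c} → b ≡ c → a + b ≡ a + c
+-congˡ a = cong (λ z → a + z)

-- Permanents of submatrices, indexed by lists of rows and columns

module _ {V : Set} where

  -- One Laplace expansion step on lists: the summand receives a chosen entry together with the list
  -- without it. Working with lists makes reordering rows and columns a statement about `_↭_`.
  sumPick : (V → List V → ℤ) → List V → ℤ
  sumPick f []       = 0ℤ
  sumPick f (c ∷ cs) = f c cs + sumPick (λ d ds → f d (c ∷ ds)) cs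

  perL : (V → V → ℤ) → List V → List V → ℤ
  perL M []       []       = 1ℤ
  perL M []       (_ ∷ _)  = 0ℤ
  perL M (r ∷ rs) cs       = sumPick (λ c cs′ → M r c * perL M rs cs′) cs

  -- The hypothesis `c ∷ ds ↭ cs` restricts the equation to pairs that really arise; membership of
  -- the chosen entry and of the remaining ones is later read off from it.
  sumPick-cong↭ : ∀ {f g} cs → (∀ c ds → c ∷ ds ↭ cs → f c ds ≡ g c ds) → sumPick f cs ≡ sumPick g cs
  sumPick-cong↭ []       eq = refl
  sumPick-cong↭ (c ∷ cs) eq = cong₂ _+_ (eq c cs ↭-refl)
    (sumPick-cong↭ cs (λ d ds p → eq d (c ∷ ds) (↭-trans (swap d c ↭-refl) (prep c p))))

  sumPick-cong : ∀ {f g} cs → (∀ c ds → f c ds ≡ g c ds) → sumPick f cs ≡ sumPick g cs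
  sumPick-cong cs eq = sumPick-cong↭ cs (λ c ds _ → eq c ds)

  sumPick-zero : ∀ cs → sumPick (λ _ _ → 0ℤ) cs ≡ 0ℤ
  sumPick-zero []       = refl
  sumPick-zero (c ∷ cs) = trans (ℤₚ.+-identityˡ _) (sumPick-zero cs)

  sumPick-zeros : ∀ {f} cs → (∀ c → c ∈ cs → ∀ ds → f c ds ≡ 0ℤ) → sumPick f cs ≡ 0ℤ
  sumPick-zeros cs eq = trans (sumPick-cong↭ cs (λ c ds p → eq c (↭ₚ.∈-resp-↭ p (here refl)) ds)) (sumPick-zero cs)

  sumPick-+ : ∀ f g cs → sumPick (λ c ds → f c ds + g c ds) cs ≡ sumPick f cs + sumPick g cs
  sumPick-+ f g []       = refl
  sumPick-+ f g (c ∷ cs) = trans (+-congˡ ((f c cs + g c cs)) (sumPick-+ _ _ cs)) (+-interchange (f c cs) (g c cs) _ _)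

  sumPick-*ˡ : ∀ k f cs → sumPick (λ c ds → k * f c ds) cs ≡ k * sumPick f cs
  sumPick-*ˡ k f []       = sym (ℤₚ.*-zeroʳ k)
  sumPick-*ˡ k f (c ∷ cs) = trans (+-congˡ (k * f c cs) (sumPick-*ˡ k _ cs)) (sym (ℤₚ.*-distribˡ-+ k _ _))

  sumPick-*ʳ : ∀ k f cs → sumPick (λ c ds → f c ds * k) cs ≡ sumPick f cs * k
  sumPick-*ʳ k f cs = trans (sumPick-cong cs (λ c ds → ℤₚ.*-comm (f c ds) k))
    (trans (sumPick-*ˡ k f cs) (ℤₚ.*-comm k _))

  sumPick-sumPick : ∀ (h : V → List V → V → List V → ℤ) cs rs →
    sumPick (λ c cs′ → sumPick (λ r rs′ → h c cs′ r rs′) rs) cs ≡ sumPick (λ r rs′ → sumPick (λ c cs′ → h c cs′ r rs′) cs) rs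
  sumPick-sumPick h []       rs = sym (sumPick-zero rs)
  sumPick-sumPick h (c ∷ cs) rs = trans (+-congˡ (sumPick (h c cs) rs) (sumPick-sumPick _ cs rs))
    (sym (sumPick-+ (h c cs) _ rs))

  sumPick-↭ : ∀ {f cs cs′} → (∀ c {ds ds′} → ds ↭ ds′ → f c ds ≡ f c ds′) → cs ↭ cs′ → sumPick f cs ≡ sumPick f cs′
  sumPick-↭ resp _↭_.refl = refl
  sumPick-↭ resp (prep x p) = cong₂ _+_ (resp x p) (sumPick-↭ (λ c q → resp c (prep x q)) p)
  sumPick-↭ {f} resp (swap {xs} {ys} x y p) = trans (+-swapˡ (f x (y ∷ xs)) (f y (x ∷ xs)) _)
    (cong₂ _+_ (resp y (prep x p)) (cong₂ _+_ (resp x (prep y p))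
      (trans (sumPick-cong xs (λ c ds → resp c (swap x y ↭-refl))) (sumPick-↭ (λ c q → resp c (prep y (prep x q))) p))))
  sumPick-↭ resp (_↭_.trans p q) = trans (sumPick-↭ resp p) (sumPick-↭ resp q)

  perL-cols : ∀ M rs {cs cs′} → cs ↭ cs′ → perL M rs cs ≡ perL M rs cs′
  perL-cols M [] {[]}     {[]}     p = refl
  perL-cols M [] {[]}     {_ ∷ _}  p = contradiction (↭-sym p) ↭ₚ.¬x∷xs↭[]
  perL-cols M [] {_ ∷ _}  {[]}     p = contradiction p ↭ₚ.¬x∷xs↭[]
  perL-cols M [] {_ ∷ _}  {_ ∷ _}  p = refl
  perL-cols M (r ∷ rs) p = sumPick-↭ (λ c q → cong (M r c *_) (perL-cols M rs q)) p

  -- `perL` expands along rows. Inductively the column expansion is applied inside the expansion of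
  -- the first row, and the two choices are exchanged.
  perL-col : ∀ M rs c cs → perL M rs (c ∷ cs) ≡ sumPick (λ r rs′ → M r c * perL M rs′ cs) rs
  perL-col M []       c cs = refl
  perL-col M (r ∷ rs) c cs = +-congˡ (M r c * perL M rs cs) (begin
    sumPick (λ d ds → M r d * perL M rs (c ∷ ds)) cs
      ≡⟨ sumPick-cong cs (λ d ds → trans (cong (M r d *_) (perL-col M rs c ds)) (sym (sumPick-*ˡ (M r d) _ rs))) ⟩
    sumPick (λ d ds → sumPick (λ r′ rs′ → M r d * (M r′ c * perL M rs′ ds)) rs) cs
      ≡⟨ sumPick-sumPick _ cs rs ⟩
    sumPick (λ r′ rs′ → sumPick (λ d ds → M r d * (M r′ c * perL M rs′ ds)) cs) rs
      ≡⟨ sumPick-cong rs (λ r′ rs′ → trans (sumPick-cong cs (λ d ds → *-swapˡ (M r d) (M r′ c) _)) (sumPick-*ˡ (M r′ c) _ cs)) ⟩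
    sumPick (λ r′ rs′ → M r′ c * perL M (r ∷ rs′) cs) rs ∎)
    where
    *-swapˡ : ∀ a b c → a * (b * c) ≡ b * (a * c)
    *-swapˡ = solve 3 (λ a b c → a :* (b :* c) := b :* (a :* c)) refl

  perL-transpose : ∀ M rs cs → perL M rs cs ≡ perL (flip M) cs rs
  perL-transpose M []       []       = refl
  perL-transpose M (r ∷ rs) []       = refl
  perL-transpose M rs       (c ∷ cs) = trans (perL-col M rs c cs)
    (sumPick-cong rs (λ r rs′ → cong (M r c *_) (perL-transpose M rs′ cs)))

  perL-rows : ∀ M {rs rs′} cs → rs ↭ rs′ → perL M rs cs ≡ perL M rs′ cs
  perL-rows M {rs} {rs′} cs p = trans (perL-transpose M rs cs)
    (trans (perL-cols (flip M) cs p) (sym (perL-transpose M rs′ cs)))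

  perL-cong : ∀ {M N} rs cs → (∀ r c → r ∈ rs → c ∈ cs → M r c ≡ N r c) → perL M rs cs ≡ perL N rs cs
  perL-cong []       []      eq = refl
  perL-cong []       (_ ∷ _) eq = refl
  perL-cong (r ∷ rs) cs      eq = sumPick-cong↭ cs (λ c ds p →
    cong₂ _*_ (eq r c (here refl) (↭ₚ.∈-resp-↭ p (here refl)))
      (perL-cong rs ds (λ r′ c′ r∈ c∈ → eq r′ c′ (there r∈) (↭ₚ.∈-resp-↭ p (there c∈)))))

  perL-zero-row : ∀ M {r} rs cs → r ∈ rs → (∀ c → c ∈ cs → M r c ≡ 0ℤ) → perL M rs cs ≡ 0ℤ
  perL-zero-row M {r} rs cs r∈ z with ∈ₚ.∈-∃++ r∈
  ... | as , bs , refl = trans (perL-rows M cs (↭ₚ.shift r as bs))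
    (sumPick-zeros cs (λ c c∈ ds → cong (_* perL M (as ++ bs) ds) (z c c∈)))

  perL-zero-col : ∀ M {c} rs cs → c ∈ cs → (∀ r → r ∈ rs → M r c ≡ 0ℤ) → perL M rs cs ≡ 0ℤ
  perL-zero-col M rs cs c∈ z = trans (perL-transpose M rs cs) (perL-zero-row (flip M) cs rs c∈ z)

  perL-row-head : ∀ M r rs c cs → (∀ d → d ∈ cs → M r d ≡ 0ℤ) → perL M (r ∷ rs) (c ∷ cs) ≡ M r c * perL M rs cs
  perL-row-head M r rs c cs z = trans (+-congˡ (M r c * perL M rs cs)
    (sumPick-zeros cs (λ d d∈ ds → cong (_* perL M rs (c ∷ ds)) (z d d∈)))) (ℤₚ.+-identityʳ _)

  perL-col-head : ∀ M r rs c cs → (∀ s → s ∈ rs → M s c ≡ 0ℤ) → perL M (r ∷ rs) (c ∷ cs) ≡ M r c * perL M rs cs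
  perL-col-head M r rs c cs z = trans (perL-transpose M (r ∷ rs) (c ∷ cs))
    (trans (perL-row-head (flip M) c cs r rs z) (cong (M r c *_) (sym (perL-transpose M rs cs))))

  -- Laplace expansion of the permanent of a sum of two matrices

  sumSplit : (List V → List V → ℤ) → List V → ℤ
  sumSplit f []       = f [] []
  sumSplit f (x ∷ xs) = sumSplit (λ a b → f (x ∷ a) b) xs + sumSplit (λ a b → f a (x ∷ b)) xs

  sumSplit-cong : ∀ {f g} xs → (∀ a b → f a b ≡ g a b) → sumSplit f xs ≡ sumSplit g xs
  sumSplit-cong []       eq = eq [] []
  sumSplit-cong (x ∷ xs) eq = cong₂ _+_ (sumSplit-cong xs (λ a b → eq (x ∷ a) b)) (sumSplit-cong xs (λ a b → eq a (x ∷ b)))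

  sumSplit-zero : ∀ {f} xs → (∀ a b → f a b ≡ 0ℤ) → sumSplit f xs ≡ 0ℤ
  sumSplit-zero []       eq = eq [] []
  sumSplit-zero (x ∷ xs) eq = cong₂ _+_ (sumSplit-zero xs (λ a b → eq (x ∷ a) b)) (sumSplit-zero xs (λ a b → eq a (x ∷ b)))

  sumSplit-+ : ∀ f g xs → sumSplit (λ a b → f a b + g a b) xs ≡ sumSplit f xs + sumSplit g xs
  sumSplit-+ f g []       = refl
  sumSplit-+ f g (x ∷ xs) = trans
    (cong₂ _+_ (sumSplit-+ (λ a b → f (x ∷ a) b) (λ a b → g (x ∷ a) b) xs) (sumSplit-+ (λ a b → f a (x ∷ b)) (λ a b → g a (x ∷ b)) xs))
    (+-interchange (sumSplit (λ a b → f (x ∷ a) b) xs) (sumSplit (λ a b → g (x ∷ a) b) xs) _ _)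

  sumSplit-* : ∀ k f xs → sumSplit (λ a b → k * f a b) xs ≡ k * sumSplit f xs
  sumSplit-* k f []       = refl
  sumSplit-* k f (x ∷ xs) = trans (cong₂ _+_ (sumSplit-* k _ xs) (sumSplit-* k _ xs)) (sym (ℤₚ.*-distribˡ-+ k _ _))

  sumSplit-sumPick : ∀ (h : List V → List V → V → List V → ℤ) rs cs →
    sumSplit (λ a b → sumPick (h a b) cs) rs ≡ sumPick (λ c ds → sumSplit (λ a b → h a b c ds) rs) cs
  sumSplit-sumPick h []       cs = refl
  sumSplit-sumPick h (r ∷ rs) cs = trans
    (cong₂ _+_ (sumSplit-sumPick (λ a → h (r ∷ a)) rs cs) (sumSplit-sumPick (λ a b → h a (r ∷ b)) rs cs))
    (sym (sumPick-+ (λ c ds → sumSplit (λ a b → h (r ∷ a) b c ds) rs) (λ c ds → sumSplit (λ a b → h a (r ∷ b) c ds) rs) cs))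

  sumSplit-pickˡ : ∀ (g : V → List V → List V → ℤ) cs →
    sumSplit (λ a b → sumPick (λ c a′ → g c a′ b) a) cs ≡ sumPick (λ c ds → sumSplit (g c) ds) cs
  sumSplit-pickˡ g []       = refl
  sumSplit-pickˡ g (x ∷ cs) = begin
    sumSplit (λ a b → g x a b + sumPick (λ c a′ → g c (x ∷ a′) b) a) cs + sumSplit (λ a b → sumPick (λ c a′ → g c a′ (x ∷ b)) a) cs
      ≡⟨ cong₂ _+_ (trans (sumSplit-+ (g x) _ cs) (+-congˡ (sumSplit (g x) cs) (sumSplit-pickˡ _ cs))) (sumSplit-pickˡ _ cs) ⟩
    (sumSplit (g x) cs + sumPick (λ c ds → sumSplit (λ a b → g c (x ∷ a) b) ds) cs) + sumPick (λ c ds → sumSplit (λ a b → g c a (x ∷ b)) ds) cs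
      ≡⟨ ℤₚ.+-assoc (sumSplit (g x) cs) _ _ ⟩
    sumSplit (g x) cs + (sumPick (λ c ds → sumSplit (λ a b → g c (x ∷ a) b) ds) cs + sumPick (λ c ds → sumSplit (λ a b → g c a (x ∷ b)) ds) cs)
      ≡⟨ +-congˡ (sumSplit (g x) cs) (sumPick-+ (λ c ds → sumSplit (λ a b → g c (x ∷ a) b) ds) (λ c ds → sumSplit (λ a b → g c a (x ∷ b)) ds) cs) ⟨
    sumSplit (g x) cs + sumPick (λ c ds → sumSplit (g c) (x ∷ ds)) cs ∎

  sumSplit-pickʳ : ∀ (g : V → List V → List V → ℤ) cs →
    sumSplit (λ a b → sumPick (λ c b′ → g c a b′) b) cs ≡ sumPick (λ c ds → sumSplit (g c) ds) cs
  sumSplit-pickʳ g []       = refl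
  sumSplit-pickʳ g (x ∷ cs) = begin
    sumSplit (λ a b → sumPick (λ c b′ → g c (x ∷ a) b′) b) cs + sumSplit (λ a b → g x a b + sumPick (λ c b′ → g c a (x ∷ b′)) b) cs
      ≡⟨ cong₂ _+_ (sumSplit-pickʳ _ cs) (trans (sumSplit-+ (g x) _ cs) (+-congˡ (sumSplit (g x) cs) (sumSplit-pickʳ _ cs))) ⟩
    sumPick (λ c ds → sumSplit (λ a b → g c (x ∷ a) b) ds) cs + (sumSplit (g x) cs + sumPick (λ c ds → sumSplit (λ a b → g c a (x ∷ b)) ds) cs)
      ≡⟨ +-swapˡ (sumPick (λ c ds → sumSplit (λ a b → g c (x ∷ a) b) ds) cs) (sumSplit (g x) cs) _ ⟩
    sumSplit (g x) cs + (sumPick (λ c ds → sumSplit (λ a b → g c (x ∷ a) b) ds) cs + sumPick (λ c ds → sumSplit (λ a b → g c a (x ∷ b)) ds) cs)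
      ≡⟨ +-congˡ (sumSplit (g x) cs) (sumPick-+ (λ c ds → sumSplit (λ a b → g c (x ∷ a) b) ds) (λ c ds → sumSplit (λ a b → g c a (x ∷ b)) ds) cs) ⟨
    sumSplit (g x) cs + sumPick (λ c ds → sumSplit (g c) (x ∷ ds)) cs ∎

  -- Each row takes its entry from A or from B; the rows that use A and the columns they hit give a
  -- minor of A, the others the complementary minor of B. In the induction the first row and its
  -- column join the part they belong to.
  perL-sum : ∀ A B rs cs → perL (λ i j → A i j + B i j) rs cs
    ≡ sumSplit (λ R₁ R₂ → sumSplit (λ C₁ C₂ → perL A R₁ C₁ * perL B R₂ C₂) cs) rs
  perL-sum A B []       []       = refl
  perL-sum A B []       (c ∷ cs) = sym (cong₂ _+_ (sumSplit-zero cs (λ a b → refl))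
    (sumSplit-zero cs (λ a b → ℤₚ.*-zeroʳ (perL A [] a))))
  perL-sum A B (r ∷ rs) cs       = begin
    sumPick (λ c ds → (A r c + B r c) * perL (λ i j → A i j + B i j) rs ds) cs
      ≡⟨ sumPick-cong cs (λ c ds → trans (cong ((A r c + B r c) *_) (perL-sum A B rs ds)) (ℤₚ.*-distribʳ-+ (X ds) (A r c) (B r c))) ⟩
    sumPick (λ c ds → A r c * X ds + B r c * X ds) cs
      ≡⟨ sumPick-+ _ _ cs ⟩
    sumPick (λ c ds → A r c * X ds) cs + sumPick (λ c ds → B r c * X ds) cs
      ≡⟨ cong₂ _+_ (side (A r)) (side (B r)) ⟩
    sumSplit (λ R₁ R₂ → sumPick (λ c ds → sumSplit (λ C₁ C₂ → A r c * (perL A R₁ C₁ * perL B R₂ C₂)) ds) cs) rs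
      + sumSplit (λ R₁ R₂ → sumPick (λ c ds → sumSplit (λ C₁ C₂ → B r c * (perL A R₁ C₁ * perL B R₂ C₂)) ds) cs) rs
      ≡⟨ cong₂ _+_ (sumSplit-cong rs (λ R₁ R₂ → trans (sym (sumSplit-pickˡ _ cs)) (sumSplit-cong cs (λ C₁ C₂ →
           trans (sumPick-cong C₁ (λ c C → sym (ℤₚ.*-assoc (A r c) _ _))) (sumPick-*ʳ (perL B R₂ C₂) _ C₁)))))
         (sumSplit-cong rs (λ R₁ R₂ → trans (sym (sumSplit-pickʳ _ cs)) (sumSplit-cong cs (λ C₁ C₂ →
           trans (sumPick-cong C₂ (λ c C → *-swapˡ (B r c) (perL A R₁ C₁) _)) (sumPick-*ˡ (perL A R₁ C₁) _ C₂))))) ⟩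
    sumSplit (λ R₁ R₂ → sumSplit (λ C₁ C₂ → perL A R₁ C₁ * perL B R₂ C₂) cs) (r ∷ rs) ∎
    where
    X : List V → ℤ
    X ds = sumSplit (λ R₁ R₂ → sumSplit (λ C₁ C₂ → perL A R₁ C₁ * perL B R₂ C₂) ds) rs
    *-swapˡ : ∀ a b c → a * (b * c) ≡ b * (a * c)
    *-swapˡ = solve 3 (λ a b c → a :* (b :* c) := b :* (a :* c)) refl
    side : ∀ (k : V → ℤ) → sumPick (λ c ds → k c * X ds) cs
      ≡ sumSplit (λ R₁ R₂ → sumPick (λ c ds → sumSplit (λ C₁ C₂ → k c * (perL A R₁ C₁ * perL B R₂ C₂)) ds) cs) rs
    side k = trans (sumPick-cong cs (λ c ds → trans (sym (sumSplit-* (k c) _ rs))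
        (sumSplit-cong rs (λ R₁ R₂ → sym (sumSplit-* (k c) _ ds))))) (sym (sumSplit-sumPick _ rs cs))

  sumSplit-left : ∀ {f} W xs → (∀ a b w → w ∈ W → w ∈ b → f a b ≡ 0ℤ) → sumSplit f (W ++ xs) ≡ sumSplit (λ a b → f (W ++ a) b) xs
  sumSplit-left []      xs z = refl
  sumSplit-left {f} (w ∷ W) xs z = trans (cong₂ _+_ (sumSplit-left W xs (λ a b x x∈ → z (w ∷ a) b x (there x∈)))
    (sumSplit-zero {λ a b → f a (w ∷ b)} (W ++ xs) (λ a b → z a (w ∷ b) w (here refl) (here refl)))) (ℤₚ.+-identityʳ _)

  sumSplit-right : ∀ {f} W xs → (∀ a b w → w ∈ W → w ∈ a → f a b ≡ 0ℤ) → sumSplit f (W ++ xs) ≡ sumSplit (λ a b → f a (W ++ b)) xs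
  sumSplit-right []      xs z = refl
  sumSplit-right {f} (w ∷ W) xs z = trans (cong₂ _+_ (sumSplit-zero {λ a b → f (w ∷ a) b} (W ++ xs) (λ a b → z (w ∷ a) b w (here refl) (here refl)))
    (sumSplit-right W xs (λ a b x x∈ → z a (w ∷ b) x (there x∈)))) (ℤₚ.+-identityˡ _)

  Vanishes : (V → V → ℤ) → List V → Set
  Vanishes A W = ∀ w → w ∈ W → ∀ x → A w x ≡ 0ℤ × A x w ≡ 0ℤ

  -- Rows and columns in W₁ can only be served by A, those in W₂ only by B. Of all splittings only
  -- the distribution of the shared rows D and columns E remains free.
  perL-conv : ∀ A B W₁ W₂ D E → Vanishes A W₂ → Vanishes B W₁ →
    perL (λ i j → A i j + B i j) (W₁ ++ W₂ ++ D) (W₁ ++ W₂ ++ E)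
    ≡ sumSplit (λ D₁ D₂ → sumSplit (λ E₁ E₂ → perL A (W₁ ++ D₁) (W₁ ++ E₁) * perL B (W₂ ++ D₂) (W₂ ++ E₂)) E) D
  perL-conv A B W₁ W₂ D E zA zB = begin
    perL (λ i j → A i j + B i j) (W₁ ++ W₂ ++ D) (W₁ ++ W₂ ++ E)
      ≡⟨ perL-sum A B (W₁ ++ W₂ ++ D) (W₁ ++ W₂ ++ E) ⟩
    sumSplit (λ R₁ R₂ → sumSplit (λ C₁ C₂ → perL A R₁ C₁ * perL B R₂ C₂) (W₁ ++ W₂ ++ E)) (W₁ ++ W₂ ++ D)
      ≡⟨ sumSplit-left W₁ (W₂ ++ D) (λ a b w w∈ w∈b → sumSplit-zero (W₁ ++ W₂ ++ E) (λ C₁ C₂ → trans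
           (cong (perL A a C₁ *_) (perL-zero-row B b C₂ w∈b (λ c _ → proj₁ (zB w w∈ c)))) (ℤₚ.*-zeroʳ (perL A a C₁)))) ⟩
    sumSplit (λ R₁ R₂ → sumSplit (λ C₁ C₂ → perL A (W₁ ++ R₁) C₁ * perL B R₂ C₂) (W₁ ++ W₂ ++ E)) (W₂ ++ D)
      ≡⟨ sumSplit-right W₂ D (λ a b w w∈ w∈a → sumSplit-zero (W₁ ++ W₂ ++ E) (λ C₁ C₂ →
           cong (_* perL B b C₂) (perL-zero-row A (W₁ ++ a) C₁ (∈ₚ.∈-++⁺ʳ W₁ w∈a) (λ c _ → proj₁ (zA w w∈ c))))) ⟩
    sumSplit (λ R₁ R₂ → sumSplit (λ C₁ C₂ → perL A (W₁ ++ R₁) C₁ * perL B (W₂ ++ R₂) C₂) (W₁ ++ W₂ ++ E)) D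
      ≡⟨ sumSplit-cong D (λ D₁ D₂ → trans (sumSplit-left W₁ (W₂ ++ E) (λ a b w w∈ w∈b → trans
           (cong (perL A (W₁ ++ D₁) a *_) (perL-zero-col B (W₂ ++ D₂) b w∈b (λ c _ → proj₂ (zB w w∈ c)))) (ℤₚ.*-zeroʳ (perL A (W₁ ++ D₁) a))))
           (sumSplit-right W₂ E (λ a b w w∈ w∈a →
           cong (_* perL B (W₂ ++ D₂) b) (perL-zero-col A (W₁ ++ D₁) (W₁ ++ a) (∈ₚ.∈-++⁺ʳ W₁ w∈a) (λ c _ → proj₂ (zA w w∈ c)))))) ⟩
    sumSplit (λ D₁ D₂ → sumSplit (λ E₁ E₂ → perL A (W₁ ++ D₁) (W₁ ++ E₁) * perL B (W₂ ++ D₂) (W₂ ++ E₂)) E) D ∎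

-- Port algebra: a set W of vertices is seen from two ports a and b through six permanents

record Ports : Set where
  constructor ports
  field c₀ ca cb cab cba cw : ℤ

open Ports public

infixl 7 _⊗_

-- Multiplication of c₀ + ca·xu + cb·yv + cab·xv + cba·yu + cw·xyuv modulo the squares of the
-- variables, where x, y stand for the rows and u, v for the columns of a, b. A port row or column
-- can be used by only one of the two pieces.
_⊗_ : Ports → Ports → Ports
ports c₀ ca cb cab cba cw ⊗ ports d₀ da db dab dba dw =
  ports (c₀ * d₀) (c₀ * da + ca * d₀) (c₀ * db + cb * d₀) (c₀ * dab + cab * d₀) (c₀ * dba + cba * d₀)
        (c₀ * dw + cw * d₀ + (ca * db + cb * da) + (cab * dba + cba * dab))

1⊗ : Ports
1⊗ = ports 1ℤ 0ℤ 0ℤ 0ℤ 0ℤ 0ℤ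

ports-cong : ∀ {a b c d e f a′ b′ c′ d′ e′ f′} → a ≡ a′ → b ≡ b′ → c ≡ c′ → d ≡ d′ → e ≡ e′ → f ≡ f′ →
  ports a b c d e f ≡ ports a′ b′ c′ d′ e′ f′
ports-cong refl refl refl refl refl refl = refl

⊗-comm : ∀ x y → x ⊗ y ≡ y ⊗ x
⊗-comm (ports c₀ ca cb cab cba cw) (ports d₀ da db dab dba dw) = ports-cong (ℤₚ.*-comm c₀ d₀)
  (lin c₀ ca d₀ da) (lin c₀ cb d₀ db) (lin c₀ cab d₀ dab) (lin c₀ cba d₀ dba) (top c₀ ca cb cab cba cw d₀ da db dab dba dw)
  where
  lin : ∀ a b c d → a * d + b * c ≡ c * b + d * a
  lin = solve 4 (λ a b c d → a :* d :+ b :* c := c :* b :+ d :* a) refl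
  top : ∀ c₀ ca cb cab cba cw d₀ da db dab dba dw → _
  top = solve 12 (λ c₀ ca cb cab cba cw d₀ da db dab dba dw →
    c₀ :* dw :+ cw :* d₀ :+ (ca :* db :+ cb :* da) :+ (cab :* dba :+ cba :* dab) :=
    d₀ :* cw :+ dw :* c₀ :+ (da :* cb :+ db :* ca) :+ (dab :* cba :+ dba :* cab)) refl

⊗-assoc : ∀ x y z → (x ⊗ y) ⊗ z ≡ x ⊗ (y ⊗ z)
⊗-assoc (ports c₀ ca cb cab cba cw) (ports d₀ da db dab dba dw) (ports e₀ ea eb eab eba ew) =
  ports-cong (ℤₚ.*-assoc c₀ d₀ e₀) (lin c₀ ca d₀ da e₀ ea) (lin c₀ cb d₀ db e₀ eb) (lin c₀ cab d₀ dab e₀ eab) (lin c₀ cba d₀ dba e₀ eba)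
    (top c₀ ca cb cab cba cw d₀ da db dab dba dw e₀ ea eb eab eba ew)
  where
  lin : ∀ a b c d e f → (a * c) * f + (a * d + b * c) * e ≡ a * (c * f + d * e) + b * (c * e)
  lin = solve 6 (λ a b c d e f → (a :* c) :* f :+ (a :* d :+ b :* c) :* e := a :* (c :* f :+ d :* e) :+ b :* (c :* e)) refl
  top : ∀ c₀ ca cb cab cba cw d₀ da db dab dba dw e₀ ea eb eab eba ew → _
  top = solve 18 (λ c₀ ca cb cab cba cw d₀ da db dab dba dw e₀ ea eb eab eba ew →
    (c₀ :* d₀) :* ew :+ (c₀ :* dw :+ cw :* d₀ :+ (ca :* db :+ cb :* da) :+ (cab :* dba :+ cba :* dab)) :* e₀
      :+ ((c₀ :* da :+ ca :* d₀) :* eb :+ (c₀ :* db :+ cb :* d₀) :* ea) :+ ((c₀ :* dab :+ cab :* d₀) :* eba :+ (c₀ :* dba :+ cba :* d₀) :* eab) :=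
    c₀ :* (d₀ :* ew :+ dw :* e₀ :+ (da :* eb :+ db :* ea) :+ (dab :* eba :+ dba :* eab)) :+ cw :* (d₀ :* e₀)
      :+ (ca :* (d₀ :* eb :+ db :* e₀) :+ cb :* (d₀ :* ea :+ da :* e₀)) :+ (cab :* (d₀ :* eba :+ dba :* e₀) :+ cba :* (d₀ :* eab :+ dab :* e₀))) refl

perL-unbalanced : ∀ {V : Set} (M : V → V → ℤ) rs cs → length rs ≢ length cs → perL M rs cs ≡ 0ℤ
perL-unbalanced M []       []      ne = contradiction refl ne
perL-unbalanced M []       (_ ∷ _) ne = refl
perL-unbalanced M (r ∷ rs) cs      ne = trans (sumPick-cong↭ cs (λ c ds p →
  trans (cong (M r c *_) (perL-unbalanced M rs ds (λ eq → ne (trans (cong suc eq) (↭ₚ.↭-length p))))) (ℤₚ.*-zeroʳ (M r c))))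
  (sumPick-zero cs)

module _ {n : ℕ} where

  open import Data.List.Membership.DecPropositional (Finₚ._≟_ {n}) using (_∈?_)

  portsOf : (Fin n → Fin n → ℤ) → Fin n → Fin n → List (Fin n) → Ports
  portsOf M a b W = ports (p [] []) (p (a ∷ []) (a ∷ [])) (p (b ∷ []) (b ∷ []))
                          (p (a ∷ []) (b ∷ [])) (p (b ∷ []) (a ∷ [])) (p (a ∷ b ∷ []) (a ∷ b ∷ []))
    where
    p : List (Fin n) → List (Fin n) → ℤ
    p D E = perL M (W ++ D) (W ++ E)

  -- Two port rows and two port columns can be split in sixteen ways. Splittings with unequally many
  -- rows and columns vanish, and the six others are the summands of the last component of `_⊗_`.
  sixteen : ∀ x₁ x₆ x₇ y₁ y₂ y₇ {x₂ x₃ x₄ x₅ x₈ x₉ y₃ y₄ y₅ y₆} →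
    x₂ ≡ 0ℤ → x₃ ≡ 0ℤ → x₄ ≡ 0ℤ → x₅ ≡ 0ℤ → x₈ ≡ 0ℤ → x₉ ≡ 0ℤ → y₃ ≡ 0ℤ → y₄ ≡ 0ℤ → y₅ ≡ 0ℤ → y₆ ≡ 0ℤ →
    ((((x₁ + x₂) + (x₃ + x₄)) + ((x₅ + x₆) + (x₇ + x₈))) + (((x₉ + y₁) + (y₂ + y₃)) + ((y₄ + y₅) + (y₆ + y₇))))
    ≡ y₇ + x₁ + (x₆ + y₂) + (x₇ + y₁)
  sixteen x₁ x₆ x₇ y₁ y₂ y₇ refl refl refl refl refl refl refl refl refl refl =
    solve 6 (λ x₁ x₆ x₇ y₁ y₂ y₇ → let z = con 0ℤ in
      ((((x₁ :+ z) :+ (z :+ z)) :+ ((z :+ x₆) :+ (x₇ :+ z))) :+ (((z :+ y₁) :+ (y₂ :+ z)) :+ ((z :+ z) :+ (z :+ y₇))))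
      := y₇ :+ x₁ :+ (x₆ :+ y₂) :+ (x₇ :+ y₁)) refl x₁ x₆ x₇ y₁ y₂ y₇

  four : ∀ x₁ x₄ {x₂ x₃} → x₂ ≡ 0ℤ → x₃ ≡ 0ℤ → (x₁ + x₂) + (x₃ + x₄) ≡ x₄ + x₁
  four x₁ x₄ refl refl = solve 2 (λ x₁ x₄ → (x₁ :+ con 0ℤ) :+ (con 0ℤ :+ x₄) := x₄ :+ x₁) refl x₁ x₄

  module _ (A B : Fin n → Fin n → ℤ) (W₁ W₂ : List (Fin n)) (zA : Vanishes A W₂) (zB : Vanishes B W₁) where

    private
      lengthen : ∀ W {D E : List (Fin n)} → length D ≢ length E → length (W ++ D) ≢ length (W ++ E)
      lengthen W {D} {E} ne eq = ne (ℕₚ.+-cancelˡ-≡ (length W) (length D) (length E)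
        (trans (sym (Listₚ.length-++ W)) (trans eq (Listₚ.length-++ W))))

      unb : ∀ D₁ E₁ D₂ E₂ → length D₁ ≢ length E₁ → perL A (W₁ ++ D₁) (W₁ ++ E₁) * perL B (W₂ ++ D₂) (W₂ ++ E₂) ≡ 0ℤ
      unb D₁ E₁ D₂ E₂ ne = cong (_* perL B (W₂ ++ D₂) (W₂ ++ E₂)) (perL-unbalanced A (W₁ ++ D₁) (W₁ ++ E₁) (lengthen W₁ ne))

      t : List (Fin n) → List (Fin n) → List (Fin n) → List (Fin n) → ℤ
      t D₁ E₁ D₂ E₂ = perL A (W₁ ++ D₁) (W₁ ++ E₁) * perL B (W₂ ++ D₂) (W₂ ++ E₂)

      lift : ∀ D E → perL (λ i j → A i j + B i j) ((W₁ ++ W₂) ++ D) ((W₁ ++ W₂) ++ E)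
        ≡ sumSplit (λ D₁ D₂ → sumSplit (λ E₁ E₂ → perL A (W₁ ++ D₁) (W₁ ++ E₁) * perL B (W₂ ++ D₂) (W₂ ++ E₂)) E) D
      lift D E = trans (cong₂ (perL _) (Listₚ.++-assoc W₁ W₂ D) (Listₚ.++-assoc W₁ W₂ E)) (perL-conv A B W₁ W₂ D E zA zB)

    portsOf-sum : ∀ a b → portsOf (λ i j → A i j + B i j) a b (W₁ ++ W₂) ≡ portsOf A a b W₁ ⊗ portsOf B a b W₂
    portsOf-sum a b = ports-cong (lift [] [])
      (trans (lift (a ∷ []) (a ∷ [])) (four (t (a ∷ []) (a ∷ []) [] []) (t [] [] (a ∷ []) (a ∷ [])) (unb (a ∷ []) [] [] (a ∷ []) λ ()) (unb [] (a ∷ []) (a ∷ []) [] λ ())))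
      (trans (lift (b ∷ []) (b ∷ [])) (four (t (b ∷ []) (b ∷ []) [] []) (t [] [] (b ∷ []) (b ∷ [])) (unb (b ∷ []) [] [] (b ∷ []) λ ()) (unb [] (b ∷ []) (b ∷ []) [] λ ())))
      (trans (lift (a ∷ []) (b ∷ [])) (four (t (a ∷ []) (b ∷ []) [] []) (t [] [] (a ∷ []) (b ∷ [])) (unb (a ∷ []) [] [] (b ∷ []) λ ()) (unb [] (b ∷ []) (a ∷ []) [] λ ())))
      (trans (lift (b ∷ []) (a ∷ [])) (four (t (b ∷ []) (a ∷ []) [] []) (t [] [] (b ∷ []) (a ∷ [])) (unb (b ∷ []) [] [] (a ∷ []) λ ()) (unb [] (a ∷ []) (b ∷ []) [] λ ())))
      (trans (lift (a ∷ b ∷ []) (a ∷ b ∷ [])) (sixteen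
        (t (a ∷ b ∷ []) (a ∷ b ∷ []) [] []) (t (a ∷ []) (a ∷ []) (b ∷ []) (b ∷ [])) (t (a ∷ []) (b ∷ []) (b ∷ []) (a ∷ []))
        (t (b ∷ []) (a ∷ []) (a ∷ []) (b ∷ [])) (t (b ∷ []) (b ∷ []) (a ∷ []) (a ∷ [])) (t [] [] (a ∷ b ∷ []) (a ∷ b ∷ []))
        (unb (a ∷ b ∷ []) (a ∷ []) [] (b ∷ []) λ ()) (unb (a ∷ b ∷ []) (b ∷ []) [] (a ∷ []) λ ()) (unb (a ∷ b ∷ []) [] [] (a ∷ b ∷ []) λ ())
        (unb (a ∷ []) (a ∷ b ∷ []) (b ∷ []) [] λ ()) (unb (a ∷ []) [] (b ∷ []) (a ∷ b ∷ []) λ ())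
        (unb (b ∷ []) (a ∷ b ∷ []) (a ∷ []) [] λ ()) (unb (b ∷ []) [] (a ∷ []) (a ∷ b ∷ []) λ ())
        (unb [] (a ∷ b ∷ []) (a ∷ b ∷ []) [] λ ()) (unb [] (a ∷ []) (a ∷ b ∷ []) (b ∷ []) λ ()) (unb [] (b ∷ []) (a ∷ b ∷ []) (a ∷ []) λ ())))

  portsOf-cong : ∀ {M N} a b W → (∀ i j → i ∈ W ++ a ∷ b ∷ [] → j ∈ W ++ a ∷ b ∷ [] → M i j ≡ N i j) → portsOf M a b W ≡ portsOf N a b W
  portsOf-cong {M} {N} a b W eq = ports-cong (go [] [] ∅ ∅) (go A A oneA oneA) (go B B oneB oneB) (go A B oneA oneB) (go B A oneB oneA) (go (a ∷ b ∷ []) (a ∷ b ∷ []) id id)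
    where
    Sub : List (Fin n) → Set
    Sub D = ∀ {i} → i ∈ D → i ∈ a ∷ b ∷ []
    ∅ : ∀ {i} → i ∈ [] → i ∈ a ∷ b ∷ []
    ∅ ()
    A B : List (Fin n)
    A = a ∷ []
    B = b ∷ []
    oneA : Sub A
    oneA (here e) = here e
    oneB : Sub B
    oneB (here e) = there (here e)
    widen : ∀ {D i} → Sub D → i ∈ W ++ D → i ∈ W ++ a ∷ b ∷ []
    widen s i∈ with ∈ₚ.∈-++⁻ W i∈
    ... | inj₁ i∈W = ∈ₚ.∈-++⁺ˡ i∈W
    ... | inj₂ i∈D = ∈ₚ.∈-++⁺ʳ W (s i∈D)
    go : ∀ D E → Sub D → Sub E → perL M (W ++ D) (W ++ E) ≡ perL N (W ++ D) (W ++ E)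
    go D E sD sE = perL-cong (W ++ D) (W ++ E) (λ i j i∈ j∈ → eq i j (widen sD i∈) (widen sE j∈))

  -- M is cut into A, the entries with row or column in W₁, and the rest B. The hypotheses make A
  -- vanish on W₂, and since M is zero between the ports, A still agrees with M on W₁ together with
  -- the ports.
  portsOf-++ : ∀ M a b W₁ W₂ → (∀ i j → i ∈ a ∷ b ∷ [] → j ∈ a ∷ b ∷ [] → M i j ≡ 0ℤ) →
    (∀ i j → i ∈ W₁ → j ∈ W₂ → M i j ≡ 0ℤ × M j i ≡ 0ℤ) → (∀ i → i ∈ W₁ → i ∉ W₂ ++ a ∷ b ∷ []) →
    portsOf M a b (W₁ ++ W₂) ≡ portsOf M a b W₁ ⊗ portsOf M a b W₂
  portsOf-++ M a b W₁ W₂ zab z₁₂ disj = trans (portsOf-cong a b (W₁ ++ W₂) (λ i j _ _ → split i j))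
    (trans (portsOf-sum A B W₁ W₂ zA zB a b) (cong₂ _⊗_ (portsOf-cong a b W₁ eqA) (portsOf-cong a b W₂ eqB)))
    where
    A B : Fin n → Fin n → ℤ
    A i j = if does (i ∈? W₁) ∨ does (j ∈? W₁) then M i j else 0ℤ
    B i j = if does (i ∈? W₁) ∨ does (j ∈? W₁) then 0ℤ else M i j
    split : ∀ i j → M i j ≡ A i j + B i j
    split i j with does (i ∈? W₁) ∨ does (j ∈? W₁)
    ... | true  = sym (ℤₚ.+-identityʳ _)
    ... | false = sym (ℤₚ.+-identityˡ _)
    out : ∀ i → i ∈ W₂ ++ a ∷ b ∷ [] → does (i ∈? W₁) ≡ false
    out i i∈ with i ∈? W₁
    ... | yes i∈W = contradiction i∈ (disj i i∈W)
    ... | no  _   = refl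
    zA : Vanishes A W₂
    zA w w∈ x rewrite out w (∈ₚ.∈-++⁺ˡ w∈) with x ∈? W₁
    ... | yes x∈ = proj₂ (z₁₂ x w x∈ w∈) , proj₁ (z₁₂ x w x∈ w∈)
    ... | no  _  = refl , refl
    zB : Vanishes B W₁
    zB w w∈ x with w ∈? W₁
    ... | no w∉ = contradiction w∈ w∉
    ... | yes _ with does (x ∈? W₁)
    ...   | true  = refl , refl
    ...   | false = refl , refl
    eqA : ∀ i j → i ∈ W₁ ++ a ∷ b ∷ [] → j ∈ W₁ ++ a ∷ b ∷ [] → A i j ≡ M i j
    eqA i j i∈ j∈ with i ∈? W₁ | j ∈? W₁
    ... | yes _ | _     = refl
    ... | no  _ | yes _ = refl
    ... | no i∉ | no j∉ with ∈ₚ.∈-++⁻ W₁ i∈ | ∈ₚ.∈-++⁻ W₁ j∈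
    ...   | inj₁ i∈W | _        = contradiction i∈W i∉
    ...   | inj₂ _   | inj₁ j∈W = contradiction j∈W j∉
    ...   | inj₂ i∈D | inj₂ j∈D = sym (zab i j i∈D j∈D)
    eqB : ∀ i j → i ∈ W₂ ++ a ∷ b ∷ [] → j ∈ W₂ ++ a ∷ b ∷ [] → B i j ≡ M i j
    eqB i j i∈ j∈ rewrite out i i∈ | out j j∈ = refl

-- Paths and their permanents

module _ {n : ℕ} (H : Graph n) where

  Apart : Fin n → Fin n → Set
  Apart x y = x ≢ y × adj H x y ≡ false

  Apart-sym : ∀ {x y} → Apart x y → Apart y x
  Apart-sym {x} {y} (ne , na) = ne ∘ sym , trans (adj-sym H y x) na

  adj⇒≢ : ∀ {x y} → adj H x y ≡ true → x ≢ y
  adj⇒≢ {x} e refl with trans (sym e) (adj-irrefl H x)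
  ... | ()

  -- Path x ws l: the vertices x ∷ ws induce a path from x to l
  data Path : Fin n → List (Fin n) → Fin n → Set where
    single : ∀ {x} → Path x [] x
    step   : ∀ {x y ws l} → adj H x y ≡ true → All (Apart x) ws → Path y ws l → Path x (y ∷ ws) l

  mat : (Fin n → ℤ) → ℤ → Fin n → Fin n → ℤ
  mat d S i j = if does (i Finₚ.≟ j) then d i else (if adj H i j then S else 0ℤ)

-- The continuant: the permanent of the tridiagonal matrix with diagonal d and off-diagonal entries
-- S. For a permanent the S² term enters with a plus sign.
cont : {V : Set} → (V → ℤ) → ℤ → List V → ℤ
cont d S []           = 1ℤ
cont d S (x ∷ [])     = d x
cont d S (x ∷ y ∷ zs) = d x * cont d S (y ∷ zs) + S * S * cont d S zs

-- A Lucas sequence with characteristic polynomial t² - Y t - S². At index k + 1 it is the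
-- continuant of k equal entries Y; the shift leaves room for the value 0 at index 0, which end
-- cases require.
𝐆 : ℤ → ℤ → ℕ → ℤ
𝐆 Y S zero          = 0ℤ
𝐆 Y S (suc zero)    = 1ℤ
𝐆 Y S (suc (suc k)) = Y * 𝐆 Y S (suc k) + S * S * 𝐆 Y S k

dropLast : {V : Set} → V → List V → List V
dropLast x []       = []
dropLast x (y ∷ ws) = x ∷ dropLast y ws

dropLast-∷ʳ : ∀ {V : Set} (x : V) ws l → dropLast x (ws ++ l ∷ []) ≡ x ∷ ws
dropLast-∷ʳ x []       l = refl
dropLast-∷ʳ x (w ∷ ws) l = cong (x ∷_) (dropLast-∷ʳ w ws l)

module _ {V : Set} (d : V → ℤ) (Y S : ℤ) where

  AllY : List V → Set
  AllY = All (λ x → d x ≡ Y)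

  cont-regular : ∀ xs → AllY xs → cont d S xs ≡ 𝐆 Y S (suc (length xs))
  cont-regular []           []            = refl
  cont-regular (x ∷ [])     (e ∷ [])      = trans e (solve 2 (λ y s → y := y :* con 1ℤ :+ s :* s :* con 0ℤ) refl Y S)
  cont-regular (x ∷ y ∷ zs) (e ∷ e′ ∷ es) = cong₂ _+_ (cong₂ _*_ e (cont-regular (y ∷ zs) (e′ ∷ es))) (cong (S * S *_) (cont-regular zs es))

  -- An end vertex with diagonal entry 0 must be exchanged with its neighbour; both leave the path
  -- and a factor S² remains. For empty `xs` the value 0 at index 0 of `𝐆` is the right one.
  cont-∷ʳ : ∀ xs l → AllY xs → d l ≡ 0ℤ → cont d S (xs ++ l ∷ []) ≡ S * S * 𝐆 Y S (length xs)
  cont-∷ʳ []           l []            z = trans z (sym (ℤₚ.*-zeroʳ (S * S)))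
  cont-∷ʳ (x ∷ [])     l (e ∷ [])      z = trans (cong (λ k → d x * k + S * S * 1ℤ) z) (trans (cong (_+ S * S * 1ℤ) (ℤₚ.*-zeroʳ (d x))) (ℤₚ.+-identityˡ _))
  cont-∷ʳ (x ∷ y ∷ zs) l (e ∷ e′ ∷ es) z = trans
    (cong₂ _+_ (cong₂ _*_ e (cont-∷ʳ (y ∷ zs) l (e′ ∷ es) z)) (cong (S * S *_) (cont-∷ʳ zs l es z)))
    (solve 4 (λ y s g h → y :* (s :* s :* g) :+ s :* s :* (s :* s :* h) := s :* s :* (y :* g :+ s :* s :* h)) refl
      Y S (𝐆 Y S (suc (length zs))) (𝐆 Y S (length zs)))

  cont-∷ : ∀ x y zs → d x ≡ 0ℤ → cont d S (x ∷ y ∷ zs) ≡ S * S * cont d S zs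
  cont-∷ x y zs z = trans (cong (λ k → k * cont d S (y ∷ zs) + S * S * cont d S zs) z) (ℤₚ.+-identityˡ _)

module _ {n : ℕ} (H : Graph n) (d : Fin n → ℤ) (S : ℤ) where

  private
    M : Fin n → Fin n → ℤ
    M = mat H d S

  mat-diag : ∀ x → M x x ≡ d x
  mat-diag x with x Finₚ.≟ x
  ... | yes _ = refl
  ... | no ne = contradiction refl ne

  mat-adj : ∀ {x y} → adj H x y ≡ true → M x y ≡ S
  mat-adj {x} {y} e with x Finₚ.≟ y
  ... | yes eq = contradiction eq (adj⇒≢ H e)
  ... | no _ rewrite e = refl

  mat-apart : ∀ {x y} → Apart H x y → M x y ≡ 0ℤ
  mat-apart {x} {y} (ne , na) with x Finₚ.≟ y
  ... | yes eq = contradiction eq ne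
  ... | no _ rewrite na = refl

  mat-sym : ∀ x y → M x y ≡ M y x
  mat-sym x y with x Finₚ.≟ y | y Finₚ.≟ x
  ... | yes refl | yes _ = refl
  ... | yes refl | no ne = contradiction refl ne
  ... | no ne | yes refl = contradiction refl ne
  ... | no _  | no _     = cong (λ t → if t then S else 0ℤ) (adj-sym H x y)

  perL-sym : ∀ rs cs → perL M rs cs ≡ perL M cs rs
  perL-sym rs cs = trans (perL-transpose M rs cs) (perL-cong cs rs (λ r c _ _ → mat-sym c r))

  private
    zeros : ∀ {x ws} → All (Apart H x) ws → ∀ w → w ∈ ws → M x w ≡ 0ℤ
    zeros ap w w∈ = mat-apart (All.lookup ap w∈)

    zeros′ : ∀ {x ws} → All (Apart H x) ws → ∀ w → w ∈ ws → M w x ≡ 0ℤ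
    zeros′ ap w w∈ = trans (mat-sym w _) (zeros ap w w∈)

  -- The first vertex is fixed or exchanged with its successor; since the path is induced, all other
  -- choices meet a zero. The exchange removes two vertices, hence the companion statement about the
  -- tail.
  perL-path : ∀ {x ws l} → Path H x ws l → perL M (x ∷ ws) (x ∷ ws) ≡ cont d S (x ∷ ws)
  perL-tail : ∀ {x ws l} → Path H x ws l → perL M ws ws ≡ cont d S ws

  perL-path {x} single = trans (cong (λ k → k * 1ℤ + 0ℤ) (mat-diag x)) (solve 1 (λ k → k :* con 1ℤ :+ con 0ℤ := k) refl (d x))
  perL-path {x} (step {y = y} {ws} e ap p) = cong₂ _+_ (cong₂ _*_ (mat-diag x) (perL-path p)) (begin
    M x y * perL M (y ∷ ws) (x ∷ ws) + sumPick (λ c cs → M x c * perL M (y ∷ ws) (x ∷ y ∷ cs)) ws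
      ≡⟨ +-congˡ (M x y * perL M (y ∷ ws) (x ∷ ws)) (sumPick-zeros ws (λ w w∈ cs → cong (_* perL M (y ∷ ws) (x ∷ y ∷ cs)) (zeros ap w w∈))) ⟩
    M x y * perL M (y ∷ ws) (x ∷ ws) + 0ℤ
      ≡⟨ ℤₚ.+-identityʳ _ ⟩
    M x y * perL M (y ∷ ws) (x ∷ ws)
      ≡⟨ cong (M x y *_) (perL-col-head M y ws x ws (zeros′ ap)) ⟩
    M x y * (M y x * perL M ws ws)
      ≡⟨ cong₂ (λ k l → k * (l * perL M ws ws)) (mat-adj e) (trans (mat-sym y x) (mat-adj e)) ⟩
    S * (S * perL M ws ws)
      ≡⟨ cong (λ k → S * (S * k)) (perL-tail p) ⟩
    S * (S * cont d S ws)
      ≡⟨ ℤₚ.*-assoc S S _ ⟨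
    S * S * cont d S ws ∎)

  perL-tail single       = refl
  perL-tail (step _ _ p) = perL-path p

  -- Without its last row and first column the matrix of a path is triangular with S on the
  -- diagonal. This gives the minors of a chain from one port to the other.
  perL-shift : ∀ {x ws l} → Path H x ws l → perL M (dropLast x ws) ws ≡ S ℤ.^ length ws
  perL-shift single = refl
  perL-shift {x} (step {y = y} {ws} e ap p) = trans (perL-row-head M x (dropLast y ws) y ws (zeros ap))
    (cong₂ _*_ (mat-adj e) (perL-shift p))

  Path-init : ∀ {x} ws {l} → Path H x (ws ++ l ∷ []) l → ∃[ k ] Path H x ws k
  Path-init []       (step e ap p) = _ , single
  Path-init (w ∷ ws) (step e ap p) with Path-init ws p
  ... | k , q = k , step e (Allₚ.++⁻ˡ ws ap) q

  sumPick-ends : ∀ (f : Fin n → List (Fin n) → ℤ) x ms l → (∀ c → c ∈ ms → ∀ ds → f c ds ≡ 0ℤ) →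
    sumPick f (x ∷ ms ++ l ∷ []) ≡ f x (ms ++ l ∷ []) + f l (x ∷ ms)
  sumPick-ends f x ms l z = +-congˡ (f x (ms ++ l ∷ [])) (last _ ms z′)
    where
    z′ : ∀ c → c ∈ ms → ∀ ds → f c (x ∷ ds) ≡ 0ℤ
    z′ c c∈ ds = z c c∈ (x ∷ ds)
    last : ∀ (g : Fin n → List (Fin n) → ℤ) ms → (∀ c → c ∈ ms → ∀ ds → g c ds ≡ 0ℤ) → sumPick g (ms ++ l ∷ []) ≡ g l ms
    last g []       z = ℤₚ.+-identityʳ _
    last g (m ∷ ms) z = trans (cong₂ _+_ (z m (here refl) (ms ++ l ∷ [])) (last (λ c ds → g c (m ∷ ds)) ms (λ c c∈ ds → z c (there c∈) (m ∷ ds))))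
      (ℤₚ.+-identityˡ _)

  -- A cycle through e: the path x ∷ ms ++ [ l ] closed up by e
  perL-cycle : ∀ Y e x ms l → Path H x (ms ++ l ∷ []) l → adj H e x ≡ true → adj H e l ≡ true → All (Apart H e) ms →
    AllY d Y S (x ∷ ms ++ l ∷ []) →
    perL M (e ∷ x ∷ ms ++ l ∷ []) (e ∷ x ∷ ms ++ l ∷ [])
      ≡ d e * 𝐆 Y S (suc (suc (suc (length ms)))) + + 2 * (S * S * 𝐆 Y S (suc (suc (length ms)))) + + 2 * S ℤ.^ suc (suc (suc (length ms)))
  perL-cycle Y e x ms l p ex el ap (dx ∷ dms) = begin
    M e e * perL M L L + sumPick (λ c cs → M e c * perL M L (e ∷ cs)) L
      ≡⟨ cong₂ _+_ (cong₂ _*_ (mat-diag e) (trans (perL-path p) (trans (cont-regular d Y S L (dx ∷ dms)) (cong (λ k → 𝐆 Y S (suc (suc k))) len))))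
          (sumPick-ends _ x ms l (λ c c∈ cs → cong (_* perL M L (e ∷ cs)) (zeros ap c c∈))) ⟩
    d e * g₃ + (M e x * perL M L (e ∷ ms ++ l ∷ []) + M e l * perL M L (e ∷ x ∷ ms))
      ≡⟨ +-congˡ (d e * g₃) (cong₂ _+_ (cong₂ _*_ (mat-adj ex) (column (ms ++ l ∷ []))) (cong₂ _*_ (mat-adj el) (column (x ∷ ms)))) ⟩
    -- The two principal minors belong to the exchange of e with a neighbour, the two mixed ones to
    -- the two orientations of the whole cycle.
    d e * g₃ + (S * (S * perL M ml ml + S * perL M xm ml) + S * (S * perL M ml xm + S * perL M xm xm))
      ≡⟨ +-congˡ (d e * g₃) (cong₂ (λ s t → S * s + S * t) (cong₂ (λ s t → S * s + S * t) tail shift) (cong₂ (λ s t → S * s + S * t) (trans (perL-sym ml xm) shift) init)) ⟩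
    d e * g₃ + (S * (S * g₂ + S * s₁) + S * (S * s₁ + S * g₂))
      ≡⟨ solve 4 (λ a g s t → a :+ (s :* (s :* g :+ s :* t) :+ s :* (s :* t :+ s :* g)) := a :+ con (+ 2) :* (s :* s :* g) :+ con (+ 2) :* (s :* (s :* t)))
          refl (d e * g₃) g₂ S s₁ ⟩
    d e * g₃ + + 2 * (S * S * g₂) + + 2 * (S * (S * s₁)) ∎
    where
    xm ml L : List (Fin n)
    xm = x ∷ ms
    ml = ms ++ l ∷ []
    L = x ∷ ml
    g₂ g₃ s₁ : ℤ
    g₂ = 𝐆 Y S (suc (suc (length ms)))
    g₃ = 𝐆 Y S (suc (suc (suc (length ms))))
    s₁ = S ℤ.^ suc (length ms)
    len : length ml ≡ suc (length ms)
    len = trans (Listₚ.length-++ ms) (ℕₚ.+-comm (length ms) 1)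
    column : ∀ C → perL M L (e ∷ C) ≡ S * perL M ml C + S * perL M xm C
    column C = trans (perL-col M L e C) (trans (sumPick-ends _ x ms l (λ r r∈ rs → cong (_* perL M rs C) (zeros′ ap r r∈)))
      (cong₂ _+_ (cong (_* perL M ml C) (trans (mat-sym x e) (mat-adj ex))) (cong (_* perL M xm C) (trans (mat-sym l e) (mat-adj el)))))
    tail : perL M ml ml ≡ g₂
    tail = trans (perL-tail p) (trans (cont-regular d Y S ml dms) (cong (λ k → 𝐆 Y S (suc k)) len))
    init : perL M xm xm ≡ g₂
    init = trans (perL-path (proj₂ (Path-init ms p))) (cont-regular d Y S xm (dx ∷ Allₚ.++⁻ˡ ms dms))
    shift : perL M xm ml ≡ s₁
    shift = trans (cong (λ R → perL M R ml) (sym (dropLast-∷ʳ x ms l))) (trans (perL-shift p) (cong (S ℤ.^_) len))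

-- A block is a connected component of the graph left after deletion of the ports a and b.
-- The argument of a kind is the number of vertices of a chain, and the length minus 3 of a cycle.

data Kind : Set where
  chain loopᵃ loopᵇ ring : ℕ → Kind

-- For p ≥ 1 the last entry of a chain is S⁴ times `𝐆` at p - 1. Written as a difference it also
-- covers p = 0, where the ports 1, 0, 0, S, S, S² are those of a bare edge between a and b.
kindPorts : ℤ → ℤ → Kind → Ports
kindPorts Y S (chain p) = ports (𝐆 Y S (suc p)) (S * S * 𝐆 Y S p) (S * S * 𝐆 Y S p) (S ℤ.^ suc p) (S ℤ.^ suc p) (S * S * (𝐆 Y S (suc p) - Y * 𝐆 Y S p))
kindPorts Y S (loopᵃ m) = ports (𝐆 Y S (3 ℕ.+ m)) (+ 2 * (S * S * 𝐆 Y S (2 ℕ.+ m)) + + 2 * S ℤ.^ (3 ℕ.+ m)) 0ℤ 0ℤ 0ℤ 0ℤ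
kindPorts Y S (loopᵇ m) = ports (𝐆 Y S (3 ℕ.+ m)) 0ℤ (+ 2 * (S * S * 𝐆 Y S (2 ℕ.+ m)) + + 2 * S ℤ.^ (3 ℕ.+ m)) 0ℤ 0ℤ 0ℤ
kindPorts Y S (ring m)  = ports (Y * 𝐆 Y S (3 ℕ.+ m) + + 2 * (S * S * 𝐆 Y S (2 ℕ.+ m)) + + 2 * S ℤ.^ (3 ℕ.+ m)) 0ℤ 0ℤ 0ℤ 0ℤ 0ℤ

module _ {n : ℕ} (H : Graph n) where

  record Cycle (e x : Fin n) (ms : List (Fin n)) (l : Fin n) : Set where
    constructor cycle
    field
      path  : Path H x (ms ++ l ∷ []) l
      first : adj H e x ≡ true
      last  : adj H e l ≡ true
      rest  : All (Apart H e) ms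

  data Block (a b : Fin n) : Kind → List (Fin n) → Set where
    chain : ∀ {y ws} → Path H b (y ∷ ws ++ a ∷ []) a → Block a b (chain (suc (length ws))) (y ∷ ws)
    loopᵃ : ∀ {x ms l} → Cycle a x ms l → All (Apart H b) (x ∷ ms ++ l ∷ []) → Block a b (loopᵃ (length ms)) (x ∷ ms ++ l ∷ [])
    loopᵇ : ∀ {x ms l} → Cycle b x ms l → All (Apart H a) (x ∷ ms ++ l ∷ []) → Block a b (loopᵇ (length ms)) (x ∷ ms ++ l ∷ [])
    ring  : ∀ {e x ms l} → Cycle e x ms l → All (Apart H a) (e ∷ x ∷ ms ++ l ∷ []) → All (Apart H b) (e ∷ x ∷ ms ++ l ∷ []) →
            Block a b (ring (length ms)) (e ∷ x ∷ ms ++ l ∷ [])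

  module _ (d : Fin n → ℤ) (Y S : ℤ) {a b : Fin n} (da : d a ≡ 0ℤ) (db : d b ≡ 0ℤ) (ab : Apart H a b) where

    private
      M : Fin n → Fin n → ℤ
      M = mat H d S
      G : ℕ → ℤ
      G = 𝐆 Y S

    ports-zero : ∀ i j → i ∈ a ∷ b ∷ [] → j ∈ a ∷ b ∷ [] → M i j ≡ 0ℤ
    ports-zero i j (here refl)         (here refl)         = trans (mat-diag H d S a) da
    ports-zero i j (here refl)         (there (here refl)) = mat-apart H d S ab
    ports-zero i j (there (here refl)) (here refl)         = mat-apart H d S (Apart-sym H ab)
    ports-zero i j (there (here refl)) (there (here refl)) = trans (mat-diag H d S b) db

    private
      dead : ∀ f W E → f ∈ a ∷ b ∷ [] → All (Apart H f) W → (∀ {c} → c ∈ E → c ∈ a ∷ b ∷ []) → ∀ c → c ∈ W ++ E → M f c ≡ 0ℤ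
      dead f W E f∈ ap E⊆ c c∈ with ∈ₚ.∈-++⁻ W c∈
      ... | inj₁ c∈W = mat-apart H d S (All.lookup ap c∈W)
      ... | inj₂ c∈E = ports-zero f c f∈ (E⊆ c∈E)

      deadRow : ∀ f W D E → f ∈ a ∷ b ∷ [] → All (Apart H f) W → (∀ {c} → c ∈ E → c ∈ a ∷ b ∷ []) → f ∈ D → perL M (W ++ D) (W ++ E) ≡ 0ℤ
      deadRow f W D E f∈ ap E⊆ f∈D = perL-zero-row M (W ++ D) (W ++ E) (∈ₚ.∈-++⁺ʳ W f∈D) (dead f W E f∈ ap E⊆)

      deadCol : ∀ f W D E → f ∈ a ∷ b ∷ [] → All (Apart H f) W → (∀ {c} → c ∈ D → c ∈ a ∷ b ∷ []) → f ∈ E → perL M (W ++ D) (W ++ E) ≡ 0ℤ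
      deadCol f W D E f∈ ap D⊆ f∈E = trans (perL-sym H d S (W ++ D) (W ++ E)) (deadRow f W E D f∈ ap D⊆ f∈E)

      [a] [b] : List (Fin n)
      [a] = a ∷ []
      [b] = b ∷ []

      ina : ∀ {c} → c ∈ [a] → c ∈ a ∷ b ∷ []
      ina (here e) = here e
      inb : ∀ {c} → c ∈ [b] → c ∈ a ∷ b ∷ []
      inb (here e) = there (here e)

      a∈ : a ∈ a ∷ b ∷ []
      a∈ = here refl
      b∈ : b ∈ a ∷ b ∷ []
      b∈ = there (here refl)

    portsOf-[] : portsOf M a b [] ≡ 1⊗
    portsOf-[] = ports-cong refl (deadRow a [] [a] [a] a∈ [] ina (here refl)) (deadRow b [] [b] [b] b∈ [] inb (here refl))
      (deadRow a [] [a] [b] a∈ [] inb (here refl)) (deadRow b [] [b] [a] b∈ [] ina (here refl))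
      (deadRow a [] (a ∷ b ∷ []) (a ∷ b ∷ []) a∈ [] id (here refl))

    perL-[] : ∀ W → perL M (W ++ []) (W ++ []) ≡ perL M W W
    perL-[] W = cong (λ L → perL M L L) (Listₚ.++-identityʳ W)

    perL-∷ʳ : ∀ W w → perL M (W ++ w ∷ []) (W ++ w ∷ []) ≡ perL M (w ∷ W) (w ∷ W)
    perL-∷ʳ W w = trans (perL-rows M (W ++ w ∷ []) (↭-sym (↭ₚ.∷↭∷ʳ w W))) (perL-cols M (w ∷ W) (↭-sym (↭ₚ.∷↭∷ʳ w W)))

    private
      chainPorts : ∀ y ws → Path H b (y ∷ ws ++ [a]) a → AllY d Y S (y ∷ ws) → portsOf M a b (y ∷ ws) ≡ kindPorts Y S (chain (suc (length ws)))
      chainPorts y ws P@(step by apb P′) dY@(_ ∷ dws) = ports-cong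
        (trans (perL-[] W) (trans (perL-path H d S (proj₂ (Path-init H d S ws P′))) (cont-regular d Y S W dY)))
        (trans (perL-path H d S P′) (cont-∷ʳ d Y S W a dY da))
        (trans (perL-∷ʳ W b) (trans (perL-path H d S (proj₂ (Path-init H d S W P))) (trans (cont-∷ d Y S b y ws db)
          (cong (S * S *_) (cont-regular d Y S ws dws)))))
        (trans (perL-cols M (W ++ [a]) toDrop) (trans (perL-sym H d S (W ++ [a]) _) shift))
        (trans (perL-rows M (W ++ [a]) toDrop) shift)
        (trans (cong (λ L → perL M L L) (sym (Listₚ.++-assoc W [a] [b]))) (trans (perL-∷ʳ (W ++ [a]) b) (trans (perL-path H d S P)
          (trans (cont-∷ d Y S b y (ws ++ [a]) db) (trans (cong (S * S *_) (cont-∷ʳ d Y S ws a dws da))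
            (solve 4 (λ y s g h → s :* s :* (s :* s :* h) := s :* s :* ((y :* g :+ s :* s :* h) :- y :* g)) refl Y S (G (suc (length ws))) (G (length ws))))))))
        where
        W : List (Fin n)
        W = y ∷ ws
        toDrop : W ++ [b] ↭ dropLast b (W ++ [a])
        toDrop = ↭-trans (↭-sym (↭ₚ.∷↭∷ʳ b W)) (↭-reflexive (sym (dropLast-∷ʳ b W a)))
        shift : perL M (dropLast b (W ++ [a])) (W ++ [a]) ≡ S ℤ.^ suc (suc (length ws))
        shift = trans (perL-shift H d S P) (cong (λ k → S ℤ.^ suc k) (trans (Listₚ.length-++ ws) (ℕₚ.+-comm (length ws) 1)))

      pathPerm : ∀ x ms l → Path H x (ms ++ l ∷ []) l → AllY d Y S (x ∷ ms ++ l ∷ []) → perL M (x ∷ ms ++ l ∷ []) (x ∷ ms ++ l ∷ []) ≡ G (3 ℕ.+ length ms)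
      pathPerm x ms l p dY = trans (perL-path H d S p) (trans (cont-regular d Y S (x ∷ ms ++ l ∷ []) dY)
        (cong (λ k → G (suc (suc k))) (trans (Listₚ.length-++ ms) (ℕₚ.+-comm (length ms) 1))))

      cyclePorts : ∀ e x ms l → Cycle e x ms l → AllY d Y S (x ∷ ms ++ l ∷ []) → d e ≡ 0ℤ →
        perL M ((x ∷ ms ++ l ∷ []) ++ e ∷ []) ((x ∷ ms ++ l ∷ []) ++ e ∷ []) ≡ + 2 * (S * S * G (2 ℕ.+ length ms)) + + 2 * S ℤ.^ (3 ℕ.+ length ms)
      cyclePorts e x ms l (cycle p f t r) dY de = trans (perL-∷ʳ (x ∷ ms ++ l ∷ []) e) (trans (perL-cycle H d S Y e x ms l p f t r dY)
        (trans (cong (λ k → k * G (3 ℕ.+ length ms) + two + + 2 * S ℤ.^ (3 ℕ.+ length ms)) de) (cong (_+ + 2 * S ℤ.^ (3 ℕ.+ length ms)) (ℤₚ.+-identityˡ two))))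
        where
        two : ℤ
        two = + 2 * (S * S * G (2 ℕ.+ length ms))

    -- The ports have diagonal entry 0 and are not adjacent here. A port without neighbours in the
    -- block thus has a zero row and column, and every minor involving it vanishes.
    blockPorts : ∀ {k W} → Block a b k W → AllY d Y S W → portsOf M a b W ≡ kindPorts Y S k
    blockPorts (chain {y} {ws} P) dY = chainPorts y ws P dY
    blockPorts (loopᵃ {x} {ms} {l} C apb) dY = ports-cong
      (trans (perL-[] W) (pathPerm x ms l (Cycle.path C) dY))
      (cyclePorts a x ms l C dY da)
      (deadRow b W [b] [b] b∈ apb inb (here refl))
      (deadCol b W [a] [b] b∈ apb ina (here refl))
      (deadRow b W [b] [a] b∈ apb ina (here refl))
      (deadRow b W (a ∷ b ∷ []) (a ∷ b ∷ []) b∈ apb id (there (here refl)))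
      where
      W : List (Fin n)
      W = x ∷ ms ++ l ∷ []
    blockPorts (loopᵇ {x} {ms} {l} C apa) dY = ports-cong
      (trans (perL-[] W) (pathPerm x ms l (Cycle.path C) dY))
      (deadRow a W [a] [a] a∈ apa ina (here refl))
      (cyclePorts b x ms l C dY db)
      (deadRow a W [a] [b] a∈ apa inb (here refl))
      (deadCol a W [b] [a] a∈ apa inb (here refl))
      (deadRow a W (a ∷ b ∷ []) (a ∷ b ∷ []) a∈ apa id (here refl))
      where
      W : List (Fin n)
      W = x ∷ ms ++ l ∷ []
    blockPorts (ring {e} {x} {ms} {l} (cycle p f t r) apa apb) (de ∷ dY) = ports-cong
      (trans (perL-[] W) (trans (perL-cycle H d S Y e x ms l p f t r dY)
        (cong (λ k → k * G (3 ℕ.+ length ms) + + 2 * (S * S * G (2 ℕ.+ length ms)) + + 2 * S ℤ.^ (3 ℕ.+ length ms)) de)))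
      (deadRow a W [a] [a] a∈ apa ina (here refl))
      (deadRow b W [b] [b] b∈ apb inb (here refl))
      (deadRow a W [a] [b] a∈ apa inb (here refl))
      (deadRow b W [b] [a] b∈ apb ina (here refl))
      (deadRow a W (a ∷ b ∷ []) (a ∷ b ∷ []) a∈ apa id (here refl))
      where
      W : List (Fin n)
      W = e ∷ x ∷ ms ++ l ∷ []

-- Decomposition of a graph whose vertices other than a and b have degree 2

AllPairs-resp-↭ : ∀ {A : Set} {R : A → A → Set} → (∀ {x y} → R x y → R y x) → ∀ {xs ys} → xs ↭ ys → AllPairs R xs → AllPairs R ys
AllPairs-resp-↭ s _↭_.refl         ps             = ps
AllPairs-resp-↭ s (prep x p)       (r ∷ ps)       = ↭ₚ.All-resp-↭ p r ∷ AllPairs-resp-↭ s p ps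
AllPairs-resp-↭ s (swap x y p)     ((r ∷ rs) ∷ r′ ∷ ps) = (s r ∷ ↭ₚ.All-resp-↭ p r′) ∷ ↭ₚ.All-resp-↭ p rs ∷ AllPairs-resp-↭ s p ps
AllPairs-resp-↭ s (_↭_.trans p q)  ps             = AllPairs-resp-↭ s q (AllPairs-resp-↭ s p ps)

Unique-resp-↭ : ∀ {A : Set} {xs ys : List A} → xs ↭ ys → Unique xs → Unique ys
Unique-resp-↭ = AllPairs-resp-↭ (λ ne → ne ∘ sym)

Unique-disjoint : ∀ {A : Set} {x : A} xs {ys} → Unique (xs ++ ys) → x ∈ xs → x ∈ ys → ⊥
Unique-disjoint (_ ∷ xs) (ap ∷ us) (here refl) x∈ys = All.lookup ap (∈ₚ.∈-++⁺ʳ xs x∈ys) refl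
Unique-disjoint (_ ∷ xs) (ap ∷ us) (there x∈)  x∈ys = Unique-disjoint xs us x∈ x∈ys

Unique-++ʳ : ∀ {A : Set} (xs : List A) {ys} → Unique (xs ++ ys) → Unique ys
Unique-++ʳ []       us       = us
Unique-++ʳ (_ ∷ xs) (_ ∷ us) = Unique-++ʳ xs us

∈-∃↭ : ∀ {A : Set} {x : A} {xs} → x ∈ xs → ∃[ ys ] xs ↭ x ∷ ys
∈-∃↭ x∈ with ∈ₚ.∈-∃++ x∈
... | as , bs , refl = as ++ bs , ↭ₚ.shift _ as bs

module _ {n : ℕ} (H : Graph n) where

  open import Data.List.Membership.DecPropositional (Finₚ._≟_ {n}) using (_∈?_)

  Degree2 : Fin n → Set
  Degree2 x = ∃[ p ] ∃[ q ] p ≢ q × adj H x p ≡ true × adj H x q ≡ true × (∀ z → adj H x z ≡ true → z ≡ p ⊎ z ≡ q)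

  other : ∀ {x p} → Degree2 x → adj H x p ≡ true → ∃[ q ] q ≢ p × adj H x q ≡ true × (∀ z → adj H x z ≡ true → z ≡ p ⊎ z ≡ q)
  other {x} {p} (p′ , q′ , ne , ep , eq , only) e with only p e
  ... | inj₁ refl = q′ , ne ∘ sym , eq , only
  ... | inj₂ refl = p′ , ne , ep , λ z ez → case only z ez of λ { (inj₁ r) → inj₂ r ; (inj₂ r) → inj₁ r }

  apart : ∀ {x y} → x ≢ y → (adj H x y ≡ true → ⊥) → Apart H x y
  apart {x} {y} ne na with adj H x y
  ... | true  = contradiction refl na
  ... | false = ne , refl

  adj-flip : ∀ {x y} → adj H x y ≡ true → adj H y x ≡ true
  adj-flip {x} {y} e = trans (adj-sym H y x) e

  Path-last∈ : ∀ {x ws l} → Path H x ws l → l ∈ x ∷ ws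
  Path-last∈ single       = here refl
  Path-last∈ (step _ _ p) = there (Path-last∈ p)

  Path-unsnoc : ∀ {x ws l} → Path H x ws l → x ≡ l ⊎ ∃[ ms ] ws ≡ ms ++ l ∷ []
  Path-unsnoc single = inj₁ refl
  Path-unsnoc (step _ _ p) with Path-unsnoc p
  ... | inj₁ refl with p
  ...   | single         = inj₂ ([] , refl)
  ...   | step e ap q    = ⊥-elim (loop e ap q)
    where
    loop : ∀ {x y ws} → adj H x y ≡ true → All (Apart H x) ws → Path H y ws x → ⊥
    loop e ap q with Path-last∈ q
    ... | here refl = adj⇒≢ H e refl
    ... | there x∈  = proj₁ (All.lookup ap x∈) refl
  Path-unsnoc (step _ _ p) | inj₂ (ms , refl) = inj₂ (_ ∷ ms , refl)

  Path-unique : ∀ {x ws l} → Path H x ws l → Unique (x ∷ ws)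
  Path-unique single        = [] ∷ []
  Path-unique (step e ap p) = (adj⇒≢ H e ∷ All.map proj₁ ap) ∷ Path-unique p

  Path-snoc : ∀ {x ws l e} → Path H x ws l → adj H l e ≡ true → (∀ w → w ∈ x ∷ ws → w ≢ l → Apart H w e) → Path H x (ws ++ e ∷ []) e
  Path-snoc single le ap = step le [] single
  Path-snoc P@(step xy apx p) le ap = step xy
    (Allₚ.++⁺ apx (ap _ (here refl) (All.lookup (AllPairs.head (Path-unique P)) (Path-last∈ p)) ∷ []))
    (Path-snoc p le (λ w w∈ → ap w (there w∈)))

  -- A path from y to l whose only further edges join y to z and l to e
  record Arc (e y : Fin n) (ws : List (Fin n)) (l z : Fin n) : Set where
    field
      path   : Path H y ws l
      yz     : adj H y z ≡ true
      le     : adj H l e ≡ true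
      closed : ∀ w → w ∈ y ∷ ws → ∀ t → adj H w t ≡ true → t ∈ y ∷ ws ⊎ (w ≡ y × t ≡ z) ⊎ (w ≡ l × t ≡ e)
      z∉     : z ∉ y ∷ ws
      e∉     : e ∉ y ∷ ws
      -- The outer neighbours of a one-vertex arc are distinct; this prevents an arc from closing up
      -- into a cycle of length 2.
      y≡l⇒   : y ≡ l → z ≢ e

  startArc : ∀ {e x} → Degree2 x → adj H x e ≡ true → ∃[ z ] Arc e x [] x z
  startArc {e} {x} d2 xe with other d2 xe
  ... | z , z≢e , xz , only = z , record
    { path = single ; yz = xz ; le = xe
    ; closed = λ { w (here refl) t wt → case only t wt of λ { (inj₁ r) → inj₂ (inj₂ (refl , r)) ; (inj₂ r) → inj₂ (inj₁ (refl , r)) } }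
    ; z∉ = λ { (here refl) → adj⇒≢ H xz refl } ; e∉ = λ { (here refl) → adj⇒≢ H xe refl } ; y≡l⇒ = λ _ → z≢e }

  -- The arc grows at its head y. By `closed`, the new vertex z can touch the old ones only at y:
  -- any other contact would be at the tail, whose free edge leads to e.
  extendArc : ∀ {e y ws l z} → Arc e y ws l z → Degree2 z → z ≢ e → ∃[ z′ ] Arc e z (y ∷ ws) l z′
  extendArc {e} {y} {ws} {l} {z} A d2 z≢e with other d2 (adj-flip (Arc.yz A))
  ... | z′ , z′≢y , zz′ , only = z′ , record
    { path = step (adj-flip yz) (All.tabulate away) path ; yz = zz′ ; le = le
    ; closed = closed′
    ; z∉ = λ { (here refl) → adj⇒≢ H zz′ refl ; (there (here refl)) → z′≢y refl
             ; (there (there z′∈)) → case trans (sym zz′) (proj₂ (away z′∈)) of λ () }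
    ; e∉ = λ { (here refl) → z≢e refl ; (there e∈) → e∉ e∈ }
    ; y≡l⇒ = λ z≡l → ⊥-elim (z∉ (subst (_∈ y ∷ ws) (sym z≡l) (Path-last∈ path))) }
    where
    open Arc A
    away : ∀ {w} → w ∈ ws → Apart H z w
    away {w} w∈ = apart (λ { refl → z∉ (there w∈) }) λ zw → case closed w (there w∈) z (adj-flip zw) of λ
      { (inj₁ z∈) → z∉ z∈
      ; (inj₂ (inj₁ (refl , _))) → All.lookup (AllPairs.head (Path-unique path)) w∈ refl
      ; (inj₂ (inj₂ (_ , z≡e))) → z≢e z≡e }
    closed′ : ∀ w → w ∈ z ∷ y ∷ ws → ∀ t → adj H w t ≡ true → t ∈ z ∷ y ∷ ws ⊎ (w ≡ z × t ≡ z′) ⊎ (w ≡ l × t ≡ e)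
    closed′ w (here refl) t wt with only t wt
    ... | inj₁ refl = inj₁ (there (here refl))
    ... | inj₂ refl = inj₂ (inj₁ (refl , refl))
    closed′ w (there w∈) t wt with closed w w∈ t wt
    ... | inj₁ t∈                    = inj₁ (there t∈)
    ... | inj₂ (inj₁ (_ , refl))     = inj₁ (here refl)
    ... | inj₂ (inj₂ r)              = inj₂ (inj₂ r)

  -- The number k of vertices not yet absorbed bounds the recursion. Growth stops when the next
  -- vertex lies outside the remaining list; in the applications it is then a port or the starting
  -- point e.
  growArc : ∀ k {e y ws l z} L → length L ≡ k → All Degree2 L → e ∉ L → Arc e y ws l z →
    ∃[ y′ ] ∃[ ws′ ] ∃[ z′ ] ∃[ L′ ] Arc e y′ ws′ l z′ × z′ ∉ L′ × y′ ∷ ws′ ++ L′ ↭ y ∷ ws ++ L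
  growArc k {z = z} L len d2 e∉L A with z ∈? L
  ... | no z∉L = _ , _ , _ , L , A , z∉L , ↭-refl
  growArc zero [] len d2 e∉L A | yes ()
  growArc (suc k) {e} {y} {ws} {l} {z} L len d2 e∉L A | yes z∈L with ∈-∃↭ z∈L
  ... | L₁ , perm with ↭ₚ.All-resp-↭ perm d2
  ...   | dz ∷ d2′ with extendArc A dz (λ { refl → e∉L z∈L })
  ...     | z′ , A′ with growArc k L₁ (ℕₚ.suc-injective (trans (sym (↭ₚ.↭-length perm)) len)) d2′ (λ e∈ → e∉L (↭ₚ.∈-resp-↭ (↭-sym perm) (there e∈))) A′
  ...       | y″ , ws″ , z″ , L″ , A″ , z″∉ , perm″ = y″ , ws″ , z″ , L″ , A″ , z″∉ ,
    ↭-trans perm″ (↭-trans (↭-sym (↭ₚ.shift z (y ∷ ws) L₁)) (↭ₚ.++⁺ˡ (y ∷ ws) (↭-sym perm)))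

  Separated : List (Fin n) → List (Fin n) → Set
  Separated W W′ = ∀ {i j} → i ∈ W → j ∈ W′ → Apart H i j

  Separated-sym : ∀ {W W′} → Separated W W′ → Separated W′ W
  Separated-sym s i∈ j∈ = Apart-sym H (s j∈ i∈)

  record Decomposition (a b : Fin n) (L : List (Fin n)) : Set where
    field
      blocks    : List (Kind × List (Fin n))
      valid     : All (λ B → Block H a b (proj₁ B) (proj₂ B)) blocks
      separated : AllPairs (λ B B′ → Separated (proj₂ B) (proj₂ B′)) blocks
      covers    : concat (map proj₂ blocks) ↭ L

  consBlock : ∀ {a b k W L L′} → Block H a b k W → Separated W L′ → W ++ L′ ↭ L → Decomposition a b L′ → Decomposition a b L
  consBlock {W = W} {L′ = L′} B sep perm D = record
    { blocks = (_ , W) ∷ blocks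
    ; valid = B ∷ valid
    ; separated = All.tabulate (λ {B′} B′∈ i∈ j∈ → sep i∈ (↭ₚ.∈-resp-↭ covers (∈ₚ.∈-concat⁺′ j∈ (∈ₚ.∈-map⁺ proj₂ B′∈)))) ∷ separated
    ; covers = ↭-trans (↭ₚ.++⁺ˡ W covers) perm }
    where open Decomposition D

  Closed : Fin n → Fin n → List (Fin n) → Set
  Closed a b L = ∀ x → x ∈ L → ∀ t → adj H x t ≡ true → t ∈ L ⊎ t ≡ a ⊎ t ≡ b

  arc-separated : ∀ {e y ws l z L′} → Arc e y ws l z → Unique (y ∷ ws ++ L′) → z ∉ L′ → e ∉ L′ → Separated (y ∷ ws) L′
  arc-separated {ws = ws} A un z∉L′ e∉L′ {i} {j} i∈ j∈ = apart (λ { refl → Unique-disjoint (_ ∷ ws) un i∈ j∈ }) λ ij →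
    case Arc.closed A i i∈ j ij of λ
      { (inj₁ j∈W) → Unique-disjoint (_ ∷ ws) un j∈W j∈
      ; (inj₂ (inj₁ (_ , refl))) → z∉L′ j∈
      ; (inj₂ (inj₂ (_ , refl))) → e∉L′ j∈ }

  arc-cycle : ∀ {e y ws l} → Arc e y ws l e → ∃[ ms ] ws ≡ ms ++ l ∷ [] × Cycle H e y ms l
  arc-cycle {e} {y} {ws} {l} A with Path-unsnoc (Arc.path A)
  ... | inj₁ y≡l = contradiction refl (Arc.y≡l⇒ A y≡l)
  ... | inj₂ (ms , refl) = ms , refl , record
    { path = path ; first = adj-flip yz ; last = adj-flip le ; rest = All.tabulate away }
    where
    open Arc A
    away : ∀ {w} → w ∈ ms → Apart H e w
    away {w} w∈ = apart (λ { refl → e∉ (there (∈ₚ.∈-++⁺ˡ w∈)) }) λ ew → case closed w (there (∈ₚ.∈-++⁺ˡ w∈)) e (adj-flip ew) of λ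
      { (inj₁ e∈) → e∉ e∈
      ; (inj₂ (inj₁ (refl , _))) → All.lookup (AllPairs.head (Path-unique path)) (∈ₚ.∈-++⁺ˡ w∈) refl
      ; (inj₂ (inj₂ (refl , _))) → Unique-disjoint ms (AllPairs.tail (Path-unique path)) w∈ (here refl) }

  arc-avoids : ∀ {e y ws l z f} → Arc e y ws l z → f ∉ y ∷ ws → f ≢ z → f ≢ e → All (Apart H f) (y ∷ ws)
  arc-avoids {ws = ws} A f∉ f≢z f≢e = All.tabulate λ {w} w∈ → apart (λ { refl → f∉ w∈ }) λ fw →
    case Arc.closed A w w∈ _ (adj-flip fw) of λ
      { (inj₁ f∈) → f∉ f∈ ; (inj₂ (inj₁ (_ , r))) → f≢z r ; (inj₂ (inj₂ (_ , r))) → f≢e r }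

  arc-chain : ∀ {a b y ws l} → Apart H a b → Arc a y ws l b → Path H b (y ∷ ws ++ a ∷ []) a
  arc-chain {a} {b} {y} {ws} {l} ab A = step (adj-flip yz)
    (Allₚ.++⁺ (All.tabulate (λ {w} w∈ → apart (λ { refl → z∉ (there w∈) }) λ bw → case closed w (there w∈) b (adj-flip bw) of λ
      { (inj₁ b∈) → z∉ b∈
      ; (inj₂ (inj₁ (refl , _))) → All.lookup (AllPairs.head (Path-unique path)) w∈ refl
      ; (inj₂ (inj₂ (_ , refl))) → proj₁ ab refl })) (Apart-sym H ab ∷ []))
    (Path-snoc path le (λ w w∈ w≢l → apart (λ { refl → e∉ w∈ }) λ wa → case closed w w∈ a wa of λ
      { (inj₁ a∈) → e∉ a∈
      ; (inj₂ (inj₁ (_ , refl))) → proj₁ ab refl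
      ; (inj₂ (inj₂ (w≡l , _))) → w≢l w≡l }))
    where open Arc A

  private
    adj? : ∀ e x → Dec (adj H e x ≡ true)
    adj? e x with adj H e x
    ... | true  = yes refl
    ... | false = no λ ()

  -- Arcs from neighbours of a are split off first; they end at a or b. When none is left, arcs from
  -- b must return to b. The rest has no edge to the ports, and an arc started beside any vertex p,
  -- with p in the role of the port, must close up at p.
  decompose : ∀ {a b} → Apart H a b → ∀ k L → length L ℕ.≤ k → Unique L → All Degree2 L → Closed a b L → a ∉ L → b ∉ L → Decomposition a b L
  decompose ab k [] len un d2 cl a∉ b∉ = record { blocks = [] ; valid = [] ; separated = [] ; covers = ↭-refl }
  decompose {a} {b} ab (suc k) L@(_ ∷ _) len un d2 cl a∉ b∉ = choose (any? (adj? a) L) (any? (adj? b) L)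
    where
    recurse : ∀ {y ws L′} → y ∷ ws ++ L′ ↭ L → Separated (y ∷ ws) L′ → Decomposition a b L′
    recurse {y} {ws} {L′} perm sep = decompose ab k L′
      (ℕₚ.≤-pred (ℕₚ.≤-trans (ℕₚ.≤-trans (s≤s (ℕₚ.≤-trans (ℕₚ.m≤n+m (length L′) (length ws)) (ℕₚ.≤-reflexive (sym (Listₚ.length-++ ws)))))
        (ℕₚ.≤-reflexive (↭ₚ.↭-length perm))) len))
      (Unique-++ʳ (y ∷ ws) (Unique-resp-↭ (↭-sym perm) un))
      (Allₚ.++⁻ʳ (y ∷ ws) (↭ₚ.All-resp-↭ (↭-sym perm) d2))
      (λ x x∈ t xt → case cl x (sub x∈) t xt of λ
        { (inj₂ r) → inj₂ r
        ; (inj₁ t∈) → case ∈ₚ.∈-++⁻ (y ∷ ws) (↭ₚ.∈-resp-↭ (↭-sym perm) t∈) of λ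
          { (inj₂ t∈′) → inj₁ t∈′
          ; (inj₁ t∈W) → case trans (sym (adj-flip xt)) (proj₂ (sep t∈W x∈)) of λ () } })
      (a∉ ∘ sub) (b∉ ∘ sub)
      where
      sub : ∀ {x} → x ∈ L′ → x ∈ L
      sub x∈ = ↭ₚ.∈-resp-↭ perm (∈ₚ.∈-++⁺ʳ (y ∷ ws) x∈)

    module FromPort (e : Fin n) (e∉ : e ∉ L) (x : Fin n) (x∈ : x ∈ L) (ex : adj H e x ≡ true) where
      L₁ : List (Fin n)
      L₁ = proj₁ (∈-∃↭ x∈)
      perm₁ : L ↭ x ∷ L₁
      perm₁ = proj₂ (∈-∃↭ x∈)
      grown : ∃[ y ] ∃[ ws ] ∃[ z ] ∃[ L′ ] Arc e y ws x z × z ∉ L′ × y ∷ ws ++ L′ ↭ x ∷ L₁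
      grown = growArc (length L₁) L₁ refl (All.tail (↭ₚ.All-resp-↭ perm₁ d2)) (λ e∈ → e∉ (↭ₚ.∈-resp-↭ (↭-sym perm₁) (there e∈)))
        (proj₂ (startArc (All.lookup d2 x∈) (adj-flip ex)))

    fromPort : ∀ e → e ∉ L → ∀ x → x ∈ L → adj H e x ≡ true →
      (∀ {y ws z} → Arc e y ws x z → z ≡ a ⊎ z ≡ b → (∀ {w} → w ∈ y ∷ ws → w ∈ L) → ∃[ κ ] Block H a b κ (y ∷ ws)) → Decomposition a b L
    fromPort e e∉ x x∈ ex make with FromPort.grown e e∉ x x∈ ex
    ... | y , ws , z , L′ , A , z∉L′ , perm = consBlock (proj₂ (make A z∈ inL)) sep perm′ (recurse perm′ sep)
      where
      perm′ : y ∷ ws ++ L′ ↭ L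
      perm′ = ↭-trans perm (↭-sym (FromPort.perm₁ e e∉ x x∈ ex))
      inL : ∀ {w} → w ∈ y ∷ ws → w ∈ L
      inL w∈ = ↭ₚ.∈-resp-↭ perm′ (∈ₚ.∈-++⁺ˡ w∈)
      sep : Separated (y ∷ ws) L′
      sep = arc-separated A (Unique-resp-↭ (↭-sym perm′) un) z∉L′ (λ e∈ → e∉ (↭ₚ.∈-resp-↭ perm′ (∈ₚ.∈-++⁺ʳ (y ∷ ws) e∈)))
      z∈ : z ≡ a ⊎ z ≡ b
      z∈ with cl y (inL (here refl)) z (Arc.yz A)
      ... | inj₂ r = r
      ... | inj₁ z∈L with ∈ₚ.∈-++⁻ (y ∷ ws) (↭ₚ.∈-resp-↭ (↭-sym perm′) z∈L)
      ...   | inj₁ z∈W = contradiction z∈W (Arc.z∉ A)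
      ...   | inj₂ z∈′ = contradiction z∈′ z∉L′

    fromA : ∀ {x y ws z} → Arc a y ws x z → z ≡ a ⊎ z ≡ b → (∀ {w} → w ∈ y ∷ ws → w ∈ L) → ∃[ κ ] Block H a b κ (y ∷ ws)
    fromA A (inj₁ refl) inL with arc-cycle A
    ... | ms , refl , C = _ , loopᵃ C (arc-avoids A (b∉ ∘ inL) (proj₁ ab ∘ sym) (proj₁ ab ∘ sym))
    fromA A (inj₂ refl) inL = _ , chain (arc-chain ab A)

    fromB : (∀ {x} → x ∈ L → adj H a x ≡ true → ⊥) →
      ∀ {x y ws z} → Arc b y ws x z → z ≡ a ⊎ z ≡ b → (∀ {w} → w ∈ y ∷ ws → w ∈ L) → ∃[ κ ] Block H a b κ (y ∷ ws)
    fromB noA A (inj₁ refl) inL = contradiction (adj-flip (Arc.yz A)) (noA (inL (here refl)))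
    fromB noA A (inj₂ refl) inL with arc-cycle A
    ... | ms , refl , C = _ , loopᵇ C (arc-avoids A (a∉ ∘ inL) (proj₁ ab) (proj₁ ab))

    free : (∀ {x} → x ∈ L → adj H a x ≡ true → ⊥) → (∀ {x} → x ∈ L → adj H b x ≡ true → ⊥) → ∀ x → x ∈ L → Decomposition a b L
    free noA noB x x∈ with All.lookup d2 x∈
    ... | p , q , p≢q , xp , xq , only with cl x x∈ p xp
    ...   | inj₂ (inj₁ refl) = contradiction (adj-flip xp) (noA x∈)
    ...   | inj₂ (inj₂ refl) = contradiction (adj-flip xp) (noB x∈)
    ...   | inj₁ p∈ = go (∈-∃↭ p∈)
      where
      go : ∃[ L₁ ] L ↭ p ∷ L₁ → Decomposition a b L
      go (L₁ , perm₁) with ↭ₚ.∈-resp-↭ perm₁ x∈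
      ... | here refl = contradiction refl (adj⇒≢ H xp)
      ... | there x∈₁ = go₂ (∈-∃↭ x∈₁)
        where
        p∉L₁ : p ∉ L₁
        p∉L₁ p∈′ = All.lookup (AllPairs.head (Unique-resp-↭ perm₁ un)) p∈′ refl
        go₂ : ∃[ L₂ ] L₁ ↭ x ∷ L₂ → Decomposition a b L
        go₂ (L₂ , perm₂) with growArc (length L₂) L₂ refl (All.tail (↭ₚ.All-resp-↭ perm₂ (All.tail (↭ₚ.All-resp-↭ perm₁ d2))))
              (λ p∈′ → p∉L₁ (↭ₚ.∈-resp-↭ (↭-sym perm₂) (there p∈′))) (proj₂ (startArc (All.lookup d2 x∈) xp))
        ... | y , ws , z , L′ , A , z∉L′ , perm = finish (cl y (inL (here refl)) z (Arc.yz A))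
          where
          perm′ : p ∷ y ∷ ws ++ L′ ↭ L
          perm′ = ↭-trans (prep p (↭-trans perm (↭-sym perm₂))) (↭-sym perm₁)
          un′ : Unique (p ∷ y ∷ ws ++ L′)
          un′ = Unique-resp-↭ (↭-sym perm′) un
          inL : ∀ {w} → w ∈ y ∷ ws → w ∈ L
          inL w∈ = ↭ₚ.∈-resp-↭ perm′ (there (∈ₚ.∈-++⁺ˡ w∈))
          ring′ : z ≡ p → Decomposition a b L
          ring′ refl with arc-cycle A
          ... | ms , refl , C = consBlock (ring C (All.tabulate (λ {w} w∈ → apart (λ { refl → a∉ (inL′ w∈) }) (noA (inL′ w∈))))
                                               (All.tabulate (λ {w} w∈ → apart (λ { refl → b∉ (inL′ w∈) }) (noB (inL′ w∈))))) sep perm′ (recurse perm′ sep)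
            where
            inL′ : ∀ {w} → w ∈ p ∷ y ∷ ws → w ∈ L
            inL′ w∈ = ↭ₚ.∈-resp-↭ perm′ (∈ₚ.∈-++⁺ˡ w∈)
            sep : Separated (p ∷ y ∷ ws) L′
            sep (there i∈) j∈ = arc-separated A (AllPairs.tail un′) z∉L′ z∉L′ i∈ j∈
            -- The neighbours of p are already x and y, which are distinct by `y≡l⇒`, so there is no
            -- room for an edge from p to j.
            sep {j = j} (here refl) j∈ = apart (λ { refl → z∉L′ j∈ }) λ pj → case other (All.lookup d2 p∈) (adj-flip (Arc.le A)) of λ
              { (t , t≢ , pt , only′) → impossible pj (only′ j pj) (only′ y (adj-flip (Arc.yz A))) }
              where
              impossible : ∀ {t} → adj H p j ≡ true → j ≡ x ⊎ j ≡ t → y ≡ x ⊎ y ≡ t → ⊥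
              impossible pj _           (inj₁ refl) = Arc.y≡l⇒ A refl refl
              impossible pj (inj₁ refl) _           = Unique-disjoint (y ∷ ws) (AllPairs.tail un′) (Path-last∈ (Arc.path A)) j∈
              impossible pj (inj₂ refl) (inj₂ refl) = Unique-disjoint (y ∷ ws) (AllPairs.tail un′) (here refl) j∈
          finish : z ∈ L ⊎ z ≡ a ⊎ z ≡ b → Decomposition a b L
          finish (inj₂ (inj₁ refl)) = contradiction (adj-flip (Arc.yz A)) (noA (inL (here refl)))
          finish (inj₂ (inj₂ refl)) = contradiction (adj-flip (Arc.yz A)) (noB (inL (here refl)))
          finish (inj₁ z∈L) with ↭ₚ.∈-resp-↭ (↭-sym perm′) z∈L
          ... | here z≡p  = ring′ z≡p
          ... | there z∈′ with ∈ₚ.∈-++⁻ (y ∷ ws) z∈′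
          ...   | inj₁ z∈W = contradiction z∈W (Arc.z∉ A)
          ...   | inj₂ z∈″ = contradiction z∈″ z∉L′

    choose : Dec (Any (λ x → adj H a x ≡ true) L) → Dec (Any (λ x → adj H b x ≡ true) L) → Decomposition a b L
    choose (yes any) _ with find any
    ... | x , x∈ , ax = fromPort a a∉ x x∈ ax fromA
    choose (no none) (yes any) with find any
    ... | x , x∈ , bx = fromPort b b∉ x x∈ bx (fromB (λ x∈ ax → none (lose x∈ ax)))
    choose (no none) (no none′) = free (λ x∈ ax → none (lose x∈ ax)) (λ x∈ bx → none′ (lose x∈ bx)) _ (here refl)

-- Counting neighbours

indicator : Bool → ℕ
indicator true  = 1
indicator false = 0

count : {V : Set} → (V → Bool) → List V → ℕ
count f []       = 0
count f (x ∷ xs) = indicator (f x) ℕ.+ count f xs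

module _ {V : Set} (f : V → Bool) where

  count-++ : ∀ xs ys → count f (xs ++ ys) ≡ count f xs ℕ.+ count f ys
  count-++ []       ys = refl
  count-++ (x ∷ xs) ys = trans (cong (indicator (f x) ℕ.+_) (count-++ xs ys)) (sym (ℕₚ.+-assoc (indicator (f x)) _ _))

  count-↭ : ∀ {xs ys} → xs ↭ ys → count f xs ≡ count f ys
  count-↭ _↭_.refl = refl
  count-↭ (prep x p) = cong (indicator (f x) ℕ.+_) (count-↭ p)
  count-↭ (swap {xs} x y p) = trans (sym (ℕₚ.+-assoc (indicator (f x)) (indicator (f y)) (count f xs)))
    (trans (cong₂ ℕ._+_ (ℕₚ.+-comm (indicator (f x)) (indicator (f y))) (count-↭ p)) (ℕₚ.+-assoc (indicator (f y)) (indicator (f x)) _))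
  count-↭ (_↭_.trans p q) = trans (count-↭ p) (count-↭ q)

  count-none : ∀ {xs} → All (λ x → f x ≡ false) xs → count f xs ≡ 0
  count-none []       = refl
  count-none (e ∷ es) rewrite e = count-none es

count-cong : ∀ {V : Set} {f g : V → Bool} xs → (∀ x → x ∈ xs → f x ≡ g x) → count f xs ≡ count g xs
count-cong []       eq = refl
count-cong (x ∷ xs) eq = cong₂ ℕ._+_ (cong indicator (eq x (here refl))) (count-cong xs (λ y y∈ → eq y (there y∈)))

module _ {n : ℕ} (H : Graph n) where

  degree-count : ∀ i → degree H i ≡ count (adj H i) (allFin n)
  degree-count i = go id
    where
    open import Data.Fin.Subset using (∣_∣)
    go : ∀ {k} (g : Fin k → Fin n) → ∣ Vec.tabulate (adj H i ∘ g) ∣ ≡ count (adj H i) (tabulate g)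
    go {zero}  g = refl
    go {suc k} g with adj H i (g zero)
    ... | true  = cong suc (go (g ∘ suc))
    ... | false = go (g ∘ suc)

  degree-list : ∀ {L} i → L ↭ allFin n → degree H i ≡ count (adj H i) L
  degree-list i p = trans (degree-count i) (sym (count-↭ (adj H i) p))

  count-apart : ∀ {x ws} → All (Apart H x) ws → count (adj H x) ws ≡ 0
  count-apart ap = count-none (adj H _) (All.map proj₂ ap)

  count-path-head : ∀ {x y ws l} → Path H x (y ∷ ws) l → count (adj H x) (y ∷ ws) ≡ 1
  count-path-head (step e ap p) rewrite e = cong suc (count-apart ap)

  count-path-last : ∀ {x} ws {a} → Path H x (ws ++ a ∷ []) a → count (adj H a) (x ∷ ws) ≡ 1
  count-path-last {x} []       {a} (step e [] single) rewrite adj-sym H a x | e = refl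
  count-path-last {x} (w ∷ ws) {a} (step e ap p)
    rewrite adj-sym H a x | proj₂ (All.lookup ap (∈ₚ.∈-++⁺ʳ ws (here refl))) = count-path-last ws p

  count-path-mid : ∀ {x} ws {a} → Path H x (ws ++ a ∷ []) a → All (λ w → count (adj H w) (x ∷ ws ++ a ∷ []) ≡ 2) ws
  count-path-mid []       p = []
  count-path-mid {x} (w ∷ ws) {a} (step e ap p) = first p ∷ All.map later (All.zip (Allₚ.++⁻ˡ ws ap , count-path-mid ws p))
    where
    later : ∀ {w′} → Apart H x w′ × count (adj H w′) (w ∷ ws ++ a ∷ []) ≡ 2 → count (adj H w′) (x ∷ w ∷ ws ++ a ∷ []) ≡ 2
    later {w′} (na , c) rewrite adj-sym H w′ x | proj₂ na = c
    first : Path H w (ws ++ a ∷ []) a → count (adj H w) (x ∷ w ∷ ws ++ a ∷ []) ≡ 2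
    first p rewrite adj-sym H w x | e | adj-irrefl H w = cong suc (head ws p)
      where
      head : ∀ ws → Path H w (ws ++ a ∷ []) a → count (adj H w) (ws ++ a ∷ []) ≡ 1
      head []       p = count-path-head p
      head (_ ∷ ws) p = count-path-head p

  count-cycle : ∀ {e x ms l} → Cycle H e x ms l → count (adj H e) (x ∷ ms ++ l ∷ []) ≡ 2
  count-cycle {e} {x} {ms} {l} C rewrite Cycle.first C = cong suc (trans (count-++ (adj H e) ms (l ∷ []))
    (trans (cong (ℕ._+ (indicator (adj H e l) ℕ.+ 0)) (count-apart (Cycle.rest C))) (cong (λ t → indicator t ℕ.+ 0) (Cycle.last C))))

  module _ (a b : Fin n) where

    isPort : Fin n → Bool
    isPort i = does (i Finₚ.≟ a) ∨ does (i Finₚ.≟ b)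

    -- The blocks are computed with non-adjacent ports; an edge between the ports comes back through
    -- `basePorts`.
    removeEdge : Graph n
    removeEdge = record
      { adj        = λ i j → adj H i j ∧ not (isPort i ∧ isPort j)
      ; adj-sym    = λ i j → cong₂ (λ s t → s ∧ not t) (adj-sym H i j) (∧-comm (isPort i) (isPort j))
      ; adj-irrefl = λ i → cong (_∧ not (isPort i ∧ isPort i)) (adj-irrefl H i) }

    isPort-a : isPort a ≡ true
    isPort-a with a Finₚ.≟ a
    ... | yes _ = refl
    ... | no ne = contradiction refl ne

    isPort-b : isPort b ≡ true
    isPort-b with b Finₚ.≟ a | b Finₚ.≟ b
    ... | yes _ | _     = refl
    ... | no _  | yes _ = refl
    ... | no _  | no ne = contradiction refl ne

    isPort-no : ∀ {i} → i ≢ a → i ≢ b → isPort i ≡ false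
    isPort-no {i} i≢a i≢b with i Finₚ.≟ a | i Finₚ.≟ b
    ... | yes e | _     = contradiction e i≢a
    ... | no _  | yes e = contradiction e i≢b
    ... | no _  | no _  = refl

    removeEdge-ab : a ≢ b → Apart removeEdge a b
    removeEdge-ab ne rewrite isPort-a | isPort-b = ne , ∧-zeroʳ (adj H a b)

    removeEdge-adjˡ : ∀ {i} j → i ≢ a → i ≢ b → adj removeEdge i j ≡ adj H i j
    removeEdge-adjˡ {i} j i≢a i≢b rewrite isPort-no i≢a i≢b = ∧-identityʳ (adj H i j)

    removeEdge-adjʳ : ∀ i {j} → j ≢ a → j ≢ b → adj removeEdge i j ≡ adj H i j
    removeEdge-adjʳ i {j} j≢a j≢b = trans (adj-sym removeEdge i j) (trans (removeEdge-adjˡ i j≢a j≢b) (adj-sym H j i))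

-- The permanent of a graph from its blocks and its two ports

basePorts : ℤ → ℤ → Bool → Ports
basePorts Y S e = ports 1ℤ (Y - S) (Y - S) t t ((Y - S) * (Y - S) + t * t)
  where
  t : ℤ
  t = if e then S else 0ℤ

blockProduct : ℤ → ℤ → List Kind → Ports
blockProduct Y S = foldr (λ k P → kindPorts Y S k ⊗ P) 1⊗

module _ {n : ℕ} (H : Graph n) {a b : Fin n} (a≢b : a ≢ b) {L : List (Fin n)} (a∉ : a ∉ L) (b∉ : b ∉ L)
         (Y S : ℤ) (d : Fin n → ℤ) (da : d a ≡ Y - S) (db : d b ≡ Y - S) (dL : AllY d Y S L) where

  private
    H° : Graph n
    H° = removeEdge H a b
    d° : Fin n → ℤ
    d° i = if isPort H a b i then 0ℤ else d i
    d°a : d° a ≡ 0ℤ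
    d°a rewrite isPort-a H a b = refl
    d°b : d° b ≡ 0ℤ
    d°b rewrite isPort-b H a b = refl
    offPorts : ∀ {i} → i ∈ L → isPort H a b i ≡ false
    offPorts {i} i∈ = isPort-no H a b {i} (λ { refl → a∉ i∈ }) (λ { refl → b∉ i∈ })
    d°L : AllY d° Y S L
    d°L = All.tabulate λ {i} i∈ → trans (cong (λ t → if t then 0ℤ else d i) (offPorts i∈)) (All.lookup dL i∈)
    M N : Fin n → Fin n → ℤ
    M = mat H° d° S
    N i j = if isPort H a b i ∧ isPort H a b j then mat H d S i j else 0ℤ

    ab° : Apart H° a b
    ab° = removeEdge-ab H a b a≢b

  portsOf-blocks : ∀ bs → All (λ B → Block H° a b (proj₁ B) (proj₂ B)) bs → AllPairs (λ B B′ → Separated H° (proj₂ B) (proj₂ B′)) bs →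
    (∀ {x} → x ∈ concat (map proj₂ bs) → x ∈ L) → portsOf M a b (concat (map proj₂ bs)) ≡ blockProduct Y S (map proj₁ bs)
  portsOf-blocks [] [] [] sub = portsOf-[] H° d° Y S d°a d°b ab°
  portsOf-blocks ((k , W) ∷ bs) (B ∷ Bs) (sep ∷ seps) sub = trans
    (portsOf-++ M a b W (concat (map proj₂ bs)) (ports-zero H° d° Y S d°a d°b ab°) zero′ disj)
    (cong₂ _⊗_ (blockPorts H° d° Y S d°a d°b ab° B (All.tabulate λ x∈ → All.lookup d°L (sub (∈ₚ.∈-++⁺ˡ x∈))))
      (portsOf-blocks bs Bs seps (λ x∈ → sub (∈ₚ.∈-++⁺ʳ W x∈))))
    where
    apart′ : ∀ {i j} → i ∈ W → j ∈ concat (map proj₂ bs) → Apart H° i j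
    apart′ i∈ j∈ with ∈ₚ.∈-concat⁻′ (map proj₂ bs) j∈
    ... | W′ , j∈W′ , W′∈ with ∈ₚ.∈-map⁻ proj₂ W′∈
    ...   | B′ , B′∈ , refl = All.lookup sep B′∈ i∈ j∈W′
    zero′ : ∀ i j → i ∈ W → j ∈ concat (map proj₂ bs) → M i j ≡ 0ℤ × M j i ≡ 0ℤ
    zero′ i j i∈ j∈ = mat-apart H° d° S (apart′ i∈ j∈) , mat-apart H° d° S (Apart-sym H° (apart′ i∈ j∈))
    disj : ∀ i → i ∈ W → i ∉ concat (map proj₂ bs) ++ a ∷ b ∷ []
    disj i i∈ i∈′ with ∈ₚ.∈-++⁻ (concat (map proj₂ bs)) i∈′
    ... | inj₁ i∈″                 = proj₁ (apart′ i∈ i∈″) refl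
    ... | inj₂ (here refl)         = a∉ (sub (∈ₚ.∈-++⁺ˡ i∈))
    ... | inj₂ (there (here refl)) = b∉ (sub (∈ₚ.∈-++⁺ˡ i∈))

  private
    -- In M the ports have diagonal entry 0 and no common edge, so the blocks multiply. N is the two
    -- by two block of the ports alone, with diagonal Y - S, and contributes `basePorts`.
    M+N : ∀ i j → M i j + N i j ≡ mat H d S i j
    M+N i j with i Finₚ.≟ j
    ... | yes refl with isPort H a b i
    ...   | true  = ℤₚ.+-identityˡ _
    ...   | false = ℤₚ.+-identityʳ _
    M+N i j | no _ with isPort H a b i | isPort H a b j | adj H i j
    ... | true  | true  | true  = ℤₚ.+-identityˡ _
    ... | true  | true  | false = refl
    ... | true  | false | true  = ℤₚ.+-identityʳ _
    ... | true  | false | false = refl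
    ... | false | _     | true  = ℤₚ.+-identityʳ _
    ... | false | _     | false = refl

    N-vanishes : Vanishes N L
    N-vanishes w w∈ x rewrite offPorts w∈ with isPort H a b x
    ... | true  = refl , refl
    ... | false = refl , refl

    Naa : N a a ≡ Y - S
    Naa rewrite isPort-a H a b = trans (mat-diag H d S a) da
    Nbb : N b b ≡ Y - S
    Nbb rewrite isPort-b H a b = trans (mat-diag H d S b) db
    t : ℤ
    t = if adj H a b then S else 0ℤ
    off : ∀ i j → i ≢ j → mat H d S i j ≡ (if adj H i j then S else 0ℤ)
    off i j ne with i Finₚ.≟ j
    ... | yes e = contradiction e ne
    ... | no _  = refl
    Nab : N a b ≡ t
    Nab rewrite isPort-a H a b | isPort-b H a b = off a b a≢b
    Nba : N b a ≡ t
    Nba rewrite isPort-a H a b | isPort-b H a b = trans (off b a (a≢b ∘ sym)) (cong (λ s → if s then S else 0ℤ) (adj-sym H b a))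

    one : ∀ x → x * 1ℤ + 0ℤ ≡ x
    one = solve 1 (λ x → x :* con 1ℤ :+ con 0ℤ := x) refl

    N-base : portsOf N a b [] ≡ basePorts Y S (adj H a b)
    N-base = ports-cong refl (trans (one _) Naa) (trans (one _) Nbb) (trans (one _) Nab) (trans (one _) Nba)
      (trans (cong₂ _+_ (cong₂ _*_ Naa (trans (one _) Nbb)) (trans (ℤₚ.+-identityʳ _) (cong₂ _*_ Nab (trans (one _) Nba)))) refl)

  permanent-blocks : ∀ bs → All (λ B → Block H° a b (proj₁ B) (proj₂ B)) bs → AllPairs (λ B B′ → Separated H° (proj₂ B) (proj₂ B′)) bs →
    concat (map proj₂ bs) ↭ L → perL (mat H d S) (a ∷ b ∷ L) (a ∷ b ∷ L) ≡ cw (blockProduct Y S (map proj₁ bs) ⊗ basePorts Y S (adj H a b))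
  permanent-blocks bs Bs seps cov = begin
    perL (mat H d S) (a ∷ b ∷ L) (a ∷ b ∷ L)
      ≡⟨ trans (perL-rows (mat H d S) (a ∷ b ∷ L) order) (perL-cols (mat H d S) ((C ++ []) ++ a ∷ b ∷ []) order) ⟩
    perL (mat H d S) ((C ++ []) ++ a ∷ b ∷ []) ((C ++ []) ++ a ∷ b ∷ [])
      ≡⟨ perL-cong ((C ++ []) ++ a ∷ b ∷ []) ((C ++ []) ++ a ∷ b ∷ []) (λ i j _ _ → sym (M+N i j)) ⟩
    cw (portsOf (λ i j → M i j + N i j) a b (C ++ []))
      ≡⟨ cong cw (portsOf-sum M N C [] (λ w ()) (λ w w∈ → N-vanishes w (↭ₚ.∈-resp-↭ cov w∈)) a b) ⟩
    cw (portsOf M a b C ⊗ portsOf N a b [])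
      ≡⟨ cong cw (cong₂ _⊗_ (portsOf-blocks bs Bs seps (↭ₚ.∈-resp-↭ cov)) N-base) ⟩
    cw (blockProduct Y S (map proj₁ bs) ⊗ basePorts Y S (adj H a b)) ∎
    where
    C : List (Fin n)
    C = concat (map proj₂ bs)
    order : a ∷ b ∷ L ↭ (C ++ []) ++ a ∷ b ∷ []
    order = ↭-trans (prep a (prep b (↭-sym cov))) (↭-trans (↭ₚ.++-comm (a ∷ b ∷ []) C) (↭-reflexive (cong (_++ a ∷ b ∷ []) (sym (Listₚ.++-identityʳ C)))))

-- Homogeneous evaluation: a polynomial Σ cₖ xᵏ of degree at most n becomes Σ cₖ Xᵏ Sⁿ⁻ᵏ

hev : ℤ → ℤ → ℕ → (ℕ → ℤ) → ℤ
hev X S zero    c = c 0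
hev X S (suc n) c = c 0 * S ℤ.^ suc n + X * hev X S n (c ∘ suc)

-- The coefficients of (a + b x) Σ cₖ xᵏ
linearCoeff : ℤ → ℤ → (ℕ → ℤ) → ℕ → ℤ
linearCoeff a b c zero    = a * c 0
linearCoeff a b c (suc k) = a * c (suc k) + b * c k

module _ (X S : ℤ) where

  hev-cong : ∀ n {c d} → (∀ k → c k ≡ d k) → hev X S n c ≡ hev X S n d
  hev-cong zero    eq = eq 0
  hev-cong (suc n) eq = cong₂ _+_ (cong (_* S ℤ.^ suc n) (eq 0)) (cong (X *_) (hev-cong n (eq ∘ suc)))

  hev-+ : ∀ n c d → hev X S n (λ k → c k + d k) ≡ hev X S n c + hev X S n d
  hev-+ zero    c d = refl
  hev-+ (suc n) c d = trans (cong (λ t → (c 0 + d 0) * S ℤ.^ suc n + X * t) (hev-+ n (c ∘ suc) (d ∘ suc)))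
    (solve 6 (λ x s a b p q → (a :+ b) :* s :+ x :* (p :+ q) := (a :* s :+ x :* p) :+ (b :* s :+ x :* q)) refl
      X (S ℤ.^ suc n) (c 0) (d 0) (hev X S n (c ∘ suc)) (hev X S n (d ∘ suc)))

  hev-* : ∀ n a c → hev X S n (λ k → a * c k) ≡ a * hev X S n c
  hev-* zero    a c = refl
  hev-* (suc n) a c = trans (cong (λ t → a * c 0 * S ℤ.^ suc n + X * t) (hev-* n a (c ∘ suc)))
    (solve 5 (λ x s a b p → a :* b :* s :+ x :* (a :* p) := a :* (b :* s :+ x :* p)) refl X (S ℤ.^ suc n) a (c 0) (hev X S n (c ∘ suc)))

  hev-0 : ∀ n → hev X S n (λ _ → 0ℤ) ≡ 0ℤ
  hev-0 zero    = refl
  hev-0 (suc n) = trans (cong (λ t → 0ℤ * S ℤ.^ suc n + X * t) (hev-0 n)) (solve 2 (λ x s → con 0ℤ :* s :+ x :* con 0ℤ := con 0ℤ) refl X (S ℤ.^ suc n))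

  hev-raise : ∀ n c → c (suc n) ≡ 0ℤ → hev X S (suc n) c ≡ S * hev X S n c
  hev-raise zero    c z = trans (cong (λ t → c 0 * (S * 1ℤ) + X * t) z) (solve 3 (λ x s a → a :* (s :* con 1ℤ) :+ x :* con 0ℤ := s :* a) refl X S (c 0))
  hev-raise (suc n) c z = trans (cong (λ t → c 0 * S ℤ.^ suc (suc n) + X * t) (hev-raise n (c ∘ suc) z))
    (solve 5 (λ x s p a h → a :* (s :* p) :+ x :* (s :* h) := s :* (a :* p :+ x :* h)) refl X S (S ℤ.^ suc n) (c 0) (hev X S n (c ∘ suc)))

  hev-linear : ∀ n a b c → (∀ k → n ℕ.< k → c k ≡ 0ℤ) →
    hev X S (suc n) (linearCoeff a b c) ≡ (a * S + b * X) * hev X S n c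
  hev-linear n a b c z = begin
    a * c 0 * S ℤ.^ suc n + X * hev X S n (λ k → a * c (suc k) + b * c k)
      ≡⟨ cong (λ t → a * c 0 * S ℤ.^ suc n + X * t) (trans (hev-+ n _ _) (cong₂ _+_ (hev-* n a (c ∘ suc)) (hev-* n b c))) ⟩
    a * c 0 * S ℤ.^ suc n + X * (a * hev X S n (c ∘ suc) + b * hev X S n c)
      ≡⟨ solve 7 (λ a b x s p c h → a :* c :* s :+ x :* (a :* p :+ b :* h) := a :* (c :* s :+ x :* p) :+ b :* x :* h) refl
           a b X (S ℤ.^ suc n) (hev X S n (c ∘ suc)) (c 0) (hev X S n c) ⟩
    a * hev X S (suc n) c + b * X * hev X S n c
      ≡⟨ cong (λ t → a * t + b * X * hev X S n c) (hev-raise n c (z (suc n) ℕₚ.≤-refl)) ⟩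
    a * (S * hev X S n c) + b * X * hev X S n c
      ≡⟨ solve 5 (λ a b x s h → a :* (s :* h) :+ b :* x :* h := (a :* s :+ b :* x) :* h) refl a b X S (hev X S n c) ⟩
    (a * S + b * X) * hev X S n c ∎

-- The Laplacian permanental polynomial as a permanent in X and S

coeff-+ₚ : ∀ f g k → coeff (f +ₚ g) k ≡ coeff f k + coeff g k
coeff-+ₚ []      g       k       = sym (ℤₚ.+-identityˡ _)
coeff-+ₚ (a ∷ f) []      k       = sym (ℤₚ.+-identityʳ _)
coeff-+ₚ (a ∷ f) (b ∷ g) zero    = refl
coeff-+ₚ (a ∷ f) (b ∷ g) (suc k) = coeff-+ₚ f g k

coeff-map : ∀ a f k → coeff (map (a *_) f) k ≡ a * coeff f k
coeff-map a []      k       = sym (ℤₚ.*-zeroʳ a)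
coeff-map a (b ∷ f) zero    = refl
coeff-map a (b ∷ f) (suc k) = coeff-map a f k

coeff-linear : ∀ a b g k → coeff ((a ∷ b ∷ []) *ₚ g) k ≡ linearCoeff a b (coeff g) k
coeff-linear a b g zero = trans (coeff-+ₚ (map (a *_) g) _ 0) (trans (ℤₚ.+-identityʳ _) (coeff-map a g 0))
coeff-linear a b g (suc k) = trans (coeff-+ₚ (map (a *_) g) _ (suc k)) (cong₂ _+_ (coeff-map a g (suc k))
  (trans (coeff-+ₚ (map (b *_) g) (0ℤ ∷ []) k) (trans (cong₂ _+_ (coeff-map b g k) (zero-list k)) (ℤₚ.+-identityʳ _))))
  where
  zero-list : ∀ k → coeff (0ℤ ∷ []) k ≡ 0ℤ
  zero-list zero    = refl
  zero-list (suc k) = refl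

linearProduct : ∀ {n} → (Fin n → ℤ) → (Fin n → ℤ) → Poly
linearProduct {n} a b = Vector.foldr _*ₚ_ 1ₚ {n} (λ i → a i ∷ b i ∷ [])

linearProduct-degree : ∀ n a b k → n ℕ.< k → coeff (linearProduct {n} a b) k ≡ 0ℤ
linearProduct-degree zero    a b (suc k) lt = refl
linearProduct-degree (suc n) a b (suc k) (s≤s lt) = trans (coeff-linear (a zero) (b zero) g (suc k))
  (trans (cong₂ (λ s t → a zero * s + b zero * t) (linearProduct-degree n _ _ (suc k) (ℕₚ.m≤n⇒m≤1+n lt)) (linearProduct-degree n _ _ k lt))
    (solve 2 (λ a b → a :* con 0ℤ :+ b :* con 0ℤ := con 0ℤ) refl (a zero) (b zero)))
  where
  g : Poly
  g = linearProduct (a ∘ suc) (b ∘ suc)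

hev-linearProduct : ∀ X S n a b → hev X S n (coeff (linearProduct {n} a b)) ≡ Vector.foldr _*_ 1ℤ {n} (λ i → a i * S + b i * X)
hev-linearProduct X S zero    a b = refl
hev-linearProduct X S (suc n) a b = trans (hev-cong X S (suc n) (coeff-linear (a zero) (b zero) (linearProduct (a ∘ suc) (b ∘ suc))))
  (trans (hev-linear X S n (a zero) (b zero) (coeff (linearProduct (a ∘ suc) (b ∘ suc))) (linearProduct-degree n _ _))
    (cong ((a zero * S + b zero * X) *_) (hev-linearProduct X S n (a ∘ suc) (b ∘ suc))))

sumL : {A : Set} → (A → ℤ) → List A → ℤ
sumL f []       = 0ℤ
sumL f (x ∷ xs) = f x + sumL f xs

module _ {A : Set} where

  sumL-cong : ∀ {f g : A → ℤ} xs → (∀ x → f x ≡ g x) → sumL f xs ≡ sumL g xs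
  sumL-cong []       eq = refl
  sumL-cong (x ∷ xs) eq = cong₂ _+_ (eq x) (sumL-cong xs eq)

  sumL-++ : ∀ (f : A → ℤ) xs ys → sumL f (xs ++ ys) ≡ sumL f xs + sumL f ys
  sumL-++ f []       ys = sym (ℤₚ.+-identityˡ _)
  sumL-++ f (x ∷ xs) ys = trans (+-congˡ (f x) (sumL-++ f xs ys)) (sym (ℤₚ.+-assoc (f x) _ _))

  sumL-* : ∀ k (f : A → ℤ) xs → sumL (λ x → k * f x) xs ≡ k * sumL f xs
  sumL-* k f []       = sym (ℤₚ.*-zeroʳ k)
  sumL-* k f (x ∷ xs) = trans (+-congˡ (k * f x) (sumL-* k f xs)) (sym (ℤₚ.*-distribˡ-+ k _ _))

  sumL-map : ∀ {B : Set} (f : B → ℤ) (g : A → B) xs → sumL f (map g xs) ≡ sumL (f ∘ g) xs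
  sumL-map f g []       = refl
  sumL-map f g (x ∷ xs) = +-congˡ (f (g x)) (sumL-map f g xs)

sumL-tabulate : ∀ {A : Set} {n} (f : A → ℤ) (g : Fin n → A) → sumL f (tabulate g) ≡ sumL (f ∘ g) (allFin n)
sumL-tabulate f g = trans (cong (sumL f) (sym (Listₚ.map-tabulate id g))) (sumL-map f g (allFin _))

sumL-cartesian : ∀ {A B C : Set} (h : C → ℤ) (f : A → B → C) xs ys → sumL h (cartesianProductWith f xs ys) ≡ sumL (λ x → sumL (λ y → h (f x y)) ys) xs
sumL-cartesian h f []       ys = refl
sumL-cartesian h f (x ∷ xs) ys = trans (sumL-++ h (map (f x) ys) _) (cong₂ _+_ (sumL-map h (f x) ys) (sumL-cartesian h f xs ys))

-- Removing position j from a tabulated list means reindexing by `punchIn j`. `Perm.insert`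
-- reindexes in the same way, so the list expansion follows the enumeration of permutations.
sumPick-tabulate : ∀ {V : Set} n (f : V → List V → ℤ) (c : Fin (suc n) → V) →
  sumPick f (tabulate c) ≡ sumL (λ j → f (c j) (tabulate (c ∘ punchIn j))) (allFin (suc n))
sumPick-tabulate zero    f c = refl
sumPick-tabulate (suc n) f c = +-congˡ (f (c zero) (tabulate (c ∘ suc)))
  (trans (sumPick-tabulate n (λ d ds → f d (c zero ∷ ds)) (c ∘ suc)) (sym (sumL-tabulate (λ j → f (c j) (tabulate (c ∘ punchIn j))) suc)))

permanentSum : ∀ {V : Set} (M : V → V → ℤ) n (r c : Fin n → V) →
  sumL (λ σ → Vector.foldr _*_ 1ℤ {n} (λ i → M (r i) (c (σ Perm.⟨$⟩ʳ i)))) (permutations n) ≡ perL M (tabulate r) (tabulate c)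
permanentSum M zero    r c = refl
permanentSum M (suc n) r c = begin
  sumL (λ σ → Vector.foldr _*_ 1ℤ {suc n} (λ i → M (r i) (c (σ Perm.⟨$⟩ʳ i)))) (permutations (suc n))
    ≡⟨ sumL-cartesian _ (Perm.insert zero) (allFin (suc n)) (permutations n) ⟩
  sumL (λ j → sumL (λ σ → M (r zero) (c j) * Vector.foldr _*_ 1ℤ {n} (λ i → M (r (suc i)) (c (punchIn j (σ Perm.⟨$⟩ʳ i))))) (permutations n)) (allFin (suc n))
    ≡⟨ sumL-cong (allFin (suc n)) (λ j → trans (sumL-* (M (r zero) (c j)) _ (permutations n)) (cong (M (r zero) (c j) *_) (permanentSum M n (r ∘ suc) (c ∘ punchIn j)))) ⟩
  sumL (λ j → M (r zero) (c j) * perL M (tabulate (r ∘ suc)) (tabulate (c ∘ punchIn j))) (allFin (suc n))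
    ≡⟨ sumPick-tabulate n (λ d ds → M (r zero) d * perL M (tabulate (r ∘ suc)) ds) c ⟨
  perL M (tabulate r) (tabulate c) ∎

module _ {n : ℕ} (H : Graph n) where

  private
    term : Perm.Permutation′ n → Poly
    term σ = linearProduct (λ i → - laplacian H i (σ Perm.⟨$⟩ʳ i)) (λ i → identity i (σ Perm.⟨$⟩ʳ i))

  π-degree : ∀ k → n ℕ.< k → coeff π[L H ] k ≡ 0ℤ
  π-degree k lt = go (permutations n)
    where
    go : ∀ ps → coeff (foldr _+ₚ_ 0ₚ (map term ps)) k ≡ 0ℤ
    go []       = refl
    go (σ ∷ ps) = trans (coeff-+ₚ (term σ) _ k) (cong₂ _+_ (linearProduct-degree n _ _ k lt) (go ps))

  -- Homogenising per (xI - L) gives per (X I - S L). Since - L has entries + 1 at the edges, the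
  -- off-diagonal entries are + S.
  π-permanent : ∀ X S → hev X S n (coeff π[L H ]) ≡ perL (mat H (λ i → X - S * + degree H i) S) (allFin n) (allFin n)
  π-permanent X S = trans (go (permutations n))
    (trans (permanentSum (λ i j → - laplacian H i j * S + identity i j * X) n id id) (perL-cong (allFin n) (allFin n) (λ i j _ _ → entry i j)))
    where
    go : ∀ ps → hev X S n (coeff (foldr _+ₚ_ 0ₚ (map term ps)))
      ≡ sumL (λ σ → Vector.foldr _*_ 1ℤ {n} (λ i → - laplacian H i (σ Perm.⟨$⟩ʳ i) * S + identity i (σ Perm.⟨$⟩ʳ i) * X)) ps
    go []       = hev-0 X S n
    go (σ ∷ ps) = trans (hev-cong X S n (coeff-+ₚ (term σ) _)) (trans (hev-+ X S n _ _) (cong₂ _+_ (hev-linearProduct X S n _ _) (go ps)))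
    entry : ∀ i j → - laplacian H i j * S + identity i j * X ≡ mat H (λ i → X - S * + degree H i) S i j
    entry i j with i Finₚ.≟ j
    ... | yes refl rewrite adj-irrefl H i = solve 3 (λ d s x → :- (d :- con 0ℤ) :* s :+ con 1ℤ :* x := x :- s :* d) refl (+ degree H i) S X
    ... | no _ with adj H i j
    ...   | true  = solve 2 (λ s x → :- (con 0ℤ :- con 1ℤ) :* s :+ con 0ℤ :* x := s) refl S X
    ...   | false = solve 2 (λ s x → :- (con 0ℤ :- con 0ℤ) :* s :+ con 0ℤ :* x := con 0ℤ) refl S X

perL-identity : ∀ {V : Set} (M : V → V → ℤ) → (∀ x → M x x ≡ 1ℤ) → (∀ x y → x ≢ y → M x y ≡ 0ℤ) → ∀ {xs} → Unique xs → perL M xs xs ≡ 1ℤ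
perL-identity M one off []                 = refl
perL-identity M one off {x ∷ xs} (ap ∷ un) = trans (perL-row-head M x xs x xs (λ y y∈ → off x y (All.lookup ap y∈)))
  (trans (cong₂ _*_ (one x) (perL-identity M one off un)) refl)

-- At X = 1, S = 0 the homogenised polynomial is its coefficient of degree n and the matrix is the
-- identity. Being monic, the polynomial reveals the number of vertices.
π-top : ∀ {n} (H : Graph n) → coeff π[L H ] n ≡ 1ℤ
π-top {n} H = trans (sym (top n (coeff π[L H ]))) (trans (π-permanent H 1ℤ 0ℤ)
  (perL-identity _ (λ x → trans (mat-diag H _ 0ℤ x) (solve 1 (λ d → con 1ℤ :- con 0ℤ :* d := con 1ℤ) refl (+ degree H x))) off (Uniqueₚ.allFin⁺ n)))
  where
  top : ∀ n c → hev 1ℤ 0ℤ n c ≡ c n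
  top zero    c = refl
  top (suc n) c = trans (solve 2 (λ a b → a :* con 0ℤ :+ con 1ℤ :* b := b) refl (c 0) _) (top n (c ∘ suc))
  off : ∀ x y → x ≢ y → mat H (λ i → 1ℤ - 0ℤ * + degree H i) 0ℤ x y ≡ 0ℤ
  off x y ne with x Finₚ.≟ y | adj H x y
  ... | yes e | _     = contradiction e ne
  ... | no _  | true  = refl
  ... | no _  | false = refl

π-order : ∀ {m n} (H : Graph m) (G : Graph n) → π[L H ] ≈ₚ π[L G ] → m ≡ n
π-order {m} {n} H G eq with ℕₚ.<-cmp m n
... | tri≈ _ m≡n _ = m≡n
... | tri< m<n _ _ = contradiction (trans (sym (π-top G)) (trans (sym (eq n)) (π-degree H n m<n))) λ ()
... | tri> _ _ n<m = contradiction (trans (sym (π-top H)) (trans (eq m) (π-degree G m n<m))) λ ()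

-- Congruences

infix 4 _≡_[mod_]

record _≡_[mod_] (x y m : ℤ) : Set where
  constructor quot
  field
    quotient : ℤ
    equation : x ≡ y + m * quotient

mod-reflexive : ∀ {x y m} → x ≡ y → x ≡ y [mod m ]
mod-reflexive {x} {m = m} refl = quot 0ℤ (solve 2 (λ x m → x := x :+ m :* con 0ℤ) refl x m)

mod-+ : ∀ {x x′ y y′ m} → x ≡ x′ [mod m ] → y ≡ y′ [mod m ] → x + y ≡ x′ + y′ [mod m ]
mod-+ {x′ = x′} {y′ = y′} {m} (quot k refl) (quot l refl) = quot (k + l)
  (solve 5 (λ x y m k l → (x :+ m :* k) :+ (y :+ m :* l) := (x :+ y) :+ m :* (k :+ l)) refl x′ y′ m k l)

mod-* : ∀ {x x′ y y′ m} → x ≡ x′ [mod m ] → y ≡ y′ [mod m ] → x * y ≡ x′ * y′ [mod m ]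
mod-* {x′ = x′} {y′ = y′} {m} (quot k refl) (quot l refl) = quot (x′ * l + k * y′ + m * k * l)
  (solve 5 (λ x y m k l → (x :+ m :* k) :* (y :+ m :* l) := x :* y :+ m :* (x :* l :+ k :* y :+ m :* k :* l)) refl x′ y′ m k l)

mod-trans : ∀ {x y z m} → x ≡ y [mod m ] → y ≡ z [mod m ] → x ≡ z [mod m ]
mod-trans {z = z} {m} (quot k refl) (quot l refl) = quot (l + k) (solve 4 (λ z m k l → z :+ m :* l :+ m :* k := z :+ m :* (l :+ k)) refl z m k l)

mod-scale : ∀ {x y m} c → x ≡ y [mod m ] → c * x ≡ c * y [mod c * m ]
mod-scale {y = y} {m} c (quot k refl) = quot k (solve 4 (λ y m c k → c :* (y :+ m :* k) := c :* y :+ c :* m :* k) refl y m c k)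

module _ {V : Set} where

  sumPick-mod : ∀ {f g : V → List V → ℤ} {m} cs → (∀ c ds → f c ds ≡ g c ds [mod m ]) → sumPick f cs ≡ sumPick g cs [mod m ]
  sumPick-mod []       eq = mod-reflexive refl
  sumPick-mod (c ∷ cs) eq = mod-+ (eq c cs) (sumPick-mod cs (λ d ds → eq d (c ∷ ds)))

  perL-mod : ∀ {M N : V → V → ℤ} {m} rs cs → (∀ i j → M i j ≡ N i j [mod m ]) → perL M rs cs ≡ perL N rs cs [mod m ]
  perL-mod []       []      eq = mod-reflexive refl
  perL-mod []       (_ ∷ _) eq = mod-reflexive refl
  perL-mod (r ∷ rs) cs      eq = sumPick-mod cs (λ c ds → mod-* (eq r c) (perL-mod rs ds eq))

  -- The permanent of an identity matrix bordered by a row f, a column g and a zero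
  bordered-identity : ∀ (I : V → V → ℤ) → (∀ x → I x x ≡ 1ℤ) → (∀ x y → x ≢ y → I x y ≡ 0ℤ) → ∀ (f g : V → ℤ) {xs} → Unique xs →
    sumPick (λ c cs → f c * sumPick (λ r rs → g r * perL I rs cs) xs) xs ≡ sumL (λ x → f x * g x) xs
  bordered-identity I one off f g []                 = refl
  bordered-identity I one off f g {y ∷ ys} (ap ∷ un) = cong₂ _+_
    (cong (f y *_) (trans (cong₂ _+_ (trans (cong (g y *_) (perL-identity I one off un)) (ℤₚ.*-identityʳ (g y)))
      (sumPick-zeros ys (λ r r∈ rs → trans (cong (g r *_) (zeroRow rs)) (ℤₚ.*-zeroʳ (g r))))) (ℤₚ.+-identityʳ (g y))))
    (trans (sumPick-cong↭ ys (λ c cs p → cong (f c *_) (trans (cong₂ _+_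
        (trans (cong (g y *_) (perL-zero-col I ys (y ∷ cs) (here refl) (λ r r∈ → off r y (λ e → All.lookup ap r∈ (sym e))))) (ℤₚ.*-zeroʳ (g y)))
        (sumPick-cong ys (λ r rs → cong (g r *_) (trans (perL-row-head I y rs y cs (λ d d∈ → off y d (All.lookup ap (↭ₚ.∈-resp-↭ p (there d∈)))))
          (trans (cong (_* perL I rs cs) (one y)) (ℤₚ.*-identityˡ _)))))) (ℤₚ.+-identityˡ _))))
      (bordered-identity I one off f g un))
    where
    zeroRow : ∀ rs → perL I (y ∷ rs) ys ≡ 0ℤ
    zeroRow rs = perL-zero-row I (y ∷ rs) ys (here refl) (λ c c∈ → off y c (All.lookup ap c∈))

-- Take n = |a|: a multiple of |a| + 1 with absolute value |a| is 0. This replaces limits in all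
-- comparisons of coefficients.
small-multiple : ∀ a → (∀ n → ∃[ k ] a ≡ + suc n * k) → a ≡ 0ℤ
small-multiple a div with div ℤ.∣ a ∣
... | k , eq with ℤ.∣ k ∣ in ek | trans (cong ℤ.∣_∣ eq) (ℤₚ.abs-* (+ suc ℤ.∣ a ∣) k)
...   | zero  | _ = trans eq (trans (cong (+ suc ℤ.∣ a ∣ *_) (ℤₚ.∣i∣≡0⇒i≡0 ek)) (ℤₚ.*-zeroʳ (+ suc ℤ.∣ a ∣)))
...   | suc j | e = contradiction (ℕₚ.≤-trans (ℕₚ.m≤m*n (suc ℤ.∣ a ∣) (suc j)) (ℕₚ.≤-reflexive (sym e))) (ℕₚ.n≮n ℤ.∣ a ∣)

-- If a + b S + k S² vanishes for every positive S, where only k depends on S, then a and b vanish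
second-order-zero : ∀ a b → (∀ n → ∃[ k ] a + + suc n * b + + suc n * + suc n * k ≡ 0ℤ) → a ≡ 0ℤ × b ≡ 0ℤ
second-order-zero a b eq = a≡0 , small-multiple b (λ n → - proj₁ (eq n) , (divide n))
  where
  a≡0 : a ≡ 0ℤ
  a≡0 = small-multiple a λ n → - (b + + suc n * proj₁ (eq n)) ,
    trans (solve 4 (λ a b s k → a := (a :+ s :* b :+ s :* s :* k) :+ s :* (:- (b :+ s :* k))) refl a b (+ suc n) (proj₁ (eq n)))
      (trans (cong (_+ + suc n * (- (b + + suc n * proj₁ (eq n)))) (proj₂ (eq n))) (ℤₚ.+-identityˡ _))
  divide : ∀ n → b ≡ + suc n * - proj₁ (eq n)
  divide n = ℤₚ.*-cancelˡ-≡ (+ suc n) b _ (begin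
    + suc n * b
      ≡⟨ solve 4 (λ a b s k → s :* b := (a :+ s :* b :+ s :* s :* k) :+ (s :* (s :* (:- k)) :- a)) refl a b (+ suc n) (proj₁ (eq n)) ⟩
    (a + + suc n * b + + suc n * + suc n * proj₁ (eq n)) + (+ suc n * (+ suc n * - proj₁ (eq n)) - a)
      ≡⟨ cong₂ (λ s t → s + (+ suc n * (+ suc n * - proj₁ (eq n)) - t)) (proj₂ (eq n)) a≡0 ⟩
    0ℤ + (+ suc n * (+ suc n * - proj₁ (eq n)) - 0ℤ)
      ≡⟨ solve 1 (λ x → con 0ℤ :+ (x :- con 0ℤ) := x) refl (+ suc n * (+ suc n * - proj₁ (eq n))) ⟩
    + suc n * (+ suc n * - proj₁ (eq n)) ∎)

-- Degree sums

e₂ : {V : Set} → (V → ℤ) → List V → ℤ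
e₂ δ []       = 0ℤ
e₂ δ (x ∷ xs) = δ x * sumL δ xs + e₂ δ xs

square-e₂ : ∀ {V : Set} (δ : V → ℤ) xs → sumL δ xs * sumL δ xs ≡ sumL (λ x → δ x * δ x) xs + + 2 * e₂ δ xs
square-e₂ δ []       = refl
square-e₂ δ (x ∷ xs) = trans (solve 2 (λ a s → (a :+ s) :* (a :+ s) := a :* a :+ s :* s :+ con (+ 2) :* (a :* s)) refl (δ x) (sumL δ xs))
  (trans (cong (λ t → δ x * δ x + t + + 2 * (δ x * sumL δ xs)) (square-e₂ δ xs))
    (solve 4 (λ d q e p → d :+ (q :+ con (+ 2) :* e) :+ con (+ 2) :* p := (d :+ q) :+ con (+ 2) :* (p :+ e)) refl
      (δ x * δ x) (sumL (λ x → δ x * δ x) xs) (e₂ δ xs) (δ x * sumL δ xs)))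

module _ {n : ℕ} (H : Graph n) where

  private
    α : Fin n → Fin n → ℤ
    α i j = + indicator (adj H i j)

  edges : List (Fin n) → ℤ
  edges []       = 0ℤ
  edges (x ∷ xs) = sumL (α x) xs + edges xs

  handshake : ∀ xs → sumL (λ x → sumL (α x) xs) xs ≡ + 2 * edges xs
  handshake []       = refl
  handshake (x ∷ xs) = trans (cong₂ _+_ (trans (cong (λ t → + indicator t + sumL (α x) xs) (adj-irrefl H x)) (ℤₚ.+-identityˡ (sumL (α x) xs))) (split xs))
    (trans (cong (λ t → sumL (α x) xs + (sumL (α x) xs + t)) (handshake xs))
      (solve 2 (λ a b → a :+ (a :+ con (+ 2) :* b) := con (+ 2) :* (a :+ b)) refl (sumL (α x) xs) (edges xs)))
    where
    split : ∀ ys → sumL (λ y → sumL (α y) (x ∷ xs)) ys ≡ sumL (α x) ys + sumL (λ y → sumL (α y) xs) ys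
    split []       = refl
    split (y ∷ ys) = trans (cong₂ (λ s t → (+ indicator s + sumL (α y) xs) + t) (adj-sym H y x) (split ys)) (+-interchange (α x y) (sumL (α y) xs) (sumL (α x) ys) (sumL (λ z → sumL (α z) xs) ys))

  sumL-count : ∀ x ys → sumL (α x) ys ≡ + count (adj H x) ys
  sumL-count x []       = refl
  sumL-count x (y ∷ ys) = cong (λ t → α x y + t) (sumL-count x ys)

  private
    I : Fin n → Fin n → ℤ
    I i j = if does (i Finₚ.≟ j) then 1ℤ else 0ℤ
    I-one : ∀ x → I x x ≡ 1ℤ
    I-one x with x Finₚ.≟ x
    ... | yes _ = refl
    ... | no ne = contradiction refl ne
    I-off : ∀ x y → x ≢ y → I x y ≡ 0ℤ
    I-off x y ne with x Finₚ.≟ y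
    ... | yes e = contradiction e ne
    ... | no _  = refl

  module _ (S : ℤ) (δ : Fin n → ℤ) where

    private
      M : Fin n → Fin n → ℤ
      M = mat H (λ i → 1ℤ - S * δ i) S

      M≡I : ∀ i j → M i j ≡ I i j [mod S ]
      M≡I i j with i Finₚ.≟ j
      ... | yes _ = quot (- δ i) (solve 2 (λ s d → con 1ℤ :- s :* d := con 1ℤ :+ s :* (:- d)) refl S (δ i))
      ... | no _ with adj H i j
      ...   | true  = quot 1ℤ (solve 1 (λ s → s := con 0ℤ :+ s :* con 1ℤ) refl S)
      ...   | false = quot 0ℤ (solve 1 (λ s → con 0ℤ := con 0ℤ :+ s :* con 0ℤ) refl S)

      M-off : ∀ {x y} → x ≢ y → M x y ≡ S * α x y
      M-off {x} {y} ne with x Finₚ.≟ y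
      ... | yes e = contradiction e ne
      ... | no _ with adj H x y
      ...   | true  = sym (ℤₚ.*-identityʳ S)
      ...   | false = sym (ℤₚ.*-zeroʳ S)

      -- The permutations that move x contribute, to second order, one transposition for each neighbour of x
      moved : ∀ x xs → Unique (x ∷ xs) → sumPick (λ c cs → M x c * perL M xs (x ∷ cs)) xs ≡ S * S * sumL (α x) xs [mod S * S * S ]
      moved x xs (ap ∷ un) = mod-trans (mod-reflexive factor) (mod-trans
        (mod-scale (S * S) (sumPick-mod xs (λ c cs → mod-* (mod-reflexive {α x c} refl) (sumPick-mod xs (λ r rs → mod-* (mod-reflexive {α x r} refl) (perL-mod rs cs M≡I))))))
        (mod-reflexive (cong (S * S *_) (trans (bordered-identity I I-one I-off (α x) (α x) un) (sumL-cong xs (λ y → idem (adj H x y)))))))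
        where
        idem : ∀ t → + indicator t * + indicator t ≡ + indicator t
        idem true  = refl
        idem false = refl
        factor : sumPick (λ c cs → M x c * perL M xs (x ∷ cs)) xs ≡ S * S * sumPick (λ c cs → α x c * sumPick (λ r rs → α x r * perL M rs cs) xs) xs
        factor = trans (sumPick-cong↭ xs (λ c cs p → begin
          M x c * perL M xs (x ∷ cs)
            ≡⟨ cong₂ _*_ (M-off (All.lookup ap (↭ₚ.∈-resp-↭ p (here refl)))) (trans (perL-col M xs x cs) (sumPick-cong↭ xs (λ r rs q →
                 trans (cong (_* perL M rs cs) (trans (mat-sym H _ S r x) (M-off (All.lookup ap (↭ₚ.∈-resp-↭ q (here refl)))))) (ℤₚ.*-assoc S (α x r) _)))) ⟩
          S * α x c * sumPick (λ r rs → S * (α x r * perL M rs cs)) xs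
            ≡⟨ cong (S * α x c *_) (sumPick-*ˡ S _ xs) ⟩
          S * α x c * (S * sumPick (λ r rs → α x r * perL M rs cs) xs)
            ≡⟨ solve 3 (λ s a p → s :* a :* (s :* p) := s :* s :* (a :* p)) refl S (α x c) _ ⟩
          S * S * (α x c * sumPick (λ r rs → α x r * perL M rs cs) xs) ∎)) (sumPick-*ˡ (S * S) _ xs)

    -- Induction on the first vertex x. If x is fixed, the factor 1 - S δ x multiplies the expansion
    -- of the rest; if x moves, only transpositions with neighbours of x reach order S².
    permanent-second-order : ∀ xs → Unique xs → perL M xs xs ≡ 1ℤ - S * sumL δ xs + S * S * (e₂ δ xs + edges xs) [mod S * S * S ]
    permanent-second-order [] un = mod-reflexive (solve 1 (λ s → con 1ℤ := con 1ℤ :- s :* con 0ℤ :+ s :* s :* (con 0ℤ :+ con 0ℤ)) refl S)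
    permanent-second-order (x ∷ xs) un@(_ ∷ un′) with permanent-second-order xs un′ | moved x xs un
    ... | quot k eq | quot l eq′ = quot (k + l - δ x * (e₂ δ xs + edges xs) - S * δ x * k) (begin
      M x x * perL M xs xs + sumPick (λ c cs → M x c * perL M xs (x ∷ cs)) xs
        ≡⟨ cong₂ _+_ (cong₂ _*_ (mat-diag H (λ i → 1ℤ - S * δ i) S x) eq) eq′ ⟩
      (1ℤ - S * δ x) * (1ℤ - S * sumL δ xs + S * S * (e₂ δ xs + edges xs) + S * S * S * k) + (S * S * sumL (α x) xs + S * S * S * l)
        ≡⟨ solve 8 (λ s d a e m c k l → (con 1ℤ :- s :* d) :* (con 1ℤ :- s :* a :+ s :* s :* (e :+ m) :+ s :* s :* s :* k) :+ (s :* s :* c :+ s :* s :* s :* l)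
             := con 1ℤ :- s :* (d :+ a) :+ s :* s :* ((d :* a :+ e) :+ (c :+ m)) :+ s :* s :* s :* (k :+ l :- d :* (e :+ m) :- s :* d :* k)) refl
             S (δ x) (sumL δ xs) (e₂ δ xs) (edges xs) (sumL (α x) xs) k l ⟩
      1ℤ - S * sumL δ (x ∷ xs) + S * S * (e₂ δ (x ∷ xs) + edges (x ∷ xs)) + S * S * S * (k + l - δ x * (e₂ δ xs + edges xs) - S * δ x * k) ∎)

module _ {n : ℕ} (H G : Graph n) (eq : π[L H ] ≈ₚ π[L G ]) where

  private
    δ : Graph n → Fin n → ℤ
    δ K i = + degree K i
    V : List (Fin n)
    V = allFin n
    σ₁ σ₂ : Graph n → ℤ
    σ₁ K = sumL (δ K) V
    σ₂ K = e₂ (δ K) V + edges K V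

    expand : ∀ K S → hev 1ℤ S n (coeff π[L K ]) ≡ 1ℤ - S * σ₁ K + S * S * σ₂ K [mod S * S * S ]
    expand K S = mod-trans (mod-reflexive (π-permanent K 1ℤ S)) (permanent-second-order K S (δ K) V (Uniqueₚ.allFin⁺ n))

    compare : σ₁ G - σ₁ H ≡ 0ℤ × σ₂ H - σ₂ G ≡ 0ℤ
    compare = second-order-zero _ _ λ m → let S = + suc m ; quot k h = expand H S ; quot l g = expand G S in k - l , ℤₚ.*-cancelˡ-≡ S _ _ (begin
      S * (σ₁ G - σ₁ H + S * (σ₂ H - σ₂ G) + S * S * (k - l))
        ≡⟨ solve 7 (λ s a a′ b b′ k l → s :* (a′ :- a :+ s :* (b :- b′) :+ s :* s :* (k :- l))
             := (con 1ℤ :- s :* a :+ s :* s :* b :+ s :* s :* s :* k) :- (con 1ℤ :- s :* a′ :+ s :* s :* b′ :+ s :* s :* s :* l)) refl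
             S (σ₁ H) (σ₁ G) (σ₂ H) (σ₂ G) k l ⟩
      (1ℤ - S * σ₁ H + S * S * σ₂ H + S * S * S * k) - (1ℤ - S * σ₁ G + S * S * σ₂ G + S * S * S * l)
        ≡⟨ cong₂ _-_ (sym h) (sym g) ⟩
      hev 1ℤ S n (coeff π[L H ]) - hev 1ℤ S n (coeff π[L G ])
        ≡⟨ cong (_- hev 1ℤ S n (coeff π[L G ])) (hev-cong 1ℤ S n eq) ⟩
      hev 1ℤ S n (coeff π[L G ]) - hev 1ℤ S n (coeff π[L G ])
        ≡⟨ ℤₚ.+-inverseʳ (hev 1ℤ S n (coeff π[L G ])) ⟩
      0ℤ
        ≡⟨ ℤₚ.*-zeroʳ S ⟨
      S * 0ℤ ∎)

    twice-edges : ∀ K → + 2 * edges K V ≡ σ₁ K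
    twice-edges K = trans (sym (handshake K V)) (sumL-cong V (λ i → trans (sumL-count K i V) (cong +_ (sym (degree-count K i)))))

    squares : Graph n → ℤ
    squares K = sumL (λ i → δ K i * δ K i) V

    -- Σ δ² is σ₁² - 2 e₂, and e₂ is σ₂ minus the number of edges, which is half of σ₁.
    squares-formula : ∀ K → squares K ≡ σ₁ K * σ₁ K + σ₁ K - + 2 * σ₂ K
    squares-formula K = begin
      squares K
        ≡⟨ solve 3 (λ q e m → q := (q :+ con (+ 2) :* e) :+ con (+ 2) :* m :- con (+ 2) :* (e :+ m)) refl (squares K) (e₂ (δ K) V) (edges K V) ⟩
      squares K + + 2 * e₂ (δ K) V + + 2 * edges K V - + 2 * σ₂ K
        ≡⟨ cong₂ (λ s t → s + t - + 2 * σ₂ K) (sym (square-e₂ (δ K) V)) (twice-edges K) ⟩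
      σ₁ K * σ₁ K + σ₁ K - + 2 * σ₂ K ∎

  degree-sum : sumL (λ i → + degree H i) (allFin n) ≡ sumL (λ i → + degree G i) (allFin n)
  degree-sum = sym (ℤₚ.i-j≡0⇒i≡j _ _ (proj₁ compare))

  degree-squares : sumL (λ i → + degree H i * + degree H i) (allFin n) ≡ sumL (λ i → + degree G i * + degree G i) (allFin n)
  degree-squares = trans (squares-formula H) (trans
    (cong₂ (λ s t → s * s + s - + 2 * t) degree-sum (ℤₚ.i-j≡0⇒i≡j _ _ (proj₂ compare))) (sym (squares-formula G)))

-- Graphs with two vertices of degree 3 and all others of degree 2

kindSize : Kind → ℕ
kindSize (chain p) = p
kindSize (loopᵃ m) = 2 ℕ.+ m
kindSize (loopᵇ m) = 2 ℕ.+ m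
kindSize (ring m)  = 3 ℕ.+ m

kindDegᵃ kindDegᵇ : Kind → ℕ
kindDegᵃ (chain p) = 1
kindDegᵃ (loopᵃ m) = 2
kindDegᵃ (loopᵇ m) = 0
kindDegᵃ (ring m)  = 0
kindDegᵇ (chain p) = 1
kindDegᵇ (loopᵃ m) = 0
kindDegᵇ (loopᵇ m) = 2
kindDegᵇ (ring m)  = 0

total : {A : Set} → (A → ℕ) → List A → ℕ
total f []       = 0
total f (x ∷ xs) = f x ℕ.+ total f xs

total-↭ : ∀ {A : Set} (f : A → ℕ) {xs ys} → xs ↭ ys → total f xs ≡ total f ys
total-↭ f _↭_.refl = refl
total-↭ f (prep x p) = cong (f x ℕ.+_) (total-↭ f p)
total-↭ f (swap {xs} x y p) = trans (sym (ℕₚ.+-assoc (f x) (f y) (total f xs)))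
  (trans (cong₂ ℕ._+_ (ℕₚ.+-comm (f x) (f y)) (total-↭ f p)) (ℕₚ.+-assoc (f y) (f x) _))
total-↭ f (_↭_.trans p q) = trans (total-↭ f p) (total-↭ f q)

edgeKinds : Bool → List Kind
edgeKinds true  = chain 0 ∷ []
edgeKinds false = []

-- The list `ks` describes the blocks up to order, with an edge between a and b entered as
-- `chain 0`. Values of the polynomial depend on `ks` alone.
record Shape {n : ℕ} (H : Graph n) (ks : List Kind) : Set where
  field
    a b       : Fin n
    L         : List (Fin n)
    a≢b       : a ≢ b
    order     : a ∷ b ∷ L ↭ allFin n
    degree-a  : degree H a ≡ 3
    degree-b  : degree H b ≡ 3
    degree-L  : All (λ x → degree H x ≡ 2) L
    blocks    : List (Kind × List (Fin n))
    valid     : All (λ B → Block (removeEdge H a b) a b (proj₁ B) (proj₂ B)) blocks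
    separated : AllPairs (λ B B′ → Separated (removeEdge H a b) (proj₂ B) (proj₂ B′)) blocks
    covers    : concat (map proj₂ blocks) ↭ L
    kinds     : edgeKinds (adj H a b) ++ map proj₁ blocks ↭ ks

Shape-↭ : ∀ {n} {H : Graph n} {ks ks′} → ks ↭ ks′ → Shape H ks → Shape H ks′
Shape-↭ p s = record { Shape s ; kinds = ↭-trans (Shape.kinds s) p }

blockProduct-↭ : ∀ Y S {ks ks′} → ks ↭ ks′ → blockProduct Y S ks ≡ blockProduct Y S ks′
blockProduct-↭ Y S _↭_.refl = refl
blockProduct-↭ Y S (prep k p) = cong (kindPorts Y S k ⊗_) (blockProduct-↭ Y S p)
blockProduct-↭ Y S (swap {ks} k l p) = trans (sym (⊗-assoc (kindPorts Y S k) (kindPorts Y S l) _))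
  (trans (cong₂ _⊗_ (⊗-comm (kindPorts Y S k) (kindPorts Y S l)) (blockProduct-↭ Y S p)) (⊗-assoc (kindPorts Y S l) (kindPorts Y S k) _))
blockProduct-↭ Y S (_↭_.trans p q) = trans (blockProduct-↭ Y S p) (blockProduct-↭ Y S q)

shapeValue : ℤ → ℤ → List Kind → ℤ
shapeValue Y S ks = cw (blockProduct Y S ks ⊗ basePorts Y S false)

-- An edge between the ports may be moved from the base matrix into the product, as a path with 0
-- interior vertices; adjacent ports then need no separate treatment.
edge-as-chain : ∀ Y S e ks → blockProduct Y S (edgeKinds e ++ ks) ⊗ basePorts Y S false ≡ blockProduct Y S ks ⊗ basePorts Y S e
edge-as-chain Y S false ks = refl
edge-as-chain Y S true  ks = trans (cong (_⊗ basePorts Y S false) (⊗-comm (kindPorts Y S (chain 0)) (blockProduct Y S ks)))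
  (trans (⊗-assoc (blockProduct Y S ks) _ _) (cong (blockProduct Y S ks ⊗_) (ports-cong refl
    (same Y S) (same Y S) (off Y S) (off Y S) (top Y S))))
  where
  same : ∀ Y S → _
  same = solve 2 (λ y s → con 1ℤ :* (y :- s) :+ s :* s :* con 0ℤ :* con 1ℤ := y :- s) refl
  off : ∀ Y S → _
  off = solve 2 (λ y s → con 1ℤ :* con 0ℤ :+ s :* con 1ℤ :* con 1ℤ := s) refl
  top : ∀ Y S → _
  top = solve 2 (λ y s → con 1ℤ :* ((y :- s) :* (y :- s) :+ con 0ℤ :* con 0ℤ) :+ s :* s :* (con 1ℤ :- y :* con 0ℤ) :* con 1ℤ
    :+ (s :* s :* con 0ℤ :* (y :- s) :+ s :* s :* con 0ℤ :* (y :- s)) :+ (s :* con 1ℤ :* con 0ℤ :+ s :* con 1ℤ :* con 0ℤ)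
    := (y :- s) :* (y :- s) :+ s :* s) refl

module _ {n : ℕ} {H : Graph n} {ks : List Kind} (shape : Shape H ks) where

  open Shape shape

  private
    un : Unique (a ∷ b ∷ L)
    un = Unique-resp-↭ (↭-sym order) (Uniqueₚ.allFin⁺ n)
    a∉ : a ∉ L
    a∉ a∈ = All.lookup (AllPairs.head un) (there a∈) refl
    b∉ : b ∉ L
    b∉ b∈ = All.lookup (AllPairs.head (AllPairs.tail un)) b∈ refl

  -- With X = Y + 2S the diagonal entry X - S d is Y at degree 2 and Y - S at degree 3.
  Shape-value : ∀ Y S → hev (Y + + 2 * S) S n (coeff π[L H ]) ≡ shapeValue Y S ks
  Shape-value Y S = begin
    hev (Y + + 2 * S) S n (coeff π[L H ])
      ≡⟨ π-permanent H (Y + + 2 * S) S ⟩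
    perL (mat H d S) (allFin n) (allFin n)
      ≡⟨ trans (perL-rows (mat H d S) (allFin n) (↭-sym order)) (perL-cols (mat H d S) (a ∷ b ∷ L) (↭-sym order)) ⟩
    perL (mat H d S) (a ∷ b ∷ L) (a ∷ b ∷ L)
      ≡⟨ permanent-blocks H a≢b a∉ b∉ Y S d (three a degree-a) (three b degree-b) (All.map (λ {x} → two x) degree-L) blocks valid separated covers ⟩
    cw (blockProduct Y S (map proj₁ blocks) ⊗ basePorts Y S (adj H a b))
      ≡⟨ cong cw (edge-as-chain Y S (adj H a b) (map proj₁ blocks)) ⟨
    cw (blockProduct Y S (edgeKinds (adj H a b) ++ map proj₁ blocks) ⊗ basePorts Y S false)
      ≡⟨ cong (λ P → cw (P ⊗ basePorts Y S false)) (blockProduct-↭ Y S kinds) ⟩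
    shapeValue Y S ks ∎
    where
    d : Fin n → ℤ
    d i = Y + + 2 * S - S * + degree H i
    three : ∀ x → degree H x ≡ 3 → d x ≡ Y - S
    three x e = trans (cong (λ k → Y + + 2 * S - S * + k) e) (solve 2 (λ y s → y :+ con (+ 2) :* s :- s :* con (+ 3) := y :- s) refl Y S)
    two : ∀ x → degree H x ≡ 2 → d x ≡ Y
    two x e = trans (cong (λ k → Y + + 2 * S - S * + k) e) (solve 2 (λ y s → y :+ con (+ 2) :* s :- s :* con (+ 2) := y) refl Y S)

  Shape-size : 2 ℕ.+ total kindSize ks ≡ n
  Shape-size = trans (cong (2 ℕ.+_) (trans (sym (total-↭ kindSize kinds)) (trans (edge (adj H a b))
    (trans (sizes blocks valid) (↭ₚ.↭-length covers))))) (trans (↭ₚ.↭-length order) (Listₚ.length-tabulate id))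
    where
    edge : ∀ e {ks} → total kindSize (edgeKinds e ++ ks) ≡ total kindSize ks
    edge true  = refl
    edge false = refl
    snoc : ∀ (ms : List (Fin n)) l → length (ms ++ l ∷ []) ≡ suc (length ms)
    snoc ms l = trans (Listₚ.length-++ ms) (ℕₚ.+-comm (length ms) 1)
    size : ∀ {k W} → Block (removeEdge H a b) a b k W → kindSize k ≡ length W
    size (chain _)                     = refl
    size (loopᵃ {x} {ms} {l} _ _)      = cong suc (sym (snoc ms l))
    size (loopᵇ {x} {ms} {l} _ _)      = cong suc (sym (snoc ms l))
    size (ring {e} {x} {ms} {l} _ _ _) = cong (2 ℕ.+_) (sym (snoc ms l))
    sizes : ∀ bs → All (λ B → Block (removeEdge H a b) a b (proj₁ B) (proj₂ B)) bs → total kindSize (map proj₁ bs) ≡ length (concat (map proj₂ bs))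
    sizes []             []       = refl
    sizes ((k , W) ∷ bs) (B ∷ Bs) = trans (cong₂ ℕ._+_ (size B) (sizes bs Bs)) (sym (Listₚ.length-++ W))

-- Recognising the two exceptional vertices from the degree sums

-- (d - 2)(d - 3) as a natural number. It is never negative, so a vanishing sum over the vertices
-- forces every term to vanish.
defect : ℕ → ℕ
defect 0                         = 6
defect 1                         = 2
defect 2                         = 0
defect 3                         = 0
defect (suc (suc (suc (suc k)))) = (2 ℕ.+ k) ℕ.* (1 ℕ.+ k)

defect-formula : ∀ d → + d * + d - + 5 * + d + + 6 ≡ + defect d
defect-formula 0 = refl
defect-formula 1 = refl
defect-formula 2 = refl
defect-formula 3 = refl
defect-formula (suc (suc (suc (suc k)))) = trans (solve 1 (λ k → (con (+ 4) :+ k) :* (con (+ 4) :+ k) :- con (+ 5) :* (con (+ 4) :+ k) :+ con (+ 6)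
  := (con (+ 2) :+ k) :* (con (+ 1) :+ k)) refl (+ k)) (sym (ℤₚ.pos-* (2 ℕ.+ k) (1 ℕ.+ k)))

defect-zero : ∀ d → defect d ≡ 0 → d ≡ 2 ⊎ d ≡ 3
defect-zero 2 _ = inj₁ refl
defect-zero 3 _ = inj₂ refl

sumDefect : ∀ {V : Set} (d : V → ℕ) xs → + total (defect ∘ d) xs
  ≡ sumL (λ x → + d x * + d x) xs - + 5 * sumL (λ x → + d x) xs + + 6 * + length xs
sumDefect d []       = refl
sumDefect d (x ∷ xs) = trans (cong₂ _+_ (sym (defect-formula (d x))) (sumDefect d xs))
  (solve 4 (λ a q s l → (a :* a :- con (+ 5) :* a :+ con (+ 6)) :+ (q :- con (+ 5) :* s :+ con (+ 6) :* l)
    := (a :* a :+ q) :- con (+ 5) :* (a :+ s) :+ con (+ 6) :* (con 1ℤ :+ l)) refl (+ d x) (sumL (λ x → + d x * + d x) xs) (sumL (λ x → + d x) xs) (+ length xs))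

total-zero : ∀ {V : Set} (f : V → ℕ) xs → total f xs ≡ 0 → All (λ x → f x ≡ 0) xs
total-zero f []       e = []
total-zero f (x ∷ xs) e = ℕₚ.m+n≡0⇒m≡0 (f x) e ∷ total-zero f xs (ℕₚ.m+n≡0⇒n≡0 (f x) e)

separate : ∀ {V : Set} (d : V → ℕ) xs → All (λ x → d x ≡ 2 ⊎ d x ≡ 3) xs → ∃[ ts ] ∃[ L ] ts ++ L ↭ xs × All (λ x → d x ≡ 3) ts × All (λ x → d x ≡ 2) L
  × sumL (λ x → + d x) xs ≡ + 2 * + length xs + + length ts
separate d [] [] = [] , [] , ↭-refl , [] , [] , refl
separate d (x ∷ xs) (e ∷ es) with separate d xs es
separate d (x ∷ xs) (inj₁ e ∷ es) | ts , L , p , t , l , s = ts , x ∷ L , ↭-trans (↭ₚ.shift x ts L) (prep x p) , t , e ∷ l ,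
  trans (cong₂ (λ i j → + i + j) e s) (solve 2 (λ a b → con (+ 2) :+ (con (+ 2) :* a :+ b) := con (+ 2) :* (con 1ℤ :+ a) :+ b) refl (+ length xs) (+ length ts))
separate d (x ∷ xs) (inj₂ e ∷ es) | ts , L , p , t , l , s = x ∷ ts , L , prep x p , e ∷ t , l ,
  trans (cong₂ (λ i j → + i + j) e s) (solve 2 (λ a b → con (+ 3) :+ (con (+ 2) :* a :+ b) := con (+ 2) :* (con 1ℤ :+ a) :+ (con 1ℤ :+ b)) refl (+ length xs) (+ length ts))

module _ {n : ℕ} (H : Graph n) where

  hits : ∀ (f : Fin n → Bool) xs → Unique xs → ∃[ ns ] length ns ≡ count f xs × Unique ns × All (λ z → f z ≡ true × z ∈ xs) ns × (∀ z → z ∈ xs → f z ≡ true → z ∈ ns)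
  hits f [] [] = [] , refl , [] , [] , λ z ()
  hits f (x ∷ xs) (ap ∷ un) with hits f xs un | f x in e
  ... | ns , len , u′ , fs , all | true = x ∷ ns , cong suc len , All.map (λ { (_ , z∈) → All.lookup ap z∈ }) fs ∷ u′ ,
    (e , here refl) ∷ All.map (λ { (t , z∈) → t , there z∈ }) fs , λ { z (here r) _ → here r ; z (there z∈) t → there (all z z∈ t) }
  ... | ns , len , u′ , fs , all | false = ns , len , u′ , All.map (λ { (t , z∈) → t , there z∈ }) fs ,
    λ { z (here refl) t → case trans (sym e) t of λ () ; z (there z∈) t → all z z∈ t }

  degree-two : ∀ x → degree H x ≡ 2 → Degree2 H x
  degree-two x e with hits (adj H x) (allFin n) (Uniqueₚ.allFin⁺ n)
  ... | ns , len , un , fs , all with ns | trans len (trans (sym (degree-count H x)) e) | un | fs | all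
  ...   | p ∷ q ∷ [] | _ | (p≢q ∷ []) ∷ _ | (ep , _) ∷ (eq , _) ∷ [] | all′ = p , q , p≢q , ep , eq , λ z ez → case all′ z (∈ₚ.∈-allFin z) ez of λ
    { (here r) → inj₁ r ; (there (here r)) → inj₂ r }

  module _ (a b : Fin n) (a≢b : a ≢ b) (L : List (Fin n)) (order : a ∷ b ∷ L ↭ allFin n)
           (degree-a : degree H a ≡ 3) (degree-b : degree H b ≡ 3) (degree-L : All (λ x → degree H x ≡ 2) L) where

    private
      H° : Graph n
      H° = removeEdge H a b
      un : Unique (a ∷ b ∷ L)
      un = Unique-resp-↭ (↭-sym order) (Uniqueₚ.allFin⁺ n)
      a∉ : a ∉ L
      a∉ a∈ = All.lookup (AllPairs.head un) (there a∈) refl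
      b∉ : b ∉ L
      b∉ b∈ = All.lookup (AllPairs.head (AllPairs.tail un)) b∈ refl
      adj° : ∀ {x} → x ∈ L → ∀ t → adj H° x t ≡ adj H x t
      adj° x∈ t = removeEdge-adjˡ H a b t (λ { refl → a∉ x∈ }) (λ { refl → b∉ x∈ })
      adj°ʳ : ∀ {x} → x ∈ L → ∀ t → adj H° t x ≡ adj H t x
      adj°ʳ x∈ t = removeEdge-adjʳ H a b t (λ { refl → a∉ x∈ }) (λ { refl → b∉ x∈ })

      degree2° : ∀ {x} → x ∈ L → Degree2 H° x
      degree2° {x} x∈ with degree-two x (All.lookup degree-L x∈)
      ... | p , q , ne , ep , eq , only = p , q , ne , trans (adj° x∈ p) ep , trans (adj° x∈ q) eq , λ z ez → only z (trans (sym (adj° x∈ z)) ez)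

      decomposition : Decomposition H° a b L
      decomposition = decompose H° (removeEdge-ab H a b a≢b) (length L) L ℕₚ.≤-refl (AllPairs.tail (AllPairs.tail un)) (All.tabulate degree2°)
        (λ x x∈ t _ → case ↭ₚ.∈-resp-↭ (↭-sym order) (∈ₚ.∈-allFin t) of λ
          { (here r) → inj₂ (inj₁ r) ; (there (here r)) → inj₂ (inj₂ r) ; (there (there t∈)) → inj₁ t∈ }) a∉ b∉

      open Decomposition decomposition

      ks : List Kind
      ks = edgeKinds (adj H a b) ++ map proj₁ blocks

      countBlocks : ∀ f {deg : Kind → ℕ} → (∀ {k W} → Block H° a b k W → count (adj H° f) W ≡ deg k) →
        ∀ bs → All (λ B → Block H° a b (proj₁ B) (proj₂ B)) bs → count (adj H° f) (concat (map proj₂ bs)) ≡ total deg (map proj₁ bs)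
      countBlocks f eq []             []       = refl
      countBlocks f eq ((k , W) ∷ bs) (B ∷ Bs) = trans (count-++ (adj H° f) W _) (cong₂ ℕ._+_ (eq B) (countBlocks f eq bs Bs))

      countᵃ : ∀ {k W} → Block H° a b k W → count (adj H° a) W ≡ kindDegᵃ k
      countᵃ (chain {y} {ws} (step _ _ p)) = count-path-last H° ws p
      countᵃ (loopᵃ C _)    = count-cycle H° C
      countᵃ (loopᵇ C ap)   = count-apart H° ap
      countᵃ (ring C ap _)  = count-apart H° ap

      countᵇ : ∀ {k W} → Block H° a b k W → count (adj H° b) W ≡ kindDegᵇ k
      countᵇ (chain {y} {ws} (step e ap _)) rewrite e = cong suc (count-apart H° (Allₚ.++⁻ˡ ws ap))
      countᵇ (loopᵃ C ap)   = count-apart H° ap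
      countᵇ (loopᵇ C _)    = count-cycle H° C
      countᵇ (ring C _ ap)  = count-apart H° ap

      edge-total : ∀ e (deg : Kind → ℕ) → deg (chain 0) ≡ 1 → ∀ ls → total deg (edgeKinds e ++ ls) ≡ indicator e ℕ.+ total deg ls
      edge-total true  deg d₀ ls = cong (ℕ._+ total deg ls) d₀
      edge-total false deg d₀ ls = refl

      portDegree : ∀ f (deg : Kind → ℕ) → deg (chain 0) ≡ 1 → (∀ {k W} → Block H° a b k W → count (adj H° f) W ≡ deg k) →
        count (adj H f) (a ∷ b ∷ []) ≡ indicator (adj H a b) → degree H f ≡ 3 → total deg ks ≡ 3
      portDegree f deg d₀ eq pe e = begin
        total deg ks                                                                  ≡⟨ edge-total (adj H a b) deg d₀ (map proj₁ blocks) ⟩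
        indicator (adj H a b) ℕ.+ total deg (map proj₁ blocks)                        ≡⟨ cong (indicator (adj H a b) ℕ.+_) (countBlocks f eq blocks valid) ⟨
        indicator (adj H a b) ℕ.+ count (adj H° f) (concat (map proj₂ blocks))        ≡⟨ cong₂ ℕ._+_ (sym pe) (trans (count-↭ (adj H° f) covers) (count-cong L (λ x x∈ → adj°ʳ x∈ f))) ⟩
        count (adj H f) (a ∷ b ∷ []) ℕ.+ count (adj H f) L                            ≡⟨ count-++ (adj H f) (a ∷ b ∷ []) L ⟨
        count (adj H f) (a ∷ b ∷ L)                                                   ≡⟨ degree-list H f order ⟨
        degree H f                                                                    ≡⟨ e ⟩
        3                                                                             ∎

    shape-from-degrees : Shape H ks × total kindDegᵃ ks ≡ 3 × total kindDegᵇ ks ≡ 3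
    shape-from-degrees = record
      { a = a ; b = b ; L = L ; a≢b = a≢b ; order = order ; degree-a = degree-a ; degree-b = degree-b ; degree-L = degree-L
      ; blocks = blocks ; valid = valid ; separated = separated ; covers = covers ; kinds = ↭-refl } ,
      portDegree a kindDegᵃ refl countᵃ portsᵃ degree-a , portDegree b kindDegᵇ refl countᵇ portsᵇ degree-b
      where
      portsᵃ : count (adj H a) (a ∷ b ∷ []) ≡ indicator (adj H a b)
      portsᵃ rewrite adj-irrefl H a = ℕₚ.+-identityʳ _
      portsᵇ : count (adj H b) (a ∷ b ∷ []) ≡ indicator (adj H a b)
      portsᵇ rewrite adj-irrefl H b | adj-sym H b a = ℕₚ.+-identityʳ _

  -- The first hypothesis is Σ (d - 2)(d - 3) = 0, so all degrees are 2 or 3. The second, Σ d = 2n +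
  -- 2, then leaves exactly two vertices of degree 3.
  find-shape : sumL (λ i → + degree H i * + degree H i) (allFin n) - + 5 * sumL (λ i → + degree H i) (allFin n) + + 6 * + length (allFin n) ≡ 0ℤ →
    sumL (λ i → + degree H i) (allFin n) ≡ + 2 * + length (allFin n) + + 2 → ∃[ ks ] Shape H ks × total kindDegᵃ ks ≡ 3 × total kindDegᵇ ks ≡ 3
  find-shape e₀ e₁ with separate (degree H) (allFin n) (All.map (λ {x} → defect-zero (degree H x)) (total-zero (defect ∘ degree H) (allFin n) (ℤₚ.+-injective (trans (sumDefect (degree H) (allFin n)) e₀))))
  ... | ts , L , p , t , l , s with ts | p | t | ℤₚ.+-injective (ℤ+ₚ.∙-cancelˡ (+ 2 * + length (allFin n)) (+ length ts) (+ 2) (trans (sym s) e₁))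
  ...   | a ∷ b ∷ [] | p′ | ta ∷ tb ∷ [] | _ = _ , shape-from-degrees a b a≢b L p′ ta tb l
    where
    a≢b : a ≢ b
    a≢b = All.lookup (AllPairs.head (Unique-resp-↭ (↭-sym p′) (Uniqueₚ.allFin⁺ n))) (here refl)

-- Isomorphisms from matching decompositions into chains

module _ {A B : Set} where

  map-injective-∈ : ∀ (f : A → B) {xs x y} → Unique (map f xs) → x ∈ xs → y ∈ xs → f x ≡ f y → x ≡ y
  map-injective-∈ f (ap ∷ un) (here refl) (here refl) e = refl
  map-injective-∈ f (ap ∷ un) (here refl) (there y∈)  e = contradiction e (All.lookup ap (∈ₚ.∈-map⁺ f y∈))
  map-injective-∈ f (ap ∷ un) (there x∈)  (here refl) e = contradiction (sym e) (All.lookup ap (∈ₚ.∈-map⁺ f x∈))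
  map-injective-∈ f (ap ∷ un) (there x∈)  (there y∈)  e = map-injective-∈ f un x∈ y∈ e

AllPairs-lookup : ∀ {A : Set} {R : A → A → Set} → (∀ {x} → R x x) → (∀ {x y} → R x y → R y x) → ∀ {xs x y} → AllPairs R xs → x ∈ xs → y ∈ xs → R x y
AllPairs-lookup r s (ap ∷ aps) (here refl) (here refl) = r
AllPairs-lookup r s (ap ∷ aps) (here refl) (there y∈)  = All.lookup ap y∈
AllPairs-lookup r s (ap ∷ aps) (there x∈)  (here refl) = s (All.lookup ap x∈)
AllPairs-lookup r s (ap ∷ aps) (there x∈)  (there y∈)  = AllPairs-lookup r s aps x∈ y∈

module _ {m n : ℕ} (H : Graph m) (G : Graph n) where

  Same : Fin m × Fin n → Fin m × Fin n → Set
  Same (x , x′) (y , y′) = adj H x y ≡ adj G x′ y′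

  Same-refl : ∀ {p} → Same p p
  Same-refl {x , x′} = trans (adj-irrefl H x) (sym (adj-irrefl G x′))

  Same-sym : ∀ {p q} → Same p q → Same q p
  Same-sym {x , x′} {y , y′} e = trans (adj-sym H y x) (trans e (adj-sym G x′ y′))

  Same-apart : ∀ {x x′ y y′} → Apart H x y → Apart G x′ y′ → Same (x , x′) (y , y′)
  Same-apart (_ , e) (_ , e′) = trans e (sym e′)

  -- The list of pairs is the graph of the bijection. Adjacency need only be compared for distinct
  -- pairs in list order; the other cases follow from symmetry and the absence of loops.
  isomorphism : ∀ ps → map proj₁ ps ↭ allFin m → map proj₂ ps ↭ allFin n → AllPairs Same ps → H ≅ G
  isomorphism ps p₁ p₂ same = Perm.permutation to from to-from from-to , λ i j → AllPairs-lookup (λ {p} → Same-refl {p}) (λ {p} {q} → Same-sym {p} {q}) same (to∈ i) (to∈ j)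
    where
    un₁ : Unique (map proj₁ ps)
    un₁ = Unique-resp-↭ (↭-sym p₁) (Uniqueₚ.allFin⁺ m)
    un₂ : Unique (map proj₂ ps)
    un₂ = Unique-resp-↭ (↭-sym p₂) (Uniqueₚ.allFin⁺ n)
    toΣ : ∀ i → ∃[ j ] (i , j) ∈ ps
    toΣ i with ∈ₚ.∈-map⁻ proj₁ (↭ₚ.∈-resp-↭ (↭-sym p₁) (∈ₚ.∈-allFin i))
    ... | (_ , j) , p∈ , refl = j , p∈
    fromΣ : ∀ j → ∃[ i ] (i , j) ∈ ps
    fromΣ j with ∈ₚ.∈-map⁻ proj₂ (↭ₚ.∈-resp-↭ (↭-sym p₂) (∈ₚ.∈-allFin j))
    ... | (i , _) , p∈ , refl = i , p∈
    to : Fin m → Fin n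
    to i = proj₁ (toΣ i)
    from : Fin n → Fin m
    from j = proj₁ (fromΣ j)
    to∈ : ∀ i → (i , to i) ∈ ps
    to∈ i = proj₂ (toΣ i)
    to-from : ∀ j → to (from j) ≡ j
    to-from j = cong proj₂ (map-injective-∈ proj₁ un₁ (to∈ (from j)) (proj₂ (fromΣ j)) refl)
    from-to : ∀ i → from (to i) ≡ i
    from-to i = cong proj₁ (map-injective-∈ proj₂ un₂ (proj₂ (fromΣ (to i))) (to∈ i) refl)

zip-proj₁ : ∀ {A B : Set} (xs : List A) (ys : List B) → length xs ≡ length ys → map proj₁ (zip xs ys) ≡ xs
zip-proj₁ []       []       e = refl
zip-proj₁ (x ∷ xs) (y ∷ ys) e = cong (x ∷_) (zip-proj₁ xs ys (ℕₚ.suc-injective e))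

zip-proj₂ : ∀ {A B : Set} (xs : List A) (ys : List B) → length xs ≡ length ys → map proj₂ (zip xs ys) ≡ ys
zip-proj₂ []       []       e = refl
zip-proj₂ (x ∷ xs) (y ∷ ys) e = cong (y ∷_) (zip-proj₂ xs ys (ℕₚ.suc-injective e))

All-zip : ∀ {A B : Set} {P : A → Set} {Q : B → Set} {xs ys} → All P xs → All Q ys → All (λ p → P (proj₁ p) × Q (proj₂ p)) (zip xs ys)
All-zip []       _        = []
All-zip (_ ∷ _)  []       = []
All-zip (p ∷ ps) (q ∷ qs) = (p , q) ∷ All-zip ps qs

zip-++ : ∀ {A B : Set} (xs : List A) (ys : List B) {xs′ ys′} → length xs ≡ length ys → zip (xs ++ xs′) (ys ++ ys′) ≡ zip xs ys ++ zip xs′ ys′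
zip-++ []       []       e = refl
zip-++ (x ∷ xs) (y ∷ ys) e = cong ((x , y) ∷_) (zip-++ xs ys (ℕₚ.suc-injective e))

module _ {m n : ℕ} (H : Graph m) (G : Graph n) where

  Same-path : ∀ {x x′ ws ws′ l l′} → Path H x ws l → Path G x′ ws′ l′ → length ws ≡ length ws′ → AllPairs (Same H G) (zip (x ∷ ws) (x′ ∷ ws′))
  Same-path single        single           e = [] ∷ []
  Same-path (step xy ap p) (step xy′ ap′ p′) e =
    (trans xy (sym xy′) ∷ All.map (λ { (q , q′) → Same-apart H G q q′ }) (All-zip ap ap′)) ∷ Same-path p p′ (ℕₚ.suc-injective e)

-- Matching the paths of two graphs

data Strand {n : ℕ} (H : Graph n) (a b : Fin n) : Kind → List (Fin n) → Set where
  empty : Strand H a b (chain 0) []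
  chain : ∀ {y ws} → Path H b (y ∷ ws ++ a ∷ []) a → Strand H a b (chain (suc (length ws))) (y ∷ ws)

IsChain : Kind → Set
IsChain k = ∃[ p ] k ≡ chain p

record Strands {n : ℕ} (H : Graph n) (a b : Fin n) (L : List (Fin n)) (ks : List Kind) : Set where
  field
    strands   : List (Kind × List (Fin n))
    kinds     : map proj₁ strands ≡ ks
    valid     : All (λ B → Strand H a b (proj₁ B) (proj₂ B)) strands
    separated : AllPairs (λ B B′ → Separated H (proj₂ B) (proj₂ B′)) strands
    covers    : concat (map proj₂ strands) ↭ L

concat-↭ : ∀ {A : Set} {xss yss : List (List A)} → xss ↭ yss → concat xss ↭ concat yss
concat-↭ _↭_.refl = ↭-refl
concat-↭ (prep xs p) = ↭ₚ.++⁺ˡ xs (concat-↭ p)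
concat-↭ (swap xs ys p) = ↭-trans (↭ₚ.shifts xs ys) (↭ₚ.++⁺ˡ ys (↭ₚ.++⁺ˡ xs (concat-↭ p)))
concat-↭ (_↭_.trans p q) = ↭-trans (concat-↭ p) (concat-↭ q)

module _ {n : ℕ} {H : Graph n} {ks : List Kind} (shape : Shape H ks) (chains : All IsChain ks) where

  open Shape shape

  private
    edgeBlocks : Bool → List (Kind × List (Fin n))
    edgeBlocks true  = (chain 0 , []) ∷ []
    edgeBlocks false = []

    edge-kinds : ∀ e → map proj₁ (edgeBlocks e ++ blocks) ≡ edgeKinds e ++ map proj₁ blocks
    edge-kinds true  = refl
    edge-kinds false = refl

    H° : Graph n
    H° = removeEdge H a b

    toStrand : ∀ {k W} → Block H° a b k W → IsChain k → Strand H° a b k W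
    toStrand (chain P) _ = chain P
    toStrand (loopᵃ _ _) (_ , ())
    toStrand (loopᵇ _ _) (_ , ())
    toStrand (ring _ _ _) (_ , ())

    edge-valid : ∀ e → All (λ B → IsChain (proj₁ B) → Strand H° a b (proj₁ B) (proj₂ B)) (edgeBlocks e ++ blocks)
    edge-valid true  = (λ _ → empty) ∷ All.map toStrand valid
    edge-valid false = All.map toStrand valid

    edge-separated : ∀ e → AllPairs (λ B B′ → Separated H° (proj₂ B) (proj₂ B′)) (edgeBlocks e ++ blocks)
    edge-separated true  = All.tabulate (λ _ ()) ∷ separated
    edge-separated false = separated

    edge-covers : ∀ e → concat (map proj₂ (edgeBlocks e ++ blocks)) ↭ L
    edge-covers true  = covers
    edge-covers false = covers

  -- `Shape` knows its kinds only up to order. Pulling that permutation back to the blocks lists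
  -- them in the order of `ks`; an edge between the ports becomes an empty strand.
  shape-strands : Strands H° a b L ks
  shape-strands with ↭ₚ.↭-map-inv proj₁ (↭-trans (↭-reflexive (edge-kinds (adj H a b))) kinds)
  ... | ss , eq , p = record
    { strands = ss ; kinds = sym eq
    ; valid = All.zipWith (λ { (f , c) → f c }) (↭ₚ.All-resp-↭ p (edge-valid (adj H a b)) , Allₚ.map⁻ (subst (All IsChain) eq chains))
    ; separated = AllPairs-resp-↭ {R = λ B B′ → Separated H° (proj₂ B) (proj₂ B′)} (λ s i∈ j∈ → Separated-sym H° s i∈ j∈) p (edge-separated (adj H a b))
    ; covers = ↭-trans (concat-↭ (↭ₚ.map⁺ proj₂ (↭-sym p))) (edge-covers (adj H a b)) }

  shape-edge : adj H a b ≡ true → chain 0 ∈ ks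
  shape-edge e = ↭ₚ.∈-resp-↭ kinds (subst (λ t → chain 0 ∈ edgeKinds t ++ map proj₁ blocks) (sym e) (here refl))

  shape-no-edge : adj H a b ≡ false → chain 0 ∉ ks
  shape-no-edge e c∈ with ∈ₚ.∈-map⁻ proj₁ (subst (λ t → chain 0 ∈ edgeKinds t ++ map proj₁ blocks) e (↭ₚ.∈-resp-↭ (↭-sym kinds) c∈))
  ... | (k , W) , B∈ , eq = absurd eq (All.lookup valid B∈)
    where
    absurd : ∀ {k W} → chain 0 ≡ k → Block H° a b k W → ⊥
    absurd () (chain _)
    absurd () (loopᵃ _ _)
    absurd () (loopᵇ _ _)
    absurd () (ring _ _ _)

module _ {m n : ℕ} (H : Graph m) (G : Graph n) {a b : Fin m} {a′ b′ : Fin n} (ab : Apart H a b) (ab′ : Apart G a′ b′) where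

  private
    Matched : List (Fin m × Fin n) → List (Fin m) → List (Fin n) → Set
    Matched ps W W′ = map proj₁ ps ≡ W × map proj₂ ps ≡ W′ × AllPairs (Same H G) ps × All (λ p → Same H G (a , a′) p × Same H G (b , b′) p) ps

    AllPairs-++ˡ : ∀ {A : Set} {R : A → A → Set} xs {ys} → AllPairs R (xs ++ ys) → AllPairs R xs
    AllPairs-++ˡ []       _          = []
    AllPairs-++ˡ (x ∷ xs) (ap ∷ aps) = Allₚ.++⁻ˡ xs ap ∷ AllPairs-++ˡ xs aps

    AllPairs-last : ∀ {A : Set} {R : A → A → Set} xs {y} → AllPairs R (xs ++ y ∷ []) → All (λ x → R x y) xs
    AllPairs-last []       _          = []
    AllPairs-last (x ∷ xs) (ap ∷ aps) = All.lookup ap (∈ₚ.∈-++⁺ʳ xs (here refl)) ∷ AllPairs-last xs aps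

    matchStrand : ∀ {k W W′} → Strand H a b k W → Strand G a′ b′ k W′ → ∃[ ps ] Matched ps W W′
    matchStrand {W = W} {W′} s s′ = zip W W′ , zip-proj₁ W W′ (sizes s s′ refl) , zip-proj₂ W W′ (sizes s s′ refl) , pairs s s′ refl , ends s s′ refl
      where
      sizes : ∀ {k k′ W W′} → Strand H a b k W → Strand G a′ b′ k′ W′ → k ≡ k′ → length W ≡ length W′
      sizes empty     empty      e = refl
      sizes empty     (chain _)  ()
      sizes (chain _) empty      ()
      sizes (chain {ws = ws} _) (chain {ws = ws′} _) e = cong suc (chain-injective e)
        where
        chain-injective : ∀ {p q} → Kind.chain (suc p) ≡ chain (suc q) → p ≡ q
        chain-injective refl = refl
      whole : ∀ {y ws y′ ws′} → Path H b (y ∷ ws ++ a ∷ []) a → Path G b′ (y′ ∷ ws′ ++ a′ ∷ []) a′ → length (y ∷ ws) ≡ length (y′ ∷ ws′) →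
        AllPairs (Same H G) ((b , b′) ∷ zip (y ∷ ws) (y′ ∷ ws′) ++ (a , a′) ∷ [])
      whole {y} {ws} {y′} {ws′} P P′ e = subst (λ z → AllPairs (Same H G) ((b , b′) ∷ z)) (zip-++ (y ∷ ws) (y′ ∷ ws′) e)
        (Same-path H G P P′ (trans (Listₚ.length-++ (y ∷ ws)) (trans (cong (ℕ._+ 1) e) (sym (Listₚ.length-++ (y′ ∷ ws′))))))
      pairs : ∀ {k k′ W W′} → Strand H a b k W → Strand G a′ b′ k′ W′ → k ≡ k′ → AllPairs (Same H G) (zip W W′)
      pairs empty     _          e = []
      pairs (chain _) empty      ()
      pairs {W = W} {W′} (chain P) (chain P′) e = AllPairs-++ˡ (zip W W′) (AllPairs.tail (whole P P′ (sizes (chain P) (chain P′) e)))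
      ends : ∀ {k k′ W W′} → Strand H a b k W → Strand G a′ b′ k′ W′ → k ≡ k′ → All (λ p → Same H G (a , a′) p × Same H G (b , b′) p) (zip W W′)
      ends empty     _          e = []
      ends (chain _) empty      ()
      ends {W = W} {W′} (chain P) (chain P′) e with whole P P′ (sizes (chain P) (chain P′) e)
      ... | fromB ∷ rest = All.zipWith (λ {p} → λ { (s , t) → Same-sym H G {p} {a , a′} s , t }) (AllPairs-last (zip W W′) rest , Allₚ.++⁻ˡ (zip W W′) fromB)

  matchStrands : ∀ ss ss′ → map proj₁ ss ≡ map proj₁ ss′ →
    All (λ B → Strand H a b (proj₁ B) (proj₂ B)) ss → All (λ B → Strand G a′ b′ (proj₁ B) (proj₂ B)) ss′ →
    AllPairs (λ B B′ → Separated H (proj₂ B) (proj₂ B′)) ss → AllPairs (λ B B′ → Separated G (proj₂ B) (proj₂ B′)) ss′ →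
    ∃[ ps ] Matched ps (concat (map proj₂ ss)) (concat (map proj₂ ss′))
  matchStrands [] [] e [] [] [] [] = [] , refl , refl , [] , []
  matchStrands ((k , W) ∷ ss) ((k′ , W′) ∷ ss′) e (s ∷ vs) (s′ ∷ vs′) (sep ∷ seps) (sep′ ∷ seps′) with Listₚ.∷-injective e
  ... | refl , e′ with matchStrand s s′ | matchStrands ss ss′ e′ vs vs′ seps seps′
  ...   | ps , p₁ , p₂ , aps , ends | qs , q₁ , q₂ , aqs , ends′ = ps ++ qs ,
    trans (Listₚ.map-++ proj₁ ps qs) (cong₂ _++_ p₁ q₁) , trans (Listₚ.map-++ proj₂ ps qs) (cong₂ _++_ p₂ q₂) ,
    AllPairsₚ.++⁺ aps aqs (All.tabulate (λ p∈ → All.tabulate (λ q∈ → cross p∈ q∈))) , Allₚ.++⁺ ends ends′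
    where
    away : ∀ {l} {K : Graph l} {W ss} → All (λ B → Separated K W (proj₂ B)) ss → ∀ {i j} → i ∈ W → j ∈ concat (map proj₂ ss) → Apart K i j
    away {ss = ss} sep i∈ j∈ with ∈ₚ.∈-concat⁻′ (map proj₂ ss) j∈
    ... | V , j∈V , V∈ with ∈ₚ.∈-map⁻ proj₂ V∈
    ...   | B , B∈ , refl = All.lookup sep B∈ i∈ j∈V
    cross : ∀ {p q} → p ∈ ps → q ∈ qs → Same H G p q
    cross {p} {q} p∈ q∈ = Same-apart H G
      (away {K = H} {W} {ss} sep (subst (proj₁ p ∈_) p₁ (∈ₚ.∈-map⁺ proj₁ p∈)) (subst (proj₁ q ∈_) q₁ (∈ₚ.∈-map⁺ proj₁ q∈)))
      (away {K = G} {W′} {ss′} sep′ (subst (proj₂ p ∈_) p₂ (∈ₚ.∈-map⁺ proj₂ p∈)) (subst (proj₂ q ∈_) q₂ (∈ₚ.∈-map⁺ proj₂ q∈)))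

-- A chain is determined by its number of vertices, and all chains run from b to a, so matching
-- strands one by one and adding the two pairs of ports gives the bijection. Adjacency of the ports
-- is read off from the presence of `chain 0`.
shape-isomorphism : ∀ {m n} {H : Graph m} {G : Graph n} {ks} → All IsChain ks → Shape H ks → Shape G ks → H ≅ G
shape-isomorphism {m} {n} {H} {G} {ks} chains s s′ = build (matchStrands H° G° ab ab′ (Strands.strands S) (Strands.strands S′)
    (trans (Strands.kinds S) (sym (Strands.kinds S′))) (Strands.valid S) (Strands.valid S′) (Strands.separated S) (Strands.separated S′))
  where
  open Shape s
  open Shape s′ using () renaming (a to a′; b to b′; L to L′; a≢b to a′≢b′; order to order′)
  H° : Graph m
  H° = removeEdge H a b
  G° : Graph n
  G° = removeEdge G a′ b′
  ab : Apart H° a b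
  ab = removeEdge-ab H a b a≢b
  ab′ : Apart G° a′ b′
  ab′ = removeEdge-ab G a′ b′ a′≢b′
  S : Strands H° a b L ks
  S = shape-strands s chains
  S′ : Strands G° a′ b′ L′ ks
  S′ = shape-strands s′ chains
  edges-agree : adj H a b ≡ adj G a′ b′
  edges-agree with adj H a b in e | adj G a′ b′ in e′
  ... | true  | true  = refl
  ... | false | false = refl
  ... | true  | false = contradiction (shape-edge s chains e) (shape-no-edge s′ chains e′)
  ... | false | true  = contradiction (shape-edge s′ chains e′) (shape-no-edge s chains e)
  notPort : ∀ {k} {a b : Fin k} {L} → a ∷ b ∷ L ↭ allFin k → ∀ {x} → x ∈ L → x ≢ a × x ≢ b
  notPort {k} o x∈ with Unique-resp-↭ (↭-sym o) (Uniqueₚ.allFin⁺ k)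
  ... | ap ∷ bp ∷ _ = (λ { refl → All.lookup ap (there x∈) refl }) , (λ { refl → All.lookup bp x∈ refl })
  build : _ → H ≅ G
  build (ps , p₁ , p₂ , aps , ends) = isomorphism H G ((a , a′) ∷ (b , b′) ∷ ps)
    (↭-trans (prep a (prep b (↭-trans (↭-reflexive p₁) (Strands.covers S)))) order)
    (↭-trans (prep a′ (prep b′ (↭-trans (↭-reflexive p₂) (Strands.covers S′)))) order′)
    ((edges-agree ∷ All.tabulate (λ p∈ → lower p∈ (proj₁ (All.lookup ends p∈)))) ∷ All.tabulate (λ p∈ → lower p∈ (proj₂ (All.lookup ends p∈)))
      ∷ allLower ps id aps)
    where
    lower : ∀ {p q} → q ∈ ps → Same H° G° p q → Same H G p q
    lower {x , x′} {y , y′} q∈ e = trans (sym (removeEdge-adjʳ H a b x (proj₁ y∉) (proj₂ y∉))) (trans e (removeEdge-adjʳ G a′ b′ x′ (proj₁ y∉′) (proj₂ y∉′)))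
      where
      y∉ : y ≢ a × y ≢ b
      y∉ = notPort order (↭ₚ.∈-resp-↭ (Strands.covers S) (subst (y ∈_) p₁ (∈ₚ.∈-map⁺ proj₁ q∈)))
      y∉′ : y′ ≢ a′ × y′ ≢ b′
      y∉′ = notPort order′ (↭ₚ.∈-resp-↭ (Strands.covers S′) (subst (y′ ∈_) p₂ (∈ₚ.∈-map⁺ proj₂ q∈)))
    allLower : ∀ qs → (∀ {q} → q ∈ qs → q ∈ ps) → AllPairs (Same H° G°) qs → AllPairs (Same H G) qs
    allLower []       sub []         = []
    allLower (q ∷ qs) sub (ap ∷ aps) = All.tabulate (λ q∈ → lower (sub (there q∈)) (All.lookup ap q∈)) ∷ allLower qs (sub ∘ there) aps

-- The decomposition of a theta graph

Path-tabulate : ∀ {n} (H : Graph n) {a} k (f : Fin (suc k) → Fin n) {x} →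
  (∀ i j → adj H (f i) (f j) ≡ (suc (toℕ i) ℕ.≡ᵇ toℕ j) ∨ (suc (toℕ j) ℕ.≡ᵇ toℕ i)) → (∀ {i j} → f i ≡ f j → i ≡ j) →
  (∀ i → x ≢ f i) → (∀ i → adj H x (f i) ≡ (toℕ i ℕ.≡ᵇ 0)) → Apart H x a →
  (∀ i → f i ≢ a) → (∀ i → adj H (f i) a ≡ (suc (toℕ i) ℕ.≡ᵇ suc k)) → Path H x (tabulate f ++ a ∷ []) a
Path-tabulate H zero    f ff inj xf adjx xa fa adja = step (adjx zero) (xa ∷ []) (step (adja zero) [] single)
Path-tabulate H (suc k) f {x} ff inj xf adjx xa fa adja = step (adjx zero)
  (Allₚ.++⁺ (Allₚ.tabulate⁺ (λ i → xf (suc i) , adjx (suc i))) (xa ∷ []))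
  (Path-tabulate H k (f ∘ suc) (λ i j → ff (suc i) (suc j)) (λ e → Finₚ.suc-injective (inj e)) (λ i e → case inj e of λ ())
    (λ i → trans (ff zero (suc i)) (next (toℕ i))) (fa zero , adja zero) (fa ∘ suc) (adja ∘ suc))
  where
  next : ∀ i → (0 ℕ.≡ᵇ i) ∨ false ≡ (i ℕ.≡ᵇ 0)
  next zero    = refl
  next (suc i) = refl

module _ {n : ℕ} (H : Graph n) {a b : Fin n} (a≢b : a ≢ b) {L : List (Fin n)} (order : a ∷ b ∷ L ↭ allFin n)
         (ss : List (Kind × List (Fin n)))
         (valid : All (λ B → Σ[ p ∈ ℕ ] proj₁ B ≡ chain (suc p) × Strand (removeEdge H a b) a b (proj₁ B) (proj₂ B)) ss)
         (separated : AllPairs (λ B B′ → Separated (removeEdge H a b) (proj₂ B) (proj₂ B′)) ss)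
         (covers : concat (map proj₂ ss) ↭ L) where

  private
    H° : Graph n
    H° = removeEdge H a b

    nonPort : ∀ {x} → x ∈ L → x ≢ a × x ≢ b
    nonPort x∈ with Unique-resp-↭ (↭-sym order) (Uniqueₚ.allFin⁺ n)
    ... | ap ∷ bp ∷ _ = (λ { refl → All.lookup ap (there x∈) refl }) , (λ { refl → All.lookup bp x∈ refl })

    block : ∀ {k W} → Σ[ p ∈ ℕ ] k ≡ chain (suc p) × Strand H° a b k W → Block H° a b k W
    block (p , () , empty)
    block (p , e , chain P) = chain P

    mid : ∀ {k W} → Strand H° a b k W → ∀ {x} → x ∈ W → count (adj H° x) (b ∷ W ++ a ∷ []) ≡ 2
    mid (chain {y} {ws} P) x∈ = All.lookup (count-path-mid H° (y ∷ ws) P) x∈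

    interior : ∀ {x} → x ∈ L → degree H x ≡ 2
    interior {x} x∈ with ∈ₚ.∈-concat⁻′ (map proj₂ ss) (↭ₚ.∈-resp-↭ (↭-sym covers) x∈)
    ... | W , x∈W , W∈ with ∈ₚ.∈-map⁻ proj₂ W∈
    ...   | B , B∈ , refl with ∈-∃↭ B∈
    ...     | ss′ , p with AllPairs-resp-↭ {R = λ B B′ → Separated H° (proj₂ B) (proj₂ B′)} (λ s i∈ j∈ → Separated-sym H° s i∈ j∈) p separated
    ...       | sep ∷ _ = begin
      degree H x                                                           ≡⟨ degree-list H x order ⟩
      count (adj H x) (a ∷ b ∷ L)                                          ≡⟨ count-cong (a ∷ b ∷ L) (λ t _ → removeEdge-adjˡ H a b t (proj₁ (nonPort x∈)) (proj₂ (nonPort x∈))) ⟨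
      count (adj H° x) (a ∷ b ∷ L)                                         ≡⟨ count-↭ (adj H° x) rearrange ⟩
      count (adj H° x) ((b ∷ proj₂ B ++ a ∷ []) ++ concat (map proj₂ ss′)) ≡⟨ count-++ (adj H° x) (b ∷ proj₂ B ++ a ∷ []) _ ⟩
      count (adj H° x) (b ∷ proj₂ B ++ a ∷ []) ℕ.+ count (adj H° x) (concat (map proj₂ ss′))
        ≡⟨ cong₂ ℕ._+_ (mid (proj₂ (proj₂ (All.lookup valid B∈))) x∈W) (count-none (adj H° x) (All.tabulate away)) ⟩
      2                                                                    ∎
      where
      away : ∀ {t} → t ∈ concat (map proj₂ ss′) → adj H° x t ≡ false
      away t∈ with ∈ₚ.∈-concat⁻′ (map proj₂ ss′) t∈
      ... | V , t∈V , V∈ with ∈ₚ.∈-map⁻ proj₂ V∈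
      ...   | B′ , B′∈ , refl = proj₂ (All.lookup sep B′∈ x∈W t∈V)
      rearrange : a ∷ b ∷ L ↭ (b ∷ proj₂ B ++ a ∷ []) ++ concat (map proj₂ ss′)
      rearrange = ↭-trans (swap a b (↭-trans (↭-sym covers) (concat-↭ (↭ₚ.map⁺ proj₂ p))))
        (prep b (↭-trans (↭-sym (↭ₚ.shift a (proj₂ B) _)) (↭-reflexive (sym (Listₚ.++-assoc (proj₂ B) (a ∷ []) _)))))

    portCount : ∀ f → (∀ {k W} → Σ[ p ∈ ℕ ] k ≡ chain (suc p) × Strand H° a b k W → count (adj H° f) W ≡ 1) →
      count (adj H f) (a ∷ b ∷ []) ≡ indicator (adj H a b) → degree H f ≡ indicator (adj H a b) ℕ.+ length ss
    portCount f one e = trans (degree-list H f order) (trans (count-++ (adj H f) (a ∷ b ∷ []) L) (cong₂ ℕ._+_ e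
      (trans (count-cong L (λ x x∈ → sym (removeEdge-adjʳ H a b f (proj₁ (nonPort x∈)) (proj₂ (nonPort x∈))))) (trans (count-↭ (adj H° f) (↭-sym covers)) (go ss valid)))))
      where
      go : ∀ bs → All (λ B → Σ[ p ∈ ℕ ] proj₁ B ≡ chain (suc p) × Strand H° a b (proj₁ B) (proj₂ B)) bs → count (adj H° f) (concat (map proj₂ bs)) ≡ length bs
      go []             []       = refl
      go ((k , W) ∷ bs) (o ∷ os) = trans (count-++ (adj H° f) W _) (cong₂ ℕ._+_ (one o) (go bs os))

    oneᵃ : ∀ {k W} → Σ[ p ∈ ℕ ] k ≡ chain (suc p) × Strand H° a b k W → count (adj H° a) W ≡ 1
    oneᵃ (p , () , empty)
    oneᵃ (p , e , chain {y} {ws} (step _ _ P)) = count-path-last H° ws P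

    oneᵇ : ∀ {k W} → Σ[ p ∈ ℕ ] k ≡ chain (suc p) × Strand H° a b k W → count (adj H° b) W ≡ 1
    oneᵇ (p , () , empty)
    oneᵇ (p , e , chain {y} {ws} (step by ap _)) rewrite by = cong suc (count-apart H° (Allₚ.++⁻ˡ ws ap))

  shape-from-strands : indicator (adj H a b) ℕ.+ length ss ≡ 3 → Shape H (edgeKinds (adj H a b) ++ map proj₁ ss)
  shape-from-strands e = record
    { a = a ; b = b ; L = L ; a≢b = a≢b ; order = order
    ; degree-a = trans (portCount a oneᵃ portsᵃ) e ; degree-b = trans (portCount b oneᵇ portsᵇ) e ; degree-L = All.tabulate interior
    ; blocks = ss ; valid = All.map block valid ; separated = separated ; covers = covers ; kinds = ↭-refl }
    where
    portsᵃ : count (adj H a) (a ∷ b ∷ []) ≡ indicator (adj H a b)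
    portsᵃ rewrite adj-irrefl H a = ℕₚ.+-identityʳ _
    portsᵇ : count (adj H b) (a ∷ b ∷ []) ≡ indicator (adj H a b)
    portsᵇ rewrite adj-irrefl H b | adj-sym H b a = ℕₚ.+-identityʳ _

module ThetaShape (p q r : ℕ) (pq : ¬ (p ≡ 0 × q ≡ 0)) (pr : ¬ (p ≡ 0 × r ≡ 0)) (qr : ¬ (q ≡ 0 × r ≡ 0)) where

  private
    N : ℕ
    N = p ℕ.+ q ℕ.+ r ℕ.+ 2
    T : Graph N
    T = θ p q r
    fr : Vertex p q r → Fin N
    fr = Inverse.from (vertices p q r)

    fr-injective : ∀ x y → fr x ≡ fr y → x ≡ y
    fr-injective x y e = trans (sym (Inverse.strictlyInverseˡ (vertices p q r) x)) (trans (cong (Inverse.to (vertices p q r)) e) (Inverse.strictlyInverseˡ (vertices p q r) y))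

    adj-fr : ∀ x y → adj T (fr x) (fr y) ≡ (x ⟶ y) ∨ (y ⟶ x)
    adj-fr x y = cong₂ (λ s t → (s ⟶ t) ∨ (t ⟶ s)) (Inverse.strictlyInverseˡ (vertices p q r) x) (Inverse.strictlyInverseˡ (vertices p q r) y)

    -- Chains run from b to a and the paths of the theta graph from u to v, hence a is v and b is u.
    a b : Fin N
    a = fr v
    b = fr u

    a≢b : a ≢ b
    a≢b e with fr-injective v u e
    ... | ()

    T° : Graph N
    T° = removeEdge T a b

    fP : Fin p → Fin N
    fP i = fr (onP i)
    fQ : Fin q → Fin N
    fQ i = fr (onQ i)
    fR : Fin r → Fin N
    fR i = fr (onR i)

    adj°-fr : ∀ x y → fr x ≢ a → fr x ≢ b → adj T° (fr x) (fr y) ≡ (x ⟶ y) ∨ (y ⟶ x)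
    adj°-fr x y xa xb = trans (removeEdge-adjˡ T a b (fr y) xa xb) (adj-fr x y)

    strand : ∀ k → (Fin k → Fin N) → List (Kind × List (Fin N))
    strand zero    f = []
    strand (suc k) f = (chain (suc k) , tabulate f) ∷ []

    ss : List (Kind × List (Fin N))
    ss = strand p fP ++ strand q fQ ++ strand r fR

    Good : Kind × List (Fin N) → Set
    Good B = Σ[ k ∈ ℕ ] proj₁ B ≡ chain (suc k) × Strand T° a b (proj₁ B) (proj₂ B)

    strand-valid : ∀ k (f : Fin k → Fin N) → (∀ i j → adj T° (f i) (f j) ≡ (suc (toℕ i) ℕ.≡ᵇ toℕ j) ∨ (suc (toℕ j) ℕ.≡ᵇ toℕ i)) →
      (∀ {i j} → f i ≡ f j → i ≡ j) → (∀ i → f i ≢ b) → (∀ i → adj T° (f i) b ≡ (toℕ i ℕ.≡ᵇ 0)) →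
      (∀ i → f i ≢ a) → (∀ i → adj T° (f i) a ≡ (suc (toℕ i) ℕ.≡ᵇ k)) → All Good (strand k f)
    strand-valid zero    f ff inj fb adjb fa adja = []
    strand-valid (suc k) f ff inj fb adjb fa adja = (k , refl ,
      subst (λ m → Strand T° a b (chain (suc m)) (tabulate f)) (Listₚ.length-tabulate (f ∘ suc)) (chain (Path-tabulate T° k f ff inj (λ i e → fb i (sym e))
        (λ i → trans (adj-sym T° b (f i)) (adjb i)) (Apart-sym T° (removeEdge-ab T a b a≢b)) fa adja))) ∷ []

    P≢a : ∀ i → fP i ≢ a
    P≢a i e with fr-injective (onP i) v e
    ... | ()
    P≢b : ∀ i → fP i ≢ b
    P≢b i e with fr-injective (onP i) u e
    ... | ()
    Q≢a : ∀ i → fQ i ≢ a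
    Q≢a i e with fr-injective (onQ i) v e
    ... | ()
    Q≢b : ∀ i → fQ i ≢ b
    Q≢b i e with fr-injective (onQ i) u e
    ... | ()
    R≢a : ∀ i → fR i ≢ a
    R≢a i e with fr-injective (onR i) v e
    ... | ()
    R≢b : ∀ i → fR i ≢ b
    R≢b i e with fr-injective (onR i) u e
    ... | ()

    validP : All Good (strand p fP)
    validP = strand-valid p fP (λ i j → adj°-fr (onP i) (onP j) (P≢a i) (P≢b i)) (λ {i} {j} e → case fr-injective (onP i) (onP j) e of λ { refl → refl })
      P≢b (λ i → adj°-fr (onP i) u (P≢a i) (P≢b i)) P≢a (λ i → trans (adj°-fr (onP i) v (P≢a i) (P≢b i)) (∨-identityʳ _))
    validQ : All Good (strand q fQ)
    validQ = strand-valid q fQ (λ i j → adj°-fr (onQ i) (onQ j) (Q≢a i) (Q≢b i)) (λ {i} {j} e → case fr-injective (onQ i) (onQ j) e of λ { refl → refl })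
      Q≢b (λ i → adj°-fr (onQ i) u (Q≢a i) (Q≢b i)) Q≢a (λ i → trans (adj°-fr (onQ i) v (Q≢a i) (Q≢b i)) (∨-identityʳ _))
    validR : All Good (strand r fR)
    validR = strand-valid r fR (λ i j → adj°-fr (onR i) (onR j) (R≢a i) (R≢b i)) (λ {i} {j} e → case fr-injective (onR i) (onR j) e of λ { refl → refl })
      R≢b (λ i → adj°-fr (onR i) u (R≢a i) (R≢b i)) R≢a (λ i → trans (adj°-fr (onR i) v (R≢a i) (R≢b i)) (∨-identityʳ _))

    strand-elements : ∀ k {f B} → B ∈ strand k f → proj₂ B ≡ tabulate f
    strand-elements (suc k) (here refl) = refl

    cross : ∀ j k {f : Fin j → Fin N} {g : Fin k → Fin N} → (∀ i i′ → Apart T° (f i) (g i′)) →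
      All (λ B → All (λ B′ → Separated T° (proj₂ B) (proj₂ B′)) (strand k g)) (strand j f)
    cross j k {f} {g} ap = All.tabulate λ B∈ → All.tabulate λ B′∈ → λ {x} {y} x∈ y∈ → go (subst (x ∈_) (strand-elements j B∈) x∈) (subst (y ∈_) (strand-elements k B′∈) y∈)
      where
      go : ∀ {x y} → x ∈ tabulate f → y ∈ tabulate g → Apart T° x y
      go x∈ y∈ with ∈ₚ.∈-tabulate⁻ x∈ | ∈ₚ.∈-tabulate⁻ y∈
      ... | i , refl | i′ , refl = ap i i′

    alone : ∀ k {f} → AllPairs (λ B B′ → Separated T° (proj₂ B) (proj₂ B′)) (strand k f)
    alone zero    = []
    alone (suc k) = [] ∷ []

    PQ : ∀ i j → Apart T° (fP i) (fQ j)
    PQ i j = (λ e → case fr-injective (onP i) (onQ j) e of λ ()) , adj°-fr (onP i) (onQ j) (P≢a i) (P≢b i)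
    PR : ∀ i j → Apart T° (fP i) (fR j)
    PR i j = (λ e → case fr-injective (onP i) (onR j) e of λ ()) , adj°-fr (onP i) (onR j) (P≢a i) (P≢b i)
    QR : ∀ i j → Apart T° (fQ i) (fR j)
    QR i j = (λ e → case fr-injective (onQ i) (onR j) e of λ ()) , adj°-fr (onQ i) (onR j) (Q≢a i) (Q≢b i)

    separated : AllPairs (λ B B′ → Separated T° (proj₂ B) (proj₂ B′)) ss
    separated = AllPairsₚ.++⁺ (alone p) (AllPairsₚ.++⁺ (alone q) (alone r) (cross q r QR))
      (All.zipWith (λ { (s , t) → Allₚ.++⁺ s t }) (cross p q PQ , cross p r PR))

    covers : concat (map proj₂ ss) ≡ tabulate fP ++ tabulate fQ ++ tabulate fR
    covers = trans (drop p fP (strand q fQ ++ strand r fR)) (cong (tabulate fP ++_) (trans (drop q fQ (strand r fR)) (cong (tabulate fQ ++_)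
      (trans (cong (λ bs → concat (map proj₂ bs)) (sym (Listₚ.++-identityʳ (strand r fR)))) (trans (drop r fR []) (Listₚ.++-identityʳ _))))))
      where
      drop : ∀ k (f : Fin k → Fin N) bs → concat (map proj₂ (strand k f ++ bs)) ≡ tabulate f ++ concat (map proj₂ bs)
      drop zero    f bs = refl
      drop (suc k) f bs = refl

    L : List (Fin N)
    L = concat (map proj₂ ss)

    everything : ∀ x → fr x ∈ a ∷ b ∷ tabulate fP ++ tabulate fQ ++ tabulate fR
    everything v       = here refl
    everything u       = there (here refl)
    everything (onP i) = there (there (∈ₚ.∈-++⁺ˡ (∈ₚ.∈-tabulate⁺ i)))
    everything (onQ i) = there (there (∈ₚ.∈-++⁺ʳ (tabulate fP) (∈ₚ.∈-++⁺ˡ (∈ₚ.∈-tabulate⁺ i))))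
    everything (onR i) = there (there (∈ₚ.∈-++⁺ʳ (tabulate fP) (∈ₚ.∈-++⁺ʳ (tabulate fQ) (∈ₚ.∈-tabulate⁺ i))))

    distinct : Unique (a ∷ b ∷ tabulate fP ++ tabulate fQ ++ tabulate fR)
    distinct = (a≢b ∷ all₃ (λ i e → P≢a i (sym e)) (λ i e → Q≢a i (sym e)) (λ i e → R≢a i (sym e)))
      ∷ all₃ (λ i e → P≢b i (sym e)) (λ i e → Q≢b i (sym e)) (λ i e → R≢b i (sym e))
      ∷ AllPairsₚ.++⁺ (uniq (λ i → onP i) λ { refl → refl }) (AllPairsₚ.++⁺ (uniq (λ i → onQ i) λ { refl → refl }) (uniq (λ i → onR i) λ { refl → refl })
          (Allₚ.tabulate⁺ λ i → Allₚ.tabulate⁺ λ j → proj₁ (QR i j)))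
        (Allₚ.tabulate⁺ λ i → Allₚ.++⁺ (Allₚ.tabulate⁺ λ j → proj₁ (PQ i j)) (Allₚ.tabulate⁺ λ j → proj₁ (PR i j)))
      where
      all₃ : ∀ {x} → (∀ i → x ≢ fP i) → (∀ i → x ≢ fQ i) → (∀ i → x ≢ fR i) → All (x ≢_) (tabulate fP ++ tabulate fQ ++ tabulate fR)
      all₃ f g h = Allₚ.++⁺ (Allₚ.tabulate⁺ f) (Allₚ.++⁺ (Allₚ.tabulate⁺ g) (Allₚ.tabulate⁺ h))
      uniq : ∀ {k} (f : Fin k → Vertex p q r) → (∀ {i j} → f i ≡ f j → i ≡ j) → Unique (tabulate (fr ∘ f))
      uniq f inj = Uniqueₚ.tabulate⁺ (λ {i} {j} e → inj (fr-injective (f i) (f j) e))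

    order : a ∷ b ∷ L ↭ allFin N
    order = subst (λ l → a ∷ b ∷ l ↭ allFin N) (sym covers) (∼bag⇒↭ (unique∧set⇒bag distinct (Uniqueₚ.allFin⁺ N)
      (λ {x} → mk⇔ (λ _ → ∈ₚ.∈-allFin x) (λ _ → subst (_∈ _) (Inverse.strictlyInverseʳ (vertices p q r) x) (everything (Inverse.to (vertices p q r) x))))))

    ab-edge : adj T a b ≡ (p ℕ.≡ᵇ 0) ∨ (q ℕ.≡ᵇ 0) ∨ (r ℕ.≡ᵇ 0)
    ab-edge = adj-fr v u

  theta-shape : Shape (θ p q r) (chain p ∷ chain q ∷ chain r ∷ [])
  theta-shape = Shape-↭ (finish ab-edge) (shape-from-strands T a≢b order ss (Allₚ.++⁺ validP (Allₚ.++⁺ validQ validR)) separated ↭-refl (three ab-edge))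
    where
    three : ∀ {e} → e ≡ (p ℕ.≡ᵇ 0) ∨ (q ℕ.≡ᵇ 0) ∨ (r ℕ.≡ᵇ 0) → indicator e ℕ.+ length ss ≡ 3
    finish : ∀ {e} → e ≡ (p ℕ.≡ᵇ 0) ∨ (q ℕ.≡ᵇ 0) ∨ (r ℕ.≡ᵇ 0) → edgeKinds e ++ map proj₁ ss ↭ chain p ∷ chain q ∷ chain r ∷ []
    three refl = counts p q r fP fQ fR pq pr qr
      where
      counts : ∀ p q r (f : Fin p → Fin N) (g : Fin q → Fin N) (h : Fin r → Fin N) → ¬ (p ≡ 0 × q ≡ 0) → ¬ (p ≡ 0 × r ≡ 0) → ¬ (q ≡ 0 × r ≡ 0) →
        indicator ((p ℕ.≡ᵇ 0) ∨ (q ℕ.≡ᵇ 0) ∨ (r ℕ.≡ᵇ 0)) ℕ.+ length (strand p f ++ strand q g ++ strand r h) ≡ 3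
      counts zero    zero    _       f g h pq pr qr = contradiction (refl , refl) pq
      counts zero    (suc q) zero    f g h pq pr qr = contradiction (refl , refl) pr
      counts zero    (suc q) (suc r) f g h pq pr qr = refl
      counts (suc p) zero    zero    f g h pq pr qr = contradiction (refl , refl) qr
      counts (suc p) zero    (suc r) f g h pq pr qr = refl
      counts (suc p) (suc q) zero    f g h pq pr qr = refl
      counts (suc p) (suc q) (suc r) f g h pq pr qr = refl
    finish refl = perms p q r fP fQ fR pq pr qr
      where
      perms : ∀ p q r (f : Fin p → Fin N) (g : Fin q → Fin N) (h : Fin r → Fin N) → ¬ (p ≡ 0 × q ≡ 0) → ¬ (p ≡ 0 × r ≡ 0) → ¬ (q ≡ 0 × r ≡ 0) →
        edgeKinds ((p ℕ.≡ᵇ 0) ∨ (q ℕ.≡ᵇ 0) ∨ (r ℕ.≡ᵇ 0)) ++ map proj₁ (strand p f ++ strand q g ++ strand r h) ↭ chain p ∷ chain q ∷ chain r ∷ []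
      perms zero    zero    _       f g h pq pr qr = contradiction (refl , refl) pq
      perms zero    (suc q) zero    f g h pq pr qr = contradiction (refl , refl) pr
      perms zero    (suc q) (suc r) f g h pq pr qr = ↭-refl
      perms (suc p) zero    zero    f g h pq pr qr = contradiction (refl , refl) qr
      perms (suc p) zero    (suc r) f g h pq pr qr = swap _ _ ↭-refl
      perms (suc p) (suc q) zero    f g h pq pr qr = ↭-trans (swap _ _ ↭-refl) (prep _ (swap _ _ ↭-refl))
      perms (suc p) (suc q) (suc r) f g h pq pr qr = ↭-refl

-- Theta and dumbbell kinds

-- With c chains the degree equations read c + 2·(loops at a) = 3 and c + 2·(loops at b) = 3. So c =
-- 3 without loops, or c = 1 with one loop at each port; the number of rings stays free.
classify : ∀ ks → total kindDegᵃ ks ≡ 3 → total kindDegᵇ ks ≡ 3 →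
  (∃[ p ] ∃[ q ] ∃[ r ] ∃[ rs ] ks ↭ chain p ∷ chain q ∷ chain r ∷ map ring rs) ⊎ (∃[ p ] ∃[ i ] ∃[ j ] ∃[ rs ] ks ↭ chain p ∷ loopᵃ i ∷ loopᵇ j ∷ map ring rs)
classify ks degᵃ degᵇ with sorted ks
  where
  sorted : ∀ ks → ∃[ cs ] ∃[ as ] ∃[ bs ] ∃[ rs ] ks ↭ map chain cs ++ map loopᵃ as ++ map loopᵇ bs ++ map ring rs
  sorted [] = [] , [] , [] , [] , ↭-refl
  sorted (k ∷ ks) with sorted ks
  sorted (chain p ∷ ks) | cs , as , bs , rs , e = p ∷ cs , as , bs , rs , prep (chain p) e
  sorted (loopᵃ i ∷ ks) | cs , as , bs , rs , e = cs , i ∷ as , bs , rs , ↭-trans (prep _ e) (↭-sym (↭ₚ.shift (loopᵃ i) (map chain cs) _))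
  sorted (loopᵇ i ∷ ks) | cs , as , bs , rs , e = cs , as , i ∷ bs , rs , ↭-trans (prep _ e)
    (↭-trans (↭-sym (↭ₚ.shift (loopᵇ i) (map chain cs) _)) (↭ₚ.++⁺ˡ (map chain cs) (↭-sym (↭ₚ.shift (loopᵇ i) (map loopᵃ as) _))))
  sorted (ring i ∷ ks) | cs , as , bs , rs , e = cs , as , bs , i ∷ rs , ↭-trans (prep _ e)
    (↭-trans (↭-sym (↭ₚ.shift (ring i) (map chain cs) _)) (↭ₚ.++⁺ˡ (map chain cs) (↭-trans (↭-sym (↭ₚ.shift (ring i) (map loopᵃ as) _))
      (↭ₚ.++⁺ˡ (map loopᵃ as) (↭-sym (↭ₚ.shift (ring i) (map loopᵇ bs) _))))))
... | cs , as , bs , rs , e = cases cs as bs (trans (sym (count₄ kindDegᵃ 1 2 0 (λ _ → refl) (λ _ → refl) (λ _ → refl) (λ _ → refl))) (trans (sym (total-↭ kindDegᵃ e)) degᵃ))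
    (trans (sym (count₄ kindDegᵇ 1 0 2 (λ _ → refl) (λ _ → refl) (λ _ → refl) (λ _ → refl))) (trans (sym (total-↭ kindDegᵇ e)) degᵇ)) e
  where
  const-total : ∀ (f : Kind → ℕ) (g : ℕ → Kind) c → (∀ x → f (g x) ≡ c) → ∀ xs ys → total f (map g xs ++ ys) ≡ length xs ℕ.* c ℕ.+ total f ys
  const-total f g c eq []       ys = refl
  const-total f g c eq (x ∷ xs) ys = trans (cong₂ ℕ._+_ (eq x) (const-total f g c eq xs ys)) (sym (ℕₚ.+-assoc c (length xs ℕ.* c) _))
  count₄ : ∀ (f : Kind → ℕ) c d e → (∀ x → f (chain x) ≡ c) → (∀ x → f (loopᵃ x) ≡ d) → (∀ x → f (loopᵇ x) ≡ e) → (∀ x → f (ring x) ≡ 0) →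
    total f (map chain cs ++ map loopᵃ as ++ map loopᵇ bs ++ map ring rs) ≡ length cs ℕ.* c ℕ.+ (length as ℕ.* d ℕ.+ length bs ℕ.* e)
  count₄ f c d e h₁ h₂ h₃ h₄ = trans (const-total f chain c h₁ cs _) (cong (length cs ℕ.* c ℕ.+_) (trans (const-total f loopᵃ d h₂ as _)
    (cong (length as ℕ.* d ℕ.+_) (trans (const-total f loopᵇ e h₃ bs _) (trans (cong (length bs ℕ.* e ℕ.+_) (rings rs)) (ℕₚ.+-identityʳ _))))))
    where
    rings : ∀ rs → total f (map ring rs) ≡ 0
    rings []       = refl
    rings (r ∷ rs) = cong₂ ℕ._+_ (h₄ r) (rings rs)
  cases : ∀ cs as bs → length cs ℕ.* 1 ℕ.+ (length as ℕ.* 2 ℕ.+ length bs ℕ.* 0) ≡ 3 → length cs ℕ.* 1 ℕ.+ (length as ℕ.* 0 ℕ.+ length bs ℕ.* 2) ≡ 3 →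
    ks ↭ map chain cs ++ map loopᵃ as ++ map loopᵇ bs ++ map ring rs →
    (∃[ p ] ∃[ q ] ∃[ r ] ∃[ rs ] ks ↭ chain p ∷ chain q ∷ chain r ∷ map ring rs) ⊎ (∃[ p ] ∃[ i ] ∃[ j ] ∃[ rs ] ks ↭ chain p ∷ loopᵃ i ∷ loopᵇ j ∷ map ring rs)
  cases cs as bs e₁ e₂ p with trans (sym (simp cs as bs)) e₁ | trans (sym (simp′ cs as bs)) e₂
    where
    simp : ∀ (cs as bs : List ℕ) → length cs ℕ.* 1 ℕ.+ (length as ℕ.* 2 ℕ.+ length bs ℕ.* 0) ≡ length cs ℕ.+ length as ℕ.* 2
    simp cs as bs = cong₂ ℕ._+_ (ℕₚ.*-identityʳ (length cs)) (trans (cong (length as ℕ.* 2 ℕ.+_) (ℕₚ.*-zeroʳ (length bs))) (ℕₚ.+-identityʳ _))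
    simp′ : ∀ (cs as bs : List ℕ) → length cs ℕ.* 1 ℕ.+ (length as ℕ.* 0 ℕ.+ length bs ℕ.* 2) ≡ length cs ℕ.+ length bs ℕ.* 2
    simp′ cs as bs = cong₂ ℕ._+_ (ℕₚ.*-identityʳ (length cs)) (cong (ℕ._+ length bs ℕ.* 2) (ℕₚ.*-zeroʳ (length as)))
  cases []                  []           bs           e₁ e₂ p | () | _
  cases []                  (_ ∷ [])     bs           e₁ e₂ p | () | _
  cases []                  (_ ∷ _ ∷ as) bs           e₁ e₂ p | () | _
  cases (c ∷ [])            []           bs           e₁ e₂ p | () | _
  cases (c ∷ [])            (i ∷ [])     []           e₁ e₂ p | _  | ()
  cases (c ∷ [])            (i ∷ [])     (j ∷ [])     e₁ e₂ p | _  | _  = inj₂ (c , i , j , rs , p)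
  cases (c ∷ [])            (i ∷ [])     (_ ∷ _ ∷ _)  e₁ e₂ p | _  | ()
  cases (c ∷ [])            (_ ∷ _ ∷ as) bs           e₁ e₂ p | () | _
  cases (c ∷ c′ ∷ [])       []           bs           e₁ e₂ p | () | _
  cases (c ∷ c′ ∷ [])       (_ ∷ as)     bs           e₁ e₂ p | () | _
  cases (c ∷ c′ ∷ c″ ∷ [])  []           []           e₁ e₂ p | _  | _  = inj₁ (c , c′ , c″ , rs , p)
  cases (c ∷ c′ ∷ c″ ∷ [])  []           (_ ∷ _)      e₁ e₂ p | _  | ()
  cases (c ∷ c′ ∷ c″ ∷ [])  (_ ∷ _)      bs           e₁ e₂ p | () | _
  cases (c ∷ c′ ∷ c″ ∷ _ ∷ _) as         bs           e₁ e₂ p | () | _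

-- The two forms, over an arbitrary type with addition and multiplication

record Ops (A : Set) : Set where
  field
    _⊕_ _⊙_ : A → A → A
    κ       : ℤ → A
  infixl 6 _⊕_
  infixl 7 _⊙_

record Arm (A : Set) : Set where
  constructor arm
  field f g h c : A

record Loop (A : Set) : Set where
  constructor loop
  field f g : A

module _ {A : Set} (O : Ops A) where

  open Ops O

  -- The last component of the product of three chains with the bare ports, where y is Y - S. In an
  -- arm, f is the minor without ports, g with one port, h from port to port, and c with both ports.
  thetaForm : A → Arm A → Arm A → Arm A → A
  thetaForm y (arm f₁ g₁ h₁ c₁) (arm f₂ g₂ h₂ c₂) (arm f₃ g₃ h₃ c₃) =
    y ⊙ y ⊙ (f₁ ⊙ f₂ ⊙ f₃) ⊕ κ (+ 2) ⊙ y ⊙ (g₁ ⊙ f₂ ⊙ f₃ ⊕ f₁ ⊙ g₂ ⊙ f₃ ⊕ f₁ ⊙ f₂ ⊙ g₃)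
    ⊕ κ (+ 2) ⊙ (g₁ ⊙ g₂ ⊙ f₃ ⊕ g₁ ⊙ f₂ ⊙ g₃ ⊕ f₁ ⊙ g₂ ⊙ g₃)
    ⊕ (c₁ ⊙ f₂ ⊙ f₃ ⊕ f₁ ⊙ c₂ ⊙ f₃ ⊕ f₁ ⊙ f₂ ⊙ c₃)
    ⊕ κ (+ 2) ⊙ (h₁ ⊙ h₂ ⊙ f₃ ⊕ h₁ ⊙ f₂ ⊙ h₃ ⊕ f₁ ⊙ h₂ ⊙ h₃)

  dumbbellForm : A → Arm A → Loop A → Loop A → A
  dumbbellForm y (arm f g h c) (loop f₁ g₁) (loop f₂ g₂) =
    f ⊙ ((y ⊙ f₁ ⊕ g₁) ⊙ (y ⊙ f₂ ⊕ g₂)) ⊕ c ⊙ (f₁ ⊙ f₂) ⊕ g ⊙ ((y ⊙ f₁ ⊕ g₁) ⊙ f₂ ⊕ f₁ ⊙ (y ⊙ f₂ ⊕ g₂))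

-- A relation compatible with the operations passes through both forms. Proved once, this serves for
-- congruences, polynomial functions, sign conditions and natural numbers.
record Respects {A B : Set} (OA : Ops A) (OB : Ops B) (R : A → B → Set) : Set where
  private
    module A = Ops OA
    module B = Ops OB
  field
    _r+_ : ∀ {x x′ y y′} → R x x′ → R y y′ → R (x A.⊕ y) (x′ B.⊕ y′)
    _r*_ : ∀ {x x′ y y′} → R x x′ → R y y′ → R (x A.⊙ y) (x′ B.⊙ y′)
    rκ   : ∀ n → R (A.κ (+ n)) (B.κ (+ n))
  infixl 6 _r+_
  infixl 7 _r*_

  ArmRel : Arm A → Arm B → Set
  ArmRel (arm f g h c) (arm f′ g′ h′ c′) = R f f′ × R g g′ × R h h′ × R c c′

  LoopRel : Loop A → Loop B → Set
  LoopRel (loop f g) (loop f′ g′) = R f f′ × R g g′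

  thetaForm-rel : ∀ {y y′ a₁ a₁′ a₂ a₂′ a₃ a₃′} → R y y′ → ArmRel a₁ a₁′ → ArmRel a₂ a₂′ → ArmRel a₃ a₃′ →
    R (thetaForm OA y a₁ a₂ a₃) (thetaForm OB y′ a₁′ a₂′ a₃′)
  thetaForm-rel y (f₁ , g₁ , h₁ , c₁) (f₂ , g₂ , h₂ , c₂) (f₃ , g₃ , h₃ , c₃) =
    y r* y r* (f₁ r* f₂ r* f₃) r+ rκ 2 r* y r* (g₁ r* f₂ r* f₃ r+ f₁ r* g₂ r* f₃ r+ f₁ r* f₂ r* g₃)
    r+ rκ 2 r* (g₁ r* g₂ r* f₃ r+ g₁ r* f₂ r* g₃ r+ f₁ r* g₂ r* g₃)
    r+ (c₁ r* f₂ r* f₃ r+ f₁ r* c₂ r* f₃ r+ f₁ r* f₂ r* c₃)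
    r+ rκ 2 r* (h₁ r* h₂ r* f₃ r+ h₁ r* f₂ r* h₃ r+ f₁ r* h₂ r* h₃)

  dumbbellForm-rel : ∀ {y y′ a a′ l₁ l₁′ l₂ l₂′} → R y y′ → ArmRel a a′ → LoopRel l₁ l₁′ → LoopRel l₂ l₂′ →
    R (dumbbellForm OA y a l₁ l₂) (dumbbellForm OB y′ a′ l₁′ l₂′)
  dumbbellForm-rel y (f , g , h , c) (f₁ , g₁) (f₂ , g₂) =
    f r* ((y r* f₁ r+ g₁) r* (y r* f₂ r+ g₂)) r+ c r* (f₁ r* f₂) r+ g r* ((y r* f₁ r+ g₁) r* f₂ r+ f₁ r* (y r* f₂ r+ g₂))

integerOps : Ops ℤ
integerOps = record { _⊕_ = _+_ ; _⊙_ = _*_ ; κ = id }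

syntaxOps : ∀ {n} → Ops (Polynomial n)
syntaxOps = record { _⊕_ = _:+_ ; _⊙_ = _:*_ ; κ = con }

chainArm : ℤ → ℤ → ℕ → Arm ℤ
chainArm Y S p = arm (𝐆 Y S (suc p)) (S * S * 𝐆 Y S p) (S ℤ.^ suc p) (S * S * (𝐆 Y S (suc p) - Y * 𝐆 Y S p))

cycleLoop : ℤ → ℤ → ℕ → Loop ℤ
cycleLoop Y S m = loop (𝐆 Y S (3 ℕ.+ m)) (+ 2 * (S * S * 𝐆 Y S (2 ℕ.+ m)) + + 2 * S ℤ.^ (3 ℕ.+ m))

ringValue : ℤ → ℤ → ℕ → ℤ
ringValue Y S m = Y * 𝐆 Y S (3 ℕ.+ m) + + 2 * (S * S * 𝐆 Y S (2 ℕ.+ m)) + + 2 * S ℤ.^ (3 ℕ.+ m)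

ringsValue : ℤ → ℤ → List ℕ → ℤ
ringsValue Y S []       = 1ℤ
ringsValue Y S (m ∷ ms) = ringValue Y S m * ringsValue Y S ms

thetaValue : ℤ → ℤ → ℕ → ℕ → ℕ → ℤ
thetaValue Y S p q r = thetaForm integerOps (Y - S) (chainArm Y S p) (chainArm Y S q) (chainArm Y S r)

dumbbellValue : ℤ → ℤ → ℕ → ℕ → ℕ → ℤ
dumbbellValue Y S p i j = dumbbellForm integerOps (Y - S) (chainArm Y S p) (cycleLoop Y S i) (cycleLoop Y S j)

module _ (Y S : ℤ) where

  scalar : ℤ → Ports
  scalar w = ports w 0ℤ 0ℤ 0ℤ 0ℤ 0ℤ

  blockProduct-rings : ∀ rs → blockProduct Y S (map ring rs) ≡ scalar (ringsValue Y S rs)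
  blockProduct-rings []       = refl
  blockProduct-rings (m ∷ rs) = trans (cong (kindPorts Y S (ring m) ⊗_) (blockProduct-rings rs))
    (ports-cong refl (lin x w) (lin x w) (lin x w) (lin x w) (top x w))
    where
    x w : ℤ
    x = ringValue Y S m
    w = ringsValue Y S rs
    lin : ∀ x w → x * 0ℤ + 0ℤ * w ≡ 0ℤ
    lin = solve 2 (λ x w → x :* con 0ℤ :+ con 0ℤ :* w := con 0ℤ) refl
    top : ∀ x w → x * 0ℤ + 0ℤ * w + (0ℤ * 0ℤ + 0ℤ * 0ℤ) + (0ℤ * 0ℤ + 0ℤ * 0ℤ) ≡ 0ℤ
    top = solve 2 (λ x w → x :* con 0ℤ :+ con 0ℤ :* w :+ (con 0ℤ :* con 0ℤ :+ con 0ℤ :* con 0ℤ) :+ (con 0ℤ :* con 0ℤ :+ con 0ℤ :* con 0ℤ) := con 0ℤ) refl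

  shapeValue-↭ : ∀ {ks ks′} → ks ↭ ks′ → shapeValue Y S ks ≡ shapeValue Y S ks′
  shapeValue-↭ p = cong (λ P → cw (P ⊗ basePorts Y S false)) (blockProduct-↭ Y S p)

  shapeValue-theta : ∀ p q r rs → shapeValue Y S (chain p ∷ chain q ∷ chain r ∷ map ring rs) ≡ thetaValue Y S p q r * ringsValue Y S rs
  shapeValue-theta p q r rs = trans (cong (λ P → cw ((kindPorts Y S (chain p) ⊗ (kindPorts Y S (chain q) ⊗ (kindPorts Y S (chain r) ⊗ P))) ⊗ basePorts Y S false)) (blockProduct-rings rs))
    (expand (Y - S) (Arm.f P) (Arm.g P) (Arm.h P) (Arm.c P) (Arm.f Q) (Arm.g Q) (Arm.h Q) (Arm.c Q) (Arm.f R) (Arm.g R) (Arm.h R) (Arm.c R) (ringsValue Y S rs))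
    where
    P Q R : Arm ℤ
    P = chainArm Y S p
    Q = chainArm Y S q
    R = chainArm Y S r
    expand : ∀ y f₁ g₁ h₁ c₁ f₂ g₂ h₂ c₂ f₃ g₃ h₃ c₃ w →
      cw ((ports f₁ g₁ g₁ h₁ h₁ c₁ ⊗ (ports f₂ g₂ g₂ h₂ h₂ c₂ ⊗ (ports f₃ g₃ g₃ h₃ h₃ c₃ ⊗ scalar w))) ⊗ ports 1ℤ y y 0ℤ 0ℤ (y * y + 0ℤ * 0ℤ))
      ≡ thetaForm integerOps y (arm f₁ g₁ h₁ c₁) (arm f₂ g₂ h₂ c₂) (arm f₃ g₃ h₃ c₃) * w
    expand = solve 14 (λ y f₁ g₁ h₁ c₁ f₂ g₂ h₂ c₂ f₃ g₃ h₃ c₃ w →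
      let o = con 0ℤ
          F₃ = f₃ :* w ; G₃ = f₃ :* o :+ g₃ :* w ; H₃ = f₃ :* o :+ h₃ :* w ; C₃ = f₃ :* o :+ c₃ :* w :+ (g₃ :* o :+ g₃ :* o) :+ (h₃ :* o :+ h₃ :* o)
          F₂ = f₂ :* F₃ ; G₂ = f₂ :* G₃ :+ g₂ :* F₃ ; H₂ = f₂ :* H₃ :+ h₂ :* F₃ ; C₂ = f₂ :* C₃ :+ c₂ :* F₃ :+ (g₂ :* G₃ :+ g₂ :* G₃) :+ (h₂ :* H₃ :+ h₂ :* H₃)
          F₁ = f₁ :* F₂ ; G₁ = f₁ :* G₂ :+ g₁ :* F₂ ; H₁ = f₁ :* H₂ :+ h₁ :* F₂ ; C₁ = f₁ :* C₂ :+ c₁ :* F₂ :+ (g₁ :* G₂ :+ g₁ :* G₂) :+ (h₁ :* H₂ :+ h₁ :* H₂)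
      in F₁ :* (y :* y :+ o :* o) :+ C₁ :* con 1ℤ :+ (G₁ :* y :+ G₁ :* y) :+ (H₁ :* o :+ H₁ :* o)
      := thetaForm syntaxOps y (arm f₁ g₁ h₁ c₁) (arm f₂ g₂ h₂ c₂) (arm f₃ g₃ h₃ c₃) :* w) refl

  shapeValue-dumbbell : ∀ p i j rs → shapeValue Y S (chain p ∷ loopᵃ i ∷ loopᵇ j ∷ map ring rs) ≡ dumbbellValue Y S p i j * ringsValue Y S rs
  shapeValue-dumbbell p i j rs = trans (cong (λ P → cw ((kindPorts Y S (chain p) ⊗ (kindPorts Y S (loopᵃ i) ⊗ (kindPorts Y S (loopᵇ j) ⊗ P))) ⊗ basePorts Y S false)) (blockProduct-rings rs))
    (expand (Y - S) (Arm.f P) (Arm.g P) (Arm.h P) (Arm.c P) (Loop.f I) (Loop.g I) (Loop.f J) (Loop.g J) (ringsValue Y S rs))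
    where
    P : Arm ℤ
    P = chainArm Y S p
    I J : Loop ℤ
    I = cycleLoop Y S i
    J = cycleLoop Y S j
    expand : ∀ y f g h c f₁ g₁ f₂ g₂ w →
      cw ((ports f g g h h c ⊗ (ports f₁ g₁ 0ℤ 0ℤ 0ℤ 0ℤ ⊗ (ports f₂ 0ℤ g₂ 0ℤ 0ℤ 0ℤ ⊗ scalar w))) ⊗ ports 1ℤ y y 0ℤ 0ℤ (y * y + 0ℤ * 0ℤ))
      ≡ dumbbellForm integerOps y (arm f g h c) (loop f₁ g₁) (loop f₂ g₂) * w
    expand = solve 10 (λ y f g h c f₁ g₁ f₂ g₂ w →
      let o = con 0ℤ
          F₂ = f₂ :* w ; A₂ = f₂ :* o :+ o :* w ; B₂ = f₂ :* o :+ g₂ :* w ; H₂ = f₂ :* o :+ o :* w ; C₂ = f₂ :* o :+ o :* w :+ (o :* o :+ g₂ :* o) :+ (o :* o :+ o :* o)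
          F₁ = f₁ :* F₂ ; A₁ = f₁ :* A₂ :+ g₁ :* F₂ ; B₁ = f₁ :* B₂ :+ o :* F₂ ; H₁ = f₁ :* H₂ :+ o :* F₂ ; C₁ = f₁ :* C₂ :+ o :* F₂ :+ (g₁ :* B₂ :+ o :* A₂) :+ (o :* H₂ :+ o :* H₂)
          F = f :* F₁ ; A = f :* A₁ :+ g :* F₁ ; B = f :* B₁ :+ g :* F₁ ; H = f :* H₁ :+ h :* F₁ ; C = f :* C₁ :+ c :* F₁ :+ (g :* B₁ :+ g :* A₁) :+ (h :* H₁ :+ h :* H₁)
      in F :* (y :* y :+ o :* o) :+ C :* con 1ℤ :+ (A :* y :+ B :* y) :+ (H :* o :+ H :* o)
      := dumbbellForm syntaxOps y (arm f g h c) (loop f₁ g₁) (loop f₂ g₂) :* w) refl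

-- First-order expansions at Y = 0, S = 1

double : ℕ → ℕ
double zero    = zero
double (suc j) = suc (suc (double j))

parity : ∀ k → ∃[ j ] (k ≡ double j ⊎ k ≡ suc (double j))
parity zero = 0 , inj₁ refl
parity (suc k) with parity k
... | j , inj₁ e = j , inj₂ (cong suc e)
... | j , inj₂ e = suc j , inj₁ (cong suc e)

-- Dual numbers: the pair (a , b) stands for a + b y with y² = 0.
dualOps : ∀ {A : Set} → Ops A → Ops (A × A)
dualOps O = record
  { _⊕_ = λ s t → proj₁ s ⊕ proj₁ t , proj₂ s ⊕ proj₂ t ; _⊙_ = λ s t → proj₁ s ⊙ proj₁ t , proj₁ s ⊙ proj₂ t ⊕ proj₂ s ⊙ proj₁ t ; κ = λ z → κ z , κ 0ℤ }
  where open Ops O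

record Jet (y x : ℤ) (j : ℤ × ℤ) : Set where
  constructor jet
  field congruence : x ≡ proj₁ j + y * proj₂ j [mod y * y ]

jet-con : ∀ y z → Jet y z (z , 0ℤ)
jet-con y z = jet (quot 0ℤ (solve 2 (λ y z → z := z :+ y :* con 0ℤ :+ y :* y :* con 0ℤ) refl y z))

jet-respects : ∀ y → Respects integerOps (dualOps integerOps) (Jet y)
jet-respects y = record
  { _r+_ = λ { {x′ = a , b} {y′ = c , d} (jet (quot k refl)) (jet (quot l refl)) → jet (quot (k + l)
      (solve 7 (λ y a b c d k l → (a :+ y :* b :+ y :* y :* k) :+ (c :+ y :* d :+ y :* y :* l) := a :+ c :+ y :* (b :+ d) :+ y :* y :* (k :+ l)) refl y a b c d k l)) }
  ; _r*_ = λ { {x′ = a , b} {y′ = c , d} (jet (quot k refl)) (jet (quot l refl)) → jet (quot (a * l + b * d + k * c + y * (b * l + k * d) + y * y * k * l)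
      (solve 7 (λ y a b c d k l → (a :+ y :* b :+ y :* y :* k) :* (c :+ y :* d :+ y :* y :* l)
        := a :* c :+ y :* (a :* d :+ b :* c) :+ y :* y :* (a :* l :+ b :* d :+ k :* c :+ y :* (b :* l :+ k :* d) :+ y :* y :* k :* l)) refl y a b c d k l)) }
  ; rκ = λ n → jet-con y (+ n) }

JetOf : (ℤ → ℤ) → ℤ × ℤ → Set
JetOf φ j = ∀ y → Jet y (φ y) j

jet-congruence : ∀ {y x a b} → Jet y x (a , b) → x ≡ a + y * b [mod y * y ]
jet-congruence (jet c) = c

jet-difference : ∀ x a b c d y → x ≡ a + y * b [mod y * y ] → x ≡ c + y * d [mod y * y ] → ∃[ k ] a - c + y * (b - d) + y * y * k ≡ 0ℤ
jet-difference x a b c d y (quot k e) (quot l f) = k - l ,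
  trans (rearrange y a b c d k l) (trans (cong₂ _-_ (sym e) (sym f)) (ℤₚ.+-inverseʳ x))
  where
  rearrange : ∀ y a b c d k l → a - c + y * (b - d) + y * y * (k - l) ≡ (a + y * b + y * y * k) - (c + y * d + y * y * l)
  rearrange = solve 7 (λ y a b c d k l → a :- c :+ y :* (b :- d) :+ y :* y :* (k :- l) := (a :+ y :* b :+ y :* y :* k) :- (c :+ y :* d :+ y :* y :* l)) refl

jet-unique : ∀ {φ ψ a b c d} → (∀ y → φ y ≡ ψ y) → JetOf φ (a , b) → JetOf ψ (c , d) → a ≡ c × b ≡ d
jet-unique {φ} {ψ} {a} {b} {c} {d} eq J K = ℤₚ.i-j≡0⇒i≡j a c (proj₁ zeros) , ℤₚ.i-j≡0⇒i≡j b d (proj₂ zeros)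
  where
  difference : ∀ y → ∃[ k ] a - c + y * (b - d) + y * y * k ≡ 0ℤ
  difference y = jet-difference (φ y) a b c d y (jet-congruence (J y)) (subst (λ x → x ≡ c + y * d [mod y * y ]) (sym (eq y)) (jet-congruence (K y)))
  zeros : a - c ≡ 0ℤ × b - d ≡ 0ℤ
  zeros = second-order-zero (a - c) (b - d) (λ n → difference (+ suc n))

module _ (y : ℤ) where

  open Respects (jet-respects y)

  jet-cong : ∀ {x x′ j} → x ≡ x′ → Jet y x j → Jet y x′ j
  jet-cong refl J = J

  jet-to : ∀ {x j j′} → j ≡ j′ → Jet y x j → Jet y x j′
  jet-to refl J = J

  jet-y : Jet y y (0ℤ , 1ℤ)
  jet-y = jet (quot 0ℤ (solve 1 (λ y → y := con 0ℤ :+ y :* con 1ℤ :+ y :* y :* con 0ℤ) refl y))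

  private
    G : ℕ → ℤ
    G = 𝐆 y 1ℤ

  -- The recurrence is y times the last term plus the one before. Modulo y² the terms of odd index
  -- stay 1, and each next term of even index gains one y.
  jet-G : ∀ j → Jet y (G (double j)) (0ℤ , + j) × Jet y (G (suc (double j))) (1ℤ , 0ℤ)
  jet-G zero    = jet-con y 0ℤ , jet-con y 1ℤ
  jet-G (suc j) with jet-G j
  ... | even , odd = even′ , jet-to (cong₂ _,_ (solve 1 (λ j → con 0ℤ :* con 0ℤ :+ con 1ℤ :* con 1ℤ := con 1ℤ) refl (+ j)) (solve 1 (λ j →
    (con 0ℤ :* (con 1ℤ :+ j) :+ con 1ℤ :* con 0ℤ) :+ (con 1ℤ :* con 0ℤ :+ con 0ℤ :* con 1ℤ) := con 0ℤ) refl (+ j))) (jet-y r* even′ r+ jet-con y 1ℤ r* odd)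
    where
    even′ : Jet y (G (double (suc j))) (0ℤ , + suc j)
    even′ = jet-to (cong₂ _,_ refl (solve 1 (λ j → (con 0ℤ :* con 0ℤ :+ con 1ℤ :* con 1ℤ) :+ (con 1ℤ :* j :+ con 0ℤ :* con 0ℤ) := con 1ℤ :+ j) refl (+ j)))
      (jet-y r* odd r+ jet-con y 1ℤ r* even)

  jet-power : ∀ k → Jet y (1ℤ ℤ.^ k) (1ℤ , 0ℤ)
  jet-power k = jet-cong (sym (ℤₚ.^-zeroˡ k)) (jet-con y 1ℤ)

module Arms {A : Set} (O : Ops A) where

  open Ops O

  -- chains with 2 j + 1 and with 2 j vertices
  evenArm oddArm : A → Arm (A × A)
  evenArm j = arm (κ 0ℤ , κ 1ℤ ⊕ j) (κ 1ℤ , κ 0ℤ) (κ 1ℤ , κ 0ℤ) (κ 0ℤ , j)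
  oddArm j  = arm (κ 1ℤ , κ 0ℤ) (κ 0ℤ , j) (κ 1ℤ , κ 0ℤ) (κ 1ℤ , κ 0ℤ)

  -- cycles of lengths 2 j + 4 and 2 j + 3
  evenLoop oddLoop : A → Loop (A × A)
  evenLoop j = loop (κ 0ℤ , κ (+ 2) ⊕ j) (κ (+ 4) , κ 0ℤ)
  oddLoop j  = loop (κ 1ℤ , κ 0ℤ) (κ (+ 2) , κ (+ 2) ⊙ (κ 1ℤ ⊕ j))

  yJet : A × A
  yJet = κ -1ℤ , κ 1ℤ

open Arms integerOps using (evenArm; oddArm; evenLoop; oddLoop; yJet)

module _ (y : ℤ) where

  open Respects (jet-respects y)

  private
    J : ℤ → ℤ × ℤ → Set
    J = Jet y

  jet-evenArm : ∀ j → ArmRel (chainArm y 1ℤ (suc (double j))) (evenArm (+ j))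
  jet-evenArm j with jet-G y (suc j) | jet-G y j
  ... | f , _ | f₀ , g = f , jet-cong y (sym (ℤₚ.*-identityˡ _)) g , jet-power y (suc (suc (double j))) ,
    jet-cong y (solve 3 (λ y a b → y :* a :+ con 1ℤ :* con 1ℤ :* b :+ con -1ℤ :* (y :* a) := con 1ℤ :* con 1ℤ :* ((y :* a :+ con 1ℤ :* con 1ℤ :* b) :- y :* a)) refl
      y (𝐆 y 1ℤ (suc (double j))) (𝐆 y 1ℤ (double j)))
      (jet-to y (cong₂ _,_ refl (solve 1 (λ j → (con 1ℤ :+ j) :+ (con -1ℤ :* (con 0ℤ :* con 0ℤ :+ con 1ℤ :* con 1ℤ) :+ con 0ℤ :* (con 0ℤ :* con 1ℤ)) := j) refl (+ j)))
        (f r+ jet-con y -1ℤ r* (jet-y y r* g)))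

  jet-oddArm : ∀ j → ArmRel (chainArm y 1ℤ (double j)) (oddArm (+ j))
  jet-oddArm j with jet-G y j
  ... | g , f = f , jet-cong y (sym (ℤₚ.*-identityˡ _)) g , jet-power y (suc (double j)) ,
    jet-cong y (solve 3 (λ y a b → a :+ con -1ℤ :* (y :* b) := con 1ℤ :* con 1ℤ :* (a :- y :* b)) refl y (𝐆 y 1ℤ (suc (double j))) (𝐆 y 1ℤ (double j)))
      (jet-to y (cong₂ _,_ refl (solve 1 (λ j → con 0ℤ :+ (con -1ℤ :* (con 0ℤ :* j :+ con 1ℤ :* con 0ℤ) :+ con 0ℤ :* (con 0ℤ :* con 0ℤ)) := con 0ℤ) refl (+ j)))
        (f r+ jet-con y -1ℤ r* (jet-y y r* g)))

  private
    two-jet : ∀ {x a b} k → J x (a , b) → J (+ 2 * (1ℤ * 1ℤ * x) + + 2 * 1ℤ ℤ.^ k) (+ 2 * a + + 2 , + 2 * b)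
    two-jet {x} {a} {b} k X = jet-to y (cong₂ _,_ refl (solve 2 (λ a b → (con (+ 2) :* b :+ con 0ℤ :* a) :+ (con (+ 2) :* con 0ℤ :+ con 0ℤ :* con 1ℤ) := con (+ 2) :* b) refl a b))
      (jet-con y (+ 2) r* jet-cong y (sym (ℤₚ.*-identityˡ x)) X r+ jet-con y (+ 2) r* jet-power y k)

  jet-evenLoop : ∀ j → LoopRel (cycleLoop y 1ℤ (suc (double j))) (evenLoop (+ j))
  jet-evenLoop j = proj₁ (jet-G y (suc (suc j))) , two-jet (4 ℕ.+ double j) (proj₂ (jet-G y (suc j)))

  jet-oddLoop : ∀ j → LoopRel (cycleLoop y 1ℤ (double j)) (oddLoop (+ j))
  jet-oddLoop j = proj₂ (jet-G y (suc j)) , two-jet (3 ℕ.+ double j) (proj₁ (jet-G y (suc j)))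

  jet-evenRing : ∀ j → J (ringValue y 1ℤ (suc (double j))) (+ 4 , 0ℤ)
  jet-evenRing j = jet-cong y (sym (ℤₚ.+-assoc (y * 𝐆 y 1ℤ (4 ℕ.+ double j)) _ _))
    (jet-to y (cong₂ _,_ refl (solve 1 (λ j → (con 0ℤ :* (con (+ 2) :+ j) :+ con 1ℤ :* con 0ℤ) :+ con 0ℤ := con 0ℤ) refl (+ j))) (jet-y y r* proj₁ (jet-evenLoop j) r+ proj₂ (jet-evenLoop j)))

  jet-oddRing : ∀ j → J (ringValue y 1ℤ (double j)) (+ 2 , + (3 ℕ.+ double j))
  jet-oddRing j = jet-cong y (sym (ℤₚ.+-assoc (y * 𝐆 y 1ℤ (3 ℕ.+ double j)) _ _))
    (jet-to y (cong₂ _,_ refl (trans (solve 1 (λ j → (con 0ℤ :* con 0ℤ :+ con 1ℤ :* con 1ℤ) :+ con (+ 2) :* (con 1ℤ :+ j) := con (+ 3) :+ (j :+ j)) refl (+ j)) (cong (λ k → + 3 + k) (double-+ j))))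
      (jet-y y r* proj₁ (jet-oddLoop j) r+ proj₂ (jet-oddLoop j)))
    where
    double-+ : ∀ j → + j + + j ≡ + double j
    double-+ j = cong +_ (go j)
      where
      go : ∀ j → j ℕ.+ j ≡ double j
      go zero    = refl
      go (suc j) = cong suc (trans (ℕₚ.+-suc j j) (cong suc (go j)))

  jet-yS : J (y - 1ℤ) yJet
  jet-yS = jet-cong y (ℤₚ.+-comm -1ℤ y) (jet-to y refl (jet-con y -1ℤ r+ jet-y y))

-- An even cycle expands as 4 and an odd cycle of length l as 2 + l y. A nonempty product thus has
-- an even positive constant term, and this term is 2 only for a single odd cycle, whose slope is
-- positive.
rings-jet : ∀ rs → ∃[ w ] ∃[ x ] JetOf (λ y → ringsValue y 1ℤ rs) (+ suc w , + x) × (rs ≡ [] × w ≡ 0 × x ≡ 0 ⊎ ∃[ t ] suc w ≡ 2 ℕ.* suc t × (t ≡ 0 → ∃[ x′ ] x ≡ suc x′))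
rings-jet [] = 0 , 0 , (λ y → jet-con y 1ℤ) , inj₁ (refl , refl , refl)
rings-jet (m ∷ rs) with parity m | rings-jet rs
... | j , inj₁ refl | w , x , J , _ = w ℕ.+ suc (w ℕ.+ 0) , 2 ℕ.* x ℕ.+ (3 ℕ.+ double j) ℕ.* suc w ,
  (λ y → jet-to y (cong₂ _,_ (sym (ℤₚ.pos-* 2 (suc w))) (trans (cong₂ _+_ (sym (ℤₚ.pos-* 2 x)) (sym (ℤₚ.pos-* (3 ℕ.+ double j) (suc w)))) refl))
    (Respects._r*_ (jet-respects y) (jet-oddRing y j) (J y))) ,
  inj₂ (w , refl , λ _ → _ , ℕₚ.+-suc (2 ℕ.* x) _)
... | j , inj₂ refl | w , x , J , _ = w ℕ.+ (suc w ℕ.+ (suc w ℕ.+ (suc w ℕ.+ 0))) , 4 ℕ.* x ℕ.+ 0 ,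
  (λ y → jet-to y (cong₂ _,_ (sym (ℤₚ.pos-* 4 (suc w))) (cong₂ _+_ (sym (ℤₚ.pos-* 4 x)) refl)) (Respects._r*_ (jet-respects y) (jet-evenRing y j) (J y))) ,
  inj₂ (w ℕ.+ suc w , quadruple w , λ e → contradiction (trans (sym (ℕₚ.+-suc w w)) e) λ ())
  where
  quadruple : ∀ w → 4 ℕ.* suc w ≡ 2 ℕ.* suc (w ℕ.+ suc w)
  quadruple w = trans (ℕₚ.*-assoc 2 2 (suc w)) (cong (2 ℕ.*_) (cong suc (cong (w ℕ.+_) (ℕₚ.+-identityʳ (suc w)))))

Odd : ℕ → Set
Odd k = ∃[ j ] k ≡ suc (double j)

-- Jets whose two coefficients are given as polynomial expressions in parameters ρ
module _ {n : ℕ} (ρ : Vec ℤ n) where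

  SyntaxJet : ℤ → ℤ → Polynomial n × Polynomial n → Set
  SyntaxJet y x e = Jet y x (⟦ proj₁ e ⟧ ρ , ⟦ proj₂ e ⟧ ρ)

  syntax-respects : ∀ y → Respects integerOps (dualOps syntaxOps) (SyntaxJet y)
  syntax-respects y = record { _r+_ = Respects._r+_ (jet-respects y) ; _r*_ = Respects._r*_ (jet-respects y) ; rκ = λ n → jet-con y (+ n) }

  module S = Arms (syntaxOps {n})

  θ̄ : (a b c : Arm (Polynomial n × Polynomial n)) → Polynomial n × Polynomial n
  θ̄ = thetaForm (dualOps syntaxOps) S.yJet

  δ̄ : Arm (Polynomial n × Polynomial n) → (a b : Loop (Polynomial n × Polynomial n)) → Polynomial n × Polynomial n
  δ̄ = dumbbellForm (dualOps syntaxOps) S.yJet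

  data ArmCode : ℕ → Arm (Polynomial n × Polynomial n) → Set where
    even : ∀ {j} e → ⟦ e ⟧ ρ ≡ + j → ArmCode (suc (double j)) (S.evenArm e)
    odd  : ∀ {j} e → ⟦ e ⟧ ρ ≡ + j → ArmCode (double j) (S.oddArm e)

  data LoopCode : ℕ → Loop (Polynomial n × Polynomial n) → Set where
    even : ∀ {j} e → ⟦ e ⟧ ρ ≡ + j → LoopCode (suc (double j)) (S.evenLoop e)
    odd  : ∀ {j} e → ⟦ e ⟧ ρ ≡ + j → LoopCode (double j) (S.oddLoop e)

  module _ (y : ℤ) where

    private
      J : ℤ → ℤ × ℤ → Set
      J = Jet y

    armCode : ∀ {p a} → ArmCode p a → Respects.ArmRel (syntax-respects y) (chainArm y 1ℤ p) a
    armCode (even {j} e eq) with jet-evenArm y j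
    ... | f , g , h , c = subst (λ k → J _ (0ℤ , 1ℤ + k)) (sym eq) f , g , h , subst (λ k → J _ (0ℤ , k)) (sym eq) c
    armCode (odd {j} e eq) with jet-oddArm y j
    ... | f , g , h , c = f , subst (λ k → J _ (0ℤ , k)) (sym eq) g , h , c

    loopCode : ∀ {m l} → LoopCode m l → Respects.LoopRel (syntax-respects y) (cycleLoop y 1ℤ m) l
    loopCode (even {j} e eq) with jet-evenLoop y j
    ... | f , g = subst (λ k → J _ (0ℤ , + 2 + k)) (sym eq) f , g
    loopCode (odd {j} e eq) with jet-oddLoop y j
    ... | f , g = f , subst (λ k → J _ (+ 2 , + 2 * (1ℤ + k))) (sym eq) g

  -- The form is evaluated over dual numbers whose entries are solver expressions; normalisation
  -- then compares the two components with the short expressions s and t.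
  theta-jet : ∀ {p q r a b c} → ArmCode p a → ArmCode q b → ArmCode r c →
    ∀ s t → ⟦ proj₁ (θ̄ a b c) ⟧↓ ρ ≡ ⟦ s ⟧↓ ρ → ⟦ proj₂ (θ̄ a b c) ⟧↓ ρ ≡ ⟦ t ⟧↓ ρ → JetOf (λ y → thetaValue y 1ℤ p q r) (⟦ s ⟧ ρ , ⟦ t ⟧ ρ)
  theta-jet {a = a} {b} {c} A B C s t es et y = jet-to y (cong₂ _,_ (prove ρ (proj₁ (θ̄ a b c)) s es) (prove ρ (proj₂ (θ̄ a b c)) t et)) (Respects.thetaForm-rel (syntax-respects y) {y′ = S.yJet} {a₁′ = a} {a₂′ = b} {a₃′ = c} (jet-yS y) (armCode y A) (armCode y B) (armCode y C))

  dumbbell-jet : ∀ {p i j a b c} → ArmCode p a → LoopCode i b → LoopCode j c →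
    ∀ s t → ⟦ proj₁ (δ̄ a b c) ⟧↓ ρ ≡ ⟦ s ⟧↓ ρ → ⟦ proj₂ (δ̄ a b c) ⟧↓ ρ ≡ ⟦ t ⟧↓ ρ → JetOf (λ y → dumbbellValue y 1ℤ p i j) (⟦ s ⟧ ρ , ⟦ t ⟧ ρ)
  dumbbell-jet {a = a} {b} {c} A B C s t es et y = jet-to y (cong₂ _,_ (prove ρ (proj₁ (δ̄ a b c)) s es) (prove ρ (proj₂ (δ̄ a b c)) t et)) (Respects.dumbbellForm-rel (syntax-respects y) {y′ = S.yJet} {a′ = a} {l₁′ = b} {l₂′ = c} (jet-yS y) (armCode y A) (loopCode y B) (loopCode y C))

-- First-order data of theta graphs and dumbbells by parity

pos-double : ∀ j → + double j ≡ + 2 * + j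
pos-double zero    = refl
pos-double (suc j) = trans (cong (λ t → + 2 + t) (pos-double j)) (solve 1 (λ j → con (+ 2) :+ con (+ 2) :* j := con (+ 2) :* (con 1ℤ :+ j)) refl (+ j))

-- The constant term is even; its half is 5, 1, 2 or 0 if 0, 1, 2 or 3 of the paths have even
-- length. If it is 1, the slope exceeds the number of vertices p + q + r + 2.
record ThetaJet (p q r : ℕ) : Set where
  field
    half   : ℕ
    slope  : ℤ
    jets   : JetOf (λ y → thetaValue y 1ℤ p q r) (+ 2 * + half , slope)
    range  : half ≡ 0 ⊎ half ≡ 1 ⊎ half ≡ 2 ⊎ half ≡ 5
    half≡0 : half ≡ 0 → Odd p × Odd q × Odd r
    half≡1 : half ≡ 1 → ∃[ x ] slope ≡ + (2 ℕ.+ (p ℕ.+ q ℕ.+ r) ℕ.+ suc x)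
    half≡2 : half ≡ 2 → slope ≡ 0ℤ

-- The contrast with `ThetaJet` for equal halves: at 1 the slope is exactly the number of vertices 6
-- + p + i + j, at 2 it is positive instead of 0, and 5 does not occur.
record DumbbellJet (p i j : ℕ) : Set where
  field
    half   : ℕ
    slope  : ℤ
    jets   : JetOf (λ y → dumbbellValue y 1ℤ p i j) (+ 2 * + half , slope)
    half≡0 : half ≡ 0 → Odd p × Odd i × Odd j
    half≡1 : half ≡ 1 → slope ≡ + (6 ℕ.+ (p ℕ.+ i ℕ.+ j))
    half≡2 : half ≡ 2 → ∃[ x ] slope ≡ + suc x
    half≢5 : half ≢ 5

private
  x₀ x₁ x₂ : Polynomial 3
  x₀ = var zero
  x₁ = var (suc zero)
  x₂ = var (suc (suc zero))

  ρ³ : ℕ → ℕ → ℕ → Vec ℤ 3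
  ρ³ i j k = + i ∷ + j ∷ + k ∷ []

  slope₁ : ∀ i j k → + 7 + + 2 * + i + + 2 * + j + + 6 * + k ≡ + (2 ℕ.+ (double i ℕ.+ double j ℕ.+ suc (double k)) ℕ.+ suc (3 ℕ.+ (double k ℕ.+ double k)))
  slope₁ i j k = sym (trans (cong₂ (λ s t → + 2 + (s + (1ℤ + t)) + (+ 4 + (t + t))) (cong₂ _+_ (pos-double i) (pos-double j)) (pos-double k))
    (solve 3 (λ i j k → con (+ 2) :+ ((con (+ 2) :* i :+ con (+ 2) :* j) :+ (con 1ℤ :+ con (+ 2) :* k)) :+ (con (+ 4) :+ (con (+ 2) :* k :+ con (+ 2) :* k))
      := con (+ 7) :+ con (+ 2) :* i :+ con (+ 2) :* j :+ con (+ 6) :* k) refl (+ i) (+ j) (+ k)))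

  dumbbell-slope : ∀ p i j → + 6 + + 2 * + p + + 2 * + i + + 2 * + j ≡ + (6 ℕ.+ (double p ℕ.+ double i ℕ.+ double j))
  dumbbell-slope p i j = sym (trans (cong₂ (λ s t → + 6 + (s + t)) (cong₂ _+_ (pos-double p) (pos-double i)) (pos-double j))
    (solve 3 (λ p i j → con (+ 6) :+ ((con (+ 2) :* p :+ con (+ 2) :* i) :+ con (+ 2) :* j) := con (+ 6) :+ con (+ 2) :* p :+ con (+ 2) :* i :+ con (+ 2) :* j) refl (+ p) (+ i) (+ j)))

theta-table : ∀ p q r → ThetaJet p q r
theta-table p q r with parity p | parity q | parity r
... | i , inj₂ refl | j , inj₂ refl | k , inj₂ refl = record
  { half = 0 ; slope = + 12 + + 4 * (+ i + + j + + k) ; range = inj₁ refl ; half≡0 = λ _ → (i , refl) , (j , refl) , (k , refl) ; half≡1 = λ () ; half≡2 = λ ()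
  ; jets = theta-jet (ρ³ i j k) (even x₀ refl) (even x₁ refl) (even x₂ refl) (con 0ℤ) (con (+ 12) :+ con (+ 4) :* (x₀ :+ x₁ :+ x₂)) refl refl }
... | i , inj₁ refl | j , inj₂ refl | k , inj₂ refl = record
  { half = 2 ; slope = 0ℤ ; range = inj₂ (inj₂ (inj₁ refl)) ; half≡0 = λ () ; half≡1 = λ () ; half≡2 = λ _ → refl
  ; jets = theta-jet (ρ³ i j k) (odd x₀ refl) (even x₁ refl) (even x₂ refl) (con (+ 4)) (con 0ℤ) refl refl }
... | i , inj₂ refl | j , inj₁ refl | k , inj₂ refl = record
  { half = 2 ; slope = 0ℤ ; range = inj₂ (inj₂ (inj₁ refl)) ; half≡0 = λ () ; half≡1 = λ () ; half≡2 = λ _ → refl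
  ; jets = theta-jet (ρ³ i j k) (even x₀ refl) (odd x₁ refl) (even x₂ refl) (con (+ 4)) (con 0ℤ) refl refl }
... | i , inj₂ refl | j , inj₂ refl | k , inj₁ refl = record
  { half = 2 ; slope = 0ℤ ; range = inj₂ (inj₂ (inj₁ refl)) ; half≡0 = λ () ; half≡1 = λ () ; half≡2 = λ _ → refl
  ; jets = theta-jet (ρ³ i j k) (even x₀ refl) (even x₁ refl) (odd x₂ refl) (con (+ 4)) (con 0ℤ) refl refl }
... | i , inj₁ refl | j , inj₁ refl | k , inj₂ refl = record
  { half = 1 ; slope = + 7 + + 2 * + i + + 2 * + j + + 6 * + k ; range = inj₂ (inj₁ refl) ; half≡0 = λ () ; half≡2 = λ ()
  ; half≡1 = λ _ → 3 ℕ.+ (double k ℕ.+ double k) , slope₁ i j k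
  ; jets = theta-jet (ρ³ i j k) (odd x₀ refl) (odd x₁ refl) (even x₂ refl) (con (+ 2)) (con (+ 7) :+ con (+ 2) :* x₀ :+ con (+ 2) :* x₁ :+ con (+ 6) :* x₂) refl refl }
... | i , inj₁ refl | j , inj₂ refl | k , inj₁ refl = record
  { half = 1 ; slope = + 7 + + 2 * + i + + 2 * + k + + 6 * + j ; range = inj₂ (inj₁ refl) ; half≡0 = λ () ; half≡2 = λ ()
  ; half≡1 = λ _ → 3 ℕ.+ (double j ℕ.+ double j) , trans (slope₁ i k j) (cong (λ s → + (2 ℕ.+ s ℕ.+ suc (3 ℕ.+ (double j ℕ.+ double j)))) (swapʳ (double i) (double k) (suc (double j))))
  ; jets = theta-jet (ρ³ i j k) (odd x₀ refl) (even x₁ refl) (odd x₂ refl) (con (+ 2)) (con (+ 7) :+ con (+ 2) :* x₀ :+ con (+ 2) :* x₂ :+ con (+ 6) :* x₁) refl refl }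
  where
  swapʳ : ∀ a b c → a ℕ.+ b ℕ.+ c ≡ a ℕ.+ c ℕ.+ b
  swapʳ a b c = trans (ℕₚ.+-assoc a b c) (trans (cong (a ℕ.+_) (ℕₚ.+-comm b c)) (sym (ℕₚ.+-assoc a c b)))
... | i , inj₂ refl | j , inj₁ refl | k , inj₁ refl = record
  { half = 1 ; slope = + 7 + + 2 * + j + + 2 * + k + + 6 * + i ; range = inj₂ (inj₁ refl) ; half≡0 = λ () ; half≡2 = λ ()
  ; half≡1 = λ _ → 3 ℕ.+ (double i ℕ.+ double i) , trans (slope₁ j k i) (cong (λ s → + (2 ℕ.+ s ℕ.+ suc (3 ℕ.+ (double i ℕ.+ double i))))
      (trans (ℕₚ.+-comm (double j ℕ.+ double k) (suc (double i))) (sym (ℕₚ.+-assoc (suc (double i)) (double j) (double k)))))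
  ; jets = theta-jet (ρ³ i j k) (even x₀ refl) (odd x₁ refl) (odd x₂ refl) (con (+ 2)) (con (+ 7) :+ con (+ 2) :* x₁ :+ con (+ 2) :* x₂ :+ con (+ 6) :* x₀) refl refl }
... | i , inj₁ refl | j , inj₁ refl | k , inj₁ refl = record
  { half = 5 ; slope = -[1+ 1 ] + -[1+ 1 ] * (+ i + + j + + k) ; range = inj₂ (inj₂ (inj₂ refl)) ; half≡0 = λ () ; half≡1 = λ () ; half≡2 = λ ()
  ; jets = theta-jet (ρ³ i j k) (odd x₀ refl) (odd x₁ refl) (odd x₂ refl) (con (+ 10)) (con -[1+ 1 ] :+ con -[1+ 1 ] :* (x₀ :+ x₁ :+ x₂)) refl refl }

dumbbell-table : ∀ p i j → DumbbellJet p i j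
dumbbell-table p i j with parity p | parity i | parity j
... | a , inj₂ refl | b , inj₁ refl | c , inj₁ refl = record
  { half = 1 ; slope = + 7 + + 2 * + a + + 2 * + b + + 2 * + c ; half≡0 = λ () ; half≡2 = λ () ; half≢5 = λ ()
  ; half≡1 = λ _ → trans (solve 3 (λ a b c → con (+ 7) :+ con (+ 2) :* a :+ con (+ 2) :* b :+ con (+ 2) :* c := con 1ℤ :+ (con (+ 6) :+ con (+ 2) :* a :+ con (+ 2) :* b :+ con (+ 2) :* c)) refl (+ a) (+ b) (+ c))
      (cong (λ t → 1ℤ + t) (dumbbell-slope a b c))
  ; jets = dumbbell-jet (ρ³ a b c) (even x₀ refl) (odd x₁ refl) (odd x₂ refl) (con (+ 2)) (con (+ 7) :+ con (+ 2) :* x₀ :+ con (+ 2) :* x₁ :+ con (+ 2) :* x₂) refl refl }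
... | a , inj₁ refl | b , inj₁ refl | c , inj₁ refl = record
  { half = 1 ; slope = + 6 + + 2 * + a + + 2 * + b + + 2 * + c ; half≡0 = λ () ; half≡2 = λ () ; half≢5 = λ ()
  ; half≡1 = λ _ → dumbbell-slope a b c
  ; jets = dumbbell-jet (ρ³ a b c) (odd x₀ refl) (odd x₁ refl) (odd x₂ refl) (con (+ 2)) (con (+ 6) :+ con (+ 2) :* x₀ :+ con (+ 2) :* x₁ :+ con (+ 2) :* x₂) refl refl }
... | a , inj₂ refl | b , inj₁ refl | c , inj₂ refl = record
  { half = 2 ; slope = + 4 + + 4 * + a ; half≡0 = λ () ; half≡1 = λ () ; half≢5 = λ () ; half≡2 = λ _ → 3 ℕ.+ 4 ℕ.* a , cong (λ t → + 4 + t) (sym (ℤₚ.pos-* 4 a))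
  ; jets = dumbbell-jet (ρ³ a b c) (even x₀ refl) (odd x₁ refl) (even x₂ refl) (con (+ 4)) (con (+ 4) :+ con (+ 4) :* x₀) refl refl }
... | a , inj₂ refl | b , inj₂ refl | c , inj₁ refl = record
  { half = 2 ; slope = + 4 + + 4 * + a ; half≡0 = λ () ; half≡1 = λ () ; half≢5 = λ () ; half≡2 = λ _ → 3 ℕ.+ 4 ℕ.* a , cong (λ t → + 4 + t) (sym (ℤₚ.pos-* 4 a))
  ; jets = dumbbell-jet (ρ³ a b c) (even x₀ refl) (even x₁ refl) (odd x₂ refl) (con (+ 4)) (con (+ 4) :+ con (+ 4) :* x₀) refl refl }
... | a , inj₁ refl | b , inj₁ refl | c , inj₂ refl = record
  { half = 2 ; slope = + 12 + + 8 * + b + + 4 * + a ; half≡0 = λ () ; half≡1 = λ () ; half≢5 = λ ()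
  ; half≡2 = λ _ → 11 ℕ.+ 8 ℕ.* b ℕ.+ 4 ℕ.* a , cong₂ (λ s t → + 12 + s + t) (sym (ℤₚ.pos-* 8 b)) (sym (ℤₚ.pos-* 4 a))
  ; jets = dumbbell-jet (ρ³ a b c) (odd x₀ refl) (odd x₁ refl) (even x₂ refl) (con (+ 4)) (con (+ 12) :+ con (+ 8) :* x₁ :+ con (+ 4) :* x₀) refl refl }
... | a , inj₁ refl | b , inj₂ refl | c , inj₁ refl = record
  { half = 2 ; slope = + 12 + + 8 * + c + + 4 * + a ; half≡0 = λ () ; half≡1 = λ () ; half≢5 = λ ()
  ; half≡2 = λ _ → 11 ℕ.+ 8 ℕ.* c ℕ.+ 4 ℕ.* a , cong₂ (λ s t → + 12 + s + t) (sym (ℤₚ.pos-* 8 c)) (sym (ℤₚ.pos-* 4 a))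
  ; jets = dumbbell-jet (ρ³ a b c) (odd x₀ refl) (even x₁ refl) (odd x₂ refl) (con (+ 4)) (con (+ 12) :+ con (+ 8) :* x₂ :+ con (+ 4) :* x₀) refl refl }
... | a , inj₁ refl | b , inj₂ refl | c , inj₂ refl = record
  { half = 8 ; slope = -[1+ 15 ] + -[1+ 3 ] * (+ b + + c) ; half≡0 = λ () ; half≡1 = λ () ; half≡2 = λ () ; half≢5 = λ ()
  ; jets = dumbbell-jet (ρ³ a b c) (odd x₀ refl) (even x₁ refl) (even x₂ refl) (con (+ 16)) (con -[1+ 15 ] :+ con -[1+ 3 ] :* (x₁ :+ x₂)) refl refl }
... | a , inj₂ refl | b , inj₂ refl | c , inj₂ refl = record
  { half = 0 ; slope = + 32 + + 16 * + a + + 4 * (+ b + + c) ; half≡0 = λ _ → (a , refl) , (b , refl) , (c , refl) ; half≡1 = λ () ; half≡2 = λ () ; half≢5 = λ ()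
  ; jets = dumbbell-jet (ρ³ a b c) (even x₀ refl) (even x₁ refl) (even x₂ refl) (con 0ℤ) (con (+ 32) :+ con (+ 16) :* x₀ :+ con (+ 4) :* (x₁ :+ x₂)) refl refl }

-- Excluding further cycles by first-order data

zero-product : ∀ a w → a ℕ.* suc w ≡ 0 → a ≡ 0
zero-product zero    w e = refl
zero-product (suc a) w ()

odd≢even : ∀ k l → suc (2 ℕ.* k) ≢ 2 ℕ.* l
odd≢even zero    (suc l) e = case trans (ℕₚ.suc-injective e) (ℕₚ.+-suc l (l ℕ.+ 0)) of λ ()
odd≢even (suc k) (suc l) e = odd≢even k l (ℕₚ.suc-injective (ℕₚ.suc-injective
  (trans (cong suc (cong suc (sym (ℕₚ.+-suc k (k ℕ.+ 0))))) (trans e (cong suc (ℕₚ.+-suc l (l ℕ.+ 0)))))))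

-- A further cycle makes `half` even, hence 2. Then a = 1 and the cycles have constant term 2, so
-- they are a single odd cycle with x > 0. The slope becomes 2x + 2B > 0, whereas `half` = 2 demands
-- slope 0.
no-rings-arithmetic : ∀ half a w x {slope B : ℤ} {rs : List ℕ} → half ≡ 0 ⊎ half ≡ 1 ⊎ half ≡ 2 ⊎ half ≡ 5 → half ≢ 0 → (half ≡ 2 → slope ≡ 0ℤ) →
  half ≡ a ℕ.* suc w → slope ≡ + 2 * + a * + x + B * + suc w →
  (rs ≡ [] × w ≡ 0 × x ≡ 0 ⊎ ∃[ t ] suc w ≡ 2 ℕ.* suc t × (t ≡ 0 → ∃[ x′ ] x ≡ suc x′)) → (a ≡ 1 → ∃[ b ] B ≡ + suc b) → rs ≡ [] × half ≡ a × slope ≡ B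
no-rings-arithmetic half a w x {B = B} range ne slope≡0 halves slopes (inj₁ (rs≡[] , refl , refl)) pos = rs≡[] , trans halves (ℕₚ.*-identityʳ a) ,
  trans slopes (solve 2 (λ a b → con (+ 2) :* a :* con 0ℤ :+ b :* con 1ℤ := b) refl (+ a) B)
no-rings-arithmetic half a w x {slope} {B} range ne slope≡0 halves slopes (inj₂ (t , w≡ , x≡)) pos = ⊥-elim (impossible range)
  where
  even-half : half ≡ 2 ℕ.* (a ℕ.* suc t)
  even-half = trans halves (trans (cong (a ℕ.*_) w≡) (trans (sym (ℕₚ.*-assoc a 2 (suc t))) (trans (cong (ℕ._* suc t) (ℕₚ.*-comm a 2)) (ℕₚ.*-assoc 2 a (suc t)))))
  nonzero : ∀ x′ b → 0ℤ ≢ + 2 * 1ℤ * + suc x′ + + suc b * + suc w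
  nonzero x′ b e with trans e (cong₂ _+_ (sym (ℤₚ.pos-* 2 (suc x′))) (sym (ℤₚ.pos-* (suc b) (suc w))))
  ... | ()
  positive : half ≡ 2 → a ≡ 1 → t ≡ 0 → ⊥
  positive e refl t≡0 with pos refl | x≡ t≡0
  ... | b , refl | x′ , refl = nonzero x′ b (trans (sym (slope≡0 e)) slopes)
  impossible : half ≡ 0 ⊎ half ≡ 1 ⊎ half ≡ 2 ⊎ half ≡ 5 → ⊥
  impossible (inj₁ e) = ne e
  impossible (inj₂ (inj₁ e)) = odd≢even 0 (a ℕ.* suc t) (trans (sym e) even-half)
  impossible (inj₂ (inj₂ (inj₂ e))) = odd≢even 2 (a ℕ.* suc t) (trans (sym e) even-half)
  impossible (inj₂ (inj₂ (inj₁ e))) = positive e (ℕₚ.m*n≡1⇒m≡1 a (suc t) product) (ℕₚ.suc-injective (ℕₚ.m*n≡1⇒n≡1 a (suc t) product))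
    where
    product : a ℕ.* suc t ≡ 1
    product = ℕₚ.*-cancelˡ-≡ (a ℕ.* suc t) 1 2 (trans (sym even-half) e)

module _ {p q r : ℕ} (T : ThetaJet p q r) {core : ℤ → ℤ} {rs : List ℕ} (eq : ∀ y → thetaValue y 1ℤ p q r ≡ core y * ringsValue y 1ℤ rs)
         {a : ℕ} {B : ℤ} (J : JetOf core (+ 2 * + a , B)) where

  open ThetaJet T

  private
    equations : ∀ {w x} → JetOf (λ y → ringsValue y 1ℤ rs) (+ suc w , + x) → half ≡ a ℕ.* suc w × slope ≡ + 2 * + a * + x + B * + suc w
    equations {w} {x} K = ℤₚ.+-injective (ℤₚ.*-cancelˡ-≡ (+ 2) (+ half) (+ (a ℕ.* suc w))
        (trans (proj₁ both) (trans (ℤₚ.*-assoc (+ 2) (+ a) (+ suc w)) (cong (+ 2 *_) (sym (ℤₚ.pos-* a (suc w))))))) , proj₂ both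
      where
      both : + 2 * + half ≡ + 2 * + a * + suc w × slope ≡ + 2 * + a * + x + B * + suc w
      both = jet-unique {φ = λ y → thetaValue y 1ℤ p q r} {ψ = λ y → core y * ringsValue y 1ℤ rs} eq jets (λ y → Respects._r*_ (jet-respects y) (J y) (K y))

  core-zero : half ≡ 0 → a ≡ 0
  core-zero e = let (w , x , K , _) = rings-jet rs in zero-product a w (trans (sym (proj₁ (equations K))) e)

  no-rings : half ≢ 0 → (a ≡ 1 → ∃[ b ] B ≡ + suc b) → rs ≡ [] × half ≡ a × slope ≡ B
  no-rings ne pos = let (w , x , K , alt) = rings-jet rs in
    no-rings-arithmetic half a w x range ne half≡2 (proj₁ (equations K)) (proj₂ (equations K)) alt pos

-- Polynomial functions

eval : Poly → ℤ → ℤ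
eval []      z = 0ℤ
eval (a ∷ f) z = a + z * eval f z

eval-+ₚ : ∀ f g z → eval (f +ₚ g) z ≡ eval f z + eval g z
eval-+ₚ []      g       z = sym (ℤₚ.+-identityˡ _)
eval-+ₚ (a ∷ f) []      z = sym (ℤₚ.+-identityʳ _)
eval-+ₚ (a ∷ f) (b ∷ g) z = trans (cong (λ t → a + b + z * t) (eval-+ₚ f g z))
  (solve 5 (λ a b z s t → a :+ b :+ z :* (s :+ t) := (a :+ z :* s) :+ (b :+ z :* t)) refl a b z (eval f z) (eval g z))

eval-map : ∀ a f z → eval (map (a *_) f) z ≡ a * eval f z
eval-map a []      z = sym (ℤₚ.*-zeroʳ a)
eval-map a (b ∷ f) z = trans (cong (λ t → a * b + z * t) (eval-map a f z))
  (solve 4 (λ a b z s → a :* b :+ z :* (a :* s) := a :* (b :+ z :* s)) refl a b z (eval f z))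

eval-*ₚ : ∀ f g z → eval (f *ₚ g) z ≡ eval f z * eval g z
eval-*ₚ []      g z = refl
eval-*ₚ (a ∷ f) g z = trans (eval-+ₚ (map (a *_) g) (0ℤ ∷ f *ₚ g) z) (trans (cong₂ (λ s t → s + (0ℤ + z * t)) (eval-map a g z) (eval-*ₚ f g z))
  (solve 4 (λ a z s t → a :* t :+ (con 0ℤ :+ z :* (s :* t)) := (a :+ z :* s) :* t) refl a z (eval f z) (eval g z)))

square : ℕ → ℤ
square n = + suc n * + suc n

-- The constant term is divisible by every n + 1, hence 0, and then the argument can be cancelled.
-- Squares are the test points because odd parts in s are known as functions of s².
poly-zero : ∀ f → (∀ n → eval f (square n) ≡ 0ℤ) → ∀ k → coeff f k ≡ 0ℤ
poly-zero []      z k = refl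
poly-zero (a ∷ f) z = λ { zero → a≡0 ; (suc k) → poly-zero f rest k }
  where
  a≡0 : a ≡ 0ℤ
  a≡0 = small-multiple a λ n → - (+ suc n * eval f (square n)) , trans (solve 3 (λ a s t → a := (a :+ s :* s :* t) :+ s :* (:- (s :* t))) refl a (+ suc n) (eval f (square n)))
    (trans (cong (_+ + suc n * - (+ suc n * eval f (square n))) (z n)) (ℤₚ.+-identityˡ _))
  rest : ∀ n → eval f (square n) ≡ 0ℤ
  rest n = ℤₚ.*-cancelˡ-≡ (+ suc n) _ _ (ℤₚ.*-cancelˡ-≡ (+ suc n) _ _ (trans (solve 3 (λ a s t → s :* (s :* t) := (a :+ s :* s :* t) :- a) refl a (+ suc n) (eval f (square n)))
    (trans (cong₂ _-_ (z n) a≡0) (solve 1 (λ s → con 0ℤ :- con 0ℤ := s :* (s :* con 0ℤ)) refl (+ suc n)))))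

poly-equal : ∀ f g → (∀ n → eval f (square n) ≡ eval g (square n)) → f ≈ₚ g
poly-equal f g eq k = ℤₚ.i-j≡0⇒i≡j (coeff f k) (coeff g k) (trans (sym (trans (coeff-+ₚ f (map (-1ℤ *_) g) k) (cong (λ t → coeff f k + t) (trans (coeff-map -1ℤ g k) (ℤₚ.-1*i≡-i (coeff g k))))))
  (poly-zero (f +ₚ map (-1ℤ *_) g) difference k))
  where
  difference : ∀ n → eval (f +ₚ map (-1ℤ *_) g) (square n) ≡ 0ℤ
  difference n = trans (eval-+ₚ f _ (square n)) (trans (cong₂ _+_ (eq n) (eval-map -1ℤ g (square n)))
    (solve 1 (λ x → x :+ con -1ℤ :* x := con 0ℤ) refl (eval g (square n))))

record PolyFun (φ : ℤ → ℤ) : Set where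
  constructor polyFun
  field
    poly   : Poly
    values : ∀ z → eval poly z ≡ φ z

functionOps : Ops (ℤ → ℤ)
functionOps = record { _⊕_ = λ φ ψ z → φ z + ψ z ; _⊙_ = λ φ ψ z → φ z * ψ z ; κ = λ c z → c }

polyFun-con : ∀ c → PolyFun (λ _ → c)
polyFun-con c = polyFun (c ∷ []) (λ z → trans (cong (λ t → c + t) (ℤₚ.*-zeroʳ z)) (ℤₚ.+-identityʳ c))

polyFun-id : PolyFun id
polyFun-id = polyFun (0ℤ ∷ 1ℤ ∷ []) (solve 1 (λ z → con 0ℤ :+ z :* (con 1ℤ :+ z :* con 0ℤ) := z) refl)

polyFun-+ : ∀ {φ ψ} → PolyFun φ → PolyFun ψ → PolyFun (λ z → φ z + ψ z)
polyFun-+ (polyFun f e) (polyFun g e′) = polyFun (f +ₚ g) (λ z → trans (eval-+ₚ f g z) (cong₂ _+_ (e z) (e′ z)))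

polyFun-* : ∀ {φ ψ} → PolyFun φ → PolyFun ψ → PolyFun (λ z → φ z * ψ z)
polyFun-* (polyFun f e) (polyFun g e′) = polyFun (f *ₚ g) (λ z → trans (eval-*ₚ f g z) (cong₂ _*_ (e z) (e′ z)))

polyFun-cong : ∀ {φ ψ} → (∀ z → φ z ≡ ψ z) → PolyFun φ → PolyFun ψ
polyFun-cong eq (polyFun f e) = polyFun f (λ z → trans (e z) (eq z))

polyFun-neg : ∀ {φ} → PolyFun φ → PolyFun (λ z → - φ z)
polyFun-neg {φ} F = polyFun-cong (λ z → ℤₚ.-1*i≡-i (φ z)) (polyFun-* (polyFun-con -1ℤ) F)

-- A property of functions is treated as a relation that ignores its second argument; closure of
-- both forms under the property is then an instance of `Respects`.
polyFun-respects : Respects functionOps functionOps (λ φ _ → PolyFun φ)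
polyFun-respects = record { _r+_ = polyFun-+ ; _r*_ = polyFun-* ; rκ = λ n → polyFun-con (+ n) }

module _ (S : ℤ) where

  polyFun-𝐆 : ∀ k → PolyFun (λ Y → 𝐆 Y S k)
  polyFun-𝐆 zero          = polyFun-con 0ℤ
  polyFun-𝐆 (suc zero)    = polyFun-con 1ℤ
  polyFun-𝐆 (suc (suc k)) = polyFun-+ (polyFun-* polyFun-id (polyFun-𝐆 (suc k))) (polyFun-* (polyFun-con (S * S)) (polyFun-𝐆 k))

  private
    chainFun : ℕ → Arm (ℤ → ℤ)
    chainFun p = arm (λ Y → 𝐆 Y S (suc p)) (λ Y → S * S * 𝐆 Y S p) (λ _ → S ℤ.^ suc p) (λ Y → S * S * (𝐆 Y S (suc p) - Y * 𝐆 Y S p))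

    loopFun : ℕ → Loop (ℤ → ℤ)
    loopFun m = loop (λ Y → 𝐆 Y S (3 ℕ.+ m)) (λ Y → + 2 * (S * S * 𝐆 Y S (2 ℕ.+ m)) + + 2 * S ℤ.^ (3 ℕ.+ m))

    chain-poly : ∀ p → Respects.ArmRel polyFun-respects (chainFun p) (chainFun p)
    chain-poly p = polyFun-𝐆 (suc p) , polyFun-* (polyFun-con (S * S)) (polyFun-𝐆 p) , polyFun-con (S ℤ.^ suc p) ,
      polyFun-* (polyFun-con (S * S)) (polyFun-+ (polyFun-𝐆 (suc p)) (polyFun-neg (polyFun-* polyFun-id (polyFun-𝐆 p))))

    loop-poly : ∀ m → Respects.LoopRel polyFun-respects (loopFun m) (loopFun m)
    loop-poly m = polyFun-𝐆 (3 ℕ.+ m) , polyFun-+ (polyFun-* (polyFun-con (+ 2)) (polyFun-* (polyFun-con (S * S)) (polyFun-𝐆 (2 ℕ.+ m)))) (polyFun-con (+ 2 * S ℤ.^ (3 ℕ.+ m)))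

    Y-S : ℤ → ℤ
    Y-S Y = Y - S

    Y-S-poly : PolyFun Y-S
    Y-S-poly = polyFun-+ polyFun-id (polyFun-con (- S))

  theta-polyFun : ∀ p q r → PolyFun (λ Y → thetaValue Y S p q r)
  theta-polyFun p q r = Respects.thetaForm-rel polyFun-respects {y = Y-S} {Y-S} {chainFun p} {chainFun p} {chainFun q} {chainFun q} {chainFun r} {chainFun r}
    Y-S-poly (chain-poly p) (chain-poly q) (chain-poly r)

  dumbbell-polyFun : ∀ p i j → PolyFun (λ Y → dumbbellValue Y S p i j)
  dumbbell-polyFun p i j = Respects.dumbbellForm-rel polyFun-respects {y = Y-S} {Y-S} {chainFun p} {chainFun p} {loopFun i} {loopFun i} {loopFun j} {loopFun j}
    Y-S-poly (chain-poly p) (loop-poly i) (loop-poly j)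

  rings-polyFun : ∀ rs → PolyFun (λ Y → ringsValue Y S rs)
  rings-polyFun []       = polyFun-con 1ℤ
  rings-polyFun (m ∷ rs) = polyFun-* (polyFun-+ (polyFun-+ (polyFun-* polyFun-id (polyFun-𝐆 (3 ℕ.+ m))) (polyFun-* (polyFun-con (+ 2)) (polyFun-* (polyFun-con (S * S)) (polyFun-𝐆 (2 ℕ.+ m)))))
    (polyFun-con (+ 2 * S ℤ.^ (3 ℕ.+ m)))) (rings-polyFun rs)

ringsValue-↭ : ∀ Y S {rs rs′} → rs ↭ rs′ → ringsValue Y S rs ≡ ringsValue Y S rs′
ringsValue-↭ Y S _↭_.refl = refl
ringsValue-↭ Y S (prep m p) = cong (ringValue Y S m *_) (ringsValue-↭ Y S p)
ringsValue-↭ Y S (swap m l p) = trans (cong (λ t → ringValue Y S m * (ringValue Y S l * t)) (ringsValue-↭ Y S p))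
  (solve 3 (λ a b c → a :* (b :* c) := b :* (a :* c)) refl (ringValue Y S m) (ringValue Y S l) _)
ringsValue-↭ Y S (_↭_.trans p q) = trans (ringsValue-↭ Y S p) (ringsValue-↭ Y S q)

-- Nonnegative coefficients

NonNeg NonPos : Poly → Set
NonNeg f = ∀ k → 0ℤ ℤ.≤ coeff f k
NonPos f = ∀ k → coeff f k ℤ.≤ 0ℤ

nonNeg-+ₚ : ∀ f g → NonNeg f → NonNeg g → NonNeg (f +ₚ g)
nonNeg-+ₚ f g nf ng k = subst (0ℤ ℤ.≤_) (sym (coeff-+ₚ f g k)) (ℤₚ.+-mono-≤ (nf k) (ng k))

nonNeg-tail : ∀ {a f} → NonNeg (a ∷ f) → NonNeg f
nonNeg-tail n k = n (suc k)

nonNeg-* : ∀ {a b} → 0ℤ ℤ.≤ a → 0ℤ ℤ.≤ b → 0ℤ ℤ.≤ a * b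
nonNeg-* {+ a} {+ b} _ _ = subst (0ℤ ℤ.≤_) (ℤₚ.pos-* a b) (ℤ.+≤+ z≤n)

nonPos-* : ∀ {a b} → 0ℤ ℤ.≤ a → b ℤ.≤ 0ℤ → a * b ℤ.≤ 0ℤ
nonPos-* {a} {b} na nb = subst (a * b ℤ.≤_) (ℤₚ.*-zeroʳ a) (ℤₚ.*-monoˡ-≤-nonNeg a {{ℤ.nonNegative na}} nb)

coeff-*-nonPos : ∀ f g → NonNeg f → ∀ k → (∀ i → i ℕ.≤ k → coeff g i ℤ.≤ 0ℤ) → coeff (f *ₚ g) k ℤ.≤ 0ℤ
coeff-*-nonPos []      g nf k ng = ℤₚ.≤-refl
coeff-*-nonPos (a ∷ f) g nf k ng = subst (ℤ._≤ 0ℤ) (sym (coeff-+ₚ (map (a *_) g) (0ℤ ∷ f *ₚ g) k))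
  (ℤₚ.+-mono-≤ (subst (ℤ._≤ 0ℤ) (sym (coeff-map a g k)) (nonPos-* (nf 0) (ng k ℕₚ.≤-refl))) (shifted k ng))
  where
  shifted : ∀ k → (∀ i → i ℕ.≤ k → coeff g i ℤ.≤ 0ℤ) → coeff (0ℤ ∷ f *ₚ g) k ℤ.≤ 0ℤ
  shifted zero    ng = ℤₚ.≤-refl
  shifted (suc k) ng = coeff-*-nonPos f g (nonNeg-tail {a} {f} nf) k (λ i i≤k → ng i (ℕₚ.m≤n⇒m≤1+n i≤k))

nonNeg-*ₚ : ∀ f g → NonNeg f → NonNeg g → NonNeg (f *ₚ g)
nonNeg-*ₚ []      g nf ng k = ℤₚ.≤-refl
nonNeg-*ₚ (a ∷ f) g nf ng = nonNeg-+ₚ (map (a *_) g) (0ℤ ∷ f *ₚ g) (λ k → subst (0ℤ ℤ.≤_) (sym (coeff-map a g k)) (nonNeg-* (nf 0) (ng k)))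
  λ { zero → ℤₚ.≤-refl ; (suc k) → nonNeg-*ₚ f g (nonNeg-tail {a} {f} nf) ng k }

-- From f = (-2 + z g) h, degree k gives 2 h_k = (z g h)_k - f_k. The first term involves only
-- coefficients of h below k, so by induction the right side is at most 0.
quotient-nonPos : ∀ f g h → NonNeg f → NonNeg g → f ≈ₚ (-[1+ 1 ] ∷ g) *ₚ h → NonPos h
quotient-nonPos f g h nf ng eq k = below (suc k) k ℕₚ.≤-refl
  where
  step-bound : ∀ k → (∀ i → i ℕ.< k → coeff h i ℤ.≤ 0ℤ) → coeff h k ℤ.≤ 0ℤ
  step-bound k small = ℤₚ.*-cancelˡ-≤-pos (coeff h k) 0ℤ (+ 2) (ℤₚ.≤-trans (bound k small) ℤₚ.≤-refl)
    where
    rest : ∀ k → (∀ i → i ℕ.< k → coeff h i ℤ.≤ 0ℤ) → coeff (0ℤ ∷ g *ₚ h) k ℤ.≤ 0ℤ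
    rest zero    small = ℤₚ.≤-refl
    rest (suc k) small = coeff-*-nonPos g h ng k (λ i i≤k → small i (s≤s i≤k))
    bound : ∀ k → (∀ i → i ℕ.< k → coeff h i ℤ.≤ 0ℤ) → + 2 * coeff h k ℤ.≤ 0ℤ
    bound k small = subst (ℤ._≤ 0ℤ) (trans (cong (λ t → coeff (0ℤ ∷ g *ₚ h) k - t) (trans (eq k) (trans (coeff-+ₚ (map (-[1+ 1 ] *_) h) (0ℤ ∷ g *ₚ h) k) (cong (λ t → t + coeff (0ℤ ∷ g *ₚ h) k) (coeff-map -[1+ 1 ] h k)))))
        (solve 2 (λ r x → r :- (con -[1+ 1 ] :* x :+ r) := con (+ 2) :* x) refl (coeff (0ℤ ∷ g *ₚ h) k) (coeff h k)))
      (ℤₚ.i≤j⇒i-j≤0 (ℤₚ.≤-trans (rest k small) (nf k)))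
  below : ∀ n k → k ℕ.< n → coeff h k ℤ.≤ 0ℤ
  below (suc n) k (s≤s k≤n) = step-bound k (λ i i<k → below n i (ℕₚ.<-≤-trans i<k k≤n))

eval-nonPos : ∀ f → NonPos f → eval f 1ℤ ℤ.≤ 0ℤ
eval-nonPos []      nf = ℤₚ.≤-refl
eval-nonPos (a ∷ f) nf = ℤₚ.+-mono-≤ (nf 0) (subst (ℤ._≤ 0ℤ) (sym (ℤₚ.*-identityˡ _)) (eval-nonPos f (nf ∘ suc)))

-- At S = -1 a bipartite theta graph has a polynomial with nonnegative coefficients, whereas an
-- odd cycle contributes a factor with constant term -2.

record NonNegFun (φ : ℤ → ℤ) : Set where
  constructor nonNegFun
  field
    poly   : Poly
    values : ∀ z → eval poly z ≡ φ z
    signs  : NonNeg poly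

nonNegFun-con : ∀ n → NonNegFun (λ _ → + n)
nonNegFun-con n = nonNegFun (+ n ∷ []) (PolyFun.values (polyFun-con (+ n))) λ { zero → ℤ.+≤+ z≤n ; (suc k) → ℤₚ.≤-refl }

nonNegFun-id : NonNegFun id
nonNegFun-id = nonNegFun (0ℤ ∷ 1ℤ ∷ []) (PolyFun.values polyFun-id) λ { zero → ℤₚ.≤-refl ; (suc zero) → ℤ.+≤+ z≤n ; (suc (suc k)) → ℤₚ.≤-refl }

nonNegFun-cong : ∀ {φ ψ} → (∀ z → φ z ≡ ψ z) → NonNegFun φ → NonNegFun ψ
nonNegFun-cong eq (nonNegFun f e n) = nonNegFun f (λ z → trans (e z) (eq z)) n

nonNegFun-respects : Respects functionOps functionOps (λ φ _ → NonNegFun φ)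
nonNegFun-respects = record
  { _r+_ = λ { (nonNegFun f e n) (nonNegFun g e′ n′) → nonNegFun (f +ₚ g) (λ z → trans (eval-+ₚ f g z) (cong₂ _+_ (e z) (e′ z))) (nonNeg-+ₚ f g n n′) }
  ; _r*_ = λ { (nonNegFun f e n) (nonNegFun g e′ n′) → nonNegFun (f *ₚ g) (λ z → trans (eval-*ₚ f g z) (cong₂ _*_ (e z) (e′ z))) (nonNeg-*ₚ f g n n′) }
  ; rκ = nonNegFun-con }

private
  G₋ : ℤ → ℕ → ℤ
  G₋ y = 𝐆 y -1ℤ

  nonNegFun-+ : ∀ {φ ψ} → NonNegFun φ → NonNegFun ψ → NonNegFun (λ z → φ z + ψ z)
  nonNegFun-+ {φ} {ψ} = Respects._r+_ nonNegFun-respects {x′ = φ} {y′ = ψ}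

  nonNegFun-* : ∀ {φ ψ} → NonNegFun φ → NonNegFun ψ → NonNegFun (λ z → φ z * ψ z)
  nonNegFun-* {φ} {ψ} = Respects._r*_ nonNegFun-respects {x′ = φ} {y′ = ψ}

  unit-square : ∀ x → x ≡ -1ℤ * -1ℤ * x
  unit-square x = sym (ℤₚ.*-identityˡ x)

  G₋-nonNeg : ∀ k → NonNegFun (λ y → G₋ y k)
  G₋-nonNeg zero          = nonNegFun-con 0
  G₋-nonNeg (suc zero)    = nonNegFun-con 1
  G₋-nonNeg (suc (suc k)) = nonNegFun-+ (nonNegFun-* nonNegFun-id (G₋-nonNeg (suc k))) (nonNegFun-cong (λ y → unit-square (G₋ y k)) (G₋-nonNeg k))

  power-even : ∀ j → -1ℤ ℤ.^ double j ≡ 1ℤ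
  power-even zero    = refl
  power-even (suc j) = trans (cong (λ t → -1ℤ * (-1ℤ * t)) (power-even j)) refl

  c-simplify : ∀ y k → G₋ y k ≡ -1ℤ * -1ℤ * (G₋ y (suc (suc k)) - y * G₋ y (suc k))
  c-simplify y k = solve 3 (λ y a b → b := con -1ℤ :* con -1ℤ :* ((y :* a :+ con -1ℤ :* con -1ℤ :* b) :- y :* a)) refl y (G₋ y (suc k)) (G₋ y k)

  chainFun : ℕ → Arm (ℤ → ℤ)
  chainFun p = arm (λ y → G₋ y (suc p)) (λ y → -1ℤ * -1ℤ * G₋ y p) (λ _ → -1ℤ ℤ.^ suc p) (λ y → -1ℤ * -1ℤ * (G₋ y (suc p) - y * G₋ y p))

  chain-nonNeg : ∀ j → Respects.ArmRel nonNegFun-respects (chainFun (suc (double j))) (chainFun (suc (double j)))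
  chain-nonNeg j = G₋-nonNeg (suc (suc (double j))) , nonNegFun-cong (λ y → unit-square (G₋ y (suc (double j)))) (G₋-nonNeg (suc (double j))) ,
    nonNegFun-cong (λ _ → sym (power-even (suc j))) (nonNegFun-con 1) , nonNegFun-cong (λ y → c-simplify y (double j)) (G₋-nonNeg (double j))

  theta-nonNeg : ∀ i j k → NonNegFun (λ y → thetaValue y -1ℤ (suc (double i)) (suc (double j)) (suc (double k)))
  theta-nonNeg i j k = Respects.thetaForm-rel nonNegFun-respects {y = λ y → y - -1ℤ} {λ y → y - -1ℤ} {chainFun (suc (double i))} {chainFun (suc (double i))}
    {chainFun (suc (double j))} {chainFun (suc (double j))} {chainFun (suc (double k))} {chainFun (suc (double k))}
    (nonNegFun-+ nonNegFun-id (nonNegFun-con 1)) (chain-nonNeg i) (chain-nonNeg j) (chain-nonNeg k)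

  naturalOps : Ops ℕ
  naturalOps = record { _⊕_ = ℕ._+_ ; _⊙_ = ℕ._*_ ; κ = ℤ.∣_∣ }

  natural-respects : Respects integerOps naturalOps (λ x n → x ≡ + n)
  natural-respects = record { _r+_ = λ e e′ → cong₂ _+_ e e′ ; _r*_ = λ {_} {m} {_} {n} e e′ → trans (cong₂ _*_ e e′) (sym (ℤₚ.pos-* m n)) ; rκ = λ n → refl }

  fib : ℕ → ℕ
  fib zero          = 0
  fib (suc zero)    = 1
  fib (suc (suc k)) = fib (suc k) ℕ.+ fib k

  fib-positive : ∀ k → ∃[ m ] fib (suc k) ≡ suc m
  fib-positive zero = 0 , refl
  fib-positive (suc k) with fib-positive k
  ... | m , e = m ℕ.+ fib k , cong (ℕ._+ fib k) e

  G₋-fib : ∀ k → G₋ 1ℤ k ≡ + fib k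
  G₋-fib zero          = refl
  G₋-fib (suc zero)    = refl
  G₋-fib (suc (suc k)) = cong₂ _+_ (trans (ℤₚ.*-identityˡ (G₋ 1ℤ (suc k))) (G₋-fib (suc k))) (trans (ℤₚ.*-identityˡ (G₋ 1ℤ k)) (G₋-fib k))

  chain-natural : ∀ j → ∃[ f ] ∃[ g ] ∃[ c ] Respects.ArmRel natural-respects (chainArm 1ℤ -1ℤ (suc (double j))) (arm (suc f) g 1 c)
  chain-natural j with fib-positive (suc (double j))
  ... | m , e = m , fib (suc (double j)) , fib (double j) , trans (G₋-fib (suc (suc (double j)))) (cong +_ e) ,
    trans (sym (unit-square (G₋ 1ℤ (suc (double j))))) (G₋-fib (suc (double j))) , power-even (suc j) , trans (sym (c-simplify 1ℤ (double j))) (G₋-fib (double j))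

  theta-positive : ∀ i j k → ∃[ m ] thetaValue 1ℤ -1ℤ (suc (double i)) (suc (double j)) (suc (double k)) ≡ + suc m
  theta-positive i j k with chain-natural i | chain-natural j | chain-natural k
  ... | f₁ , g₁ , c₁ , A₁ | f₂ , g₂ , c₂ , A₂ | f₃ , g₃ , c₃ , A₃ = _ ,
    Respects.thetaForm-rel natural-respects {y′ = 2} {a₁′ = arm (suc f₁) g₁ 1 c₁} {a₂′ = arm (suc f₂) g₂ 1 c₂} {a₃′ = arm (suc f₃) g₃ 1 c₃} refl A₁ A₂ A₃

  -- 𝐆 Y S vanishes at Y = 0 for even indices; this is the quotient by Y
  E₋ : ℕ → ℤ → ℤ
  E₋ zero    y = 0ℤ
  E₋ (suc j) y = G₋ y (suc (double j)) + E₋ j y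

  E₋-quotient : ∀ j y → G₋ y (double j) ≡ y * E₋ j y
  E₋-quotient zero    y = sym (ℤₚ.*-zeroʳ y)
  E₋-quotient (suc j) y = trans (cong (λ t → y * G₋ y (suc (double j)) + -1ℤ * -1ℤ * t) (E₋-quotient j y))
    (solve 3 (λ y a b → y :* a :+ con -1ℤ :* con -1ℤ :* (y :* b) := y :* (a :+ b)) refl y (G₋ y (suc (double j))) (E₋ j y))

  E₋-nonNeg : ∀ j → NonNegFun (E₋ j)
  E₋-nonNeg zero    = nonNegFun-con 0
  E₋-nonNeg (suc j) = nonNegFun-+ (G₋-nonNeg (suc (double j))) (E₋-nonNeg j)

  ringTail : ℕ → ℤ → ℤ
  ringTail j y = G₋ y (3 ℕ.+ double j) + + 2 * E₋ (suc j) y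

  ringTail-nonNeg : ∀ j → NonNegFun (ringTail j)
  ringTail-nonNeg j = nonNegFun-+ (G₋-nonNeg (3 ℕ.+ double j)) (nonNegFun-* (nonNegFun-con 2) (E₋-nonNeg (suc j)))

  -- The two orientations of a cycle of odd length contribute 2 S^length = -2 at S = -1; all other
  -- terms contain y.
  odd-ring : ∀ j y → ringValue y -1ℤ (double j) ≡ -[1+ 1 ] + y * ringTail j y
  odd-ring j y = trans (cong₂ (λ s t → y * G₋ y (3 ℕ.+ double j) + + 2 * (-1ℤ * -1ℤ * s) + + 2 * (-1ℤ * t)) (E₋-quotient (suc j) y) (power-even (suc j)))
    (solve 3 (λ y g e → y :* g :+ con (+ 2) :* (con -1ℤ :* con -1ℤ :* (y :* e)) :+ con (+ 2) :* (con -1ℤ :* con 1ℤ) := con -[1+ 1 ] :+ y :* (g :+ con (+ 2) :* e)) refl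
      y (G₋ y (3 ℕ.+ double j)) (E₋ (suc j) y))

  ringTail-at-1 : ∀ j → ∃[ m ] ringTail j 1ℤ ≡ + (2 ℕ.+ m)
  ringTail-at-1 j with fib-positive (2 ℕ.+ double j) | fib-positive (suc (double j))
  ... | m , e | l , e′ = m ℕ.+ suc (l ℕ.+ 0) ℕ.+ l , trans (cong₂ (λ s t → s + + 2 * t) (trans (G₋-fib (3 ℕ.+ double j)) (cong +_ e))
      (trans (sym (ℤₚ.*-identityˡ (E₋ (suc j) 1ℤ))) (trans (sym (E₋-quotient (suc j) 1ℤ)) (trans (G₋-fib (double (suc j))) (cong +_ e′)))))
    (trans (cong (λ t → + suc m + t) (sym (ℤₚ.pos-* 2 (suc l)))) (cong +_ (cong suc (arith m l))))
    where
    arith : ∀ m l → m ℕ.+ suc (l ℕ.+ suc (l ℕ.+ 0)) ≡ suc (m ℕ.+ suc (l ℕ.+ 0) ℕ.+ l)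
    arith m l = trans (ℕₚ.+-suc m _) (cong suc (trans (cong (m ℕ.+_) (ℕₚ.+-comm l (suc (l ℕ.+ 0)))) (sym (ℕₚ.+-assoc m (suc (l ℕ.+ 0)) l))))

-- The cofactor h has nonpositive coefficients, so h(1) ≤ 0, while the cycle has a nonnegative value
-- at y = 1. Their product cannot be the positive value of the theta graph.
odd-ring-impossible : ∀ i j k l {h : ℤ → ℤ} → PolyFun h →
  (∀ y → thetaValue y -1ℤ (suc (double i)) (suc (double j)) (suc (double k)) ≡ ringValue y -1ℤ (double l) * h y) → ⊥
odd-ring-impossible i j k l {h} (polyFun ph values) eq = contradiction-at-1 (ringTail-at-1 l) (theta-positive i j k)
  where
  open NonNegFun (theta-nonNeg i j k) renaming (poly to pf; values to f-values; signs to f-signs)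
  open NonNegFun (ringTail-nonNeg l) renaming (poly to pg; values to g-values; signs to g-signs)
  h-signs : NonPos ph
  h-signs = quotient-nonPos pf pg ph f-signs g-signs (poly-equal pf ((-[1+ 1 ] ∷ pg) *ₚ ph) λ n → trans (f-values (square n)) (trans (eq (square n))
    (sym (trans (eval-*ₚ (-[1+ 1 ] ∷ pg) ph (square n)) (cong₂ _*_ (trans (cong (λ t → -[1+ 1 ] + square n * t) (g-values (square n))) (sym (odd-ring l (square n)))) (values (square n)))))))
  h≤0 : h 1ℤ ℤ.≤ 0ℤ
  h≤0 = subst (ℤ._≤ 0ℤ) (values 1ℤ) (eval-nonPos ph h-signs)
  contradiction-at-1 : ∃[ m ] ringTail l 1ℤ ≡ + (2 ℕ.+ m) → ∃[ m ] thetaValue 1ℤ -1ℤ (suc (double i)) (suc (double j)) (suc (double k)) ≡ + suc m → ⊥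
  contradiction-at-1 (m , e) (m′ , e′) = absurd (subst₂ ℤ._≤_ (trans (sym (eq 1ℤ)) e′) refl product≤0)
    where
    ring≡ : ringValue 1ℤ -1ℤ (double l) ≡ + m
    ring≡ = trans (odd-ring l 1ℤ) (trans (cong (λ t → -[1+ 1 ] + 1ℤ * t) e) (cong (λ t → -[1+ 1 ] + t) (ℤₚ.*-identityˡ (+ (2 ℕ.+ m)))))
    product≤0 : ringValue 1ℤ -1ℤ (double l) * h 1ℤ ℤ.≤ 0ℤ
    product≤0 = nonPos-* {ringValue 1ℤ -1ℤ (double l)} {h 1ℤ} (subst (0ℤ ℤ.≤_) (sym ring≡) (ℤ.+≤+ z≤n)) h≤0
    absurd : + suc m′ ℤ.≤ 0ℤ → ⊥
    absurd (ℤ.+≤+ ())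

-- `Odd` refers to the argument of `ring`, which is the length minus 3: all the cycles have even
-- length.
all-odd-rings : ∀ i j k {core : ℤ → ℤ} rs → PolyFun core →
  (∀ y → thetaValue y -1ℤ (suc (double i)) (suc (double j)) (suc (double k)) ≡ core y * ringsValue y -1ℤ rs) → All Odd rs
all-odd-rings i j k {core} rs pc eq = All.tabulate λ {m} m∈ → check m (parity m) (∈-∃↭ m∈)
  where
  check : ∀ m → ∃[ l ] (m ≡ double l ⊎ m ≡ suc (double l)) → ∃[ rs′ ] rs ↭ m ∷ rs′ → Odd m
  check m (l , inj₂ e) _ = l , e
  check m (l , inj₁ refl) (rs′ , p) = ⊥-elim (odd-ring-impossible i j k l {λ y → core y * ringsValue y -1ℤ rs′} (polyFun-* pc (rings-polyFun -1ℤ rs′))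
    λ y → trans (eq y) (trans (cong (core y *_) (ringsValue-↭ y -1ℤ p)) (solve 3 (λ a b c → a :* (b :* c) := b :* (a :* c)) refl (core y) (ringValue y -1ℤ (double l)) (ringsValue y -1ℤ rs′))))

-- The substitution Y = 1 - s², S = s

-- The value of a theta graph times (1 + s²)³, where x = s^P and X = (-s²)^P for a path with P
-- edges, and likewise for the other two. The pure powers of s come from the minors between the
-- ports.
thetaT : (s x y z X Y Z : ℤ) → ℤ
thetaT s x y z X Y Z = (1ℤ - s + + 2 * s * s) * (1ℤ - s + + 2 * s * s) - s * s * (1ℤ - s) * (1ℤ - s) * (X + Y + Z)
  + (1ℤ + s) * (1ℤ + s) * (X * Y + X * Z + Y * Z) - (+ 2 + s + s * s) * (+ 2 + s + s * s) * (X * Y * Z)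
  + + 2 * (1ℤ + s * s) * (1ℤ + s * s) * (y * z + x * z + x * y - X * y * z - Y * x * z - Z * x * y)

module _ (s : ℤ) where

  private
    w Y z : ℤ
    w = 1ℤ + s * s
    Y = 1ℤ - s * s
    z = - (s * s)

  -- Binet's formula for the roots 1 and -s²; their difference 1 + s² is kept as a factor on the
  -- left.
  𝐆-closed : ∀ k → w * 𝐆 Y s k ≡ 1ℤ - z ℤ.^ k
  𝐆-closed zero          = ℤₚ.*-zeroʳ w
  𝐆-closed (suc zero)    = solve 1 (λ s → (con 1ℤ :+ s :* s) :* con 1ℤ := con 1ℤ :- (:- (s :* s)) :* con 1ℤ) refl s
  𝐆-closed (suc (suc k)) = begin
    w * (Y * 𝐆 Y s (suc k) + s * s * 𝐆 Y s k)
      ≡⟨ solve 5 (λ w y s a b → w :* (y :* a :+ s :* s :* b) := y :* (w :* a) :+ s :* s :* (w :* b)) refl w Y s (𝐆 Y s (suc k)) (𝐆 Y s k) ⟩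
    Y * (w * 𝐆 Y s (suc k)) + s * s * (w * 𝐆 Y s k)
      ≡⟨ cong₂ (λ a b → Y * a + s * s * b) (𝐆-closed (suc k)) (𝐆-closed k) ⟩
    Y * (1ℤ - z * z ℤ.^ k) + s * s * (1ℤ - z ℤ.^ k)
      ≡⟨ solve 2 (λ s a → (con 1ℤ :- s :* s) :* (con 1ℤ :- :- (s :* s) :* a) :+ s :* s :* (con 1ℤ :- a) := con 1ℤ :- :- (s :* s) :* (:- (s :* s) :* a)) refl s (z ℤ.^ k) ⟩
    1ℤ - z ℤ.^ suc (suc k) ∎

  closedArm : ℕ → Arm ℤ
  closedArm p = arm (1ℤ - z ℤ.^ suc p) (s * s + z ℤ.^ suc p) (w * s ℤ.^ suc p) (s * s * s * s - z ℤ.^ suc p)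

  arm-closed : ∀ p → arm (w * Arm.f (chainArm Y s p)) (w * Arm.g (chainArm Y s p)) (w * Arm.h (chainArm Y s p)) (w * Arm.c (chainArm Y s p)) ≡ closedArm p
  arm-closed p = arm-cong (𝐆-closed (suc p))
    (trans (solve 3 (λ w s a → w :* (s :* s :* a) := s :* s :* (w :* a)) refl w s (𝐆 Y s p)) (trans (cong (s * s *_) (𝐆-closed p))
      (solve 2 (λ s a → s :* s :* (con 1ℤ :- a) := s :* s :+ :- (s :* s) :* a) refl s (z ℤ.^ p))))
    refl
    (trans (solve 5 (λ w y s a b → w :* (s :* s :* (a :- y :* b)) := s :* s :* (w :* a :- y :* (w :* b))) refl w Y s (𝐆 Y s (suc p)) (𝐆 Y s p))
      (trans (cong₂ (λ a b → s * s * (a - Y * b)) (𝐆-closed (suc p)) (𝐆-closed p))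
        (solve 2 (λ s a → s :* s :* ((con 1ℤ :- :- (s :* s) :* a) :- (con 1ℤ :- s :* s) :* (con 1ℤ :- a)) := s :* s :* s :* s :- :- (s :* s) :* a) refl s (z ℤ.^ p))))
    where
    arm-cong : ∀ {f g h c f′ g′ h′ c′ : ℤ} → f ≡ f′ → g ≡ g′ → h ≡ h′ → c ≡ c′ → arm f g h c ≡ arm f′ g′ h′ c′
    arm-cong refl refl refl refl = refl

  -- The form is linear in each arm, so each of the three factors w can be absorbed by one arm.
  theta-homogeneous : ∀ w y f₁ g₁ h₁ c₁ f₂ g₂ h₂ c₂ f₃ g₃ h₃ c₃ → w * w * w * thetaForm integerOps y (arm f₁ g₁ h₁ c₁) (arm f₂ g₂ h₂ c₂) (arm f₃ g₃ h₃ c₃)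
    ≡ thetaForm integerOps y (arm (w * f₁) (w * g₁) (w * h₁) (w * c₁)) (arm (w * f₂) (w * g₂) (w * h₂) (w * c₂)) (arm (w * f₃) (w * g₃) (w * h₃) (w * c₃))
  theta-homogeneous = solve 14 (λ w y f₁ g₁ h₁ c₁ f₂ g₂ h₂ c₂ f₃ g₃ h₃ c₃ → w :* w :* w :* thetaForm syntaxOps y (arm f₁ g₁ h₁ c₁) (arm f₂ g₂ h₂ c₂) (arm f₃ g₃ h₃ c₃)
    := thetaForm syntaxOps y (arm (w :* f₁) (w :* g₁) (w :* h₁) (w :* c₁)) (arm (w :* f₂) (w :* g₂) (w :* h₂) (w :* c₂)) (arm (w :* f₃) (w :* g₃) (w :* h₃) (w :* c₃))) refl

  theta-closed-form : ∀ s x y z X Y Z → thetaForm integerOps (1ℤ - s * s - s) (arm (1ℤ - X) (s * s + X) ((1ℤ + s * s) * x) (s * s * s * s - X))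
    (arm (1ℤ - Y) (s * s + Y) ((1ℤ + s * s) * y) (s * s * s * s - Y)) (arm (1ℤ - Z) (s * s + Z) ((1ℤ + s * s) * z) (s * s * s * s - Z)) ≡ thetaT s x y z X Y Z
  theta-closed-form = solve 7 (λ s x y z X Y Z → let o = con 1ℤ ; t = con (+ 2) in
    thetaForm syntaxOps (o :- s :* s :- s) (arm (o :- X) (s :* s :+ X) ((o :+ s :* s) :* x) (s :* s :* s :* s :- X))
      (arm (o :- Y) (s :* s :+ Y) ((o :+ s :* s) :* y) (s :* s :* s :* s :- Y)) (arm (o :- Z) (s :* s :+ Z) ((o :+ s :* s) :* z) (s :* s :* s :* s :- Z))
    := (o :- s :+ t :* s :* s) :* (o :- s :+ t :* s :* s) :- s :* s :* (o :- s) :* (o :- s) :* (X :+ Y :+ Z)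
      :+ (o :+ s) :* (o :+ s) :* (X :* Y :+ X :* Z :+ Y :* Z) :- (t :+ s :+ s :* s) :* (t :+ s :+ s :* s) :* (X :* Y :* Z)
      :+ t :* (o :+ s :* s) :* (o :+ s :* s) :* (y :* z :+ x :* z :+ x :* y :- X :* y :* z :- Y :* x :* z :- Z :* x :* y)) refl

  -- thetaT in terms of the numbers of edges of the three paths
  thetaE : ℕ → ℕ → ℕ → ℤ
  thetaE P Q R = thetaT s (s ℤ.^ P) (s ℤ.^ Q) (s ℤ.^ R) (z ℤ.^ P) (z ℤ.^ Q) (z ℤ.^ R)

  theta-closed : ∀ p q r → w * w * w * thetaValue Y s p q r ≡ thetaE (suc p) (suc q) (suc r)
  theta-closed p q r = trans (theta-homogeneous w (Y - s) (Arm.f A) (Arm.g A) (Arm.h A) (Arm.c A) (Arm.f B) (Arm.g B) (Arm.h B) (Arm.c B) (Arm.f C) (Arm.g C) (Arm.h C) (Arm.c C))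
    (trans (cong₃ (thetaForm integerOps (Y - s)) (arm-closed p) (arm-closed q) (arm-closed r)) (theta-closed-form s (s ℤ.^ suc p) (s ℤ.^ suc q) (s ℤ.^ suc r) (z ℤ.^ suc p) (z ℤ.^ suc q) (z ℤ.^ suc r)))
    where
    A B C : Arm ℤ
    A = chainArm Y s p
    B = chainArm Y s q
    C = chainArm Y s r
    cong₃ : ∀ {X : Set} (f : X → X → X → ℤ) {a a′ b b′ c c′} → a ≡ a′ → b ≡ b′ → c ≡ c′ → f a b c ≡ f a′ b′ c′
    cong₃ f refl refl refl = refl

-- Theta graphs are distinguished by the lowest power of s at which their values differ

module _ (s : ℤ) .{{_ : ℤ.NonZero s}} where

  private
    infix 4 _⊑_
    record _⊑_ (m : ℕ) (x : ℤ) : Set where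
      constructor ⟨_⟩
      field divisibility : s ℤ.^ m ∣ x

    open _⊑_

    ⊑-+ : ∀ {m x y} → m ⊑ x → m ⊑ y → m ⊑ x + y
    ⊑-+ ⟨ d ⟩ ⟨ d′ ⟩ = ⟨ ∣m∣n⇒∣m+n d d′ ⟩

    ⊑-- : ∀ {m x y} → m ⊑ x → m ⊑ y → m ⊑ x - y
    ⊑-- ⟨ d ⟩ ⟨ d′ ⟩ = ⟨ ∣m∣n⇒∣m-n d d′ ⟩

    ⊑-*ˡ : ∀ {m} k {x} → m ⊑ x → m ⊑ k * x
    ⊑-*ˡ k ⟨ d ⟩ = ⟨ ∣n⇒∣m*n k d ⟩

    ⊑-*ʳ : ∀ {m} k {x} → m ⊑ x → m ⊑ x * k
    ⊑-*ʳ k ⟨ d ⟩ = ⟨ ∣m⇒∣m*n k d ⟩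

    power : ∀ {a b} → a ℕ.≤ b → a ⊑ s ℤ.^ b
    power {a} {b} a≤b = ⟨ divides (s ℤ.^ (b ℕ.∸ a)) (trans (cong (s ℤ.^_) (sym (ℕₚ.m∸n+n≡m a≤b))) (ℤₚ.^-distribˡ-+-* s (b ℕ.∸ a) a)) ⟩

    weaken : ∀ {a b x} → a ℕ.≤ b → b ⊑ x → a ⊑ x
    weaken a≤b ⟨ d ⟩ = ⟨ ∣-trans (divisibility (power a≤b)) d ⟩

    times : ∀ {a b x y} → a ⊑ x → b ⊑ y → a ℕ.+ b ⊑ x * y
    times {a} {b} ⟨ divides k refl ⟩ ⟨ divides l refl ⟩ = ⟨ divides (k * l) (trans (solve 4 (λ k l a b → k :* a :* (l :* b) := k :* l :* (a :* b)) refl k l (s ℤ.^ a) (s ℤ.^ b))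
      (cong (k * l *_) (sym (ℤₚ.^-distribˡ-+-* s a b)))) ⟩

    cancel : ∀ m c → suc m ⊑ s ℤ.^ m * c → s ∣ c
    cancel zero    c ⟨ d ⟩ = subst₂ _∣_ (ℤₚ.*-identityʳ s) (ℤₚ.*-identityˡ c) d
    cancel (suc m) c ⟨ d ⟩ = cancel m c ⟨ *-cancelˡ-∣ s (subst (s ℤ.^ suc (suc m) ∣_) (ℤₚ.*-assoc s (s ℤ.^ m) c) d) ⟩

    z : ℤ
    z = - (s * s)

    σ : ℕ → ℤ
    σ zero    = 1ℤ
    σ (suc n) = -1ℤ * σ n

    z-power : ∀ n → z ℤ.^ n ≡ s ℤ.^ (n ℕ.+ n) * σ n
    z-power zero = refl
    z-power (suc n) = trans (cong (z *_) (z-power n)) (trans (solve 3 (λ s p t → :- (s :* s) :* (p :* t) := s :* (s :* p) :* (con -1ℤ :* t)) refl s (s ℤ.^ (n ℕ.+ n)) (σ n))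
      (cong (λ k → s * s ℤ.^ k * σ (suc n)) (sym (ℕₚ.+-suc n n))))

    z-divides : ∀ n → n ℕ.+ n ⊑ z ℤ.^ n
    z-divides n = ⟨ divides (σ n) (trans (z-power n) (ℤₚ.*-comm (s ℤ.^ (n ℕ.+ n)) (σ n))) ⟩

    one-divides : ∀ {n} → 1 ℕ.≤ n → 1 ⊑ z ℤ.^ n
    one-divides {n} 1≤n = weaken (ℕₚ.≤-trans 1≤n (ℕₚ.m≤m+n n n)) (z-divides n)

    e₁ e₂′ pairs triples : (P Q R : ℕ) → ℤ
    e₁ P Q R = z ℤ.^ P + z ℤ.^ Q + z ℤ.^ R
    e₂′ P Q R = z ℤ.^ P * z ℤ.^ Q + z ℤ.^ P * z ℤ.^ R + z ℤ.^ Q * z ℤ.^ R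
    pairs P Q R = s ℤ.^ Q * s ℤ.^ R + s ℤ.^ P * s ℤ.^ R + s ℤ.^ P * s ℤ.^ Q
    triples P Q R = z ℤ.^ P * s ℤ.^ Q * s ℤ.^ R + z ℤ.^ Q * s ℤ.^ P * s ℤ.^ R + z ℤ.^ R * s ℤ.^ P * s ℤ.^ Q

    product-z : ∀ P Q R → z ℤ.^ P * z ℤ.^ Q * z ℤ.^ R ≡ z ℤ.^ (P ℕ.+ Q ℕ.+ R)
    product-z P Q R = sym (trans (ℤₚ.^-distribˡ-+-* z (P ℕ.+ Q) R) (cong (_* z ℤ.^ R) (ℤₚ.^-distribˡ-+-* z P Q)))

    -- The product of the three powers of -s² depends only on P + Q + R, so the last symmetric
    -- function drops out of the comparison.
    vanish : ∀ P Q R P′ Q′ R′ → thetaE s P Q R ≡ thetaE s P′ Q′ R′ → P ℕ.+ Q ℕ.+ R ≡ P′ ℕ.+ Q′ ℕ.+ R′ →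
      (thetaE s P Q R - thetaE s P′ Q′ R′) + (+ 2 + s + s * s) * (+ 2 + s + s * s) * (z ℤ.^ P * z ℤ.^ Q * z ℤ.^ R - z ℤ.^ P′ * z ℤ.^ Q′ * z ℤ.^ R′) ≡ 0ℤ
    vanish P Q R P′ Q′ R′ e sum = trans (cong₂ (λ a b → a - thetaE s P′ Q′ R′ + (+ 2 + s + s * s) * (+ 2 + s + s * s) * (b - z ℤ.^ P′ * z ℤ.^ Q′ * z ℤ.^ R′)) e
        (trans (product-z P Q R) (trans (cong (z ℤ.^_) sum) (sym (product-z P′ Q′ R′)))))
      (solve 3 (λ a b c → a :- a :+ c :* (b :- b) := con 0ℤ) refl (thetaE s P′ Q′ R′) (z ℤ.^ P′ * z ℤ.^ Q′ * z ℤ.^ R′) ((+ 2 + s + s * s) * (+ 2 + s + s * s)))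

    -- The relation between two equal values, solved for the terms of lowest order
    balance : ∀ s x y z X Y Z x′ y′ z′ X′ Y′ Z′ →
      s * s * ((X + Y + Z) - (X′ + Y′ + Z′)) * ((1ℤ - s) * (1ℤ - s))
        ≡ (1ℤ + s) * (1ℤ + s) * ((X * Y + X * Z + Y * Z) - (X′ * Y′ + X′ * Z′ + Y′ * Z′))
          + + 2 * (1ℤ + s * s) * (1ℤ + s * s) * (((y * z + x * z + x * y) - (y′ * z′ + x′ * z′ + x′ * y′)) - ((X * y * z + Y * x * z + Z * x * y) - (X′ * y′ * z′ + Y′ * x′ * z′ + Z′ * x′ * y′)))
          - ((thetaT s x y z X Y Z - thetaT s x′ y′ z′ X′ Y′ Z′) + (+ 2 + s + s * s) * (+ 2 + s + s * s) * (X * Y * Z - X′ * Y′ * Z′))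
    balance = solve 13 (λ s x y z X Y Z x′ y′ z′ X′ Y′ Z′ →
      let o = con 1ℤ ; t = con (+ 2)
          T = λ x y z X Y Z → (o :- s :+ t :* s :* s) :* (o :- s :+ t :* s :* s) :- s :* s :* (o :- s) :* (o :- s) :* (X :+ Y :+ Z)
            :+ (o :+ s) :* (o :+ s) :* (X :* Y :+ X :* Z :+ Y :* Z) :- (t :+ s :+ s :* s) :* (t :+ s :+ s :* s) :* (X :* Y :* Z)
            :+ t :* (o :+ s :* s) :* (o :+ s :* s) :* (y :* z :+ x :* z :+ x :* y :- X :* y :* z :- Y :* x :* z :- Z :* x :* y)
      in s :* s :* ((X :+ Y :+ Z) :- (X′ :+ Y′ :+ Z′)) :* ((o :- s) :* (o :- s))
        := (o :+ s) :* (o :+ s) :* ((X :* Y :+ X :* Z :+ Y :* Z) :- (X′ :* Y′ :+ X′ :* Z′ :+ Y′ :* Z′))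
          :+ t :* (o :+ s :* s) :* (o :+ s :* s) :* (((y :* z :+ x :* z :+ x :* y) :- (y′ :* z′ :+ x′ :* z′ :+ x′ :* y′)) :- ((X :* y :* z :+ Y :* x :* z :+ Z :* x :* y) :- (X′ :* y′ :* z′ :+ Y′ :* x′ :* z′ :+ Z′ :* x′ :* y′)))
          :- ((T x y z X Y Z :- T x′ y′ z′ X′ Y′ Z′) :+ (t :+ s :+ s :* s) :* (t :+ s :+ s :* s) :* (X :* Y :* Z :- X′ :* Y′ :* Z′))) refl

    balanced : ∀ P Q R P′ Q′ R′ → thetaE s P Q R ≡ thetaE s P′ Q′ R′ → P ℕ.+ Q ℕ.+ R ≡ P′ ℕ.+ Q′ ℕ.+ R′ →
      s * s * (e₁ P Q R - e₁ P′ Q′ R′) * ((1ℤ - s) * (1ℤ - s))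
        ≡ (1ℤ + s) * (1ℤ + s) * (e₂′ P Q R - e₂′ P′ Q′ R′) + + 2 * (1ℤ + s * s) * (1ℤ + s * s) * ((pairs P Q R - pairs P′ Q′ R′) - (triples P Q R - triples P′ Q′ R′))
    balanced P Q R P′ Q′ R′ e sum = trans (balance s (s ℤ.^ P) (s ℤ.^ Q) (s ℤ.^ R) (z ℤ.^ P) (z ℤ.^ Q) (z ℤ.^ R) (s ℤ.^ P′) (s ℤ.^ Q′) (s ℤ.^ R′) (z ℤ.^ P′) (z ℤ.^ Q′) (z ℤ.^ R′))
      (trans (+-congˡ main (cong -_ (vanish P Q R P′ Q′ R′ e sum))) (ℤₚ.+-identityʳ main))
      where
      main : ℤ
      main = (1ℤ + s) * (1ℤ + s) * (e₂′ P Q R - e₂′ P′ Q′ R′) + + 2 * (1ℤ + s * s) * (1ℤ + s * s) * ((pairs P Q R - pairs P′ Q′ R′) - (triples P Q R - triples P′ Q′ R′))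

    sum₃ : ∀ {m a b c} → m ⊑ a → m ⊑ b → m ⊑ c → m ⊑ a + b + c
    sum₃ da db dc = ⊑-+ (⊑-+ da db) dc

    module _ {m P Q R : ℕ} (1≤P : 1 ℕ.≤ P) (P≤Q : P ℕ.≤ Q) (Q≤R : Q ℕ.≤ R) (m≤ : m ℕ.≤ P ℕ.+ Q) where

      private
        P≤R : P ℕ.≤ R
        P≤R = ℕₚ.≤-trans P≤Q Q≤R
        m≤PR : m ℕ.≤ P ℕ.+ R
        m≤PR = ℕₚ.≤-trans m≤ (ℕₚ.+-monoʳ-≤ P Q≤R)
        m≤QR : m ℕ.≤ Q ℕ.+ R
        m≤QR = ℕₚ.≤-trans m≤PR (ℕₚ.+-monoˡ-≤ R P≤Q)
        pair : ∀ A B → m ℕ.≤ A ℕ.+ B → m ⊑ s ℤ.^ A * s ℤ.^ B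
        pair A B le = weaken le (times (power {A} {A} ℕₚ.≤-refl) (power {B} {B} ℕₚ.≤-refl))
        triple : ∀ A B C → 1 ℕ.≤ A → m ℕ.≤ B ℕ.+ C → suc m ⊑ z ℤ.^ A * s ℤ.^ B * s ℤ.^ C
        triple A B C 1≤A le = subst (suc m ⊑_) (sym (ℤₚ.*-assoc (z ℤ.^ A) (s ℤ.^ B) (s ℤ.^ C))) (times {1} {m} (one-divides 1≤A) (pair B C le))
        square-pair : ∀ A B → 1 ℕ.≤ A → m ℕ.≤ A ℕ.+ B → suc m ⊑ z ℤ.^ A * z ℤ.^ B
        square-pair A B 1≤A le = weaken (ℕₚ.≤-trans (ℕₚ.+-mono-≤ (ℕₚ.≤-trans 1≤A (ℕₚ.m≤m+n A B)) le) (ℕₚ.≤-reflexive (rearrange A B))) (times (z-divides A) (z-divides B))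
          where
          rearrange : ∀ A B → (A ℕ.+ B) ℕ.+ (A ℕ.+ B) ≡ (A ℕ.+ A) ℕ.+ (B ℕ.+ B)
          rearrange A B = trans (ℕₚ.+-assoc A B _) (trans (cong (A ℕ.+_) (trans (sym (ℕₚ.+-assoc B A B)) (trans (cong (ℕ._+ B) (ℕₚ.+-comm B A)) (ℕₚ.+-assoc A B B)))) (sym (ℕₚ.+-assoc A A _)))

      -- P + Q is the least exponent among the three pairs. Products that contain a power of -s²
      -- gain at least one further factor s, as the next two lemmas record.
      pairs-divides : m ⊑ pairs P Q R
      pairs-divides = sum₃ (pair Q R m≤QR) (pair P R m≤PR) (pair P Q m≤)

      triples-divides : suc m ⊑ triples P Q R
      triples-divides = sum₃ (triple P Q R 1≤P m≤QR) (triple Q P R (ℕₚ.≤-trans 1≤P P≤Q) m≤PR) (triple R P Q (ℕₚ.≤-trans 1≤P P≤R) m≤)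

      e₂-divides : suc m ⊑ e₂′ P Q R
      e₂-divides = sum₃ (square-pair P Q 1≤P m≤) (square-pair P R 1≤P m≤PR) (square-pair Q R (ℕₚ.≤-trans 1≤P P≤Q) m≤QR)

    -- If the shortest cycle of the first graph is shorter than all cycles of the second
    shorter-cycle : ∀ {P Q R P′ Q′ R′} → 1 ℕ.≤ P → P ℕ.≤ Q → Q ℕ.≤ R → 1 ℕ.≤ P′ → P′ ℕ.≤ Q′ → Q′ ℕ.≤ R′ → P ℕ.+ Q ℕ.+ R ≡ P′ ℕ.+ Q′ ℕ.+ R′ →
      thetaE s P Q R ≡ thetaE s P′ Q′ R′ → suc (P ℕ.+ Q) ℕ.≤ P′ ℕ.+ Q′ → suc (P ℕ.+ Q) ⊑ s * s * (e₁ P Q R - e₁ P′ Q′ R′) →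
      s ∣ + 2 * (1ℤ + s ℤ.^ (R ℕ.∸ Q) + s ℤ.^ (R ℕ.∸ P))
    shorter-cycle {P} {Q} {R} {P′} {Q′} {R′} 1≤P P≤Q Q≤R 1≤P′ P′≤Q′ Q′≤R′ sum e lt d₁ = cancel m _ (subst (suc m ⊑_) factor
      -- Since 2 (1 + s²)² = 2 + 2 (2 + s²) s², the balance isolates twice `pairs P Q R` up to
      -- multiples of s^(m + 1).
      (subst (suc m ⊑_) (solve 6 (λ s a d p p′ t → (a :- (o :+ s) :* (o :+ s) :* d) :- t₂ :* (t₂ :+ s :* s) :* s :* s :* p :+ t₂ :* (o :+ s :* s) :* (o :+ s :* s) :* (p′ :+ t)
          := (a :- ((o :+ s) :* (o :+ s) :* d :+ t₂ :* (o :+ s :* s) :* (o :+ s :* s) :* ((p :- p′) :- t))) :+ t₂ :* p) refl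
          s (s * s * (e₁ P Q R - e₁ P′ Q′ R′) * ((1ℤ - s) * (1ℤ - s))) (e₂′ P Q R - e₂′ P′ Q′ R′) (pairs P Q R) (pairs P′ Q′ R′) (triples P Q R - triples P′ Q′ R′)
        |> λ eq → trans eq (trans (cong (λ t → (s * s * (e₁ P Q R - e₁ P′ Q′ R′) * ((1ℤ - s) * (1ℤ - s)) - t) + + 2 * pairs P Q R) (sym (balanced P Q R P′ Q′ R′ e sum)))
          (solve 2 (λ a b → a :- a :+ b := b) refl (s * s * (e₁ P Q R - e₁ P′ Q′ R′) * ((1ℤ - s) * (1ℤ - s))) (+ 2 * pairs P Q R))))
        small))
      where
      infixl 0 _|>_
      _|>_ : ∀ {A B : Set} → A → (A → B) → B
      a |> f = f a
      m : ℕ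
      m = P ℕ.+ Q
      o t₂ : ∀ {n} → Polynomial n
      o = con 1ℤ
      t₂ = con (+ 2)
      small : suc m ⊑ (s * s * (e₁ P Q R - e₁ P′ Q′ R′) * ((1ℤ - s) * (1ℤ - s)) - (1ℤ + s) * (1ℤ + s) * (e₂′ P Q R - e₂′ P′ Q′ R′))
        - + 2 * (+ 2 + s * s) * s * s * pairs P Q R + + 2 * (1ℤ + s * s) * (1ℤ + s * s) * (pairs P′ Q′ R′ + (triples P Q R - triples P′ Q′ R′))
      small = ⊑-+ (⊑-- (⊑-- (⊑-*ʳ ((1ℤ - s) * (1ℤ - s)) d₁)
          (⊑-*ˡ ((1ℤ + s) * (1ℤ + s)) (⊑-- (e₂-divides 1≤P P≤Q Q≤R ℕₚ.≤-refl) (weaken (ℕₚ.n≤1+n _) (e₂-divides 1≤P′ P′≤Q′ Q′≤R′ lt)))))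
          (times {1} {m} (⊑-*ˡ (+ 2 * (+ 2 + s * s) * s) (power {1} {1} ℕₚ.≤-refl |> subst (1 ⊑_) (ℤₚ.*-identityʳ s))) (pairs-divides 1≤P P≤Q Q≤R ℕₚ.≤-refl)))
        (⊑-*ˡ (+ 2 * (1ℤ + s * s) * (1ℤ + s * s)) (⊑-+ (pairs-divides 1≤P′ P′≤Q′ Q′≤R′ lt)
          (⊑-- (triples-divides 1≤P P≤Q Q≤R ℕₚ.≤-refl) (weaken (ℕₚ.n≤1+n _) (triples-divides 1≤P′ P′≤Q′ Q′≤R′ lt)))))
      factor : + 2 * pairs P Q R ≡ s ℤ.^ m * (+ 2 * (1ℤ + s ℤ.^ (R ℕ.∸ Q) + s ℤ.^ (R ℕ.∸ P)))
      factor = trans (cong (λ t → + 2 * t) (cong₂ _+_ (cong₂ _+_ qr pr) pq))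
        (solve 3 (λ a b c → con (+ 2) :* (a :* c :+ a :* b :+ a) := a :* (con (+ 2) :* (con 1ℤ :+ b :+ c))) refl (s ℤ.^ m) (s ℤ.^ (R ℕ.∸ Q)) (s ℤ.^ (R ℕ.∸ P)))
        where
        pq : s ℤ.^ P * s ℤ.^ Q ≡ s ℤ.^ m
        pq = sym (ℤₚ.^-distribˡ-+-* s P Q)
        pr : s ℤ.^ P * s ℤ.^ R ≡ s ℤ.^ m * s ℤ.^ (R ℕ.∸ Q)
        pr = trans (cong (λ k → s ℤ.^ P * s ℤ.^ k) (sym (ℕₚ.m+[n∸m]≡n Q≤R))) (trans (cong (s ℤ.^ P *_) (ℤₚ.^-distribˡ-+-* s Q (R ℕ.∸ Q)))
          (trans (sym (ℤₚ.*-assoc (s ℤ.^ P) _ _)) (cong (_* s ℤ.^ (R ℕ.∸ Q)) pq)))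
        qr : s ℤ.^ Q * s ℤ.^ R ≡ s ℤ.^ m * s ℤ.^ (R ℕ.∸ P)
        qr = trans (cong (λ k → s ℤ.^ Q * s ℤ.^ k) (sym (ℕₚ.m+[n∸m]≡n (ℕₚ.≤-trans P≤Q Q≤R)))) (trans (cong (s ℤ.^ Q *_) (ℤₚ.^-distribˡ-+-* s P (R ℕ.∸ P)))
          (trans (sym (ℤₚ.*-assoc (s ℤ.^ Q) _ _)) (cong (_* s ℤ.^ (R ℕ.∸ P)) (trans (ℤₚ.*-comm (s ℤ.^ Q) (s ℤ.^ P)) pq))))

    s²z-divides : ∀ {m} n → suc m ℕ.≤ 2 ℕ.+ (n ℕ.+ n) → suc m ⊑ s * s * z ℤ.^ n
    s²z-divides n le = weaken le (times {2} {n ℕ.+ n} (subst (λ t → 2 ⊑ s * t) (ℤₚ.*-identityʳ s) (power {2} {2} ℕₚ.≤-refl)) (z-divides n))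

    -- If the shortest path of the first graph is shorter than that of the second, and by far the shortest in the first
    shorter-path : ∀ {P Q R P′ Q′ R′} → 1 ℕ.≤ P → 2 ℕ.+ P ℕ.≤ Q → Q ℕ.≤ R → P ℕ.< P′ → P′ ℕ.≤ Q′ → Q′ ℕ.≤ R′ → P ℕ.+ Q ℕ.+ R ≡ P′ ℕ.+ Q′ ℕ.+ R′ →
      thetaE s P Q R ≡ thetaE s P′ Q′ R′ → ∃[ k ] s ∣ σ P * ((1ℤ - s) * (1ℤ - s)) - + 2 * k
    shorter-path {P} {Q} {R} {P′} {Q′} {R′} 1≤P 2+P≤Q Q≤R P<P′ P′≤Q′ Q′≤R′ sum e = w² * k , cancel m _ (subst (suc m ⊑_) factor small)
      where
      -- The order of the dominant term s² (-s²)^P. In both graphs any two paths have total length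
      -- at least m, so the pairs enter only as an even multiple of s^m.
      m : ℕ
      m = 2 ℕ.+ (P ℕ.+ P)
      w² : ℤ
      w² = (1ℤ + s * s) * (1ℤ + s * s)
      P≤Q : P ℕ.≤ Q
      P≤Q = ℕₚ.≤-trans (ℕₚ.m≤n+m P 2) 2+P≤Q
      1≤P′ : 1 ℕ.≤ P′
      1≤P′ = ℕₚ.≤-trans 1≤P (ℕₚ.<⇒≤ P<P′)
      m≤PQ : m ℕ.≤ P ℕ.+ Q
      m≤PQ = ℕₚ.≤-trans (ℕₚ.≤-reflexive (sym (trans (ℕₚ.+-suc P (suc P)) (cong suc (ℕₚ.+-suc P P))))) (ℕₚ.+-monoʳ-≤ P 2+P≤Q)
      m≤P′P′ : m ℕ.≤ P′ ℕ.+ P′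
      m≤P′P′ = ℕₚ.≤-trans (ℕₚ.≤-reflexive (cong suc (sym (ℕₚ.+-suc P P)))) (ℕₚ.+-mono-≤ P<P′ P<P′)
      m≤P′Q′ : m ℕ.≤ P′ ℕ.+ Q′
      m≤P′Q′ = ℕₚ.≤-trans m≤P′P′ (ℕₚ.+-monoʳ-≤ P′ P′≤Q′)
      pairs-difference : m ⊑ pairs P Q R - pairs P′ Q′ R′
      pairs-difference = ⊑-- (pairs-divides 1≤P P≤Q Q≤R m≤PQ) (pairs-divides 1≤P′ P′≤Q′ Q′≤R′ m≤P′Q′)
      k : ℤ
      k = _∣_.quotient (divisibility pairs-difference)
      k-equation : pairs P Q R - pairs P′ Q′ R′ ≡ k * s ℤ.^ m
      k-equation = _∣_.equality (divisibility pairs-difference)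
      far : ∀ n → P ℕ.< n → suc m ℕ.≤ 2 ℕ.+ (n ℕ.+ n)
      far n lt = s≤s (s≤s (ℕₚ.+-mono-≤ lt (ℕₚ.<⇒≤ lt)))
      P<Q : P ℕ.< Q
      P<Q = ℕₚ.≤-trans (ℕₚ.n≤1+n (suc P)) 2+P≤Q
      z²P : s * s * z ℤ.^ P ≡ s ℤ.^ m * σ P
      z²P = trans (cong (s * s *_) (z-power P)) (solve 3 (λ s p t → s :* s :* (p :* t) := s :* (s :* p) :* t) refl s (s ℤ.^ (P ℕ.+ P)) (σ P))
      tails : ℤ
      tails = s * s * z ℤ.^ Q + s * s * z ℤ.^ R - (s * s * z ℤ.^ P′ + s * s * z ℤ.^ Q′ + s * s * z ℤ.^ R′)
      small : suc m ⊑ (1ℤ + s) * (1ℤ + s) * (e₂′ P Q R - e₂′ P′ Q′ R′) - + 2 * (1ℤ + s * s) * (1ℤ + s * s) * (triples P Q R - triples P′ Q′ R′) - tails * ((1ℤ - s) * (1ℤ - s))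
      small = ⊑-- (⊑-- (⊑-*ˡ ((1ℤ + s) * (1ℤ + s)) (⊑-- (e₂-divides 1≤P P≤Q Q≤R m≤PQ) (e₂-divides 1≤P′ P′≤Q′ Q′≤R′ m≤P′Q′)))
          (⊑-*ˡ (+ 2 * (1ℤ + s * s) * (1ℤ + s * s)) (⊑-- (triples-divides 1≤P P≤Q Q≤R m≤PQ) (triples-divides 1≤P′ P′≤Q′ Q′≤R′ m≤P′Q′))))
        (⊑-*ʳ ((1ℤ - s) * (1ℤ - s)) (⊑-- (⊑-+ (s²z-divides Q (far Q P<Q)) (s²z-divides R (far R (ℕₚ.<-≤-trans P<Q Q≤R))))
          (sum₃ (s²z-divides P′ (far P′ P<P′)) (s²z-divides Q′ (far Q′ (ℕₚ.<-≤-trans P<P′ P′≤Q′))) (s²z-divides R′ (far R′ (ℕₚ.<-≤-trans P<P′ (ℕₚ.≤-trans P′≤Q′ Q′≤R′)))))))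
      factor : (1ℤ + s) * (1ℤ + s) * (e₂′ P Q R - e₂′ P′ Q′ R′) - + 2 * (1ℤ + s * s) * (1ℤ + s * s) * (triples P Q R - triples P′ Q′ R′) - tails * ((1ℤ - s) * (1ℤ - s))
        ≡ s ℤ.^ m * (σ P * ((1ℤ - s) * (1ℤ - s)) - + 2 * (w² * k))
      factor = begin
        (1ℤ + s) * (1ℤ + s) * (e₂′ P Q R - e₂′ P′ Q′ R′) - + 2 * (1ℤ + s * s) * (1ℤ + s * s) * (triples P Q R - triples P′ Q′ R′) - tails * ((1ℤ - s) * (1ℤ - s))
          ≡⟨ regroup s (e₂′ P Q R - e₂′ P′ Q′ R′) (triples P Q R - triples P′ Q′ R′) (pairs P Q R - pairs P′ Q′ R′) (z ℤ.^ P) (z ℤ.^ Q) (z ℤ.^ R) (z ℤ.^ P′) (z ℤ.^ Q′) (z ℤ.^ R′) ⟩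
        (1ℤ + s) * (1ℤ + s) * (e₂′ P Q R - e₂′ P′ Q′ R′) + + 2 * (1ℤ + s * s) * (1ℤ + s * s) * ((pairs P Q R - pairs P′ Q′ R′) - (triples P Q R - triples P′ Q′ R′))
          - s * s * (e₁ P Q R - e₁ P′ Q′ R′) * ((1ℤ - s) * (1ℤ - s)) + (s * s * z ℤ.^ P * ((1ℤ - s) * (1ℤ - s)) - + 2 * (w² * (pairs P Q R - pairs P′ Q′ R′)))
          ≡⟨ cong₂ _+_ (trans (cong (_- s * s * (e₁ P Q R - e₁ P′ Q′ R′) * ((1ℤ - s) * (1ℤ - s))) (sym (balanced P Q R P′ Q′ R′ e sum))) (ℤₚ.+-inverseʳ (s * s * (e₁ P Q R - e₁ P′ Q′ R′) * ((1ℤ - s) * (1ℤ - s)))))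
               (cong₂ (λ a b → a * ((1ℤ - s) * (1ℤ - s)) - + 2 * (w² * b)) z²P k-equation) ⟩
        0ℤ + (s ℤ.^ m * σ P * ((1ℤ - s) * (1ℤ - s)) - + 2 * (w² * (k * s ℤ.^ m)))
          ≡⟨ solve 5 (λ p t u w k → con 0ℤ :+ (p :* t :* u :- con (+ 2) :* (w :* (k :* p))) := p :* (t :* u :- con (+ 2) :* (w :* k))) refl (s ℤ.^ m) (σ P) ((1ℤ - s) * (1ℤ - s)) w² k ⟩
        s ℤ.^ m * (σ P * ((1ℤ - s) * (1ℤ - s)) - + 2 * (w² * k)) ∎
        where
        regroup : ∀ s d t p X Y Z X′ Y′ Z′ → (1ℤ + s) * (1ℤ + s) * d - + 2 * (1ℤ + s * s) * (1ℤ + s * s) * t - (s * s * Y + s * s * Z - (s * s * X′ + s * s * Y′ + s * s * Z′)) * ((1ℤ - s) * (1ℤ - s))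
          ≡ (1ℤ + s) * (1ℤ + s) * d + + 2 * (1ℤ + s * s) * (1ℤ + s * s) * (p - t) - s * s * ((X + Y + Z) - (X′ + Y′ + Z′)) * ((1ℤ - s) * (1ℤ - s))
            + (s * s * X * ((1ℤ - s) * (1ℤ - s)) - + 2 * ((1ℤ + s * s) * (1ℤ + s * s) * p))
        regroup = solve 10 (λ s d t p X Y Z X′ Y′ Z′ → let o = con 1ℤ ; b = con (+ 2) in
          (o :+ s) :* (o :+ s) :* d :- b :* (o :+ s :* s) :* (o :+ s :* s) :* t :- (s :* s :* Y :+ s :* s :* Z :- (s :* s :* X′ :+ s :* s :* Y′ :+ s :* s :* Z′)) :* ((o :- s) :* (o :- s))
          := (o :+ s) :* (o :+ s) :* d :+ b :* (o :+ s :* s) :* (o :+ s :* s) :* (p :- t) :- s :* s :* ((X :+ Y :+ Z) :- (X′ :+ Y′ :+ Z′)) :* ((o :- s) :* (o :- s))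
            :+ (s :* s :* X :* ((o :- s) :* (o :- s)) :- b :* ((o :+ s :* s) :* (o :+ s :* s) :* p))) refl

    sign-cases : ∀ n → σ n ≡ 1ℤ ⊎ σ n ≡ -1ℤ
    sign-cases zero = inj₁ refl
    sign-cases (suc n) with sign-cases n
    ... | inj₁ e = inj₂ (cong (-1ℤ *_) e)
    ... | inj₂ e = inj₁ (cong (-1ℤ *_) e)

  -- If Q ≤ P + 1, then P + Q is below both 2P + 2, the least order of the single-path terms, and P′
  -- + Q′, so the shortest cycle decides. Otherwise Q ≥ P + 2 and the term of the shortest path
  -- decides.
  shortest-path : ∀ {P Q R P′ Q′ R′} → 1 ℕ.≤ P → P ℕ.≤ Q → Q ℕ.≤ R → P ℕ.< P′ → P′ ℕ.≤ Q′ → Q′ ℕ.≤ R′ → P ℕ.+ Q ℕ.+ R ≡ P′ ℕ.+ Q′ ℕ.+ R′ →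
    thetaE s P Q R ≡ thetaE s P′ Q′ R′ → (∃[ i ] ∃[ j ] s ∣ + 2 * (1ℤ + s ℤ.^ i + s ℤ.^ j)) ⊎ (∃[ t ] ∃[ k ] (t ≡ 1ℤ ⊎ t ≡ -1ℤ) × s ∣ t * ((1ℤ - s) * (1ℤ - s)) - + 2 * k)
  shortest-path {P} {Q} {R} {P′} {Q′} {R′} 1≤P P≤Q Q≤R P<P′ P′≤Q′ Q′≤R′ sum e with Q ℕₚ.≤? suc P
  ... | no Q≰ = inj₂ (σ P , proj₁ far , sign-cases P , proj₂ far)
    where
    far : ∃[ k ] s ∣ σ P * ((1ℤ - s) * (1ℤ - s)) - + 2 * k
    far = shorter-path 1≤P (ℕₚ.≰⇒> Q≰) Q≤R P<P′ P′≤Q′ Q′≤R′ sum e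
  ... | yes Q≤1+P = inj₁ (R ℕ.∸ Q , R ℕ.∸ P , shorter-cycle 1≤P P≤Q Q≤R (ℕₚ.≤-trans 1≤P (ℕₚ.<⇒≤ P<P′)) P′≤Q′ Q′≤R′ sum e
      (ℕₚ.≤-trans (ℕₚ.≤-reflexive (sym (ℕₚ.+-suc P Q))) (ℕₚ.≤-trans (ℕₚ.+-monoʳ-≤ P (s≤s Q≤1+P)) (ℕₚ.≤-trans (ℕₚ.≤-reflexive (ℕₚ.+-suc P (suc P))) (ℕₚ.+-mono-≤ P<P′ (ℕₚ.≤-trans P<P′ P′≤Q′)))))
      (subst (suc (P ℕ.+ Q) ⊑_) (distribute s (z ℤ.^ P) (z ℤ.^ Q) (z ℤ.^ R) (z ℤ.^ P′) (z ℤ.^ Q′) (z ℤ.^ R′))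
        (⊑-- (sum₃ (s²z-divides P (bound ℕₚ.≤-refl)) (s²z-divides Q (bound P≤Q)) (s²z-divides R (bound (ℕₚ.≤-trans P≤Q Q≤R))))
             (sum₃ (s²z-divides P′ (bound (ℕₚ.<⇒≤ P<P′))) (s²z-divides Q′ (bound (ℕₚ.≤-trans (ℕₚ.<⇒≤ P<P′) P′≤Q′))) (s²z-divides R′ (bound (ℕₚ.≤-trans (ℕₚ.<⇒≤ P<P′) (ℕₚ.≤-trans P′≤Q′ Q′≤R′))))))))
    where
    bound : ∀ {n} → P ℕ.≤ n → suc (P ℕ.+ Q) ℕ.≤ 2 ℕ.+ (n ℕ.+ n)
    bound {n} P≤n = s≤s (ℕₚ.≤-trans (ℕₚ.+-monoʳ-≤ P Q≤1+P) (ℕₚ.≤-trans (ℕₚ.≤-reflexive (ℕₚ.+-suc P P)) (s≤s (ℕₚ.+-mono-≤ P≤n P≤n))))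
    distribute : ∀ s X Y Z X′ Y′ Z′ → s * s * X + s * s * Y + s * s * Z - (s * s * X′ + s * s * Y′ + s * s * Z′) ≡ s * s * ((X + Y + Z) - (X′ + Y′ + Z′))
    distribute = solve 7 (λ s X Y Z X′ Y′ Z′ → s :* s :* X :+ s :* s :* Y :+ s :* s :* Z :- (s :* s :* X′ :+ s :* s :* Y′ :+ s :* s :* Z′) := s :* s :* ((X :+ Y :+ Z) :- (X′ :+ Y′ :+ Z′))) refl

  -- The single-path terms of the common length P cancel. The others have order at least 2 + 2Q,
  -- above P + Q, so the shortest cycle decides.
  second-path : ∀ {P Q R Q′ R′} → 1 ℕ.≤ P → P ℕ.≤ Q → Q ℕ.≤ R → Q ℕ.< Q′ → Q′ ℕ.≤ R′ → P ℕ.+ Q ℕ.+ R ≡ P ℕ.+ Q′ ℕ.+ R′ →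
    thetaE s P Q R ≡ thetaE s P Q′ R′ → ∃[ i ] ∃[ j ] s ∣ + 2 * (1ℤ + s ℤ.^ i + s ℤ.^ j)
  second-path {P} {Q} {R} {Q′} {R′} 1≤P P≤Q Q≤R Q<Q′ Q′≤R′ sum e = R ℕ.∸ Q , R ℕ.∸ P , shorter-cycle 1≤P P≤Q Q≤R 1≤P (ℕₚ.≤-trans P≤Q (ℕₚ.<⇒≤ Q<Q′)) Q′≤R′ sum e
    (ℕₚ.≤-trans (ℕₚ.≤-reflexive (sym (ℕₚ.+-suc P Q))) (ℕₚ.+-monoʳ-≤ P Q<Q′))
    (subst (suc (P ℕ.+ Q) ⊑_) (distribute s (z ℤ.^ P) (z ℤ.^ Q) (z ℤ.^ R) (z ℤ.^ Q′) (z ℤ.^ R′))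
      (⊑-- (⊑-+ (s²z-divides Q (bound ℕₚ.≤-refl)) (s²z-divides R (bound Q≤R))) (⊑-+ (s²z-divides Q′ (bound (ℕₚ.<⇒≤ Q<Q′))) (s²z-divides R′ (bound (ℕₚ.≤-trans (ℕₚ.<⇒≤ Q<Q′) Q′≤R′))))))
    where
    bound : ∀ {n} → Q ℕ.≤ n → suc (P ℕ.+ Q) ℕ.≤ 2 ℕ.+ (n ℕ.+ n)
    bound {n} Q≤n = s≤s (ℕₚ.m≤n⇒m≤1+n (ℕₚ.+-mono-≤ (ℕₚ.≤-trans P≤Q Q≤n) Q≤n))
    distribute : ∀ s X Y Z Y′ Z′ → s * s * Y + s * s * Z - (s * s * Y′ + s * s * Z′) ≡ s * s * ((X + Y + Z) - (X + Y′ + Z′))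
    distribute = solve 6 (λ s X Y Z Y′ Z′ → s :* s :* Y :+ s :* s :* Z :- (s :* s :* Y′ :+ s :* s :* Z′) := s :* s :* ((X :+ Y :+ Z) :- (X :+ Y′ :+ Z′))) refl

  private
    Coincidence : Set
    Coincidence = ∃[ i ] ∃[ j ] s ∣ + 2 * (1ℤ + s ℤ.^ i + s ℤ.^ j)

    Parity : Set
    Parity = ∃[ t ] ∃[ k ] (t ≡ 1ℤ ⊎ t ≡ -1ℤ) × s ∣ t * ((1ℤ - s) * (1ℤ - s)) - + 2 * k

  sorted-unique : ¬ Coincidence → ¬ Parity → ∀ {P Q R P′ Q′ R′} → 1 ℕ.≤ P → P ℕ.≤ Q → Q ℕ.≤ R → 1 ℕ.≤ P′ → P′ ℕ.≤ Q′ → Q′ ℕ.≤ R′ → P ℕ.+ Q ℕ.+ R ≡ P′ ℕ.+ Q′ ℕ.+ R′ →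
    thetaE s P Q R ≡ thetaE s P′ Q′ R′ → P ≡ P′ × Q ≡ Q′ × R ≡ R′
  sorted-unique no-coincidence no-parity {P} {Q} {R} {P′} {Q′} {R′} 1≤P P≤Q Q≤R 1≤P′ P′≤Q′ Q′≤R′ sum e = first (ℕₚ.<-cmp P P′)
    where
    impossible : ¬ (Coincidence ⊎ Parity)
    impossible (inj₁ c) = no-coincidence c
    impossible (inj₂ c) = no-parity c
    second : P ≡ P′ → Tri (Q ℕ.< Q′) (Q ≡ Q′) (Q′ ℕ.< Q) → P ≡ P′ × Q ≡ Q′ × R ≡ R′
    second refl (tri< lt _ _)   = ⊥-elim (no-coincidence (second-path 1≤P P≤Q Q≤R lt Q′≤R′ sum e))
    second refl (tri> _ _ lt)   = ⊥-elim (no-coincidence (second-path 1≤P′ P′≤Q′ Q′≤R′ lt Q≤R (sym sum) (sym e)))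
    second refl (tri≈ _ refl _) = refl , refl , ℕₚ.+-cancelˡ-≡ (P ℕ.+ Q) R R′ sum
    first : Tri (P ℕ.< P′) (P ≡ P′) (P′ ℕ.< P) → P ≡ P′ × Q ≡ Q′ × R ≡ R′
    first (tri< lt _ _) = ⊥-elim (impossible (shortest-path 1≤P P≤Q Q≤R lt P′≤Q′ Q′≤R′ sum e))
    first (tri> _ _ lt) = ⊥-elim (impossible (shortest-path 1≤P′ P′≤Q′ Q′≤R′ lt P≤Q Q≤R (sym sum) (sym e)))
    first (tri≈ _ P≡P′ _) = second P≡P′ (ℕₚ.<-cmp Q Q′)

private

  strip : ∀ c t → + 8 ∣ c + + 8 * t → + 8 ∣ c
  strip c t d = subst (+ 8 ∣_) (solve 2 (λ c t → c :+ con (+ 8) :* t :- t :* con (+ 8) := c) refl c t) (∣m∣n⇒∣m-n d (divides t refl))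

  -- Modulo 8 the sum is 6, 4 or 2, according to which exponents are 0. The argument in `odd-square`
  -- needs an even s, and s must divide none of 2, 4, 6; the least such positive s is 8.
  no-cycle : ¬ (∃[ i ] ∃[ j ] + 8 ∣ + 2 * (1ℤ + (+ 8) ℤ.^ i + (+ 8) ℤ.^ j))
  no-cycle (zero  , zero  , d) = from-no (+ 8 ∣? + 6) d
  no-cycle (zero  , suc j , d) = from-no (+ 8 ∣? + 4) (strip (+ 4) (+ 2 * (+ 8) ℤ.^ j)
    (subst (+ 8 ∣_) (solve 1 (λ a → con (+ 2) :* (con 1ℤ :+ con 1ℤ :+ con (+ 8) :* a) := con (+ 4) :+ con (+ 8) :* (con (+ 2) :* a)) refl ((+ 8) ℤ.^ j)) d))
  no-cycle (suc i , zero  , d) = from-no (+ 8 ∣? + 4) (strip (+ 4) (+ 2 * (+ 8) ℤ.^ i)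
    (subst (+ 8 ∣_) (solve 1 (λ a → con (+ 2) :* (con 1ℤ :+ con (+ 8) :* a :+ con 1ℤ) := con (+ 4) :+ con (+ 8) :* (con (+ 2) :* a)) refl ((+ 8) ℤ.^ i)) d))
  no-cycle (suc i , suc j , d) = from-no (+ 8 ∣? + 2) (strip (+ 2) (+ 2 * ((+ 8) ℤ.^ i + (+ 8) ℤ.^ j))
    (subst (+ 8 ∣_) (solve 2 (λ a b → con (+ 2) :* (con 1ℤ :+ con (+ 8) :* a :+ con (+ 8) :* b) := con (+ 2) :+ con (+ 8) :* (con (+ 2) :* (a :+ b))) refl ((+ 8) ℤ.^ i) ((+ 8) ℤ.^ j)) d))

  odd-square : ¬ (∃[ t ] ∃[ k ] (t ≡ 1ℤ ⊎ t ≡ -1ℤ) × + 8 ∣ t * ((1ℤ - + 8) * (1ℤ - + 8)) - + 2 * k)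
  odd-square (_ , k , inj₁ refl , divides q eq) = from-no (+ 2 ∣? + 49) (divides (+ 4 * q + k)
    (trans (solve 1 (λ k → con (+ 49) := con (+ 49) :- con (+ 2) :* k :+ con (+ 2) :* k) refl k) (trans (cong (_+ + 2 * k) eq)
      (solve 2 (λ q k → q :* con (+ 8) :+ con (+ 2) :* k := (con (+ 4) :* q :+ k) :* con (+ 2)) refl q k))))
  odd-square (_ , k , inj₂ refl , divides q eq) = from-no (+ 2 ∣? - + 49) (divides (+ 4 * q + k)
    (trans (solve 1 (λ k → con (- + 49) := con (- + 49) :- con (+ 2) :* k :+ con (+ 2) :* k) refl k) (trans (cong (_+ + 2 * k) eq)
      (solve 2 (λ q k → q :* con (+ 8) :+ con (+ 2) :* k := (con (+ 4) :* q :+ k) :* con (+ 2)) refl q k))))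

theta-unique : ∀ {P Q R P′ Q′ R′} → 1 ℕ.≤ P → P ℕ.≤ Q → Q ℕ.≤ R → 1 ℕ.≤ P′ → P′ ℕ.≤ Q′ → Q′ ℕ.≤ R′ → P ℕ.+ Q ℕ.+ R ≡ P′ ℕ.+ Q′ ℕ.+ R′ →
  thetaE (+ 8) P Q R ≡ thetaE (+ 8) P′ Q′ R′ → P ≡ P′ × Q ≡ Q′ × R ≡ R′
theta-unique = sorted-unique (+ 8) no-cycle odd-square

-- The part of a value that is odd in s, again at Y = 1 - s² and S = s

oddTheta : (z X Y Z : ℤ) → ℤ
oddTheta z X Y Z = - (1ℤ + + 2 * z) + z * (X + Y + Z) + (X * Y + X * Z + Y * Z) - (+ 2 + z) * (X * Y * Z)

oddDumbbell : (z X K L : ℤ) → ℤ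
oddDumbbell z X K L = (1ℤ - K * K) * (1ℤ - L * L) * (z * X - (1ℤ + + 2 * z))
  - (1ℤ + z) * (1ℤ - X) * ((K + K * K) * (1ℤ - L * L) + (L + L * L) * (1ℤ - K * K))

-- The powers are common arguments because even exponents make them equal at s and - s; only the
-- sign of the explicit s differs.
thetaT-odd-part : ∀ s x y z X Y Z → thetaT s x y z X Y Z - thetaT (- s) x y z X Y Z ≡ + 4 * s * oddTheta (s * s) X Y Z
thetaT-odd-part = solve 7 (λ s x y z X Y Z →
  let o = con 1ℤ ; t = con (+ 2)
      T = λ s → (o :- s :+ t :* s :* s) :* (o :- s :+ t :* s :* s) :- s :* s :* (o :- s) :* (o :- s) :* (X :+ Y :+ Z)
        :+ (o :+ s) :* (o :+ s) :* (X :* Y :+ X :* Z :+ Y :* Z) :- (t :+ s :+ s :* s) :* (t :+ s :+ s :* s) :* (X :* Y :* Z)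
        :+ t :* (o :+ s :* s) :* (o :+ s :* s) :* (y :* z :+ x :* z :+ x :* y :- X :* y :* z :- Y :* x :* z :- Z :* x :* y)
  in T s :- T (:- s) := con (+ 4) :* s :* (:- (o :+ t :* (s :* s)) :+ (s :* s) :* (X :+ Y :+ Z) :+ (X :* Y :+ X :* Z :+ Y :* Z) :- (t :+ (s :* s)) :* (X :* Y :* Z))) refl

-- K and L are s raised to the lengths of the two even cycles; K² and L² are then the corresponding
-- powers of -s².
dumbbellT : (s x X K L : ℤ) → ℤ
dumbbellT s x X K L = dumbbellForm integerOps (1ℤ - s * s - s) (arm (1ℤ - X) (s * s + X) x (s * s * s * s - X))
  (loop (1ℤ - K * K) (+ 2 * (s * s + K * K) + + 2 * ((1ℤ + s * s) * K))) (loop (1ℤ - L * L) (+ 2 * (s * s + L * L) + + 2 * ((1ℤ + s * s) * L)))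

dumbbellT-odd-part : ∀ s x x′ X K L → dumbbellT s x X K L - dumbbellT (- s) x′ X K L ≡ + 4 * s * oddDumbbell (s * s) X K L
dumbbellT-odd-part = solve 6 (λ s x x′ X K L →
  let o = con 1ℤ ; t = con (+ 2) ; z = s :* s
      T = λ s x → dumbbellForm syntaxOps (o :- s :* s :- s) (arm (o :- X) (s :* s :+ X) x (s :* s :* s :* s :- X))
        (loop (o :- K :* K) (t :* (s :* s :+ K :* K) :+ t :* ((o :+ s :* s) :* K))) (loop (o :- L :* L) (t :* (s :* s :+ L :* L) :+ t :* ((o :+ s :* s) :* L)))
  in T s x :- T (:- s) x′ := con (+ 4) :* s :* ((o :- K :* K) :* (o :- L :* L) :* (z :* X :- (o :+ t :* z))
    :- (o :+ z) :* (o :- X) :* ((K :+ K :* K) :* (o :- L :* L) :+ (L :+ L :* L) :* (o :- K :* K)))) refl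

-- Closed forms of cycles and dumbbells

module _ (s : ℤ) where

  private
    w Y z : ℤ
    w = 1ℤ + s * s
    Y = 1ℤ - s * s
    z = - (s * s)

  -- The companion Lucas sequence: the sum of the (k + 1)-th powers of the roots 1 and -s².
  ring-closed : ∀ k → Y * 𝐆 Y s (suc k) + + 2 * (s * s * 𝐆 Y s k) ≡ 1ℤ + z ℤ.^ suc k
  ring-closed zero          = solve 1 (λ s → (con 1ℤ :- s :* s) :* con 1ℤ :+ con (+ 2) :* (s :* s :* con 0ℤ) := con 1ℤ :+ :- (s :* s) :* con 1ℤ) refl s
  ring-closed (suc zero)    = solve 1 (λ s → (con 1ℤ :- s :* s) :* ((con 1ℤ :- s :* s) :* con 1ℤ :+ s :* s :* con 0ℤ) :+ con (+ 2) :* (s :* s :* con 1ℤ)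
    := con 1ℤ :+ :- (s :* s) :* (:- (s :* s) :* con 1ℤ)) refl s
  ring-closed (suc (suc k)) = trans (recurrence s Y (𝐆 Y s (suc k)) (𝐆 Y s k))
    (trans (cong₂ (λ a b → Y * a + s * s * b) (ring-closed (suc k)) (ring-closed k))
      (solve 2 (λ s a → (con 1ℤ :- s :* s) :* (con 1ℤ :+ :- (s :* s) :* (:- (s :* s) :* a)) :+ s :* s :* (con 1ℤ :+ :- (s :* s) :* a)
        := con 1ℤ :+ :- (s :* s) :* (:- (s :* s) :* (:- (s :* s) :* a))) refl s (z ℤ.^ k)))
    where
    recurrence : ∀ s y a b → y * (y * (y * a + s * s * b) + s * s * a) + + 2 * (s * s * (y * a + s * s * b))
      ≡ y * (y * (y * a + s * s * b) + + 2 * (s * s * a)) + s * s * (y * a + + 2 * (s * s * b))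
    recurrence = solve 4 (λ s y a b → y :* (y :* (y :* a :+ s :* s :* b) :+ s :* s :* a) :+ con (+ 2) :* (s :* s :* (y :* a :+ s :* s :* b))
      := y :* (y :* (y :* a :+ s :* s :* b) :+ con (+ 2) :* (s :* s :* a)) :+ s :* s :* (y :* a :+ con (+ 2) :* (s :* s :* b))) refl

  power-double : ∀ h → s ℤ.^ double h ≡ (s * s) ℤ.^ h
  power-double zero    = refl
  power-double (suc h) = trans (sym (ℤₚ.*-assoc s s _)) (cong (s * s *_) (power-double h))

  negated-power-double : ∀ h → z ℤ.^ double h ≡ (s * s) ℤ.^ double h
  negated-power-double zero    = refl
  negated-power-double (suc h) = trans (cong (λ t → z * (z * t)) (negated-power-double h)) (solve 2 (λ s t → :- (s :* s) :* (:- (s :* s) :* t) := s :* s :* (s :* s :* t)) refl s ((s * s) ℤ.^ double h))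

  square-power : ∀ h → (s * s) ℤ.^ double h ≡ (s * s) ℤ.^ h * (s * s) ℤ.^ h
  square-power zero    = refl
  square-power (suc h) = trans (cong (λ t → s * s * (s * s * t)) (square-power h)) (solve 2 (λ s t → s :* s :* (s :* s :* (t :* t)) := s :* s :* t :* (s :* s :* t)) refl s ((s * s) ℤ.^ h))

  -- For length 2h the two orientations add 2 s^(2h) to 1 + s^(4h), which completes a square.
  even-ring : ∀ j → ringValue Y s (suc (double j)) ≡ (1ℤ + (s * s) ℤ.^ (2 ℕ.+ j)) * (1ℤ + (s * s) ℤ.^ (2 ℕ.+ j))
  even-ring j = trans (cong₂ (λ a b → a + + 2 * b) (trans (ring-closed (3 ℕ.+ double j)) (cong (λ t → 1ℤ + t) (trans (negated-power-double (2 ℕ.+ j)) (square-power (2 ℕ.+ j))))) (power-double (2 ℕ.+ j)))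
    (solve 1 (λ a → con 1ℤ :+ a :* a :+ con (+ 2) :* a := (con 1ℤ :+ a) :* (con 1ℤ :+ a)) refl ((s * s) ℤ.^ (2 ℕ.+ j)))

  closedLoop : ℕ → Loop ℤ
  closedLoop m = loop (1ℤ - z ℤ.^ (3 ℕ.+ m)) (+ 2 * (s * s + z ℤ.^ (3 ℕ.+ m)) + + 2 * (w * s ℤ.^ (3 ℕ.+ m)))

  loop-closed : ∀ m → loop (w * Loop.f (cycleLoop Y s m)) (w * Loop.g (cycleLoop Y s m)) ≡ closedLoop m
  loop-closed m = cong₂ loop (𝐆-closed s (3 ℕ.+ m))
    (trans (solve 4 (λ w s a b → w :* (con (+ 2) :* (s :* s :* a) :+ con (+ 2) :* b) := con (+ 2) :* (s :* s :* (w :* a)) :+ con (+ 2) :* (w :* b)) refl w s (𝐆 Y s (2 ℕ.+ m)) (s ℤ.^ (3 ℕ.+ m)))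
      (cong (λ t → t + + 2 * (w * s ℤ.^ (3 ℕ.+ m))) (trans (cong (λ t → + 2 * (s * s * t)) (𝐆-closed s (2 ℕ.+ m)))
        (solve 2 (λ s a → con (+ 2) :* (s :* s :* (con 1ℤ :- a)) := con (+ 2) :* (s :* s :+ :- (s :* s) :* a)) refl s (z ℤ.^ (2 ℕ.+ m))))))

  dumbbell-homogeneous : ∀ w y f g h c f₁ g₁ f₂ g₂ → w * w * w * dumbbellForm integerOps y (arm f g h c) (loop f₁ g₁) (loop f₂ g₂)
    ≡ dumbbellForm integerOps y (arm (w * f) (w * g) (w * h) (w * c)) (loop (w * f₁) (w * g₁)) (loop (w * f₂) (w * g₂))
  dumbbell-homogeneous = solve 10 (λ w y f g h c f₁ g₁ f₂ g₂ → w :* w :* w :* dumbbellForm syntaxOps y (arm f g h c) (loop f₁ g₁) (loop f₂ g₂)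
    := dumbbellForm syntaxOps y (arm (w :* f) (w :* g) (w :* h) (w :* c)) (loop (w :* f₁) (w :* g₁)) (loop (w :* f₂) (w :* g₂))) refl

  even-dumbbell-closed : ∀ e i j → w * w * w * dumbbellValue Y s (suc (double e)) (suc (double i)) (suc (double j))
    ≡ dumbbellT s (w * s ℤ.^ double (suc e)) ((s * s) ℤ.^ double (suc e)) ((s * s) ℤ.^ (2 ℕ.+ i)) ((s * s) ℤ.^ (2 ℕ.+ j))
  even-dumbbell-closed e i j = trans (dumbbell-homogeneous w (Y - s) (Arm.f A) (Arm.g A) (Arm.h A) (Arm.c A) (Loop.f B) (Loop.g B) (Loop.f C) (Loop.g C))
    (trans (cong₃ (arm-closed s (suc (double e))) (loop-closed (suc (double i))) (loop-closed (suc (double j))))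
      (cong₃ (cong (λ t → arm (1ℤ - t) (s * s + t) (w * s ℤ.^ double (suc e)) (s * s * s * s - t)) (negated-power-double (suc e))) (even-loop i) (even-loop j)))
    where
    A : Arm ℤ
    A = chainArm Y s (suc (double e))
    B C : Loop ℤ
    B = cycleLoop Y s (suc (double i))
    C = cycleLoop Y s (suc (double j))
    cong₃ : ∀ {a a′ b b′ c c′} → a ≡ a′ → b ≡ b′ → c ≡ c′ → dumbbellForm integerOps (Y - s) a b c ≡ dumbbellForm integerOps (Y - s) a′ b′ c′
    cong₃ refl refl refl = refl
    even-loop : ∀ i → closedLoop (suc (double i)) ≡ loop (1ℤ - (s * s) ℤ.^ (2 ℕ.+ i) * (s * s) ℤ.^ (2 ℕ.+ i))
      (+ 2 * (s * s + (s * s) ℤ.^ (2 ℕ.+ i) * (s * s) ℤ.^ (2 ℕ.+ i)) + + 2 * (w * (s * s) ℤ.^ (2 ℕ.+ i)))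
    even-loop i = cong₂ (λ a b → loop (1ℤ - a) (+ 2 * (s * s + a) + + 2 * (w * b))) (trans (negated-power-double (2 ℕ.+ i)) (square-power (2 ℕ.+ i))) (power-double (2 ℕ.+ i))

  even-theta-closed : ∀ i j k → w * w * w * thetaValue Y s (suc (double i)) (suc (double j)) (suc (double k))
    ≡ thetaT s ((s * s) ℤ.^ suc i) ((s * s) ℤ.^ suc j) ((s * s) ℤ.^ suc k) ((s * s) ℤ.^ double (suc i)) ((s * s) ℤ.^ double (suc j)) ((s * s) ℤ.^ double (suc k))
  even-theta-closed i j k = trans (theta-closed s (suc (double i)) (suc (double j)) (suc (double k)))
    (cong₆ (power-double (suc i)) (power-double (suc j)) (power-double (suc k)) (negated-power-double (suc i)) (negated-power-double (suc j)) (negated-power-double (suc k)))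
    where
    cong₆ : ∀ {a a′ b b′ c c′ d d′ e e′ f f′} → a ≡ a′ → b ≡ b′ → c ≡ c′ → d ≡ d′ → e ≡ e′ → f ≡ f′ → thetaT s a b c d e f ≡ thetaT s a′ b′ c′ d′ e′ f′
    cong₆ refl refl refl refl refl refl = refl

-- φ is the odd part of the value, as a function of z = s², up to a common factor
OddPart : (ℤ → ℤ → ℤ) → (ℤ → ℤ) → Set
OddPart value φ = ∀ s → (1ℤ + s * s) * (1ℤ + s * s) * (1ℤ + s * s) * (value (1ℤ - s * s) s - value (1ℤ - s * s) (- s)) ≡ + 4 * s * φ (s * s)

negated-square : ∀ s → - s * - s ≡ s * s
negated-square = solve 1 (λ s → :- s :* :- s := s :* s) refl

odd-part : ∀ {value φ} (T : ℤ → ℤ) → (∀ s → (1ℤ + s * s) * (1ℤ + s * s) * (1ℤ + s * s) * value (1ℤ - s * s) s ≡ T s) → (∀ s → T s - T (- s) ≡ + 4 * s * φ (s * s)) → OddPart value φ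
odd-part {value} T closed difference s = trans (solve 3 (λ w a b → w :* (a :- b) := w :* a :- w :* b) refl (w * w * w) (value (1ℤ - s * s) s) (value (1ℤ - s * s) (- s)))
  (trans (cong₂ _-_ (closed s) (trans (cong (λ t → (1ℤ + t) * (1ℤ + t) * (1ℤ + t) * value (1ℤ - t) (- s)) (sym (negated-square s))) (closed (- s)))) (difference s))
  where
  w : ℤ
  w = 1ℤ + s * s

theta-odd-part : ∀ i j k → OddPart (λ Y S → thetaValue Y S (suc (double i)) (suc (double j)) (suc (double k))) (λ z → oddTheta z (z ℤ.^ double (suc i)) (z ℤ.^ double (suc j)) (z ℤ.^ double (suc k)))
theta-odd-part i j k = odd-part {λ Y S → thetaValue Y S (suc (double i)) (suc (double j)) (suc (double k))} {λ z → oddTheta z (z ℤ.^ double (suc i)) (z ℤ.^ double (suc j)) (z ℤ.^ double (suc k))}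
  (λ s → T s (s * s)) (λ s → even-theta-closed s i j k) λ s → trans (cong (λ t → T s (s * s) - T (- s) t) (negated-square s))
    (thetaT-odd-part s ((s * s) ℤ.^ suc i) ((s * s) ℤ.^ suc j) ((s * s) ℤ.^ suc k) ((s * s) ℤ.^ double (suc i)) ((s * s) ℤ.^ double (suc j)) ((s * s) ℤ.^ double (suc k)))
  where
  -- The square of s is a separate argument, so that replacing s by - s leaves the powers untouched.
  T : ℤ → ℤ → ℤ
  T s z = thetaT s (z ℤ.^ suc i) (z ℤ.^ suc j) (z ℤ.^ suc k) (z ℤ.^ double (suc i)) (z ℤ.^ double (suc j)) (z ℤ.^ double (suc k))

dumbbell-odd-part : ∀ e i j → OddPart (λ Y S → dumbbellValue Y S (suc (double e)) (suc (double i)) (suc (double j))) (λ z → oddDumbbell z (z ℤ.^ double (suc e)) (z ℤ.^ (2 ℕ.+ i)) (z ℤ.^ (2 ℕ.+ j)))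
dumbbell-odd-part e i j = odd-part {λ Y S → dumbbellValue Y S (suc (double e)) (suc (double i)) (suc (double j))} {λ z → oddDumbbell z (z ℤ.^ double (suc e)) (z ℤ.^ (2 ℕ.+ i)) (z ℤ.^ (2 ℕ.+ j))}
  (λ s → T s (s * s)) (λ s → even-dumbbell-closed s e i j) λ s → trans (cong (λ t → T s (s * s) - T (- s) t) (negated-square s))
    (dumbbellT-odd-part s (h s (s * s)) (h (- s) (s * s)) ((s * s) ℤ.^ double (suc e)) ((s * s) ℤ.^ (2 ℕ.+ i)) ((s * s) ℤ.^ (2 ℕ.+ j)))
  where
  h : ℤ → ℤ → ℤ
  h s z = (1ℤ + z) * s ℤ.^ double (suc e)
  T : ℤ → ℤ → ℤ
  T s z = dumbbellT s (h s z) (z ℤ.^ double (suc e)) (z ℤ.^ (2 ℕ.+ i)) (z ℤ.^ (2 ℕ.+ j))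

ringsFun : List ℕ → ℤ → ℤ
ringsFun []       z = 1ℤ
ringsFun (h ∷ hs) z = (1ℤ + z ℤ.^ h) * (1ℤ + z ℤ.^ h) * ringsFun hs z

odds : List ℕ → List ℕ
odds = map (λ j → suc (double j))

halves : List ℕ → List ℕ
halves = map (2 ℕ.+_)

even-rings : ∀ s js → ringsValue (1ℤ - s * s) s (odds js) ≡ ringsFun (halves js) (s * s)
even-rings s []       = refl
even-rings s (j ∷ js) = cong₂ _*_ (even-ring s j) (even-rings s js)

-- Even cycles are even functions of s, so their product factors out of the difference between s and
-- - s. Cancelling 4s at positive integers s leaves an identity at squares.
odd-parts-equal : ∀ {F C : ℤ → ℤ → ℤ} {φ ψ} → OddPart F φ → OddPart C ψ → ∀ js → (∀ Y S → F Y S ≡ C Y S * ringsValue Y S (odds js)) →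
  ∀ n → φ (square n) ≡ ringsFun (halves js) (square n) * ψ (square n)
odd-parts-equal {F} {C} {φ} {ψ} oF oC js eq n = ℤₚ.*-cancelˡ-≡ (+ 4 * s) (φ (s * s)) (W * ψ (s * s)) (begin
  + 4 * s * φ (s * s)                           ≡⟨ sym (oF s) ⟩
  w * (F y s - F y (- s))                       ≡⟨ cong₂ (λ a b → w * (a - b)) (eq y s) (eq y (- s)) ⟩
  w * (C y s * ringsValue y s (odds js) - C y (- s) * ringsValue y (- s) (odds js))
    ≡⟨ cong₂ (λ a b → w * (C y s * a - C y (- s) * b)) (even-rings s js) (trans (cong (λ t → ringsValue (1ℤ - t) (- s) (odds js)) (sym (negated-square s)))
         (trans (even-rings (- s) js) (cong (ringsFun (halves js)) (negated-square s)))) ⟩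
  w * (C y s * W - C y (- s) * W)               ≡⟨ solve 4 (λ w a b W → w :* (a :* W :- b :* W) := W :* (w :* (a :- b))) refl w (C y s) (C y (- s)) W ⟩
  W * (w * (C y s - C y (- s)))                 ≡⟨ cong (W *_) (oC s) ⟩
  W * (+ 4 * s * ψ (s * s))                     ≡⟨ solve 3 (λ W a b → W :* (a :* b) := a :* (W :* b)) refl W (+ 4 * s) (ψ (s * s)) ⟩
  + 4 * s * (W * ψ (s * s))                     ∎)
  where
  s y w W : ℤ
  s = + suc n
  y = 1ℤ - s * s
  w = (1ℤ + s * s) * (1ℤ + s * s) * (1ℤ + s * s)
  W = ringsFun (halves js) (s * s)

-- Low coefficients of the odd parts

shift : ℕ → Poly → Poly
shift zero    f = f
shift (suc e) f = 0ℤ ∷ shift e f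

eval-shift : ∀ e f z → eval (shift e f) z ≡ z ℤ.^ e * eval f z
eval-shift zero    f z = sym (ℤₚ.*-identityˡ (eval f z))
eval-shift (suc e) f z = trans (ℤₚ.+-identityˡ _) (trans (cong (z *_) (eval-shift e f z)) (sym (ℤₚ.*-assoc z (z ℤ.^ e) (eval f z))))

coeff-shift-< : ∀ e f i → i ℕ.< e → coeff (shift e f) i ≡ 0ℤ
coeff-shift-< (suc e) f zero    _        = refl
coeff-shift-< (suc e) f (suc i) (s≤s lt) = coeff-shift-< e f i lt

coeff-shift-+ : ∀ e f i → coeff (shift e f) (e ℕ.+ i) ≡ coeff f i
coeff-shift-+ zero    f i = refl
coeff-shift-+ (suc e) f i = coeff-shift-+ e f i

coeff-shift-all : ∀ {P : ℤ → Set} e f i → P 0ℤ → (∀ j → P (coeff f j)) → P (coeff (shift e f) i)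
coeff-shift-all zero    f i       p₀ p = p i
coeff-shift-all (suc e) f zero    p₀ p = p₀
coeff-shift-all {P} (suc e) f (suc i) p₀ p = coeff-shift-all {P} e f i p₀ p

monomial : ℕ → Poly
monomial e = shift e (1ℤ ∷ [])

eval-monomial : ∀ e z → eval (monomial e) z ≡ z ℤ.^ e
eval-monomial e z = trans (eval-shift e (1ℤ ∷ []) z) (solve 2 (λ z p → p :* (con 1ℤ :+ z :* con 0ℤ) := p) refl z (z ℤ.^ e))

monomial-≥0 : ∀ e i → 0ℤ ℤ.≤ coeff (monomial e) i
monomial-≥0 e i = coeff-shift-all {λ x → 0ℤ ℤ.≤ x} e (1ℤ ∷ []) i ℤₚ.≤-refl λ { zero → ℤ.+≤+ z≤n ; (suc _) → ℤₚ.≤-refl }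

monomial-≤1 : ∀ e i → coeff (monomial e) i ℤ.≤ 1ℤ
monomial-≤1 e i = coeff-shift-all {λ x → x ℤ.≤ 1ℤ} e (1ℤ ∷ []) i (ℤ.+≤+ z≤n) λ { zero → ℤₚ.≤-refl ; (suc _) → ℤ.+≤+ z≤n }

monomial-≢ : ∀ e i → e ≢ i → coeff (monomial e) i ≡ 0ℤ
monomial-≢ zero    zero    ne = ⊥-elim (ne refl)
monomial-≢ zero    (suc i) ne = refl
monomial-≢ (suc e) zero    ne = refl
monomial-≢ (suc e) (suc i) ne = monomial-≢ e i (ne ∘ cong suc)

monomial-pair : ∀ e h → coeff (monomial e) h + coeff (monomial e) (suc h) ℤ.≤ 1ℤ
monomial-pair e h with e ℕₚ.≟ h
... | yes refl = subst (ℤ._≤ 1ℤ) (sym (trans (cong (λ t → coeff (monomial e) e + t) (monomial-≢ e (suc e) (ℕₚ.<⇒≢ (ℕₚ.n<1+n e)))) (ℤₚ.+-identityʳ _))) (monomial-≤1 e e)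
... | no e≢h   = subst (ℤ._≤ 1ℤ) (sym (trans (cong (λ t → t + coeff (monomial e) (suc h)) (monomial-≢ e h e≢h)) (ℤₚ.+-identityˡ _))) (monomial-≤1 e (suc h))

lowest : Poly
lowest = -1ℤ ∷ -[1+ 1 ] ∷ []

lowest-vanishes : ∀ {i} → 2 ℕ.≤ i → coeff lowest i ≡ 0ℤ
lowest-vanishes (s≤s (s≤s _)) = refl

-- A functional of the coefficients of degrees h and h + 1 on polynomials - 1 - 2z + …
record Low (a h : ℕ) (B : ℤ) (f : Poly) : Set where
  constructor low
  field
    constant : coeff f 0 ≡ -1ℤ
    linear   : coeff f 1 ≡ -[1+ 1 ]
    bound    : + a * coeff f h + coeff f (suc h) ℤ.≤ B

-- Multiplication by (1 + z^k)², the value of a cycle of length 2k at z = s². Below degree 2k only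
-- the middle term 2 z^k has an effect.
timesRing : ℕ → Poly → Poly
timesRing k f = f +ₚ (map (+ 2 *_) (shift k f) +ₚ shift (k ℕ.+ k) f)

eval-timesRing : ∀ k f z → eval (timesRing k f) z ≡ (1ℤ + z ℤ.^ k) * (1ℤ + z ℤ.^ k) * eval f z
eval-timesRing k f z = trans (eval-+ₚ f _ z) (trans (cong (λ t → eval f z + t) (trans (eval-+ₚ (map (+ 2 *_) (shift k f)) _ z)
    (cong₂ _+_ (trans (eval-map (+ 2) (shift k f) z) (cong (+ 2 *_) (eval-shift k f z))) (trans (eval-shift (k ℕ.+ k) f z) (cong (_* eval f z) (ℤₚ.^-distribˡ-+-* z k k))))))
  (solve 2 (λ x f → f :+ (con (+ 2) :* (x :* f) :+ x :* x :* f) := (con 1ℤ :+ x) :* (con 1ℤ :+ x) :* f) refl (z ℤ.^ k) (eval f z)))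

coeff-timesRing : ∀ k f i → i ℕ.< k ℕ.+ k → coeff (timesRing k f) i ≡ coeff f i + + 2 * coeff (shift k f) i
coeff-timesRing k f i lt = trans (coeff-+ₚ f _ i) (cong (λ t → coeff f i + t) (trans (coeff-+ₚ (map (+ 2 *_) (shift k f)) _ i)
  (trans (cong₂ _+_ (coeff-map (+ 2) (shift k f) i) (coeff-shift-< (k ℕ.+ k) f i lt)) (ℤₚ.+-identityʳ _))))

coeff-timesRing-< : ∀ k f i → i ℕ.< k → coeff (timesRing k f) i ≡ coeff f i
coeff-timesRing-< k f i lt = trans (coeff-timesRing k f i (ℕₚ.<-≤-trans lt (ℕₚ.m≤m+n k k)))
  (trans (cong (λ t → coeff f i + + 2 * t) (coeff-shift-< k f i lt)) (ℤₚ.+-identityʳ _))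

module _ {a h : ℕ} (2≤h : 2 ℕ.≤ h) where

  private
    head-preserved : ∀ {k B} f → h ℕ.≤ k → Low a h B f → coeff (timesRing k f) 0 ≡ -1ℤ × coeff (timesRing k f) 1 ≡ -[1+ 1 ]
    head-preserved {k} f h≤k (low c l _) = trans (coeff-timesRing-< k f 0 (ℕₚ.≤-trans (s≤s z≤n) 2≤k)) c , trans (coeff-timesRing-< k f 1 2≤k) l
      where
      2≤k : 2 ℕ.≤ k
      2≤k = ℕₚ.≤-trans 2≤h h≤k

    1+h<h+h : suc h ℕ.< h ℕ.+ h
    1+h<h+h = ℕₚ.+-monoˡ-≤ h 2≤h

    decrease : ∀ {x y B} x′ y′ c → + a * x + y ℤ.≤ B → + a * x′ + y′ ℤ.≤ c → + a * (x + x′) + (y + y′) ℤ.≤ B + c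
    decrease {x} {y} {B} x′ y′ c le le′ = subst (ℤ._≤ B + c) (solve 5 (λ a x y x′ y′ → (a :* x :+ y) :+ (a :* x′ :+ y′) := a :* (x :+ x′) :+ (y :+ y′)) refl (+ a) x y x′ y′) (ℤₚ.+-mono-≤ le le′)

  -- The term 2 z^h adds 2·(-1) in degree h and 2·(-2) in degree h + 1, so the functional drops by
  -- 2a + 4, hence by at least 4.
  equal-ring : ∀ {B f} → Low a h B f → Low a h (B - + 4) (timesRing h f)
  equal-ring {B} {f} L = low (proj₁ heads) (proj₂ heads)
    (subst₂ (λ s t → + a * s + t ℤ.≤ B - + 4)
      (sym (trans (coeff-timesRing h f h (ℕₚ.<-trans (ℕₚ.n<1+n h) 1+h<h+h)) (cong (λ t → coeff f h + + 2 * t) (trans (shifted 0 (ℕₚ.+-identityʳ h)) (Low.constant L)))))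
      (sym (trans (coeff-timesRing h f (suc h) 1+h<h+h) (cong (λ t → coeff f (suc h) + + 2 * t) (trans (shifted 1 (ℕₚ.+-comm h 1)) (Low.linear L)))))
      (decrease {coeff f h} {coeff f (suc h)} (+ 2 * -1ℤ) (+ 2 * -[1+ 1 ]) (- + 4) (Low.bound L) (ℤₚ.+-monoˡ-≤ (- + 4) (nonPositive a))))
    where
    heads : coeff (timesRing h f) 0 ≡ -1ℤ × coeff (timesRing h f) 1 ≡ -[1+ 1 ]
    heads = head-preserved f ℕₚ.≤-refl L
    shifted : ∀ i {j} → h ℕ.+ i ≡ j → coeff (shift h f) j ≡ coeff f i
    shifted i refl = coeff-shift-+ h f i
    nonPositive : ∀ a → + a * -[1+ 1 ] ℤ.≤ 0ℤ
    nonPositive zero    = ℤₚ.≤-refl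
    nonPositive (suc a) = ℤ.-≤+

  -- For k > h the ring can reach degree h + 1 only if k = h + 1, and there it adds -2.
  longer-ring : ∀ {k B f} → h ℕ.< k → Low a h B f → Low a h B (timesRing k f)
  longer-ring {k} {B} {f} h<k L = low (proj₁ heads) (proj₂ heads)
    (subst₂ (λ s t → + a * s + t ℤ.≤ B) (sym (coeff-timesRing-< k f h h<k)) (sym (coeff-timesRing k f (suc h) (ℕₚ.<-≤-trans 1+h<h+h (ℕₚ.+-mono-≤ (ℕₚ.<⇒≤ h<k) (ℕₚ.<⇒≤ h<k)))))
      (ℤₚ.≤-trans (ℤₚ.+-monoʳ-≤ (+ a * coeff f h) (ℤₚ.≤-trans (ℤₚ.+-monoʳ-≤ (coeff f (suc h)) (nonPositive (ℕₚ.m≤n⇒m<n∨m≡n h<k))) (ℤₚ.≤-reflexive (ℤₚ.+-identityʳ _)))) (Low.bound L)))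
    where
    heads : coeff (timesRing k f) 0 ≡ -1ℤ × coeff (timesRing k f) 1 ≡ -[1+ 1 ]
    heads = head-preserved f (ℕₚ.<⇒≤ h<k) L
    nonPositive : suc h ℕ.< k ⊎ suc h ≡ k → + 2 * coeff (shift k f) (suc h) ℤ.≤ 0ℤ
    nonPositive (inj₁ lt)   = ℤₚ.≤-reflexive (cong (+ 2 *_) (coeff-shift-< k f (suc h) lt))
    nonPositive (inj₂ refl) = subst (λ t → + 2 * t ℤ.≤ 0ℤ) (sym (trans (trans (cong (coeff (shift (suc h) f)) (sym (ℕₚ.+-identityʳ (suc h)))) (coeff-shift-+ (suc h) f 0)) (Low.constant L))) ℤ.-≤+

  weaken-low : ∀ {B B′ f} → B ℤ.≤ B′ → Low a h B f → Low a h B′ f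
  weaken-low le (low c l b) = low c l (ℤₚ.≤-trans b le)

  any-ring : ∀ {k B f} → h ℕ.≤ k → Low a h B f → Low a h B (timesRing k f)
  any-ring {k} {B} h≤k L with ℕₚ.m≤n⇒m<n∨m≡n h≤k
  ... | inj₁ lt   = longer-ring lt L
  ... | inj₂ refl = weaken-low (ℤₚ.i-j≤i B (+ 4)) (equal-ring L)

  rings-low : ∀ {B f} hs → All (h ℕ.≤_) hs → Low a h B f → Low a h B (foldr timesRing f hs)
  rings-low []       []         L = L
  rings-low (k ∷ hs) (le ∷ les) L = any-ring le (rings-low hs les L)

  shortest-ring-low : ∀ {B f} hs → All (h ℕ.≤_) hs → h ∈ hs → Low a h B f → Low a h (B - + 4) (foldr timesRing f hs)
  shortest-ring-low (_ ∷ hs) (_ ∷ les)  (here refl) L = equal-ring (rings-low hs les L)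
  shortest-ring-low (_ ∷ hs) (le ∷ les) (there h∈)  L = any-ring le (shortest-ring-low hs les h∈ L)

eval-rings : ∀ hs f z → eval (foldr timesRing f hs) z ≡ ringsFun hs z * eval f z
eval-rings []       f z = sym (ℤₚ.*-identityˡ _)
eval-rings (h ∷ hs) f z = trans (eval-timesRing h (foldr timesRing f hs) z) (trans (cong ((1ℤ + z ℤ.^ h) * (1ℤ + z ℤ.^ h) *_) (eval-rings hs f z)) (sym (ℤₚ.*-assoc ((1ℤ + z ℤ.^ h) * (1ℤ + z ℤ.^ h)) (ringsFun hs z) (eval f z))))

minimum : ∀ x xs → ∃[ m ] m ∈ x ∷ xs × All (m ℕ.≤_) (x ∷ xs)
minimum x []       = x , here refl , ℕₚ.≤-refl ∷ []
minimum x (y ∷ ys) with minimum y ys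
... | m , m∈ , all with ℕₚ.≤-total x m
...   | inj₁ x≤m = x , here refl , ℕₚ.≤-refl ∷ All.map (ℕₚ.≤-trans x≤m) all
...   | inj₂ m≤x = m , there m∈ , m≤x ∷ all

thetaPoly : ℕ → ℕ → ℕ → Poly
thetaPoly P Q R = lowest +ₚ (monomial (suc P) +ₚ monomial (suc Q) +ₚ monomial (suc R)) +ₚ (monomial (P ℕ.+ Q) +ₚ monomial (P ℕ.+ R) +ₚ monomial (Q ℕ.+ R))
  +ₚ shift (P ℕ.+ Q ℕ.+ R) (-[1+ 1 ] ∷ -1ℤ ∷ [])

eval-thetaPoly : ∀ P Q R z → eval (thetaPoly P Q R) z ≡ oddTheta z (z ℤ.^ P) (z ℤ.^ Q) (z ℤ.^ R)
eval-thetaPoly P Q R z = trans (eval-+ₚ₄ lowest (monomial (suc P) +ₚ monomial (suc Q) +ₚ monomial (suc R)) (monomial (P ℕ.+ Q) +ₚ monomial (P ℕ.+ R) +ₚ monomial (Q ℕ.+ R)) (shift (P ℕ.+ Q ℕ.+ R) (-[1+ 1 ] ∷ -1ℤ ∷ [])))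
  (trans (cong₂ _+_ (cong₂ _+_ (cong (λ t → eval lowest z + t) (monomials (suc P) (suc Q) (suc R)))
      (trans (monomials (P ℕ.+ Q) (P ℕ.+ R) (Q ℕ.+ R)) (cong₂ _+_ (cong₂ _+_ (ℤₚ.^-distribˡ-+-* z P Q) (ℤₚ.^-distribˡ-+-* z P R)) (ℤₚ.^-distribˡ-+-* z Q R))))
    (trans (eval-shift (P ℕ.+ Q ℕ.+ R) (-[1+ 1 ] ∷ -1ℤ ∷ []) z) (cong (_* eval (-[1+ 1 ] ∷ -1ℤ ∷ []) z) (trans (ℤₚ.^-distribˡ-+-* z (P ℕ.+ Q) R) (cong (_* z ℤ.^ R) (ℤₚ.^-distribˡ-+-* z P Q))))))
    (collect z (z ℤ.^ P) (z ℤ.^ Q) (z ℤ.^ R)))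
  where
  eval-+ₚ₄ : ∀ f g h k → eval (f +ₚ g +ₚ h +ₚ k) z ≡ eval f z + eval g z + eval h z + eval k z
  eval-+ₚ₄ f g h k = trans (eval-+ₚ (f +ₚ g +ₚ h) k z) (cong (λ t → t + eval k z) (trans (eval-+ₚ (f +ₚ g) h z) (cong (λ t → t + eval h z) (eval-+ₚ f g z))))
  monomials : ∀ a b c → eval (monomial a +ₚ monomial b +ₚ monomial c) z ≡ z ℤ.^ a + z ℤ.^ b + z ℤ.^ c
  monomials a b c = trans (eval-+ₚ (monomial a +ₚ monomial b) (monomial c) z) (cong₂ _+_ (trans (eval-+ₚ (monomial a) (monomial b) z) (cong₂ _+_ (eval-monomial a z) (eval-monomial b z))) (eval-monomial c z))
  collect : ∀ z X Y Z → (-1ℤ + z * (-[1+ 1 ] + z * 0ℤ)) + (z * X + z * Y + z * Z) + (X * Y + X * Z + Y * Z) + X * Y * Z * (-[1+ 1 ] + z * (-1ℤ + z * 0ℤ)) ≡ oddTheta z X Y Z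
  collect = solve 4 (λ z X Y Z → (con -1ℤ :+ z :* (con -[1+ 1 ] :+ z :* con 0ℤ)) :+ (z :* X :+ z :* Y :+ z :* Z) :+ (X :* Y :+ X :* Z :+ Y :* Z) :+ X :* Y :* Z :* (con -[1+ 1 ] :+ z :* (con -1ℤ :+ z :* con 0ℤ))
    := :- (con 1ℤ :+ con (+ 2) :* z) :+ z :* (X :+ Y :+ Z) :+ (X :* Y :+ X :* Z :+ Y :* Z) :- (con (+ 2) :+ z) :* (X :* Y :* Z)) refl

module _ (P Q R : ℕ) where

  private
    three : ℕ → ℕ → ℕ → ℕ → ℤ
    three a b c i = coeff (monomial a) i + coeff (monomial b) i + coeff (monomial c) i

    top : ℕ → ℤ
    top = coeff (shift (P ℕ.+ Q ℕ.+ R) (-[1+ 1 ] ∷ -1ℤ ∷ []))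

    three-≥0 : ∀ a b c i → 0ℤ ℤ.≤ three a b c i
    three-≥0 a b c i = ℤₚ.+-mono-≤ (ℤₚ.+-mono-≤ (monomial-≥0 a i) (monomial-≥0 b i)) (monomial-≥0 c i)

    three-≤3 : ∀ a b c i → three a b c i ℤ.≤ + 3
    three-≤3 a b c i = ℤₚ.+-mono-≤ (ℤₚ.+-mono-≤ (monomial-≤1 a i) (monomial-≤1 b i)) (monomial-≤1 c i)

    three-0 : ∀ {a b c i} → a ≢ i → b ≢ i → c ≢ i → three a b c i ≡ 0ℤ
    three-0 {a} {b} {c} {i} a≢ b≢ c≢ = cong₂ _+_ (cong₂ _+_ (monomial-≢ a i a≢) (monomial-≢ b i b≢)) (monomial-≢ c i c≢)

  coeff-thetaPoly : ∀ i → coeff (thetaPoly P Q R) i ≡ coeff lowest i + three (suc P) (suc Q) (suc R) i + three (P ℕ.+ Q) (P ℕ.+ R) (Q ℕ.+ R) i + top i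
  coeff-thetaPoly i = trans (coeff-+ₚ (lowest +ₚ m₁ +ₚ m₂) _ i) (cong (λ t → t + top i) (trans (coeff-+ₚ (lowest +ₚ m₁) m₂ i)
    (cong₂ _+_ (trans (coeff-+ₚ lowest m₁ i) (cong (λ t → coeff lowest i + t) (sum (suc P) (suc Q) (suc R)))) (sum (P ℕ.+ Q) (P ℕ.+ R) (Q ℕ.+ R)))))
    where
    m₁ m₂ : Poly
    m₁ = monomial (suc P) +ₚ monomial (suc Q) +ₚ monomial (suc R)
    m₂ = monomial (P ℕ.+ Q) +ₚ monomial (P ℕ.+ R) +ₚ monomial (Q ℕ.+ R)
    sum : ∀ a b c → coeff (monomial a +ₚ monomial b +ₚ monomial c) i ≡ three a b c i
    sum a b c = trans (coeff-+ₚ (monomial a +ₚ monomial b) (monomial c) i) (cong (λ t → t + coeff (monomial c) i) (coeff-+ₚ (monomial a) (monomial b) i))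

  -- The negative terms are -1 - 2z and the multiple -(2 + z) of z^(P + Q + R); neither reaches the
  -- degrees in question.
  thetaPoly-≥0 : ∀ {i} → 2 ℕ.≤ i → i ℕ.< P ℕ.+ Q ℕ.+ R → 0ℤ ℤ.≤ coeff (thetaPoly P Q R) i
  thetaPoly-≥0 {i} 2≤i i<N = subst (0ℤ ℤ.≤_) (sym (coeff-thetaPoly i))
    (ℤₚ.+-mono-≤ (ℤₚ.+-mono-≤ (ℤₚ.+-mono-≤ (ℤₚ.≤-reflexive (sym (lowest-vanishes 2≤i))) (three-≥0 (suc P) (suc Q) (suc R) i)) (three-≥0 (P ℕ.+ Q) (P ℕ.+ R) (Q ℕ.+ R) i))
      (ℤₚ.≤-reflexive (sym (coeff-shift-< (P ℕ.+ Q ℕ.+ R) _ i i<N))))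

  -- The exponents P + 1, Q + 1, R + 1 are odd and P + Q, P + R, Q + R are even, so at most three of them coincide.
  thetaPoly-low : ∀ i j k → P ≡ double (suc i) → Q ≡ double (suc j) → R ≡ double (suc k) → ∀ {h} → 2 ℕ.≤ h → Low 0 h (+ 3) (thetaPoly P Q R)
  thetaPoly-low i j k refl refl refl {h} 2≤h = low
    (initial 0 (s≤s z≤n)) (initial 1 (s≤s (s≤s z≤n)))
    (subst (ℤ._≤ + 3) (sym (trans (ℤₚ.+-identityˡ _) (coeff-thetaPoly (suc h))))
      (ℤₚ.+-mono-≤ {y = + 3} {v = 0ℤ} (subst (ℤ._≤ + 3) (cong (λ t → t + three (suc P) (suc Q) (suc R) (suc h) + three (P ℕ.+ Q) (P ℕ.+ R) (Q ℕ.+ R) (suc h)) (sym (lowest-vanishes (ℕₚ.m≤n⇒m≤1+n 2≤h))))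
          (subst (λ t → t + three (P ℕ.+ Q) (P ℕ.+ R) (Q ℕ.+ R) (suc h) ℤ.≤ + 3) (sym (ℤₚ.+-identityˡ (three (suc P) (suc Q) (suc R) (suc h)))) (atMost3 (parity (suc h)))))
        (coeff-shift-all {λ x → x ℤ.≤ 0ℤ} (P ℕ.+ Q ℕ.+ R) (-[1+ 1 ] ∷ -1ℤ ∷ []) (suc h) ℤₚ.≤-refl λ { zero → ℤ.-≤+ ; (suc zero) → ℤ.-≤+ ; (suc (suc _)) → ℤₚ.≤-refl })))
    where
    double-+ : ∀ a b → double a ℕ.+ double b ≡ double (a ℕ.+ b)
    double-+ zero    b = refl
    double-+ (suc a) b = cong (λ n → suc (suc n)) (double-+ a b)
    even≢odd : ∀ a b → double a ≢ suc (double b)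
    even≢odd (suc a) (suc b) e = even≢odd a b (ℕₚ.suc-injective (ℕₚ.suc-injective e))
    even-sum : ∀ a b {c} {n} → n ≡ suc (double c) → double a ℕ.+ double b ≢ n
    even-sum a b {c} refl e = even≢odd (a ℕ.+ b) c (trans (sym (double-+ a b)) e)
    odd-double : ∀ a {c n} → n ≡ double c → suc (double a) ≢ n
    odd-double a {c} refl e = even≢odd c a (sym e)
    above : ∀ {e d} → suc d ℕ.≤ e → e ≢ d
    above lt refl = ℕₚ.<-irrefl refl lt
    initial : ∀ d → d ℕ.< 2 → coeff (thetaPoly P Q R) d ≡ coeff lowest d
    initial d d<2 = trans (coeff-thetaPoly d) (trans (cong₂ (λ a b → a + b) (cong₂ (λ a b → coeff lowest d + a + b)
        (three-0 {suc P} {suc Q} {suc R} (above (big (ℕₚ.n≤1+n 2) (s≤s (s≤s (s≤s z≤n))))) (above (big (ℕₚ.n≤1+n 2) (s≤s (s≤s (s≤s z≤n))))) (above (big (ℕₚ.n≤1+n 2) (s≤s (s≤s (s≤s z≤n))))))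
        (three-0 {P ℕ.+ Q} {P ℕ.+ R} {Q ℕ.+ R} (above (big ℕₚ.≤-refl (s≤s (s≤s z≤n)))) (above (big ℕₚ.≤-refl (s≤s (s≤s z≤n)))) (above (big ℕₚ.≤-refl (s≤s (s≤s z≤n))))))
        (coeff-shift-< (P ℕ.+ Q ℕ.+ R) (-[1+ 1 ] ∷ -1ℤ ∷ []) d (big ℕₚ.≤-refl (s≤s (s≤s z≤n)))))
      (solve 1 (λ x → x :+ con 0ℤ :+ con 0ℤ :+ con 0ℤ := x) refl (coeff lowest d)))
      where
      big : ∀ {c e} → 2 ℕ.≤ c → c ℕ.≤ e → d ℕ.< e
      big le le′ = ℕₚ.≤-trans d<2 (ℕₚ.≤-trans le le′)
    atMost3 : ∃[ l ] (suc h ≡ double l ⊎ suc h ≡ suc (double l)) → three (suc P) (suc Q) (suc R) (suc h) + three (P ℕ.+ Q) (P ℕ.+ R) (Q ℕ.+ R) (suc h) ℤ.≤ + 3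
    atMost3 (l , inj₁ e) = subst (λ t → t + three (P ℕ.+ Q) (P ℕ.+ R) (Q ℕ.+ R) (suc h) ℤ.≤ + 3) (sym (three-0 {suc P} {suc Q} {suc R} (odd-double (suc i) e) (odd-double (suc j) e) (odd-double (suc k) e)))
      (subst (ℤ._≤ + 3) (sym (ℤₚ.+-identityˡ _)) (three-≤3 (P ℕ.+ Q) (P ℕ.+ R) (Q ℕ.+ R) (suc h)))
    atMost3 (l , inj₂ e) = subst (λ t → three (suc P) (suc Q) (suc R) (suc h) + t ℤ.≤ + 3) (sym (three-0 {P ℕ.+ Q} {P ℕ.+ R} {Q ℕ.+ R} (even-sum (suc i) (suc j) e) (even-sum (suc i) (suc k) e) (even-sum (suc j) (suc k) e)))
      (subst (ℤ._≤ + 3) (sym (ℤₚ.+-identityʳ _)) (three-≤3 (suc P) (suc Q) (suc R) (suc h)))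

private
  polyFun-power : ∀ e → PolyFun (λ z → z ℤ.^ e)
  polyFun-power e = polyFun (monomial e) (eval-monomial e)

  pairLow : ℕ → Poly
  pairLow a = shift a (-1ℤ ∷ -1ℤ ∷ [])

  pairLow-≤0 : ∀ a i → coeff (pairLow a) i ℤ.≤ 0ℤ
  pairLow-≤0 a i = coeff-shift-all {λ x → x ℤ.≤ 0ℤ} a (-1ℤ ∷ -1ℤ ∷ []) i ℤₚ.≤-refl λ { zero → ℤ.-≤+ ; (suc zero) → ℤ.-≤+ ; (suc (suc _)) → ℤₚ.≤-refl }

  pairLow-sum : ∀ a → coeff (pairLow a) a + coeff (pairLow a) (suc a) ≡ -[1+ 1 ]
  pairLow-sum a = cong₂ _+_ (trans (cong (coeff (pairLow a)) (sym (ℕₚ.+-identityʳ a))) (coeff-shift-+ a _ 0)) (trans (cong (coeff (pairLow a)) (sym (ℕₚ.+-comm a 1))) (coeff-shift-+ a _ 1))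

module DumbbellPoly (P a b : ℕ) (2≤P : 2 ℕ.≤ P) (2≤a : 2 ℕ.≤ a) (2≤b : 2 ℕ.≤ b) where

  private
    F₁ F₂ F₃ : ℤ → ℤ → ℤ → ℤ → ℤ
    F₁ z X K L = (1ℤ + + 2 * z + -1ℤ * z * X) * (1ℤ + -1ℤ * L * L) + -1ℤ * (1ℤ + z) * (1ℤ + -1ℤ * X) * (1ℤ + -1ℤ * L + -[1+ 1 ] * L * L)
    F₂ z X K L = 1ℤ + + 2 * z + -1ℤ * z * X + -1ℤ * (1ℤ + z) * (1ℤ + -1ℤ * X) * (1ℤ + -1ℤ * K)
    F₃ z X K L = 1ℤ + z

    -- Besides -1 - 2z, the terms of possibly low degree are zX and -(1 + z) times K or L. All
    -- others carry K², L², XK or XL, whose degree exceeds h + 1 when h is at most both a and b.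
    split : ∀ z X K L → oddDumbbell z X K L ≡ (-1ℤ + z * (-[1+ 1 ] + z * 0ℤ)) + z * X + K * (-1ℤ + z * (-1ℤ + z * 0ℤ)) + L * (-1ℤ + z * (-1ℤ + z * 0ℤ))
      + (K * K * F₁ z X K L + L * L * F₂ z X K L + X * K * F₃ z X K L + X * L * F₃ z X K L)
    split = solve 4 (λ z X K L → let o = con 1ℤ ; t = con (+ 2) ; m = con -1ℤ in
      (o :- K :* K) :* (o :- L :* L) :* (z :* X :- (o :+ t :* z)) :- (o :+ z) :* (o :- X) :* ((K :+ K :* K) :* (o :- L :* L) :+ (L :+ L :* L) :* (o :- K :* K))
      := (m :+ z :* (con -[1+ 1 ] :+ z :* con 0ℤ)) :+ z :* X :+ K :* (m :+ z :* (m :+ z :* con 0ℤ)) :+ L :* (m :+ z :* (m :+ z :* con 0ℤ))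
        :+ (K :* K :* ((o :+ t :* z :+ m :* z :* X) :* (o :+ m :* L :* L) :+ m :* (o :+ z) :* (o :+ m :* X) :* (o :+ m :* L :+ con -[1+ 1 ] :* L :* L))
          :+ L :* L :* (o :+ t :* z :+ m :* z :* X :+ m :* (o :+ z) :* (o :+ m :* X) :* (o :+ m :* K)) :+ X :* K :* (o :+ z) :+ X :* L :* (o :+ z))) refl

    infixl 6 _⊞_
    infixl 7 _⊠_
    _⊞_ : ∀ {φ ψ} → PolyFun φ → PolyFun ψ → PolyFun (λ z → φ z + ψ z)
    _⊞_ = polyFun-+
    _⊠_ : ∀ {φ ψ} → PolyFun φ → PolyFun ψ → PolyFun (λ z → φ z * ψ z)
    _⊠_ = polyFun-*
    κ : ∀ c → PolyFun (λ _ → c)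
    κ = polyFun-con
    ζ : PolyFun id
    ζ = polyFun-id
    X′ : PolyFun (λ z → z ℤ.^ P)
    X′ = polyFun-power P
    K′ : PolyFun (λ z → z ℤ.^ a)
    K′ = polyFun-power a
    L′ : PolyFun (λ z → z ℤ.^ b)
    L′ = polyFun-power b

    P₁ : PolyFun (λ z → F₁ z (z ℤ.^ P) (z ℤ.^ a) (z ℤ.^ b))
    P₁ = (κ 1ℤ ⊞ κ (+ 2) ⊠ ζ ⊞ κ -1ℤ ⊠ ζ ⊠ X′) ⊠ (κ 1ℤ ⊞ κ -1ℤ ⊠ L′ ⊠ L′) ⊞ κ -1ℤ ⊠ (κ 1ℤ ⊞ ζ) ⊠ (κ 1ℤ ⊞ κ -1ℤ ⊠ X′) ⊠ (κ 1ℤ ⊞ κ -1ℤ ⊠ L′ ⊞ κ -[1+ 1 ] ⊠ L′ ⊠ L′)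
    P₂ : PolyFun (λ z → F₂ z (z ℤ.^ P) (z ℤ.^ a) (z ℤ.^ b))
    P₂ = κ 1ℤ ⊞ κ (+ 2) ⊠ ζ ⊞ κ -1ℤ ⊠ ζ ⊠ X′ ⊞ κ -1ℤ ⊠ (κ 1ℤ ⊞ ζ) ⊠ (κ 1ℤ ⊞ κ -1ℤ ⊠ X′) ⊠ (κ 1ℤ ⊞ κ -1ℤ ⊠ K′)
    P₃ : PolyFun (λ z → 1ℤ + z)
    P₃ = κ 1ℤ ⊞ ζ

    sum₅ : Poly → Poly → Poly → Poly → Poly → Poly
    sum₅ f g h k l = f +ₚ g +ₚ h +ₚ k +ₚ l

    high : Poly
    high = shift (a ℕ.+ a) (PolyFun.poly P₁) +ₚ shift (b ℕ.+ b) (PolyFun.poly P₂) +ₚ shift (P ℕ.+ a) (PolyFun.poly P₃) +ₚ shift (P ℕ.+ b) (PolyFun.poly P₃)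

  dumbbellPoly : Poly
  dumbbellPoly = sum₅ lowest (monomial (suc P)) (pairLow a) (pairLow b) high

  eval-dumbbellPoly : ∀ z → eval dumbbellPoly z ≡ oddDumbbell z (z ℤ.^ P) (z ℤ.^ a) (z ℤ.^ b)
  eval-dumbbellPoly z = trans (cong₂′ (eval-+ₚ₄ lowest (monomial (suc P)) (pairLow a) (pairLow b)) (eval-+ₚ₄ (shift (a ℕ.+ a) (PolyFun.poly P₁)) (shift (b ℕ.+ b) (PolyFun.poly P₂)) (shift (P ℕ.+ a) (PolyFun.poly P₃)) (shift (P ℕ.+ b) (PolyFun.poly P₃))))
    (trans (cong₂ _+_
        (cong₂ _+_ (cong₂ _+_ (cong (λ t → eval lowest z + t) (eval-monomial (suc P) z)) (eval-shift a (-1ℤ ∷ -1ℤ ∷ []) z)) (eval-shift b (-1ℤ ∷ -1ℤ ∷ []) z))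
        (cong₂ _+_ (cong₂ _+_ (cong₂ _+_ (product a a P₁) (product b b P₂)) (product P a P₃)) (product P b P₃)))
      (sym (split z (z ℤ.^ P) (z ℤ.^ a) (z ℤ.^ b))))
    where
    eval-+ₚ₄ : ∀ f g h k → eval (f +ₚ g +ₚ h +ₚ k) z ≡ eval f z + eval g z + eval h z + eval k z
    eval-+ₚ₄ f g h k = trans (eval-+ₚ (f +ₚ g +ₚ h) k z) (cong (λ t → t + eval k z) (trans (eval-+ₚ (f +ₚ g) h z) (cong (λ t → t + eval h z) (eval-+ₚ f g z))))
    cong₂′ : ∀ {s t} → eval (lowest +ₚ monomial (suc P) +ₚ pairLow a +ₚ pairLow b) z ≡ s → eval high z ≡ t → eval dumbbellPoly z ≡ s + t
    cong₂′ e e′ = trans (eval-+ₚ (lowest +ₚ monomial (suc P) +ₚ pairLow a +ₚ pairLow b) high z) (cong₂ _+_ e e′)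
    product : ∀ c d {φ} (F : PolyFun φ) → eval (shift (c ℕ.+ d) (PolyFun.poly F)) z ≡ z ℤ.^ c * z ℤ.^ d * φ z
    product c d F = trans (eval-shift (c ℕ.+ d) (PolyFun.poly F) z) (cong₂ _*_ (ℤₚ.^-distribˡ-+-* z c d) (PolyFun.values F z))

  private
    module _ {h : ℕ} (2≤h : 2 ℕ.≤ h) (h≤a : h ℕ.≤ a) (h≤b : h ℕ.≤ b) where

      coefficient : ∀ i → i ℕ.≤ suc h → coeff dumbbellPoly i ≡ coeff lowest i + coeff (monomial (suc P)) i + coeff (pairLow a) i + coeff (pairLow b) i
      coefficient i i≤ = trans (coeff-+ₚ (lowest +ₚ monomial (suc P) +ₚ pairLow a +ₚ pairLow b) high i) (trans (cong₂ _+_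
          (trans (coeff-+ₚ (lowest +ₚ monomial (suc P) +ₚ pairLow a) (pairLow b) i) (cong (λ t → t + coeff (pairLow b) i)
            (trans (coeff-+ₚ (lowest +ₚ monomial (suc P)) (pairLow a) i) (cong (λ t → t + coeff (pairLow a) i) (coeff-+ₚ lowest (monomial (suc P)) i)))))
          high-vanishes)
        (ℤₚ.+-identityʳ _))
        where
        beyond : ∀ {c d} → 2 ℕ.≤ c → h ℕ.≤ d → i ℕ.< c ℕ.+ d
        beyond 2≤c h≤d = ℕₚ.≤-trans (s≤s i≤) (ℕₚ.+-mono-≤ 2≤c h≤d)
        high-vanishes : coeff high i ≡ 0ℤ
        high-vanishes = trans (coeff-+ₚ (h₁ +ₚ h₂ +ₚ h₃) h₄ i) (cong₂ _+_ (trans (coeff-+ₚ (h₁ +ₚ h₂) h₃ i) (cong₂ _+_ (trans (coeff-+ₚ h₁ h₂ i)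
          (cong₂ _+_ (coeff-shift-< (a ℕ.+ a) _ i (beyond 2≤a h≤a)) (coeff-shift-< (b ℕ.+ b) _ i (beyond 2≤b h≤b)))) (coeff-shift-< (P ℕ.+ a) _ i (beyond 2≤P h≤a)))) (coeff-shift-< (P ℕ.+ b) _ i (beyond 2≤P h≤b)))
          where
          h₁ h₂ h₃ h₄ : Poly
          h₁ = shift (a ℕ.+ a) (PolyFun.poly P₁)
          h₂ = shift (b ℕ.+ b) (PolyFun.poly P₂)
          h₃ = shift (P ℕ.+ a) (PolyFun.poly P₃)
          h₄ = shift (P ℕ.+ b) (PolyFun.poly P₃)

      initial : ∀ d → d ℕ.< 2 → coeff dumbbellPoly d ≡ coeff lowest d
      initial d d<2 = trans (coefficient d (ℕₚ.≤-trans (ℕₚ.<⇒≤ d<2) (ℕₚ.m≤n⇒m≤1+n 2≤h))) (trans (cong₂ _+_ (cong₂ _+_ (cong (λ t → coeff lowest d + t)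
          (coeff-shift-< (suc P) _ d (ℕₚ.≤-trans d<2 (ℕₚ.m≤n⇒m≤1+n 2≤P)))) (coeff-shift-< a _ d (ℕₚ.≤-trans d<2 2≤a))) (coeff-shift-< b _ d (ℕₚ.≤-trans d<2 2≤b)))
        (solve 1 (λ x → x :+ con 0ℤ :+ con 0ℤ :+ con 0ℤ := x) refl (coeff lowest d)))

      functional : ∀ {A B} → coeff (pairLow a) h + coeff (pairLow a) (suc h) ℤ.≤ A → coeff (pairLow b) h + coeff (pairLow b) (suc h) ℤ.≤ B → Low 1 h (1ℤ + A + B) dumbbellPoly
      functional {A} {B} boundA boundB = low (initial 0 (s≤s z≤n)) (initial 1 (s≤s (s≤s z≤n)))
        (subst (ℤ._≤ 1ℤ + A + B) (sym (trans (cong₂ (λ s t → 1ℤ * s + t) (trans (coefficient h (ℕₚ.n≤1+n h)) (cong (λ t → t + m h + pa h + pb h) (lowest-vanishes 2≤h)))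
            (trans (coefficient (suc h) ℕₚ.≤-refl) (cong (λ t → t + m (suc h) + pa (suc h) + pb (suc h)) (lowest-vanishes (ℕₚ.m≤n⇒m≤1+n 2≤h)))))
          (solve 6 (λ x y z x′ y′ z′ → con 1ℤ :* (con 0ℤ :+ x :+ y :+ z) :+ (con 0ℤ :+ x′ :+ y′ :+ z′) := (x :+ x′) :+ (y :+ y′) :+ (z :+ z′)) refl (m h) (pa h) (pb h) (m (suc h)) (pa (suc h)) (pb (suc h)))))
          (ℤₚ.+-mono-≤ (ℤₚ.+-mono-≤ (monomial-pair (suc P) h) boundA) boundB))
        where
        m pa pb : ℕ → ℤ
        m = coeff (monomial (suc P))
        pa = coeff (pairLow a)
        pb = coeff (pairLow b)

    pair-≤0 : ∀ c h → coeff (pairLow c) h + coeff (pairLow c) (suc h) ℤ.≤ 0ℤ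
    pair-≤0 c h = ℤₚ.+-mono-≤ (pairLow-≤0 c h) (pairLow-≤0 c (suc h))

  -- The functional adds the coefficients of degrees h and h + 1. The monomial z^(P + 1) contributes
  -- at most 1, a cycle of the dumbbell with half-length h contributes -2, and a separate one at
  -- most -4.
  rings-dumbbell-low : ∀ {h} hs → 2 ℕ.≤ h → h ∈ a ∷ b ∷ hs → All (h ℕ.≤_) (a ∷ b ∷ hs) → Low 1 h -1ℤ (foldr timesRing dumbbellPoly hs)
  rings-dumbbell-low hs 2≤h (here refl) (h≤a ∷ h≤b ∷ all) = rings-low 2≤h hs all (functional 2≤h h≤a h≤b (ℤₚ.≤-reflexive (pairLow-sum a)) (pair-≤0 b a))
  rings-dumbbell-low hs 2≤h (there (here refl)) (h≤a ∷ h≤b ∷ all) = rings-low 2≤h hs all (functional 2≤h h≤a h≤b (pair-≤0 a b) (ℤₚ.≤-reflexive (pairLow-sum b)))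
  rings-dumbbell-low {h} hs 2≤h (there (there h∈)) (h≤a ∷ h≤b ∷ all) =
    weaken-low 2≤h (ℤ.-≤- z≤n) (shortest-ring-low 2≤h hs all h∈ (functional 2≤h h≤a h≤b (pair-≤0 a h) (pair-≤0 b h)))

-- In degrees h and h + 1 the coefficients of a theta polynomial are nonnegative, so a functional
-- with nonnegative weights cannot be negative on it.
theta-not-low : ∀ {P Q R a h f} → 2 ℕ.≤ h → suc h ℕ.< P ℕ.+ Q ℕ.+ R → thetaPoly P Q R ≈ₚ f → ¬ Low a h -1ℤ f
theta-not-low {P} {Q} {R} {a} {h} {f} 2≤h lt eq L = absurd (ℤₚ.≤-trans (ℤₚ.+-mono-≤ (scaled a (nonNegative h 2≤h (ℕₚ.<-trans (ℕₚ.n<1+n h) lt))) (nonNegative (suc h) (ℕₚ.m≤n⇒m≤1+n 2≤h) lt)) (Low.bound L))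
  where
  nonNegative : ∀ i → 2 ℕ.≤ i → i ℕ.< P ℕ.+ Q ℕ.+ R → 0ℤ ℤ.≤ coeff f i
  nonNegative i le lt = subst (0ℤ ℤ.≤_) (eq i) (thetaPoly-≥0 P Q R le lt)
  scaled : ∀ a {x} → 0ℤ ℤ.≤ x → 0ℤ ℤ.≤ + a * x
  scaled a {x} le = subst (ℤ._≤ + a * x) (ℤₚ.*-zeroʳ (+ a)) (ℤₚ.*-monoˡ-≤-nonNeg (+ a) le)
  absurd : ¬ 0ℤ ℤ.≤ -1ℤ
  absurd ()

-- Exclusion of even cycles and even dumbbells

private
  2≤half : ∀ {h} js → h ∈ halves js → 2 ℕ.≤ h
  2≤half (j ∷ js) (here refl) = s≤s (s≤s z≤n)
  2≤half (j ∷ js) (there h∈)  = 2≤half js h∈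

no-even-rings : ∀ i j k i′ j′ k′ js → let N = double (suc i) ℕ.+ double (suc j) ℕ.+ double (suc k) in
  (∀ Y S → thetaValue Y S (suc (double i)) (suc (double j)) (suc (double k)) ≡ thetaValue Y S (suc (double i′)) (suc (double j′)) (suc (double k′)) * ringsValue Y S (odds js)) →
  All (λ h → suc h ℕ.< N) (halves js) → js ≡ []
no-even-rings i j k i′ j′ k′ []       eq bounds = refl
no-even-rings i j k i′ j′ k′ (l ∷ js) eq bounds = ⊥-elim (impossible (minimum (2 ℕ.+ l) (halves js)))
  where
  P Q R P′ Q′ R′ : ℕ
  P = double (suc i)
  Q = double (suc j)
  R = double (suc k)
  P′ = double (suc i′)
  Q′ = double (suc j′)
  R′ = double (suc k′)
  hs : List ℕ
  hs = halves (l ∷ js)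
  equal : thetaPoly P Q R ≈ₚ foldr timesRing (thetaPoly P′ Q′ R′) hs
  equal = poly-equal (thetaPoly P Q R) (foldr timesRing (thetaPoly P′ Q′ R′) hs) λ n → trans (eval-thetaPoly P Q R (square n))
    (trans (odd-parts-equal {λ Y S → thetaValue Y S (suc (double i)) (suc (double j)) (suc (double k))} {λ Y S → thetaValue Y S (suc (double i′)) (suc (double j′)) (suc (double k′))}
        {λ z → oddTheta z (z ℤ.^ P) (z ℤ.^ Q) (z ℤ.^ R)} {λ z → oddTheta z (z ℤ.^ P′) (z ℤ.^ Q′) (z ℤ.^ R′)} (theta-odd-part i j k) (theta-odd-part i′ j′ k′) (l ∷ js) eq n)
      (sym (trans (eval-rings hs (thetaPoly P′ Q′ R′) (square n)) (cong (ringsFun hs (square n) *_) (eval-thetaPoly P′ Q′ R′ (square n))))))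
  impossible : ∃[ h ] h ∈ hs × All (h ℕ.≤_) hs → ⊥
  -- At most 3 monomials meet in degree h + 1, and the shortest cycle subtracts 4; the bound is 3 -
  -- 4 = -1.
  impossible (h , h∈ , least) = theta-not-low {P} {Q} {R} 2≤h (All.lookup bounds h∈) equal
    (shortest-ring-low 2≤h hs least h∈ (thetaPoly-low P′ Q′ R′ i′ j′ k′ refl refl refl 2≤h))
    where
    2≤h : 2 ℕ.≤ h
    2≤h = 2≤half (l ∷ js) h∈

no-even-dumbbell : ∀ i j k e a b js → let N = double (suc i) ℕ.+ double (suc j) ℕ.+ double (suc k) in
  (∀ Y S → thetaValue Y S (suc (double i)) (suc (double j)) (suc (double k)) ≡ dumbbellValue Y S (suc (double e)) (suc (double a)) (suc (double b)) * ringsValue Y S (odds js)) →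
  All (λ h → suc h ℕ.< N) (halves (a ∷ b ∷ js)) → ⊥
no-even-dumbbell i j k e a b js eq bounds = impossible (minimum (2 ℕ.+ a) (halves (b ∷ js)))
  where
  P Q R E A B : ℕ
  P = double (suc i)
  Q = double (suc j)
  R = double (suc k)
  E = double (suc e)
  A = 2 ℕ.+ a
  B = 2 ℕ.+ b
  open DumbbellPoly E A B (s≤s (s≤s z≤n)) (s≤s (s≤s z≤n)) (s≤s (s≤s z≤n))
  equal : thetaPoly P Q R ≈ₚ foldr timesRing dumbbellPoly (halves js)
  equal = poly-equal (thetaPoly P Q R) (foldr timesRing dumbbellPoly (halves js)) λ n → trans (eval-thetaPoly P Q R (square n))
    (trans (odd-parts-equal {λ Y S → thetaValue Y S (suc (double i)) (suc (double j)) (suc (double k))} {λ Y S → dumbbellValue Y S (suc (double e)) (suc (double a)) (suc (double b))}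
        {λ z → oddTheta z (z ℤ.^ P) (z ℤ.^ Q) (z ℤ.^ R)} {λ z → oddDumbbell z (z ℤ.^ E) (z ℤ.^ A) (z ℤ.^ B)} (theta-odd-part i j k) (dumbbell-odd-part e a b) js eq n)
      (sym (trans (eval-rings (halves js) dumbbellPoly (square n)) (cong (ringsFun (halves js) (square n) *_) (eval-dumbbellPoly (square n))))))
  impossible : ∃[ h ] h ∈ A ∷ B ∷ halves js × All (h ℕ.≤_) (A ∷ B ∷ halves js) → ⊥
  impossible (h , h∈ , least) = theta-not-low {P} {Q} {R} 2≤h (All.lookup bounds h∈) equal (rings-dumbbell-low (halves js) 2≤h h∈ least)
    where
    2≤h : 2 ℕ.≤ h
    2≤h = 2≤half (a ∷ b ∷ js) h∈

-- The components of a graph with the polynomial of a theta graph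

sumL-↭ : ∀ {A : Set} (f : A → ℤ) {xs ys} → xs ↭ ys → sumL f xs ≡ sumL f ys
sumL-↭ f _↭_.refl = refl
sumL-↭ f (prep x p) = cong (λ t → f x + t) (sumL-↭ f p)
sumL-↭ f (swap x y p) = trans (cong (λ t → f x + (f y + t)) (sumL-↭ f p)) (solve 3 (λ a b c → a :+ (b :+ c) := b :+ (a :+ c)) refl (f x) (f y) _)
sumL-↭ f (_↭_.trans p q) = trans (sumL-↭ f p) (sumL-↭ f q)

-- The two hypotheses of `find-shape`, available for a known shape; equality of the degree sums
-- carries them over to H.
Shape-degrees : ∀ {n} {H : Graph n} {ks} → Shape H ks →
  sumL (λ i → + degree H i * + degree H i) (allFin n) - + 5 * sumL (λ i → + degree H i) (allFin n) + + 6 * + length (allFin n) ≡ 0ℤ ×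
  sumL (λ i → + degree H i) (allFin n) ≡ + 2 * + length (allFin n) + + 2
Shape-degrees {n} {H} s =
    trans (cong₂ _+_ (cong₂ (λ a b → a - + 5 * b) squares-value degrees-value) (cong (λ t → + 6 * + t) (sym (↭ₚ.↭-length order))))
      (solve 1 (λ l → con (+ 9) :+ (con (+ 9) :+ con (+ 4) :* l) :- con (+ 5) :* (con (+ 3) :+ (con (+ 3) :+ con (+ 2) :* l)) :+ con (+ 6) :* (con (+ 2) :+ l) := con 0ℤ) refl (+ length L)) ,
  trans degrees-value (trans (solve 1 (λ l → con (+ 3) :+ (con (+ 3) :+ con (+ 2) :* l) := con (+ 2) :* (con (+ 2) :+ l) :+ con (+ 2)) refl (+ length L)) (cong (λ t → + 2 * + t + + 2) (↭ₚ.↭-length order)))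
  where
  open Shape s
  squares degrees : List (Fin n) → ℤ
  squares = sumL (λ i → + degree H i * + degree H i)
  degrees = sumL (λ i → + degree H i)
  constant : ∀ (φ : ℕ → ℤ) xs → All (λ x → degree H x ≡ 2) xs → sumL (φ ∘ degree H) xs ≡ φ 2 * + length xs
  constant φ []       []       = sym (ℤₚ.*-zeroʳ (φ 2))
  constant φ (x ∷ xs) (e ∷ es) = trans (cong₂ _+_ (cong φ e) (constant φ xs es)) (solve 2 (λ c l → c :+ c :* l := c :* (con 1ℤ :+ l)) refl (φ 2) (+ length xs))
  squares-value : squares (allFin n) ≡ + 9 + (+ 9 + + 4 * + length L)
  squares-value = trans (sumL-↭ _ (↭-sym order)) (cong₂ (λ x y → + x * + x + y) degree-a (cong₂ (λ x y → + x * + x + y) degree-b (constant (λ d → + d * + d) L degree-L)))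
  degrees-value : degrees (allFin n) ≡ + 3 + (+ 3 + + 2 * + length L)
  degrees-value = trans (sumL-↭ _ (↭-sym order)) (cong₂ (λ x y → + x + y) degree-a (cong₂ (λ x y → + x + y) degree-b (constant +_ L degree-L)))

all-odd : ∀ rs → All Odd rs → ∃[ js ] rs ≡ odds js
all-odd []       []               = [] , refl
all-odd (_ ∷ rs) ((j , refl) ∷ o) = let (js , e) = all-odd rs o in j ∷ js , cong (suc (double j) ∷_) e

j≤double : ∀ j → j ℕ.≤ double j
j≤double zero    = z≤n
j≤double (suc j) = s≤s (ℕₚ.m≤n⇒m≤1+n (j≤double j))

-- The cycles fit into the graph, so degrees h and h + 1 stay below the total length of the three
-- paths, where the theta polynomial can become negative again.
half-bounds : ∀ p q r js → All (λ m → 2 ℕ.+ m ℕ.≤ p ℕ.+ q ℕ.+ r) (odds js) → All (λ h → suc h ℕ.< suc p ℕ.+ suc q ℕ.+ suc r) (halves js)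
half-bounds p q r []       []       = []
half-bounds p q r (j ∷ js) (b ∷ bs) = ℕₚ.≤-trans (s≤s (ℕₚ.≤-trans (s≤s (s≤s (s≤s (j≤double j)))) b))
    (s≤s (ℕₚ.+-mono-≤ (ℕₚ.+-monoʳ-≤ p (ℕₚ.n≤1+n q)) (ℕₚ.n≤1+n r))) ∷ half-bounds p q r js bs

module _ {p q r : ℕ} where

  -- A nonzero constant term at Y = 0, S = 1 settles the matter. If it is 0, both theta graphs have
  -- three even paths; signs then exclude odd cycles and odd parts exclude even ones.
  only-theta : ∀ {p′ q′ r′ rs} → (∀ Y S → thetaValue Y S p q r ≡ thetaValue Y S p′ q′ r′ * ringsValue Y S rs) → All (λ m → 2 ℕ.+ m ℕ.≤ p ℕ.+ q ℕ.+ r) rs → rs ≡ []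
  only-theta {p′} {q′} {r′} {rs} eq bounds = cases (ThetaJet.half T ℕₚ.≟ 0)
    where
    T : ThetaJet p q r
    T = theta-table p q r
    T′ : ThetaJet p′ q′ r′
    T′ = theta-table p′ q′ r′
    open ThetaJet
    positive : half T′ ≡ 1 → ∃[ b ] slope T′ ≡ + suc b
    positive e = _ , proj₂ (half≡1 T′ e)
    all-even : Odd p × Odd q × Odd r → Odd p′ × Odd q′ × Odd r′ → rs ≡ []
    all-even ((i , refl) , (j , refl) , (k , refl)) ((i′ , refl) , (j′ , refl) , (k′ , refl)) =
      conclude (all-odd rs (all-odd-rings i j k {λ y → thetaValue y -1ℤ p′ q′ r′} rs (theta-polyFun -1ℤ p′ q′ r′) (λ y → eq y -1ℤ)))
      where
      conclude : ∃[ js ] rs ≡ odds js → rs ≡ []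
      conclude (js , e) = trans e (cong odds (no-even-rings i j k i′ j′ k′ js (λ Y S → trans (eq Y S) (cong (λ t → thetaValue Y S p′ q′ r′ * ringsValue Y S t) e))
        (half-bounds p q r js (subst (All (λ m → 2 ℕ.+ m ℕ.≤ p ℕ.+ q ℕ.+ r)) e bounds))))
    cases : Dec (half T ≡ 0) → rs ≡ []
    cases (no ne) = proj₁ (no-rings T {core = λ y → thetaValue y 1ℤ p′ q′ r′} (λ y → eq y 1ℤ) {half T′} {slope T′} (jets T′) ne positive)
    cases (yes e) = all-even (half≡0 T e) (half≡0 T′ (core-zero T {core = λ y → thetaValue y 1ℤ p′ q′ r′} {rs} (λ y → eq y 1ℤ) {half T′} {slope T′} (jets T′) e))

  no-dumbbell : ∀ {p′ i j rs} → (∀ Y S → thetaValue Y S p q r ≡ dumbbellValue Y S p′ i j * ringsValue Y S rs) → All (λ m → 2 ℕ.+ m ℕ.≤ p ℕ.+ q ℕ.+ r) (i ∷ j ∷ rs) →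
    p ℕ.+ q ℕ.+ r ≡ p′ ℕ.+ (2 ℕ.+ i ℕ.+ (2 ℕ.+ j ℕ.+ total (3 ℕ.+_) rs)) → ⊥
  no-dumbbell {p′} {i} {j} {rs} eq bounds size = cases (ThetaJet.half T ℕₚ.≟ 0)
    where
    T : ThetaJet p q r
    T = theta-table p q r
    D : DumbbellJet p′ i j
    D = dumbbell-table p′ i j
    module T = ThetaJet T
    module D = DumbbellJet D
    positive : D.half ≡ 1 → ∃[ b ] D.slope ≡ + suc b
    positive e = _ , D.half≡1 e
    all-even : Odd p × Odd q × Odd r → Odd p′ × Odd i × Odd j → ⊥
    all-even ((a , refl) , (b , refl) , (c , refl)) ((e , refl) , (k , refl) , (l , refl)) =
      conclude (all-odd rs (all-odd-rings a b c {λ y → dumbbellValue y -1ℤ p′ i j} rs (dumbbell-polyFun -1ℤ p′ i j) (λ y → eq y -1ℤ)))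
      where
      conclude : ∃[ js ] rs ≡ odds js → ⊥
      conclude (js , o) = no-even-dumbbell a b c e k l js (λ Y S → trans (eq Y S) (cong (λ t → dumbbellValue Y S p′ i j * ringsValue Y S t) o))
        (half-bounds p q r (k ∷ l ∷ js) (subst (λ t → All (λ m → 2 ℕ.+ m ℕ.≤ p ℕ.+ q ℕ.+ r) (i ∷ j ∷ t)) o bounds))
    -- For constant term 2 the slope of a theta graph exceeds the number of vertices, while that of
    -- a dumbbell without further cycles equals it.
    too-large : ∀ x → 2 ℕ.+ (p ℕ.+ q ℕ.+ r) ℕ.+ suc x ≡ 6 ℕ.+ (p′ ℕ.+ i ℕ.+ j) → rs ≡ [] → ⊥
    too-large x e refl = ℕₚ.m+1+n≢m (2 ℕ.+ (p ℕ.+ q ℕ.+ r)) (trans e (trans (arrange p′ i j) (cong (2 ℕ.+_) (sym size))))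
      where
      arrange : ∀ p i j → 6 ℕ.+ (p ℕ.+ i ℕ.+ j) ≡ 2 ℕ.+ (p ℕ.+ (2 ℕ.+ i ℕ.+ (2 ℕ.+ j ℕ.+ 0)))
      arrange p i j = ℤₚ.+-injective (solve 3 (λ p i j → con (+ 6) :+ (p :+ i :+ j) := con (+ 2) :+ (p :+ (con (+ 2) :+ i :+ (con (+ 2) :+ j :+ con 0ℤ)))) refl (+ p) (+ i) (+ j))
    compare : rs ≡ [] × T.half ≡ D.half × T.slope ≡ D.slope → T.half ≡ 0 ⊎ T.half ≡ 1 ⊎ T.half ≡ 2 ⊎ T.half ≡ 5 → T.half ≢ 0 → ⊥
    compare _ (inj₁ e) ne = ne e
    compare (rs≡[] , h , s) (inj₂ (inj₁ e)) _ = let (x , t) = T.half≡1 e in too-large x (ℤₚ.+-injective (trans (sym t) (trans s (D.half≡1 (trans (sym h) e))))) rs≡[]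
    compare (_ , h , s) (inj₂ (inj₂ (inj₁ e))) _ = case trans (sym (T.half≡2 e)) (trans s (proj₂ (D.half≡2 (trans (sym h) e)))) of λ ()
    compare (_ , h , _) (inj₂ (inj₂ (inj₂ e))) _ = D.half≢5 (trans (sym h) e)
    cases : Dec (T.half ≡ 0) → ⊥
    cases (no ne) = compare (no-rings T {core = λ y → dumbbellValue y 1ℤ p′ i j} (λ y → eq y 1ℤ) {D.half} {D.slope} D.jets ne positive) T.range ne
    cases (yes e) = all-even (T.half≡0 e) (D.half≡0 (core-zero T {core = λ y → dumbbellValue y 1ℤ p′ i j} {rs} (λ y → eq y 1ℤ) {D.half} {D.slope} D.jets e))

-- From equal values to equal path lengths

thetaKinds : ℕ → ℕ → ℕ → List Kind
thetaKinds p q r = chain p ∷ chain q ∷ chain r ∷ []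

sort₃ : ∀ p q r → ∃[ a ] ∃[ b ] ∃[ c ] a ℕ.≤ b × b ℕ.≤ c × thetaKinds p q r ↭ thetaKinds a b c
sort₃ p q r = insert (ℕₚ.≤-total q r)
  where
  place : ∀ {b c} → b ℕ.≤ c → p ℕ.≤ b ⊎ b ℕ.≤ p → p ℕ.≤ c ⊎ c ℕ.≤ p → ∃[ x ] ∃[ y ] ∃[ z ] x ℕ.≤ y × y ℕ.≤ z × thetaKinds p b c ↭ thetaKinds x y z
  place b≤c (inj₁ p≤b) _          = _ , _ , _ , p≤b , b≤c , ↭-refl
  place b≤c (inj₂ b≤p) (inj₁ p≤c) = _ , _ , _ , b≤p , p≤c , ↭-swap _ _ ↭-refl
  place b≤c (inj₂ b≤p) (inj₂ c≤p) = _ , _ , _ , b≤c , c≤p , ↭-trans (↭-swap _ _ ↭-refl) (↭-prep _ (↭-swap _ _ ↭-refl))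
  insert : q ℕ.≤ r ⊎ r ℕ.≤ q → ∃[ x ] ∃[ y ] ∃[ z ] x ℕ.≤ y × y ℕ.≤ z × thetaKinds p q r ↭ thetaKinds x y z
  insert (inj₁ q≤r) = place q≤r (ℕₚ.≤-total p q) (ℕₚ.≤-total p r)
  insert (inj₂ r≤q) = let (x , y , z , x≤y , y≤z , σ) = place r≤q (ℕₚ.≤-total p r) (ℕₚ.≤-total p q) in
    x , y , z , x≤y , y≤z , ↭-trans (↭-prep _ (↭-swap _ _ ↭-refl)) σ

thetaValue-shape : ∀ Y S p q r → shapeValue Y S (thetaKinds p q r) ≡ thetaValue Y S p q r
thetaValue-shape Y S p q r = trans (shapeValue-theta Y S p q r []) (ℤₚ.*-identityʳ (thetaValue Y S p q r))

-- The lengths are sorted and counted in edges before the comparison at s = 8; equal sizes supply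
-- the equal total length that the comparison requires.
theta-kinds-unique : ∀ p q r p′ q′ r′ → (∀ Y S → shapeValue Y S (thetaKinds p q r) ≡ shapeValue Y S (thetaKinds p′ q′ r′)) →
  total kindSize (thetaKinds p q r) ≡ total kindSize (thetaKinds p′ q′ r′) → thetaKinds p q r ↭ thetaKinds p′ q′ r′
theta-kinds-unique p q r p′ q′ r′ eq size with sort₃ p q r | sort₃ p′ q′ r′
... | a , b , c , a≤b , b≤c , σ | a′ , b′ , c′ , a′≤b′ , b′≤c′ , σ′ =
  ↭-trans σ (↭-trans (↭-reflexive (same (theta-unique {suc a} {suc b} {suc c} {suc a′} {suc b′} {suc c′} (s≤s z≤n) (s≤s a≤b) (s≤s b≤c) (s≤s z≤n) (s≤s a′≤b′) (s≤s b′≤c′) sum (values (+ 8))))) (↭-sym σ′))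
  where
  same : suc a ≡ suc a′ × suc b ≡ suc b′ × suc c ≡ suc c′ → thetaKinds a b c ≡ thetaKinds a′ b′ c′
  same (refl , refl , refl) = refl
  values : ∀ s → thetaE s (suc a) (suc b) (suc c) ≡ thetaE s (suc a′) (suc b′) (suc c′)
  values s = trans (sym (theta-closed s a b c)) (trans (cong ((1ℤ + s * s) * (1ℤ + s * s) * (1ℤ + s * s) *_) (trans (sym (thetaValue-shape Y s a b c))
    (trans (sym (shapeValue-↭ Y s σ)) (trans (eq Y s) (trans (shapeValue-↭ Y s σ′) (thetaValue-shape Y s a′ b′ c′)))))) (theta-closed s a′ b′ c′))
    where
    Y : ℤ
    Y = 1ℤ - s * s
  edge-total : ∀ a b c → suc a ℕ.+ suc b ℕ.+ suc c ≡ 3 ℕ.+ (a ℕ.+ (b ℕ.+ (c ℕ.+ 0)))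
  edge-total a b c = ℤₚ.+-injective (solve 3 (λ a b c → con 1ℤ :+ a :+ (con 1ℤ :+ b) :+ (con 1ℤ :+ c) := con (+ 3) :+ (a :+ (b :+ (c :+ con 0ℤ)))) refl (+ a) (+ b) (+ c))
  sum : suc a ℕ.+ suc b ℕ.+ suc c ≡ suc a′ ℕ.+ suc b′ ℕ.+ suc c′
  sum = trans (edge-total a b c) (trans (cong (3 ℕ.+_) (trans (sym (total-↭ kindSize σ)) (trans size (total-↭ kindSize σ′)))) (sym (edge-total a′ b′ c′)))

ring-sizes : ∀ rs → total kindSize (map ring rs) ≡ total (3 ℕ.+_) rs
ring-sizes []       = refl
ring-sizes (m ∷ rs) = cong (3 ℕ.+ m ℕ.+_) (ring-sizes rs)

total-bounds : ∀ {A : Set} (f : A → ℕ) xs → All (λ x → f x ℕ.≤ total f xs) xs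
total-bounds f []       = []
total-bounds f (x ∷ xs) = ℕₚ.m≤m+n (f x) (total f xs) ∷ All.map (λ le → ℕₚ.≤-trans le (ℕₚ.m≤n+m (total f xs) (f x))) (total-bounds f xs)

theta-determined : ∀ p q r ks → total kindDegᵃ ks ≡ 3 → total kindDegᵇ ks ≡ 3 → total kindSize ks ≡ total kindSize (thetaKinds p q r) →
  (∀ Y S → shapeValue Y S ks ≡ shapeValue Y S (thetaKinds p q r)) → ks ↭ thetaKinds p q r
theta-determined p q r ks degᵃ degᵇ size eq = cases (classify ks degᵃ degᵇ)
  where
  size′ : ∀ {ks′} → ks ↭ ks′ → p ℕ.+ q ℕ.+ r ≡ total kindSize ks′
  size′ σ = trans (trans (ℕₚ.+-assoc p q r) (cong (λ t → p ℕ.+ (q ℕ.+ t)) (sym (ℕₚ.+-identityʳ r)))) (trans (sym size) (total-↭ kindSize σ))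
  value : ∀ {ks′} → ks ↭ ks′ → ∀ Y S → thetaValue Y S p q r ≡ shapeValue Y S ks′
  value σ Y S = trans (sym (thetaValue-shape Y S p q r)) (trans (sym (eq Y S)) (shapeValue-↭ Y S σ))
  bounds : ∀ {n} rs → total kindSize (map ring rs) ℕ.≤ n → All (λ m → 2 ℕ.+ m ℕ.≤ n) rs
  bounds rs le = All.map (λ {m} le′ → ℕₚ.≤-trans (ℕₚ.n≤1+n (2 ℕ.+ m)) (ℕₚ.≤-trans le′ (ℕₚ.≤-trans (ℕₚ.≤-reflexive (sym (ring-sizes rs))) le))) (total-bounds (3 ℕ.+_) rs)
  cases : (∃[ p′ ] ∃[ q′ ] ∃[ r′ ] ∃[ rs ] ks ↭ chain p′ ∷ chain q′ ∷ chain r′ ∷ map ring rs) ⊎ (∃[ p′ ] ∃[ i ] ∃[ j ] ∃[ rs ] ks ↭ chain p′ ∷ loopᵃ i ∷ loopᵇ j ∷ map ring rs) →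
    ks ↭ thetaKinds p q r
  cases (inj₁ (p′ , q′ , r′ , rs , σ)) = conclude rs σ (only-theta {p} {q} {r} {p′} {q′} {r′} {rs} (λ Y S → trans (value σ Y S) (shapeValue-theta Y S p′ q′ r′ rs))
      (bounds rs (ℕₚ.≤-trans (ℕₚ.m≤n+m _ r′) (ℕₚ.≤-trans (ℕₚ.m≤n+m _ q′) (ℕₚ.≤-trans (ℕₚ.m≤n+m _ p′) (ℕₚ.≤-reflexive (sym (size′ σ))))))))
    where
    conclude : ∀ rs → ks ↭ chain p′ ∷ chain q′ ∷ chain r′ ∷ map ring rs → rs ≡ [] → ks ↭ thetaKinds p q r
    conclude _ σ refl = ↭-trans σ (theta-kinds-unique p′ q′ r′ p q r (λ Y S → trans (sym (shapeValue-↭ Y S σ)) (eq Y S)) (trans (sym (total-↭ kindSize σ)) size))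
  cases (inj₂ (p′ , i , j , rs , σ)) = ⊥-elim (no-dumbbell {p} {q} {r} {p′} {i} {j} {rs} (λ Y S → trans (value σ Y S) (shapeValue-dumbbell Y S p′ i j rs))
      (ℕₚ.≤-trans (ℕₚ.m≤m+n (2 ℕ.+ i) _) rest₁ ∷ ℕₚ.≤-trans (ℕₚ.m≤m+n (2 ℕ.+ j) _) rest₂ ∷ bounds rs (ℕₚ.≤-trans (ℕₚ.m≤n+m _ (2 ℕ.+ j)) rest₂))
      (trans (size′ σ) (cong (λ t → p′ ℕ.+ (2 ℕ.+ i ℕ.+ (2 ℕ.+ j ℕ.+ t))) (ring-sizes rs))))
    where
    rest₁ : 2 ℕ.+ i ℕ.+ (2 ℕ.+ j ℕ.+ total kindSize (map ring rs)) ℕ.≤ p ℕ.+ q ℕ.+ r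
    rest₁ = ℕₚ.≤-trans (ℕₚ.m≤n+m _ p′) (ℕₚ.≤-reflexive (sym (size′ σ)))
    rest₂ : 2 ℕ.+ j ℕ.+ total kindSize (map ring rs) ℕ.≤ p ℕ.+ q ℕ.+ r
    rest₂ = ℕₚ.≤-trans (ℕₚ.m≤n+m _ (2 ℕ.+ i)) rest₁

theorem1p2 : ∀ (p q r : ℕ) →
    ¬ (p ≡ 0 × q ≡ 0) → ¬ (p ≡ 0 × r ≡ 0) → ¬ (q ≡ 0 × r ≡ 0) →
    ∀ {m : ℕ} (H : Graph m) → π[L H ] ≈ₚ π[L θ p q r ] → H ≅ θ p q r
theorem1p2 p q r pq pr qr H eq = same-order (π-order H (θ p q r) eq) H eq
  where
  n : ℕ
  n = p ℕ.+ q ℕ.+ r ℕ.+ 2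
  G : Graph n
  G = θ p q r
  shape : Shape G (thetaKinds p q r)
  shape = ThetaShape.theta-shape p q r pq pr qr
  same-order : ∀ {m} → m ≡ n → (H : Graph m) → π[L H ] ≈ₚ π[L G ] → H ≅ G
  -- Once the numbers of vertices are identified, both polynomials are homogenised in the same
  -- degree n and can be compared at every Y and S.
  same-order refl H eq = conclude (find-shape H
      (trans (cong₂ (λ s t → t - + 5 * s + + 6 * + length (allFin n)) (degree-sum H G eq) (degree-squares H G eq)) (proj₁ (Shape-degrees shape)))
      (trans (degree-sum H G eq) (proj₂ (Shape-degrees shape))))
    where
    conclude : ∃[ ks ] Shape H ks × total kindDegᵃ ks ≡ 3 × total kindDegᵇ ks ≡ 3 → H ≅ G
    conclude (ks , shape-H , degᵃ , degᵇ) = shape-isomorphism ((_ , refl) ∷ (_ , refl) ∷ (_ , refl) ∷ []) (Shape-↭ (theta-determined p q r ks degᵃ degᵇ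
        (ℕₚ.suc-injective (ℕₚ.suc-injective (trans (Shape-size shape-H) (sym (Shape-size shape)))))
        (λ Y S → trans (sym (Shape-value shape-H Y S)) (trans (hev-cong (Y + + 2 * S) S n eq) (Shape-value shape Y S)))) shape-H) shape
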